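{- Let $k$ be a positive integer. For every integer $n\ge 0$: \begin{align*} &N^{0}(k,2k;n)\equiv 0 \pmod{2},\\ &N^{0}(0,4;8n+r) \equiv 0 \pmod{4}\ (r\in\{5,7\}),\quad N^{0}(0,4;16n+13) \equiv 0 \pmod{8},\\ &N^{0}(1,4;8n+4) \equiv 0 \pmod{2},\quad N^{0}(1,4;8n+6)\equiv 0 \pmod{4},\quad N^{0}(1,4;40n+r)\equiv 0 \pmod{5}\ (r\in\{28,36\}),\\ &N^{0}(2,4;16n+13)\equiv 0 \pmod{4},\\ &N^{0}(0,8;8n+r)\equiv 0 \pmod{2}\ (r\in\{5,7\}),\quad N^{0}(0,8;16n+13) \equiv 0 \pmod{4},\quad N^{0}(0,8;16n+15)\equiv 0 \pmod{16},\\ &N^{0}(2,8;8n+1)\equiv 0 \pmod{4},\quad N^{0}(2,8;16n+11)\equiv 0 \pmod{8},\quad N^{0}(2,8;16n+13)\equiv 0 \pmod{2}. \end{align*}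
   Context: An odd Durfee symbol of a positive integer $n$ consists of a nonnegative integer $D$ together with two (possibly empty) non-increasing sequences of odd positive integers $a_1\ge\cdots\ge a_s$ (top row) and $b_1\ge\cdots\ge b_t$ (bottom row), all entries at most $2D+1$, such that $n=\sum a_i+\sum b_j+2D^2+2D+1$. Its odd rank is $s-t$. $N^{0}(a,M;n)$ is the number of odd Durfee symbols of $n$ whose odd rank is congruent to $a$ modulo $M$, with $N^0(a,M;0)=0$. -}

module Defs where

open import Data.Nat using (ℕ; _+_; _*_; _≤_; _≥_; _%_)
open import Data.Nat.Divisibility using () renaming (_∣_ to _∣ℕ_)
open import Data.Integer using (ℤ; +_; _-_)
open import Data.Integer.Divisibility using (_∣_)
open import Data.List using (List; length)
open import Data.Nat.ListAction using (sum)
open import Data.List.Relation.Unary.All using (All)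
open import Data.List.Relation.Unary.Linked using (Linked)
open import Data.Product using (Σ)
open import Data.Fin using (Fin)
open import Function.Bundles using (_↔_)
open import Relation.Binary.PropositionalEquality using (_≡_)

IsOdd : ℕ → Set
IsOdd x = x % 2 ≡ 1

record OddDurfeeSymbol (n : ℕ) : Set where
  constructor mkSymbol
  field
    D          : ℕ
    top        : List ℕ
    bottom     : List ℕ
    top-nonincr    : Linked _≥_ top
    bottom-nonincr : Linked _≥_ bottom
    top-odd        : All IsOdd top
    bottom-odd     : All IsOdd bottom
    top-bound      : All (λ x → x ≤ 2 * D + 1) top
    bottom-bound   : All (λ x → x ≤ 2 * D + 1) bottom
    weight         : sum top + sum bottom + (2 * (D * D) + 2 * D + 1) ≡ n

open OddDurfeeSymbol public

oddRank : ∀ {n} → OddDurfeeSymbol n → ℤ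
oddRank σ = + length (top σ) - + length (bottom σ)

_≡_[mod_] : ℤ → ℤ → ℕ → Set
x ≡ y [mod M ] = (+ M) ∣ (x - y)

N⁰≡ : ℤ → ℕ → ℕ → ℕ → Set
N⁰≡ a M n c = Σ (OddDurfeeSymbol n) (λ σ → oddRank σ ≡ a [mod M ]) ↔ Fin c

N⁰-divisible : ℕ → ℤ → ℕ → ℕ → Set
N⁰-divisible m a M n = ∀ c → N⁰≡ a M n c → m ∣ℕ c

{-# OPTIONS --safe #-}
-- For w = 2 cos t let R w be the series in x whose coefficient of x^(n-1) is the sum of cos (t r)
-- over the odd Durfee symbols of n, where r is the odd rank:
--   R w = ∑_D x^(2D²+2D) / ∏_{i ≤ D} (1 − w x^(2i+1) + x^(4i+2)).
-- Partial fractions in w turn R w into an Appell–Lerch sum divided by (x²; x²)∞. The even part of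
-- that sum is of the same kind, with w² − 2 in place of w, and it also occurs in the partial
-- fraction expansion of an infinite product with nodes x^(2j+1) and −x^(4k+2). Hence the even part
-- of R w plus x times R (2 − w²) at x² is an explicit product; the nodes −x^(4k+4) similarly give
-- the odd part for w = 2. For w = 2, 0, √2 these products are evaluated by theta functions, and
-- repeated use of φ(x)² = φ(x²)² + 4 x ψ(x⁴)² produces the powers of 2. The count at 8n + 4 is
-- 2 (x²; x²)^10 / (x; x)^9, which modulo 5 is (x; x) times a series in x⁵, and pentagonal numbers
-- are 0, 1 or 2 modulo 5. The residue classes of the rank are recovered by finite Fourier analysis.
module Submission where

open import Level using (0ℓ)
open import Algebra.Bundles using (CommutativeRing; RawRing)
open import Algebra.Structures using (IsCommutativeRing)
open import Algebra.Solver.Ring.AlmostCommutativeRing using (fromCommutativeRing; _-Raw-AlmostCommutative⟶_)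
import Algebra.Solver.Ring
import Algebra.Properties.Ring
import Relation.Binary.Reasoning.Setoid
open import Data.Nat.Base as ℕ using (ℕ; zero; suc; _≤_; _<_; z≤n; s≤s; ∣_-_∣)
import Data.Nat.Properties as ℕₚ
open import Data.Nat.Solver using (module +-*-Solver)
open import Data.Integer.Base as ℤ using (ℤ; +_; -[1+_]; _⊖_)
import Data.Integer.Properties as ℤₚ
open import Data.Maybe.Base using (Maybe; just; nothing)
open import Data.Product.Base using (Σ; ∃; _×_; _,_; proj₁; proj₂)
open import Data.Sum.Base using (_⊎_; inj₁; inj₂)
open import Data.Empty using (⊥; ⊥-elim)
open import Data.List.Base using (List; []; _∷_; _++_; map; length; filter; cartesianProduct; applyDownFrom)
open import Data.List.Relation.Unary.All as All using (All; []; _∷_)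
open import Data.List.Relation.Unary.AllPairs as AllPairs using (AllPairs; []; _∷_)
open import Data.Bool.Base using (if_then_else_)
open import Function.Base using (_∘_; _$_)
open import Relation.Nullary using (¬_; yes; no; Dec; does)
open import Relation.Binary.PropositionalEquality as ≡ using (_≡_; cong; cong₂; subst; module ≡-Reasoning)
import Data.List.Relation.Unary.AllPairs.Properties as AllPairsₚ
import Data.List.Relation.Unary.All.Properties as Allₚ
open import Relation.Binary.Definitions using (tri<; tri≈; tri>)
open +-*-Solver using () renaming (solve to solveℕ; _:+_ to _⊕_; _:*_ to _⊗_; _:=_ to _⊜_; con to conℕ)

-- For v = x^(2j+1) the product (1 - wv + v²)(1 + wv + v²) involves only v² and w² - 2. Hence the
-- even and odd parts of the Appell-Lerch sum are read off a numerator, and halving exponents turns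
-- its x^(6T), T = j(j+1)/2, into x^(3T). In an infinite product over the nodes x^(2j+1) alone the
-- exponent is 2T; each such node gains exactly x^T against the nodes -x^(4k+2), which is why these
-- are added. Their own terms have exponent 1 + 12T, with k for j: x times an Appell-Lerch sum at
-- x².
--
-- No convergence is used: a limit takes coefficients that have become stationary, and an identity
-- is proved modulo x^N for every N from a finite one. The coefficients lie in a commutative ring,
-- to serve ℤ and, for w = √2, also ℤ[√2]; the congruences moreover divide by 2, so doubling must be
-- injective there.
--
-- Fourier analysis returns a multiple of the count, so for a power of 2 the theta identity must
-- supply a surplus factor 2 or 4. The class k modulo 2k is settled differently: exchange of the
-- rows maps it to itself, and it contains no symbol of rank 0.

module Arithmetic where

  -- Recursive, so that `double (suc n)` reduces to two successors and the coefficients of even and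
  -- odd parts compute by pattern matching.
  double : ℕ → ℕ
  double zero = zero
  double (suc n) = suc (suc (double n))

  double≡+ : ∀ n → double n ≡ n ℕ.+ n
  double≡+ zero = ≡.refl
  double≡+ (suc n) = cong suc (≡.trans (cong suc (double≡+ n)) (≡.sym (ℕₚ.+-suc n n)))

  double≡2* : ∀ n → double n ≡ 2 ℕ.* n
  double≡2* n = ≡.trans (double≡+ n) (cong (n ℕ.+_) (≡.sym (ℕₚ.+-identityʳ n)))

  n≤double : ∀ n → n ≤ double n
  n≤double n = ℕₚ.≤-trans (ℕₚ.m≤m+n n n) (ℕₚ.≤-reflexive (≡.sym (double≡+ n)))

  double-< : ∀ {m n} → m < n → suc (double m) < double n
  double-< {zero} {suc n} _ = s≤s (s≤s z≤n)
  double-< {suc m} {suc n} (s≤s p) = s≤s (s≤s (double-< p))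

  triangle : ℕ → ℕ
  triangle zero = 0
  triangle (suc n) = triangle n ℕ.+ suc n

  k≤triangle : ∀ k → k ≤ triangle k
  k≤triangle zero = z≤n
  k≤triangle (suc k) = ℕₚ.m≤n+m (suc k) (triangle k)

  2*triangle : ∀ n → 2 ℕ.* triangle n ≡ n ℕ.* suc n
  2*triangle zero = ≡.refl
  2*triangle (suc n) = ≡.trans (ℕₚ.*-distribˡ-+ 2 (triangle n) (suc n)) (≡.trans (cong (ℕ._+ 2 ℕ.* suc n) (2*triangle n))
    (solveℕ 1 (λ n → n ⊗ (conℕ 1 ⊕ n) ⊕ conℕ 2 ⊗ (conℕ 1 ⊕ n) ⊜ (conℕ 1 ⊕ n) ⊗ (conℕ 2 ⊕ n)) ≡.refl n))


open Arithmetic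

-- Finite sums, finite products and partial fractions in a commutative ring.

module RingTools (R : CommutativeRing 0ℓ 0ℓ) where

  open CommutativeRing R public hiding (zero)
  open Algebra.Properties.Ring ring public using (-‿distribˡ-*; -‿distribʳ-*; -‿involutive; -0#≈0#; -‿+-comm)
  open Relation.Binary.Reasoning.Setoid setoid public

  -- The separate clause for 1 makes `nat 1` reduce to `1#` instead of `1# + 0#`, so that the
  -- integer coefficients of the ring solver, interpreted by `int`, are the expected terms.
  nat : ℕ → Carrier
  nat 0 = 0#
  nat 1 = 1#
  nat (suc (suc n)) = 1# + nat (suc n)

  nat-suc : ∀ n → nat (suc n) ≈ 1# + nat n
  nat-suc zero = sym (+-identityʳ 1#)
  nat-suc (suc n) = refl

  int : ℤ → Carrier
  int (+ n) = nat n
  int -[1+ n ] = - nat (suc n)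

  private
    swap-middle : ∀ a b c d → (a + b) + (c + d) ≈ (a + c) + (b + d)
    swap-middle a b c d = begin
      (a + b) + (c + d) ≈⟨ +-assoc a b (c + d) ⟩
      a + (b + (c + d)) ≈⟨ +-congˡ (sym (+-assoc b c d)) ⟩
      a + ((b + c) + d) ≈⟨ +-congˡ (+-congʳ (+-comm b c)) ⟩
      a + ((c + b) + d) ≈⟨ +-congˡ (+-assoc c b d) ⟩
      a + (c + (b + d)) ≈⟨ sym (+-assoc a c (b + d)) ⟩
      (a + c) + (b + d) ∎

  nat-+ : ∀ m n → nat (m ℕ.+ n) ≈ nat m + nat n
  nat-+ zero n = sym (+-identityˡ _)
  nat-+ (suc m) n = begin
    nat (suc (m ℕ.+ n))   ≈⟨ nat-suc (m ℕ.+ n) ⟩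
    1# + nat (m ℕ.+ n)    ≈⟨ +-congˡ (nat-+ m n) ⟩
    1# + (nat m + nat n)  ≈⟨ sym (+-assoc _ _ _) ⟩
    (1# + nat m) + nat n  ≈⟨ +-congʳ (sym (nat-suc m)) ⟩
    nat (suc m) + nat n ∎

  nat-* : ∀ m n → nat (m ℕ.* n) ≈ nat m * nat n
  nat-* zero n = sym (zeroˡ _)
  nat-* (suc m) n = begin
    nat (n ℕ.+ m ℕ.* n)          ≈⟨ nat-+ n (m ℕ.* n) ⟩
    nat n + nat (m ℕ.* n)        ≈⟨ +-cong (sym (*-identityˡ _)) (nat-* m n) ⟩
    1# * nat n + nat m * nat n   ≈⟨ sym (distribʳ _ _ _) ⟩
    (1# + nat m) * nat n         ≈⟨ *-congʳ (sym (nat-suc m)) ⟩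
    nat (suc m) * nat n ∎

  int-⊖ : ∀ m n → int (m ⊖ n) ≈ nat m - nat n
  int-⊖ m zero = begin
    nat m      ≈⟨ sym (+-identityʳ _) ⟩
    nat m + 0# ≈⟨ +-congˡ (sym -0#≈0#) ⟩
    nat m - 0# ∎
  int-⊖ zero (suc n) = sym (+-identityˡ _)
  int-⊖ (suc m) (suc n) = begin
    int (suc m ⊖ suc n)                 ≡⟨ cong int (ℤₚ.[1+m]⊖[1+n]≡m⊖n m n) ⟩
    int (m ⊖ n)                         ≈⟨ int-⊖ m n ⟩
    nat m - nat n                       ≈⟨ sym (+-identityˡ _) ⟩
    0# + (nat m - nat n)                ≈⟨ +-congʳ (sym (-‿inverseʳ 1#)) ⟩
    (1# - 1#) + (nat m - nat n)         ≈⟨ swap-middle _ _ _ _ ⟩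
    (1# + nat m) + (- 1# - nat n)       ≈⟨ +-cong (sym (nat-suc m)) (-‿+-comm _ _) ⟩
    nat (suc m) - (1# + nat n)          ≈⟨ +-congˡ (-‿cong (sym (nat-suc n))) ⟩
    nat (suc m) - nat (suc n) ∎

  int-+ : ∀ i j → int (i ℤ.+ j) ≈ int i + int j
  int-+ (+ m) (+ n) = nat-+ m n
  int-+ (+ m) -[1+ n ] = int-⊖ m (suc n)
  int-+ -[1+ m ] (+ n) = trans (int-⊖ n (suc m)) (+-comm _ _)
  int-+ -[1+ m ] -[1+ n ] = begin
    - nat (suc (suc (m ℕ.+ n)))     ≡⟨ cong (λ k → - nat (suc k)) (ℕₚ.+-suc m n) ⟨
    - nat (suc m ℕ.+ suc n)         ≈⟨ -‿cong (nat-+ (suc m) (suc n)) ⟩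
    - (nat (suc m) + nat (suc n))   ≈⟨ sym (-‿+-comm _ _) ⟩
    - nat (suc m) - nat (suc n) ∎

  int-neg : ∀ i → int (ℤ.- i) ≈ - int i
  int-neg (+ zero) = sym -0#≈0#
  int-neg (+ suc n) = refl
  int-neg -[1+ n ] = sym (-‿involutive _)

  int-* : ∀ i j → int (i ℤ.* j) ≈ int i * int j
  int-* (+ m) (+ n) = trans (reflexive (cong int (≡.sym (ℤₚ.pos-* m n)))) (nat-* m n)
  int-* (+ m) -[1+ n ] = begin
    int (+ m ℤ.* (ℤ.- (+ suc n)))    ≡⟨ cong int (ℤₚ.neg-distribʳ-* (+ m) (+ suc n)) ⟨
    int (ℤ.- (+ m ℤ.* + suc n))      ≈⟨ int-neg (+ m ℤ.* + suc n) ⟩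
    - int (+ m ℤ.* + suc n)          ≈⟨ -‿cong (int-* (+ m) (+ suc n)) ⟩
    - (nat m * nat (suc n))          ≈⟨ -‿distribʳ-* _ _ ⟩
    nat m * - nat (suc n) ∎
  int-* -[1+ m ] (+ n) = begin
    int ((ℤ.- (+ suc m)) ℤ.* + n)    ≡⟨ cong int (ℤₚ.neg-distribˡ-* (+ suc m) (+ n)) ⟨
    int (ℤ.- (+ suc m ℤ.* + n))      ≈⟨ int-neg (+ suc m ℤ.* + n) ⟩
    - int (+ suc m ℤ.* + n)          ≈⟨ -‿cong (int-* (+ suc m) (+ n)) ⟩
    - (nat (suc m) * nat n)          ≈⟨ -‿distribˡ-* _ _ ⟩
    - nat (suc m) * nat n ∎
  int-* -[1+ m ] -[1+ n ] = begin
    nat (suc m ℕ.* suc n)            ≈⟨ nat-* (suc m) (suc n) ⟩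
    nat (suc m) * nat (suc n)        ≈⟨ sym (-‿involutive _) ⟩
    - - (nat (suc m) * nat (suc n))  ≈⟨ -‿cong (-‿distribʳ-* _ _) ⟩
    - (nat (suc m) * - nat (suc n))  ≈⟨ -‿distribˡ-* _ _ ⟩
    - nat (suc m) * - nat (suc n) ∎

  private
    ℤ-raw : RawRing 0ℓ 0ℓ
    ℤ-raw = record { Carrier = ℤ ; _≈_ = _≡_ ; _+_ = ℤ._+_ ; _*_ = ℤ._*_ ; -_ = ℤ.-_ ; 0# = + 0 ; 1# = + 1 }

    morphism : ℤ-raw -Raw-AlmostCommutative⟶ fromCommutativeRing R
    morphism = record
      { ⟦_⟧ = int ; +-homo = int-+ ; *-homo = int-* ; -‿homo = int-neg ; 0-homo = refl ; 1-homo = refl }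

    coeff≟ : ∀ i j → Maybe (int i ≈ int j)
    coeff≟ i j with i ℤₚ.≟ j
    ... | yes eq = just (reflexive (cong int eq))
    ... | no _ = nothing

  open Algebra.Solver.Ring ℤ-raw (fromCommutativeRing R) morphism coeff≟ public
    using (solve; _:=_; con; _:+_; _:*_; _:-_; :-_; _:^_)

  infixr 8 _^_
  _^_ : Carrier → ℕ → Carrier
  y ^ zero = 1#
  y ^ suc n = y * y ^ n

  ^-congˡ : ∀ n {y z} → y ≈ z → y ^ n ≈ z ^ n
  ^-congˡ zero p = refl
  ^-congˡ (suc n) p = *-cong p (^-congˡ n p)

  ^-homo-* : ∀ y m n → y ^ (m ℕ.+ n) ≈ y ^ m * y ^ n
  ^-homo-* y zero n = sym (*-identityˡ _)
  ^-homo-* y (suc m) n = trans (*-congˡ (^-homo-* y m n)) (sym (*-assoc _ _ _))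

  ^-distrib-* : ∀ y z n → (y * z) ^ n ≈ y ^ n * z ^ n
  ^-distrib-* y z zero = sym (*-identityˡ _)
  ^-distrib-* y z (suc n) = trans (*-congˡ (^-distrib-* y z n))
    (solve 4 (λ y z a b → y :* z :* (a :* b) := y :* a :* (z :* b)) refl _ _ _ _)

  ^-assocʳ : ∀ y m n → (y ^ m) ^ n ≈ y ^ (m ℕ.* n)
  ^-assocʳ y zero n = one^ n
    where
    one^ : ∀ n → 1# ^ n ≈ 1#
    one^ zero = refl
    one^ (suc n) = trans (*-identityˡ _) (one^ n)
  ^-assocʳ y (suc m) n = begin
    (y * y ^ m) ^ n        ≈⟨ ^-distrib-* y (y ^ m) n ⟩
    y ^ n * (y ^ m) ^ n    ≈⟨ *-congˡ (^-assocʳ y m n) ⟩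
    y ^ n * y ^ (m ℕ.* n)  ≈⟨ sym (^-homo-* y n (m ℕ.* n)) ⟩
    y ^ (n ℕ.+ m ℕ.* n) ∎

  ∑< : ℕ → (ℕ → Carrier) → Carrier
  ∑< zero f = 0#
  ∑< (suc n) f = ∑< n f + f n

  ∏< : ℕ → (ℕ → Carrier) → Carrier
  ∏< zero f = 1#
  ∏< (suc n) f = ∏< n f * f n

  ∑-cong< : ∀ n {f g} → (∀ k → k < n → f k ≈ g k) → ∑< n f ≈ ∑< n g
  ∑-cong< zero p = refl
  ∑-cong< (suc n) p = +-cong (∑-cong< n (λ k k<n → p k (ℕₚ.m<n⇒m<1+n k<n))) (p n ℕₚ.≤-refl)

  ∑-cong : ∀ n {f g} → (∀ k → f k ≈ g k) → ∑< n f ≈ ∑< n g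
  ∑-cong n p = ∑-cong< n (λ k _ → p k)

  ∏-cong< : ∀ n {f g} → (∀ k → k < n → f k ≈ g k) → ∏< n f ≈ ∏< n g
  ∏-cong< zero p = refl
  ∏-cong< (suc n) p = *-cong (∏-cong< n (λ k k<n → p k (ℕₚ.m<n⇒m<1+n k<n))) (p n ℕₚ.≤-refl)

  ∏-cong : ∀ n {f g} → (∀ k → f k ≈ g k) → ∏< n f ≈ ∏< n g
  ∏-cong n p = ∏-cong< n (λ k _ → p k)

  ∑-+ : ∀ n f g → ∑< n (λ k → f k + g k) ≈ ∑< n f + ∑< n g
  ∑-+ zero f g = sym (+-identityˡ _)
  ∑-+ (suc n) f g = trans (+-congʳ (∑-+ n f g)) (swap-middle _ _ _ _)

  ∑-*ˡ : ∀ n c f → ∑< n (λ k → c * f k) ≈ c * ∑< n f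
  ∑-*ˡ zero c f = sym (zeroʳ c)
  ∑-*ˡ (suc n) c f = trans (+-congʳ (∑-*ˡ n c f)) (sym (distribˡ c _ _))

  ∑-0 : ∀ n → ∑< n (λ _ → 0#) ≈ 0#
  ∑-0 zero = refl
  ∑-0 (suc n) = trans (+-identityʳ _) (∑-0 n)

  ∏-* : ∀ n f g → ∏< n (λ k → f k * g k) ≈ ∏< n f * ∏< n g
  ∏-* zero f g = sym (*-identityˡ _)
  ∏-* (suc n) f g = trans (*-congʳ (∏-* n f g))
    (solve 4 (λ a b c d → a :* b :* (c :* d) := a :* c :* (b :* d)) refl _ _ _ _)

  ∏-1 : ∀ n → ∏< n (λ _ → 1#) ≈ 1#
  ∏-1 zero = refl
  ∏-1 (suc n) = trans (*-identityʳ _) (∏-1 n)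

  ∑-first : ∀ n f → ∑< (suc n) f ≈ f 0 + ∑< n (f ∘ suc)
  ∑-first zero f = +-comm _ _
  ∑-first (suc n) f = trans (+-congʳ (∑-first n f)) (+-assoc _ _ _)

  ∏-first : ∀ n f → ∏< (suc n) f ≈ f 0 * ∏< n (f ∘ suc)
  ∏-first zero f = *-comm _ _
  ∏-first (suc n) f = trans (*-congʳ (∏-first n f)) (*-assoc _ _ _)

  ∏-split : ∀ m n f → ∏< (m ℕ.+ n) f ≈ ∏< m f * ∏< n (λ k → f (m ℕ.+ k))
  ∏-split m zero f = trans (reflexive (cong (λ k → ∏< k f) (ℕₚ.+-identityʳ m))) (sym (*-identityʳ _))
  ∏-split m (suc n) f = begin
    ∏< (m ℕ.+ suc n) f                                ≡⟨ cong (λ k → ∏< k f) (ℕₚ.+-suc m n) ⟩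
    ∏< (m ℕ.+ n) f * f (m ℕ.+ n)                      ≈⟨ *-congʳ (∏-split m n f) ⟩
    ∏< m f * ∏< n (λ k → f (m ℕ.+ k)) * f (m ℕ.+ n)   ≈⟨ *-assoc _ _ _ ⟩
    ∏< m f * ∏< (suc n) (λ k → f (m ℕ.+ k)) ∎

  -- Substitution D = j + m in a sum over j ≤ D. In the rank series j will be the node that is
  -- expanded and m the number of nodes after it.
  ∑-triangle : ∀ n (f : ℕ → ℕ → Carrier) →
    ∑< n (λ D → ∑< (suc D) (f D)) ≈ ∑< n (λ j → ∑< (n ℕ.∸ j) (λ m → f (j ℕ.+ m) j))
  ∑-triangle zero f = refl
  ∑-triangle (suc n) f = begin
    ∑< n (λ D → ∑< (suc D) (f D)) + ∑< (suc n) (f n)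
      ≈⟨ +-congʳ (∑-triangle n f) ⟩
    ∑< n (λ j → ∑< (n ℕ.∸ j) (λ m → f (j ℕ.+ m) j)) + (∑< n (f n) + f n n)
      ≈⟨ sym (+-assoc _ _ _) ⟩
    ∑< n (λ j → ∑< (n ℕ.∸ j) (λ m → f (j ℕ.+ m) j)) + ∑< n (f n) + f n n
      ≈⟨ +-congʳ (sym (∑-+ n _ _)) ⟩
    ∑< n (λ j → ∑< (n ℕ.∸ j) (λ m → f (j ℕ.+ m) j) + f n j) + f n n
      ≈⟨ +-cong (∑-cong< n step) last ⟩
    ∑< (suc n) (λ j → ∑< (suc n ℕ.∸ j) (λ m → f (j ℕ.+ m) j)) ∎
    where
    step : ∀ j → j < n → ∑< (n ℕ.∸ j) (λ m → f (j ℕ.+ m) j) + f n j ≈ ∑< (suc n ℕ.∸ j) (λ m → f (j ℕ.+ m) j)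
    step j j<n rewrite ℕₚ.+-∸-assoc 1 (ℕₚ.<⇒≤ j<n) =
      +-congˡ (reflexive (cong (λ k → f k j) (≡.sym (ℕₚ.m+[n∸m]≡n (ℕₚ.<⇒≤ j<n)))))
    last : f n n ≈ ∑< (suc n ℕ.∸ n) (λ m → f (n ℕ.+ m) n)
    last rewrite ℕₚ.m+n∸n≡m 1 n = sym (trans (+-identityˡ _) (reflexive (cong (λ k → f k n) (ℕₚ.+-identityʳ n))))

  qpoch : Carrier → ℕ → Carrier
  qpoch y n = ∏< n (λ k → 1# - y ^ suc k)

  -- The product of a row of partial fraction coefficients for nodes in arithmetic progression:
  -- y plays the role of the square of the step, and Θ j k that of θ for the j-th and k-th node.
  module ArithmeticRow (y : Carrier) (δ : ℕ) (Θ : ℕ → ℕ → Carrier) (j : ℕ)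
    (Θ-diag : Θ j j ≈ 1#)
    (Θ-< : ∀ m → Θ j (j ℕ.+ suc m) * ((1# - y ^ suc m) * (1# - y ^ (j ℕ.+ (j ℕ.+ suc m) ℕ.+ 1 ℕ.+ δ))) ≈ 1#)
    (Θ-> : ∀ k → k < j → Θ j k * ((1# - y ^ (j ℕ.∸ k)) * (1# - y ^ (j ℕ.+ k ℕ.+ 1 ℕ.+ δ))) ≈ - y ^ (j ℕ.∸ k)) where

    private
      ∏-reversed : ∀ j → ∏< j (λ k → 1# - y ^ (j ℕ.∸ k)) ≈ qpoch y j
      ∏-reversed zero = refl
      ∏-reversed (suc j) = trans (∏-first j _) (trans (*-congˡ (∏-reversed j)) (*-comm _ _))

      ∏-powers : ∀ j → ∏< j (λ k → - y ^ (j ℕ.∸ k)) ≈ (- 1#) ^ j * y ^ triangle j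
      ∏-powers zero = sym (*-identityˡ _)
      ∏-powers (suc j) = trans (∏-first j _) (trans (*-congˡ (∏-powers j))
        (trans (solve 3 (λ a b c → :- a :* (b :* c) := :- con (+ 1) :* b :* (c :* a)) refl _ _ _)
          (*-congˡ (sym (^-homo-* y (triangle j) (suc j))))))

      ∏-shifted : ∀ d n → qpoch y d * ∏< n (λ k → 1# - y ^ (d ℕ.+ k ℕ.+ 1)) ≈ qpoch y (d ℕ.+ n)
      ∏-shifted d n = trans (*-congˡ (∏-cong n (λ k → +-congˡ (-‿cong (reflexive (cong (y ^_) (ℕₚ.+-comm (d ℕ.+ k) 1)))))))
        (sym (∏-split d n _))

      left : ∏< j (Θ j) * (qpoch y j * ∏< j (λ k → 1# - y ^ (j ℕ.+ k ℕ.+ 1 ℕ.+ δ))) ≈ (- 1#) ^ j * y ^ triangle j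
      left = begin
        ∏< j (Θ j) * (qpoch y j * ∏< j (λ k → 1# - y ^ (j ℕ.+ k ℕ.+ 1 ℕ.+ δ)))
          ≈⟨ *-congˡ (trans (*-congʳ (sym (∏-reversed j))) (sym (∏-* j _ _))) ⟩
        ∏< j (Θ j) * ∏< j (λ k → (1# - y ^ (j ℕ.∸ k)) * (1# - y ^ (j ℕ.+ k ℕ.+ 1 ℕ.+ δ)))
          ≈⟨ sym (∏-* j _ _) ⟩
        ∏< j (λ k → Θ j k * ((1# - y ^ (j ℕ.∸ k)) * (1# - y ^ (j ℕ.+ k ℕ.+ 1 ℕ.+ δ))))
          ≈⟨ ∏-cong< j Θ-> ⟩
        ∏< j (λ k → - y ^ (j ℕ.∸ k))
          ≈⟨ ∏-powers j ⟩
        (- 1#) ^ j * y ^ triangle j ∎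

      last : ℕ
      last = j ℕ.+ δ ℕ.+ j

      shifted : qpoch y (j ℕ.+ δ) * ∏< j (λ k → 1# - y ^ (j ℕ.+ k ℕ.+ 1 ℕ.+ δ)) ≈ qpoch y last
      shifted = trans (*-congˡ (∏-cong j (λ k → +-congˡ (-‿cong (reflexive (cong (y ^_) (exponent j k δ)))))))
        (∏-shifted (j ℕ.+ δ) j)
        where
        exponent : ∀ j k δ → j ℕ.+ k ℕ.+ 1 ℕ.+ δ ≡ j ℕ.+ δ ℕ.+ k ℕ.+ 1
        exponent = solveℕ 3 (λ j k δ → j ⊕ k ⊕ conℕ 1 ⊕ δ ⊜ j ⊕ δ ⊕ k ⊕ conℕ 1) ≡.refl

    -- Induction on the number m of nodes after the j-th. The nodes before it contribute the sign
    -- and `y ^ triangle j`; each later node contributes one factor to each of the two growing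
    -- q-Pochhammer symbols. All denominators stay multiplied out.
    row : ∀ m → ∏< (suc j ℕ.+ m) (Θ j) * (qpoch y m * qpoch y (suc last ℕ.+ m) * qpoch y j)
          ≈ (- 1#) ^ j * y ^ triangle j * (1# - y ^ suc last) * qpoch y (j ℕ.+ δ)
    row zero = begin
      ∏< (suc j ℕ.+ 0) (Θ j) * (1# * qpoch y (suc last ℕ.+ 0) * qpoch y j)
        ≡⟨ cong₂ (λ k l → ∏< k (Θ j) * (1# * qpoch y l * qpoch y j)) (ℕₚ.+-identityʳ (suc j)) (ℕₚ.+-identityʳ (suc last)) ⟩
      ∏< j (Θ j) * Θ j j * (1# * (qpoch y last * (1# - y ^ suc last)) * qpoch y j)
        ≈⟨ *-cong (*-congˡ Θ-diag) (*-congʳ (*-congˡ (*-congʳ (sym shifted)))) ⟩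
      ∏< j (Θ j) * 1# * (1# * (qpoch y (j ℕ.+ δ) * Q * (1# - y ^ suc last)) * qpoch y j)
        ≈⟨ solve 5 (λ P p Q z q → P :* con (+ 1) :* (con (+ 1) :* (p :* Q :* z) :* q) := P :* (q :* Q) :* z :* p) refl _ _ _ _ _ ⟩
      ∏< j (Θ j) * (qpoch y j * Q) * (1# - y ^ suc last) * qpoch y (j ℕ.+ δ)
        ≈⟨ *-congʳ (*-congʳ left) ⟩
      (- 1#) ^ j * y ^ triangle j * (1# - y ^ suc last) * qpoch y (j ℕ.+ δ) ∎
      where Q = ∏< j (λ k → 1# - y ^ (j ℕ.+ k ℕ.+ 1 ℕ.+ δ))
    row (suc m) = begin
      ∏< (suc j ℕ.+ suc m) (Θ j) * (qpoch y (suc m) * qpoch y (suc last ℕ.+ suc m) * qpoch y j)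
        ≡⟨ cong₂ (λ k l → ∏< k (Θ j) * (qpoch y (suc m) * qpoch y l * qpoch y j)) (ℕₚ.+-suc (suc j) m) (ℕₚ.+-suc (suc last) m) ⟩
      P * Θ j (suc j ℕ.+ m) * (qpoch y m * (1# - y ^ suc m) * (qpoch y (suc last ℕ.+ m) * (1# - y ^ suc (suc last ℕ.+ m))) * qpoch y j)
        ≈⟨ solve 7 (λ P t p y q z r → P :* t :* (p :* y :* (q :* z) :* r) := P :* (p :* q :* r) :* (t :* (y :* z))) refl P _ _ _ _ _ _ ⟩
      P * (qpoch y m * qpoch y (suc last ℕ.+ m) * qpoch y j) * (Θ j (suc j ℕ.+ m) * ((1# - y ^ suc m) * (1# - y ^ suc (suc last ℕ.+ m))))
        ≡⟨ cong₂ (λ k l → P * (qpoch y m * qpoch y (suc last ℕ.+ m) * qpoch y j) * (Θ j k * ((1# - y ^ suc m) * (1# - y ^ l)))) (≡.sym (ℕₚ.+-suc j m)) (exponent j δ m) ⟩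
      P * (qpoch y m * qpoch y (suc last ℕ.+ m) * qpoch y j) * (Θ j (j ℕ.+ suc m) * ((1# - y ^ suc m) * (1# - y ^ (j ℕ.+ (j ℕ.+ suc m) ℕ.+ 1 ℕ.+ δ))))
        ≈⟨ trans (*-cong (row m) (Θ-< m)) (*-identityʳ _) ⟩
      (- 1#) ^ j * y ^ triangle j * (1# - y ^ suc last) * qpoch y (j ℕ.+ δ) ∎
      where
      P = ∏< (suc j ℕ.+ m) (Θ j)
      exponent : ∀ j δ m → suc (suc (j ℕ.+ δ ℕ.+ j) ℕ.+ m) ≡ j ℕ.+ (j ℕ.+ suc m) ℕ.+ 1 ℕ.+ δ
      exponent = solveℕ 3 (λ j δ m → conℕ 2 ⊕ (j ⊕ δ ⊕ j ⊕ m) ⊜ j ⊕ (j ⊕ (conℕ 1 ⊕ m)) ⊕ conℕ 1 ⊕ δ) ≡.refl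

  ∑ₗ ∏ₗ : {I : Set} → List I → (I → Carrier) → Carrier
  ∑ₗ [] f = 0#
  ∑ₗ (i ∷ l) f = f i + ∑ₗ l f
  ∏ₗ [] f = 1#
  ∏ₗ (i ∷ l) f = f i * ∏ₗ l f

  ∑ₗ-cong : {I : Set} (l : List I) {f g : I → Carrier} → (∀ i → f i ≈ g i) → ∑ₗ l f ≈ ∑ₗ l g
  ∑ₗ-cong [] p = refl
  ∑ₗ-cong (i ∷ l) p = +-cong (p i) (∑ₗ-cong l p)

  ∑ₗ-+ : {I : Set} (l : List I) (f g : I → Carrier) → ∑ₗ l (λ i → f i + g i) ≈ ∑ₗ l f + ∑ₗ l g
  ∑ₗ-+ [] f g = sym (+-identityˡ _)
  ∑ₗ-+ (i ∷ l) f g = trans (+-congˡ (∑ₗ-+ l f g)) (swap-middle _ _ _ _)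

  ∑ₗ-*ˡ : {I : Set} (l : List I) (c : Carrier) (f : I → Carrier) → ∑ₗ l (λ i → c * f i) ≈ c * ∑ₗ l f
  ∑ₗ-*ˡ [] c f = sym (zeroʳ c)
  ∑ₗ-*ˡ (i ∷ l) c f = trans (+-congˡ (∑ₗ-*ˡ l c f)) (sym (distribˡ c _ _))

  ∑ₗ-++ : {I : Set} (l l′ : List I) (f : I → Carrier) → ∑ₗ (l ++ l′) f ≈ ∑ₗ l f + ∑ₗ l′ f
  ∑ₗ-++ [] l′ f = sym (+-identityˡ _)
  ∑ₗ-++ (i ∷ l) l′ f = trans (+-congˡ (∑ₗ-++ l l′ f)) (sym (+-assoc _ _ _))

  ∏ₗ-++ : {I : Set} (l l′ : List I) (f : I → Carrier) → ∏ₗ (l ++ l′) f ≈ ∏ₗ l f * ∏ₗ l′ f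
  ∏ₗ-++ [] l′ f = sym (*-identityˡ _)
  ∏ₗ-++ (i ∷ l) l′ f = trans (*-congˡ (∏ₗ-++ l l′ f)) (sym (*-assoc _ _ _))

  ∑ₗ-map : {I J : Set} (h : I → J) (l : List I) (f : J → Carrier) → ∑ₗ (map h l) f ≈ ∑ₗ l (f ∘ h)
  ∑ₗ-map h [] f = refl
  ∑ₗ-map h (i ∷ l) f = +-congˡ (∑ₗ-map h l f)

  module PartialFractions {I : Set} (_#_ : I → I → Set) (θ : I → I → Carrier) (θ-diag : ∀ i → θ i i ≈ 1#) where

    -- Partial fractions for two nodes. The expansion over any list of nodes follows from this
    -- relation for γ together with the same relation for the rows of θ.
    Compatible : (I → Carrier) → I → I → Set
    Compatible γ i k = γ i * θ i k + γ k * θ k i ≈ γ i * γ k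

    -- Expand γ y times the decomposition over the remaining nodes by Compatible; the terms
    -- containing γ y then collapse by the decomposition of the row θ y.
    partialFractions : (∀ {y i k} → y # i → y # k → i # k → Compatible (θ y) i k) →
      ∀ γ y l → AllPairs _#_ (y ∷ l) → AllPairs (Compatible γ) (y ∷ l) →
      ∑ₗ (y ∷ l) (λ i → γ i * ∏ₗ (y ∷ l) (θ i)) ≈ ∏ₗ (y ∷ l) γ
    partialFractions rows γ y [] _ _ = begin
      γ y * (θ y y * 1#) + 0# ≈⟨ +-congʳ (*-congˡ (*-congʳ (θ-diag y))) ⟩
      γ y * (1# * 1#) + 0#    ≈⟨ solve 1 (λ g → g :* (con (+ 1) :* con (+ 1)) :+ con (+ 0) := g :* con (+ 1)) refl (γ y) ⟩
      γ y * 1# ∎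
    partialFractions rows γ y l@(z ∷ l′) (y#l ∷ #l) (γyl ∷ γl) = begin
      γ y * (θ y y * ∏ₗ l (θ y)) + ∑ₗ l (λ i → γ i * (θ i y * ∏ₗ l (θ i)))
        ≈⟨ +-congʳ (*-congˡ (trans (*-congʳ (θ-diag y)) (*-identityˡ _))) ⟩
      γ y * ∏ₗ l (θ y) + ∑ₗ l (λ i → γ i * (θ i y * ∏ₗ l (θ i)))
        ≈⟨ +-congʳ (*-congˡ (sym (partialFractions rows (θ y) z l′ #l (row l y#l #l)))) ⟩
      γ y * ∑ₗ l (λ i → θ y i * ∏ₗ l (θ i)) + ∑ₗ l (λ i → γ i * (θ i y * ∏ₗ l (θ i)))
        ≈⟨ +-congʳ (sym (∑ₗ-*ˡ l _ _)) ⟩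
      ∑ₗ l (λ i → γ y * (θ y i * ∏ₗ l (θ i))) + ∑ₗ l (λ i → γ i * (θ i y * ∏ₗ l (θ i)))
        ≈⟨ sym (∑ₗ-+ l _ _) ⟩
      ∑ₗ l (λ i → γ y * (θ y i * ∏ₗ l (θ i)) + γ i * (θ i y * ∏ₗ l (θ i)))
        ≈⟨ combine l (λ i → ∏ₗ l (θ i)) γyl ⟩
      ∑ₗ l (λ i → γ y * (γ i * ∏ₗ l (θ i)))
        ≈⟨ ∑ₗ-*ˡ l _ _ ⟩
      γ y * ∑ₗ l (λ i → γ i * ∏ₗ l (θ i))
        ≈⟨ *-congˡ (partialFractions rows γ z l′ #l γl) ⟩
      γ y * ∏ₗ l γ ∎
      where
      row-all : ∀ i l → y # i → All (y #_) l → All (i #_) l → All (Compatible (θ y) i) l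
      row-all i [] _ _ _ = []
      row-all i (k ∷ l) y#i (y#k ∷ y#l) (i#k ∷ i#l) = rows y#i y#k i#k ∷ row-all i l y#i y#l i#l
      row : ∀ l → All (y #_) l → AllPairs _#_ l → AllPairs (Compatible (θ y)) l
      row [] _ _ = []
      row (i ∷ l) (y#i ∷ y#l) (i#l ∷ #l) = row-all i l y#i y#l i#l ∷ row l y#l #l
      combine : ∀ l (p : I → Carrier) → All (Compatible γ y) l →
        ∑ₗ l (λ i → γ y * (θ y i * p i) + γ i * (θ i y * p i)) ≈ ∑ₗ l (λ i → γ y * (γ i * p i))
      combine [] p _ = refl
      combine (i ∷ l) p (c ∷ cs) = +-cong
        (trans (solve 5 (λ a b c d e → a :* (b :* e) :+ c :* (d :* e) := (a :* b :+ c :* d) :* e) refl (γ y) (θ y i) (γ i) (θ i y) (p i))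
          (trans (*-congʳ c) (*-assoc _ _ _)))
        (combine l p cs)

-- Listing the odd Durfee symbols of n without repetition.

module Enumeration where

  open import Defs
  open import Data.List.Base using (lookup)
  open import Data.Nat.ListAction using (sum)
  open import Data.Nat.DivMod using (_%_; [m+kn]%n≡m%n)
  import Data.Nat.Divisibility as ℕ∣
  open import Data.List.Properties using (∷-injectiveʳ)
  open import Data.List.Relation.Unary.Linked using (Linked; []; [-]; _∷_)
  import Data.List.Relation.Unary.Linked as Linked
  import Data.List.Relation.Unary.Linked.Properties as Linkedₚ
  open import Data.List.Relation.Unary.Any using (here; index)
  open import Data.List.Relation.Unary.Any.Properties using (lookup-index)
  open import Data.List.Membership.Propositional using (_∈_)
  open import Data.List.Membership.Propositional.Properties using (∈-++⁺ˡ; ∈-++⁺ʳ; ∈-++⁻; ∈-map⁺; ∈-map⁻; ∈-cartesianProduct⁺; ∈-cartesianProduct⁻; ∈-filter⁺; ∈-filter⁻; ∈-lookup)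
  open import Data.List.Relation.Unary.Unique.Propositional using (Unique)
  import Data.List.Relation.Unary.Unique.Propositional.Properties as Uniqueₚ
  open import Data.Fin.Base using (Fin)
  import Data.Fin.Properties as Finₚ
  open import Function.Bundles using (Inverse)

  -- Multiplication by x^d, on the level of lists graded by size.
  delay : {X : Set} → ℕ → (ℕ → List X) → ℕ → List X
  delay zero f n = f n
  delay (suc d) f zero = []
  delay (suc d) f (suc n) = delay d f n

  delay-cong : {X : Set} → ∀ d {f g : ℕ → List X} n → (∀ k → k ≤ n → f k ≡ g k) → delay d f n ≡ delay d g n
  delay-cong zero n p = p n ℕₚ.≤-refl
  delay-cong (suc d) zero p = ≡.refl
  delay-cong (suc d) (suc n) p = delay-cong d n (λ k k≤n → p k (ℕₚ.m≤n⇒m≤1+n k≤n))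

  ∈-delay⁻ : {X : Set} → ∀ d (f : ℕ → List X) n {y} → y ∈ delay d f n → ∃ λ k → d ℕ.+ k ≡ n × y ∈ f k
  ∈-delay⁻ zero f n p = n , ≡.refl , p
  ∈-delay⁻ (suc d) f (suc n) p with k , q , r ← ∈-delay⁻ d f n p = k , cong suc q , r

  ∈-delay⁺ : {X : Set} → ∀ d (f : ℕ → List X) {k n y} → d ℕ.+ k ≡ n → y ∈ f k → y ∈ delay d f n
  ∈-delay⁺ zero f ≡.refl p = p
  ∈-delay⁺ (suc d) f ≡.refl p = ∈-delay⁺ d f ≡.refl p

  delay-unique : {X : Set} → ∀ d (f : ℕ → List X) n → (∀ k → Unique (f k)) → Unique (delay d f n)
  delay-unique zero f n u = u n
  delay-unique (suc d) f zero u = []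
  delay-unique (suc d) f (suc n) u = delay-unique d f n u

  odd : ℕ → ℕ
  odd m = suc (2 ℕ.* m)

  -- Non-increasing lists of odd numbers below 2 m with sum n. The first argument is fuel:
  -- the result does not depend on it once it exceeds n.
  rows′ : ℕ → ℕ → ℕ → List (List ℕ)
  rows′ zero m n = []
  rows′ (suc f) zero zero = [] ∷ []
  rows′ (suc f) zero (suc n) = []
  rows′ (suc f) (suc m) n = rows′ (suc f) m n ++ delay (odd m) (λ k → map (odd m ∷_) (rows′ f (suc m) k)) n

  rows : ℕ → ℕ → List (List ℕ)
  rows m n = rows′ (suc n) m n

  fuel : ∀ f f′ m n → n < f → n < f′ → rows′ f m n ≡ rows′ f′ m n
  fuel (suc f) (suc f′) zero zero p q = ≡.refl
  fuel (suc f) (suc f′) zero (suc n) p q = ≡.refl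
  fuel (suc f) (suc f′) (suc m) n p q = cong₂ _++_ (fuel (suc f) (suc f′) m n p q) (tail-part n p q)
    where
    tail-part : ∀ n → n < suc f → n < suc f′ →
      delay (odd m) (λ k → map (odd m ∷_) (rows′ f (suc m) k)) n ≡ delay (odd m) (λ k → map (odd m ∷_) (rows′ f′ (suc m) k)) n
    tail-part zero _ _ = ≡.refl
    tail-part (suc n) (s≤s p) (s≤s q) = delay-cong (2 ℕ.* m) n (λ k k≤n → cong (map (odd m ∷_))
      (fuel f f′ (suc m) k (ℕₚ.≤-<-trans k≤n p) (ℕₚ.≤-<-trans k≤n q)))

  -- Either the largest admissible part is absent or one copy of it is removed. With the fuel
  -- eliminated, this becomes the functional equation of the generating function.
  rows-unfold : ∀ m n → rows (suc m) n ≡ rows m n ++ delay (odd m) (λ k → map (odd m ∷_) (rows (suc m) k)) n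
  rows-unfold m zero = ≡.refl
  rows-unfold m (suc n) = cong (rows m (suc n) ++_) (delay-cong (2 ℕ.* m) n (λ k k≤n → cong (map (odd m ∷_))
    (fuel (suc n) (suc k) (suc m) k (s≤s k≤n) ℕₚ.≤-refl)))

  record Row (m n : ℕ) (l : List ℕ) : Set where
    field
      nonincreasing : Linked ℕ._≥_ l
      all-odd : All IsOdd l
      bounded : All (_< 2 ℕ.* m) l
      total : sum l ≡ n
  open Row

  odd-isOdd : ∀ m → IsOdd (odd m)
  odd-isOdd m = ≡.trans (cong (λ k → suc k % 2) (ℕₚ.*-comm 2 m)) ([m+kn]%n≡m%n 1 m 2)

  odd-< : ∀ m → odd m < 2 ℕ.* suc m
  odd-< m = ℕₚ.≤-reflexive (≡.sym (ℕₚ.*-suc 2 m))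

  cons-linked : ∀ {y l} → All (_≤ y) l → Linked ℕ._≥_ l → Linked ℕ._≥_ (y ∷ l)
  cons-linked [] [] = [-]
  cons-linked (p ∷ _) [-] = p ∷ [-]
  cons-linked (p ∷ _) (q ∷ qs) = p ∷ q ∷ qs

  rows-sound : ∀ f m n {l} → l ∈ rows′ f m n → Row m n l
  rows-sound (suc f) zero zero (here ≡.refl) = record { nonincreasing = [] ; all-odd = [] ; bounded = [] ; total = ≡.refl }
  rows-sound (suc f) (suc m) n p with ∈-++⁻ (rows′ (suc f) m n) p
  ... | inj₁ q = record
    { nonincreasing = nonincreasing r ; all-odd = all-odd r
    ; bounded = All.map (λ b → ℕₚ.<-≤-trans b (ℕₚ.*-monoʳ-≤ 2 (ℕₚ.n≤1+n m))) (bounded r) ; total = total r }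
    where r = rows-sound (suc f) m n q
  ... | inj₂ q with k , eq , q′ ← ∈-delay⁻ (odd m) (λ k → map (odd m ∷_) (rows′ f (suc m) k)) n q
      with l′ , q″ , ≡.refl ← ∈-map⁻ (odd m ∷_) q′ = record
    { nonincreasing = cons-linked (All.map (λ b → ℕ.s≤s⁻¹ (ℕₚ.<-≤-trans b (ℕₚ.≤-reflexive (ℕₚ.*-suc 2 m)))) (bounded r)) (nonincreasing r)
    ; all-odd = odd-isOdd m ∷ all-odd r
    ; bounded = odd-< m ∷ bounded r
    ; total = ≡.trans (cong (odd m ℕ.+_) (total r)) eq }
    where r = rows-sound f (suc m) k q″

  even-not-odd : ∀ m → ¬ IsOdd (2 ℕ.* m)
  even-not-odd m p with () ← ≡.trans (≡.sym ([m+kn]%n≡m%n 0 m 2)) (≡.trans (cong (_% 2) (ℕₚ.*-comm m 2)) p)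

  odd-cases : ∀ m y → IsOdd y → y < 2 ℕ.* suc m → y ≡ odd m ⊎ y < 2 ℕ.* m
  odd-cases m y o p with ℕₚ.<-cmp y (2 ℕ.* m)
  ... | tri< q _ _ = inj₂ q
  ... | tri≈ _ ≡.refl _ = ⊥-elim (even-not-odd m o)
  ... | tri> _ _ q = inj₁ (ℕₚ.≤-antisym (ℕ.s≤s⁻¹ (ℕₚ.≤-trans p (ℕₚ.≤-reflexive (ℕₚ.*-suc 2 m)))) q)

  rows-complete : ∀ f m n {l} → n < f → Row m n l → l ∈ rows′ f m n
  rows-complete (suc f) zero n {[]} _ r rewrite ≡.sym (total r) = here ≡.refl
  rows-complete (suc f) zero n {y ∷ l} _ r with () ← All.head (bounded r)
  rows-complete (suc f) (suc m) n {[]} p r = ∈-++⁺ˡ (rows-complete (suc f) m n p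
    record { nonincreasing = [] ; all-odd = [] ; bounded = [] ; total = total r })
  rows-complete (suc f) (suc m) n {y ∷ l} p r with odd-cases m y (All.head (all-odd r)) (All.head (bounded r))
  ... | inj₂ q = ∈-++⁺ˡ (rows-complete (suc f) m n p record
    { nonincreasing = nonincreasing r ; all-odd = all-odd r ; total = total r
    ; bounded = All.map (λ y≥z → ℕₚ.≤-<-trans y≥z q) (Linkedₚ.Linked⇒All (λ p q → ℕₚ.≤-trans q p) ℕₚ.≤-refl (nonincreasing r)) })
  ... | inj₁ ≡.refl = ∈-++⁺ʳ (rows′ (suc f) m n) (∈-delay⁺ (odd m) (λ k → map (odd m ∷_) (rows′ f (suc m) k)) (total r)
    (∈-map⁺ (odd m ∷_) (rows-complete f (suc m) (sum l) (ℕₚ.≤-trans (ℕₚ.m≤n+m (suc (sum l)) (2 ℕ.* m)) (ℕₚ.≤-trans (ℕₚ.≤-reflexive (≡.trans (ℕₚ.+-suc (2 ℕ.* m) (sum l)) (total r))) (ℕ.s≤s⁻¹ p)))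
      record { nonincreasing = Linked.tail (nonincreasing r) ; all-odd = All.tail (all-odd r) ; bounded = All.tail (bounded r) ; total = ≡.refl })))

  rows-unique : ∀ f m n → Unique (rows′ f m n)
  rows-unique zero m n = []
  rows-unique (suc f) zero zero = [] ∷ []
  rows-unique (suc f) zero (suc n) = []
  rows-unique (suc f) (suc m) n = Uniqueₚ.++⁺ (rows-unique (suc f) m n)
    (delay-unique (odd m) _ n (λ k → Uniqueₚ.map⁺ ∷-injectiveʳ (rows-unique f (suc m) k)))
    λ (p , q) → disjoint p (∈-delay⁻ (odd m) (λ k → map (odd m ∷_) (rows′ f (suc m) k)) n q)
    where
    disjoint : ∀ {l} → l ∈ rows′ (suc f) m n → (∃ λ k → odd m ℕ.+ k ≡ n × l ∈ map (odd m ∷_) (rows′ f (suc m) k)) → ⊥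
    disjoint p (k , _ , q) with l′ , _ , ≡.refl ← ∈-map⁻ (odd m ∷_) q =
      ℕₚ.<⇒≱ (All.head (bounded (rows-sound (suc f) m n p))) (ℕₚ.n≤1+n _)

  -- Product of two graded families, with the same recursion as the Cauchy product of series.
  conv : {X Y : Set} → (ℕ → List X) → (ℕ → List Y) → ℕ → List (X × Y)
  conv f g zero = cartesianProduct (f 0) (g 0)
  conv f g (suc n) = cartesianProduct (f 0) (g (suc n)) ++ conv (f ∘ suc) g n

  ∈-conv⁻ : {X Y : Set} → ∀ (f : ℕ → List X) (g : ℕ → List Y) n {y z} → (y , z) ∈ conv f g n →
    ∃ λ i → ∃ λ j → i ℕ.+ j ≡ n × y ∈ f i × z ∈ g j
  ∈-conv⁻ f g zero p = 0 , 0 , ≡.refl , ∈-cartesianProduct⁻ (f 0) (g 0) p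
  ∈-conv⁻ f g (suc n) p with ∈-++⁻ (cartesianProduct (f 0) (g (suc n))) p
  ... | inj₁ q = 0 , suc n , ≡.refl , ∈-cartesianProduct⁻ (f 0) (g (suc n)) q
  ... | inj₂ q with i , j , r , s ← ∈-conv⁻ (f ∘ suc) g n q = suc i , j , cong suc r , s

  ∈-conv⁺ : {X Y : Set} → ∀ (f : ℕ → List X) (g : ℕ → List Y) n {y z} i j → i ℕ.+ j ≡ n → y ∈ f i → z ∈ g j → (y , z) ∈ conv f g n
  ∈-conv⁺ f g zero zero zero p q r = ∈-cartesianProduct⁺ q r
  ∈-conv⁺ f g (suc n) zero .(suc n) ≡.refl q r = ∈-++⁺ˡ (∈-cartesianProduct⁺ q r)
  ∈-conv⁺ f g (suc n) (suc i) j p q r = ∈-++⁺ʳ (cartesianProduct (f 0) (g (suc n))) (∈-conv⁺ (f ∘ suc) g n i j (ℕₚ.suc-injective p) q r)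

  -- `size` recovers the degree of the first component, up to an offset c that grows along the
  -- recursion; hence pairs from different splittings of n are different.
  conv-unique : {X Y : Set} → ∀ (f : ℕ → List X) (g : ℕ → List Y) n (size : X → ℕ) c → (∀ i {y} → y ∈ f i → size y ≡ c ℕ.+ i) →
    (∀ i → Unique (f i)) → (∀ j → Unique (g j)) → Unique (conv f g n)
  conv-unique f g zero size c h u w = Uniqueₚ.cartesianProduct⁺ (u 0) (w 0)
  conv-unique f g (suc n) size c h u w = Uniqueₚ.++⁺ (Uniqueₚ.cartesianProduct⁺ (u 0) (w (suc n)))
    (conv-unique (f ∘ suc) g n size (suc c) (λ i p → ≡.trans (h (suc i) p) (ℕₚ.+-suc c i)) (u ∘ suc) w)
    λ (p , q) → disjoint p q
    where
    disjoint : ∀ {yz} → yz ∈ cartesianProduct (f 0) (g (suc n)) → yz ∈ conv (f ∘ suc) g n → ⊥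
    disjoint p q with i , _ , _ , r , _ ← ∈-conv⁻ (f ∘ suc) g n q
      with () ← ℕₚ.+-cancelˡ-≡ c 0 (suc i) (≡.trans (≡.sym (h 0 (proj₁ (∈-cartesianProduct⁻ (f 0) (g (suc n)) p)))) (h (suc i) r))

  Raw : Set
  Raw = ℕ × (List ℕ × List ℕ)

  durfee : ℕ → ℕ
  durfee D = suc (2 ℕ.* (D ℕ.* D ℕ.+ D))

  block : ℕ → ℕ → List (List ℕ × List ℕ)
  block D = delay (durfee D) (conv (rows (suc D)) (rows (suc D)))

  symbols< : ℕ → ℕ → List Raw
  symbols< zero n = []
  symbols< (suc D) n = symbols< D n ++ map (D ,_) (block D n)

  -- Searching D < n suffices because 2D² + 2D + 1 exceeds D.
  symbols : ℕ → List Raw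
  symbols n = symbols< n n

  block-unique : ∀ D n → Unique (block D n)
  block-unique D n = delay-unique (durfee D) _ n (λ k → conv-unique (rows (suc D)) (rows (suc D)) k sum 0
    (λ i p → total (rows-sound (suc i) (suc D) i p)) (λ i → rows-unique (suc i) (suc D) i) (λ i → rows-unique (suc i) (suc D) i))

  ∈-symbols<⁻ : ∀ E n {D p} → (D , p) ∈ symbols< E n → D < E × p ∈ block D n
  ∈-symbols<⁻ (suc E) n q with ∈-++⁻ (symbols< E n) q
  ... | inj₁ r with s , t ← ∈-symbols<⁻ E n r = ℕₚ.m<n⇒m<1+n s , t
  ... | inj₂ r with p , s , ≡.refl ← ∈-map⁻ (E ,_) r = ℕₚ.≤-refl , s

  ∈-symbols<⁺ : ∀ E n {D p} → D < E → p ∈ block D n → (D , p) ∈ symbols< E n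
  ∈-symbols<⁺ (suc E) n {D} q r with ℕₚ.m≤n⇒m<n∨m≡n (ℕ.s≤s⁻¹ q)
  ... | inj₁ s = ∈-++⁺ˡ (∈-symbols<⁺ E n s r)
  ... | inj₂ ≡.refl = ∈-++⁺ʳ (symbols< E n) (∈-map⁺ (E ,_) r)

  symbols<-unique : ∀ E n → Unique (symbols< E n)
  symbols<-unique zero n = []
  symbols<-unique (suc E) n = Uniqueₚ.++⁺ (symbols<-unique E n) (Uniqueₚ.map⁺ (λ { ≡.refl → ≡.refl }) (block-unique E n))
    λ (p , q) → disjoint p q
    where
    disjoint : ∀ {y} → y ∈ symbols< E n → y ∈ map (E ,_) (block E n) → ⊥
    disjoint p q with _ , _ , ≡.refl ← ∈-map⁻ (E ,_) q = ℕₚ.<-irrefl ≡.refl (proj₁ (∈-symbols<⁻ E n p))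

  raw : ∀ {n} → OddDurfeeSymbol n → Raw
  raw s = D s , top s , bottom s

  private
    bound⇒ : ∀ {D} → ∀ {y} → y ≤ 2 ℕ.* D ℕ.+ 1 → y < 2 ℕ.* suc D
    bound⇒ {D} p = ℕₚ.≤-trans (s≤s p) (ℕₚ.≤-reflexive (solveℕ 1 (λ D → conℕ 1 ⊕ (conℕ 2 ⊗ D ⊕ conℕ 1) ⊜ conℕ 2 ⊗ (conℕ 1 ⊕ D)) ≡.refl D))

    bound⇐ : ∀ {D} → ∀ {y} → y < 2 ℕ.* suc D → y ≤ 2 ℕ.* D ℕ.+ 1
    bound⇐ {D} p = ℕ.s≤s⁻¹ (ℕₚ.≤-trans p (ℕₚ.≤-reflexive (solveℕ 1 (λ D → conℕ 2 ⊗ (conℕ 1 ⊕ D) ⊜ conℕ 1 ⊕ (conℕ 2 ⊗ D ⊕ conℕ 1)) ≡.refl D)))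

    durfee-weight : ∀ s D → durfee D ℕ.+ s ≡ s ℕ.+ (2 ℕ.* (D ℕ.* D) ℕ.+ 2 ℕ.* D ℕ.+ 1)
    durfee-weight = solveℕ 2 (λ s D → conℕ 1 ⊕ conℕ 2 ⊗ (D ⊗ D ⊕ D) ⊕ s ⊜ s ⊕ (conℕ 2 ⊗ (D ⊗ D) ⊕ conℕ 2 ⊗ D ⊕ conℕ 1)) ≡.refl

  raw∈symbols : ∀ {n} (s : OddDurfeeSymbol n) → raw s ∈ symbols n
  raw∈symbols {n} s = ∈-symbols<⁺ n n D<n (∈-delay⁺ (durfee (D s)) _ eq (∈-conv⁺ (rows (suc (D s))) (rows (suc (D s))) _ (sum (top s)) (sum (bottom s)) ≡.refl
      (row (top-nonincr s) (top-odd s) (top-bound s)) (row (bottom-nonincr s) (bottom-odd s) (bottom-bound s))))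
    where
    eq : durfee (D s) ℕ.+ (sum (top s) ℕ.+ sum (bottom s)) ≡ n
    eq = ≡.trans (durfee-weight (sum (top s) ℕ.+ sum (bottom s)) (D s)) (weight s)
    D<n : D s < n
    D<n = ℕₚ.≤-trans (s≤s (ℕₚ.≤-trans (ℕₚ.m≤n+m (D s) (D s ℕ.* D s)) (ℕₚ.m≤n*m (D s ℕ.* D s ℕ.+ D s) 2))) (ℕₚ.≤-trans (ℕₚ.m≤m+n (durfee (D s)) _) (ℕₚ.≤-reflexive eq))
    row : ∀ {l} → Linked ℕ._≥_ l → All IsOdd l → All (λ y → y ≤ 2 ℕ.* D s ℕ.+ 1) l → l ∈ rows (suc (D s)) (sum l)
    row {l} p q r = rows-complete (suc (sum l)) (suc (D s)) (sum l) ℕₚ.≤-refl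
      record { nonincreasing = p ; all-odd = q ; bounded = All.map (bound⇒ {D s}) r ; total = ≡.refl }

  symbol : ∀ {n y} → y ∈ symbols n → ∃ λ (s : OddDurfeeSymbol n) → raw s ≡ y
  symbol {n} {E , t , u} p with _ , q ← ∈-symbols<⁻ n n p
    with k , eq , r ← ∈-delay⁻ (durfee E) _ n q
    with i , j , eq′ , t∈ , u∈ ← ∈-conv⁻ (rows (suc E)) (rows (suc E)) k r
    with rt ← rows-sound (suc i) (suc E) i t∈ | ru ← rows-sound (suc j) (suc E) j u∈ =
    mkSymbol E t u (nonincreasing rt) (nonincreasing ru) (all-odd rt) (all-odd ru) (All.map (bound⇐ {E}) (bounded rt)) (All.map (bound⇐ {E}) (bounded ru))
      (≡.trans (≡.sym (durfee-weight (sum t ℕ.+ sum u) E)) (≡.trans (cong (durfee E ℕ.+_) (≡.trans (cong₂ ℕ._+_ (total rt) (total ru)) eq′)) eq))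
    , ≡.refl

  -- The fields besides D and the two rows are proofs of propositions with at most one proof each.
  raw-injective : ∀ {n} (s s′ : OddDurfeeSymbol n) → raw s ≡ raw s′ → s ≡ s′
  raw-injective (mkSymbol E t u a₁ a₂ a₃ a₄ a₅ a₆ a₇) (mkSymbol .E .t .u b₁ b₂ b₃ b₄ b₅ b₆ b₇) ≡.refl
    with ≡.refl ← Linked.irrelevant ℕₚ.≤-irrelevant a₁ b₁ | ≡.refl ← Linked.irrelevant ℕₚ.≤-irrelevant a₂ b₂
       | ≡.refl ← All.irrelevant ℕₚ.≡-irrelevant a₃ b₃ | ≡.refl ← All.irrelevant ℕₚ.≡-irrelevant a₄ b₄
       | ≡.refl ← All.irrelevant ℕₚ.≤-irrelevant a₅ b₅ | ≡.refl ← All.irrelevant ℕₚ.≤-irrelevant a₆ b₆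
       | ≡.refl ← ℕₚ.≡-irrelevant a₇ b₇ = ≡.refl

  rank : Raw → ℤ
  rank (_ , t , u) = + length t ℤ.- + length u

  lookup-injective : {X : Set} {l : List X} → Unique l → ∀ i j → lookup l i ≡ lookup l j → i ≡ j
  lookup-injective (p ∷ u) Fin.zero Fin.zero eq = ≡.refl
  lookup-injective {l = y ∷ l} (p ∷ u) Fin.zero (Fin.suc j) eq = ⊥-elim (All.lookup p (∈-lookup j) eq)
  lookup-injective {l = y ∷ l} (p ∷ u) (Fin.suc i) Fin.zero eq = ⊥-elim (All.lookup p (∈-lookup i) (≡.sym eq))
  lookup-injective (p ∷ u) (Fin.suc i) (Fin.suc j) eq = cong Fin.suc (lookup-injective u i j eq)

  class? : ∀ a M r → Dec (r ≡ a [mod M ])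
  class? a M r = M ℕ∣.∣? ℤ.∣ r ℤ.- a ∣

  -- A positive M determines the quotient, so a symbol belongs to a class in only one way.
  class-irrelevant : ∀ {M N} → 1 ≤ M → (p q : M ℕ∣.∣ N) → p ≡ q
  class-irrelevant {suc M} _ (ℕ∣.divides k p) (ℕ∣.divides k′ q)
    with ≡.refl ← ℕₚ.*-cancelʳ-≡ k k′ (suc M) (≡.trans (≡.sym p) q) = cong (ℕ∣.divides k) (ℕₚ.≡-irrelevant p q)

  inClass : ℤ → ℕ → ℕ → List Raw
  inClass a M n = filter (class? a M ∘ rank) (symbols n)

  -- The number c is given only through some bijection with `Fin c`; injections in both directions
  -- between `Fin c` and the positions in a concrete list pin it down.
  count≡length : ∀ a {M} n c → 1 ≤ M → N⁰≡ a M n c → c ≡ length (inClass a M n)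
  count≡length a {M} n c 1≤M iso = Finₚ.cantor-schröder-bernstein {f = f} {g} f-injective g-injective
    where
    l : List Raw
    l = inClass a M n
    Class : Set
    Class = Σ (OddDurfeeSymbol n) (λ σ → oddRank σ ≡ a [mod M ])
    to : Class → Fin c
    to = Inverse.to iso
    from : Fin c → Class
    from = Inverse.from iso
    equal : ∀ (s s′ : Class) → raw (proj₁ s) ≡ raw (proj₁ s′) → s ≡ s′
    equal (s , p) (s′ , p′) eq = pair s s′ (raw-injective s s′ eq) p p′
      where
      pair : ∀ s s′ → s ≡ s′ → ∀ p p′ → _≡_ {A = Class} (s , p) (s′ , p′)
      pair s .s ≡.refl p p′ = cong (s ,_) (class-irrelevant 1≤M p p′)
    member : ∀ (s : Class) → raw (proj₁ s) ∈ l
    member s = ∈-filter⁺ (class? a M ∘ rank) (raw∈symbols (proj₁ s)) (proj₂ s)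
    f : Fin c → Fin (length l)
    f i = index (member (from i))
    f-injective : ∀ {i j} → f i ≡ f j → i ≡ j
    f-injective {i} {j} eq = ≡.trans (≡.sym (Inverse.strictlyInverseˡ iso i)) (≡.trans (cong to
      (equal (from i) (from j) (≡.trans (lookup-index (member (from i))) (≡.trans (cong (lookup l) eq) (≡.sym (lookup-index (member (from j)))))))) (Inverse.strictlyInverseˡ iso j))
    element : ∀ {y} → y ∈ l → ∃ λ (s : Class) → raw (proj₁ s) ≡ y
    element {y} y∈l = (proj₁ s , subst (λ y → rank y ≡ a [mod M ]) (≡.sym (proj₂ s)) (proj₂ p)) , proj₂ s
      where
      p : y ∈ symbols n × rank y ≡ a [mod M ]
      p = ∈-filter⁻ (class? a M ∘ rank) {xs = symbols n} y∈l
      s : ∃ λ (s : OddDurfeeSymbol n) → raw s ≡ y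
      s = symbol (proj₁ p)
    nth : Fin (length l) → Class
    nth i = proj₁ (element (∈-lookup {xs = l} i))
    g : Fin (length l) → Fin c
    g i = to (nth i)
    g-injective : ∀ {i j} → g i ≡ g j → i ≡ j
    g-injective {i} {j} eq = lookup-injective (Uniqueₚ.filter⁺ (class? a M ∘ rank) (symbols<-unique n n)) i j
      (≡.trans (≡.sym (proj₂ (element (∈-lookup {xs = l} i)))) (≡.trans (cong (λ s → raw (proj₁ s))
        (≡.trans (≡.sym (Inverse.strictlyInverseʳ iso (nth i))) (≡.trans (cong from eq) (Inverse.strictlyInverseʳ iso (nth j))))) (proj₂ (element (∈-lookup {xs = l} j)))))

-- Formal power series over a commutative ring.

module SeriesIdentities (A : CommutativeRing 0ℓ 0ℓ) where

  module A = RingTools A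

  Series : Set
  Series = ℕ → A.Carrier

  infix 4 _≋_
  -- A record rather than a bare function type, so that f and g can be inferred from a proof.
  record _≋_ (f g : Series) : Set where
    constructor pointwise
    field at : ∀ n → f n A.≈ g n
  open _≋_ public

  module Cauchy where

    tail : Series → Series
    tail f n = f (suc n)

    add : Series → Series → Series
    add f g n = f n A.+ g n

    -- Recursion on the tail of the left factor, so that ring laws are proved by induction on the
    -- degree without sums over pairs of indices.
    mul : Series → Series → Series
    mul f g zero = f 0 A.* g 0
    mul f g (suc n) = f 0 A.* g (suc n) A.+ mul (tail f) g n

    one : Series
    one zero = A.1#
    one (suc n) = A.0#

    mul-cong : ∀ {f f′ g g′} n → (∀ k → k ≤ n → f k A.≈ f′ k) → (∀ k → k ≤ n → g k A.≈ g′ k) → mul f g n A.≈ mul f′ g′ n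
    mul-cong zero p q = A.*-cong (p 0 z≤n) (q 0 z≤n)
    mul-cong (suc n) p q = A.+-cong (A.*-cong (p 0 z≤n) (q (suc n) ℕₚ.≤-refl))
      (mul-cong n (λ k k≤n → p (suc k) (s≤s k≤n)) (λ k k≤n → q k (ℕₚ.m≤n⇒m≤1+n k≤n)))

    mul-cong∀ : ∀ {f f′ g g′} n → (∀ k → f k A.≈ f′ k) → (∀ k → g k A.≈ g′ k) → mul f g n A.≈ mul f′ g′ n
    mul-cong∀ n p q = mul-cong n (λ k _ → p k) (λ k _ → q k)

    mul-zeroˡ : ∀ g n → mul (λ _ → A.0#) g n A.≈ A.0#
    mul-zeroˡ g zero = A.zeroˡ _
    mul-zeroˡ g (suc n) = A.trans (A.+-cong (A.zeroˡ _) (mul-zeroˡ g n)) (A.+-identityˡ _)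

    mul-scaleˡ : ∀ c f g n → mul (λ k → c A.* f k) g n A.≈ c A.* mul f g n
    mul-scaleˡ c f g zero = A.*-assoc _ _ _
    mul-scaleˡ c f g (suc n) = A.trans (A.+-cong (A.*-assoc _ _ _) (mul-scaleˡ c (tail f) g n)) (A.sym (A.distribˡ _ _ _))

    mul-distribʳ : ∀ h f g n → mul (add f g) h n A.≈ mul f h n A.+ mul g h n
    mul-distribʳ h f g zero = A.distribʳ _ _ _
    mul-distribʳ h f g (suc n) = A.trans (A.+-cong (A.distribʳ _ _ _) (mul-distribʳ h (tail f) (tail g) n))
      (A.solve 4 (λ a b c d → (a A.:+ b) A.:+ (c A.:+ d) A.:= (a A.:+ c) A.:+ (b A.:+ d)) A.refl _ _ _ _)

    mul-sucʳ : ∀ f g n → mul f g (suc n) A.≈ f (suc n) A.* g 0 A.+ mul f (tail g) n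
    mul-sucʳ f g zero = A.+-comm _ _
    mul-sucʳ f g (suc n) = A.trans (A.+-congˡ (mul-sucʳ (tail f) g n))
      (A.solve 3 (λ a b c → a A.:+ (b A.:+ c) A.:= b A.:+ (a A.:+ c)) A.refl _ _ _)

    mul-comm : ∀ f g n → mul f g n A.≈ mul g f n
    mul-comm f g zero = A.*-comm _ _
    mul-comm f g (suc n) = A.trans (A.+-cong (A.*-comm _ _) (mul-comm (tail f) g n)) (A.sym (mul-sucʳ g f n))

    mul-assoc : ∀ f g h n → mul (mul f g) h n A.≈ mul f (mul g h) n
    mul-assoc f g h zero = A.*-assoc _ _ _
    mul-assoc f g h (suc n) = A.begin
      f 0 A.* g 0 A.* h (suc n) A.+ mul (add (λ k → f 0 A.* tail g k) (mul (tail f) g)) h n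
        A.≈⟨ A.+-congˡ (mul-distribʳ h (λ k → f 0 A.* tail g k) (mul (tail f) g) n) ⟩
      f 0 A.* g 0 A.* h (suc n) A.+ (mul (λ k → f 0 A.* tail g k) h n A.+ mul (mul (tail f) g) h n)
        A.≈⟨ A.+-congˡ (A.+-cong (mul-scaleˡ (f 0) (tail g) h n) (mul-assoc (tail f) g h n)) ⟩
      f 0 A.* g 0 A.* h (suc n) A.+ (f 0 A.* mul (tail g) h n A.+ mul (tail f) (mul g h) n)
        A.≈⟨ A.solve 5 (λ a b c d e → a A.:* b A.:* c A.:+ (a A.:* d A.:+ e) A.:= a A.:* (b A.:* c A.:+ d) A.:+ e) A.refl _ _ _ _ _ ⟩
      f 0 A.* (g 0 A.* h (suc n) A.+ mul (tail g) h n) A.+ mul (tail f) (mul g h) n A.∎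

    mul-identityˡ : ∀ g n → mul one g n A.≈ g n
    mul-identityˡ g zero = A.*-identityˡ _
    mul-identityˡ g (suc n) = A.trans (A.+-cong (A.*-identityˡ _) (mul-zeroˡ g n)) (A.+-identityʳ _)

    isCommutativeRing : IsCommutativeRing _≋_ add mul (λ f n → A.- f n) (λ _ → A.0#) one
    isCommutativeRing = record
      { isRing = record
        { +-isAbelianGroup = record
          { isGroup = record
            { isMonoid = record
              { isSemigroup = record
                { isMagma = record
                  { isEquivalence = record
                    { refl = pointwise λ _ → A.refl
                    ; sym = λ p → pointwise λ n → A.sym (at p n)
                    ; trans = λ p q → pointwise λ n → A.trans (at p n) (at q n) }
                  ; ∙-cong = λ p q → pointwise λ n → A.+-cong (at p n) (at q n) }
                ; assoc = λ f g h → pointwise λ n → A.+-assoc _ _ _ }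
              ; identity = (λ f → pointwise λ n → A.+-identityˡ _) , (λ f → pointwise λ n → A.+-identityʳ _) }
            ; inverse = (λ f → pointwise λ n → A.-‿inverseˡ _) , (λ f → pointwise λ n → A.-‿inverseʳ _)
            ; ⁻¹-cong = λ p → pointwise λ n → A.-‿cong (at p n) }
          ; comm = λ f g → pointwise λ n → A.+-comm _ _ }
        ; *-cong = λ p q → pointwise λ n → mul-cong∀ n (at p) (at q)
        ; *-assoc = λ f g h → pointwise (mul-assoc f g h)
        ; *-identity = (λ f → pointwise (mul-identityˡ f)) , (λ f → pointwise λ n → A.trans (mul-comm f one n) (mul-identityˡ f n))
        ; distrib = (λ f g h → pointwise λ n → A.trans (mul-comm f (add g h) n)
                       (A.trans (mul-distribʳ f g h n) (A.+-cong (mul-comm g f n) (mul-comm h f n))))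
                  , (λ f g h → pointwise λ n → mul-distribʳ f g h n) }
      ; *-comm = λ f g → pointwise (mul-comm f g) }

  open Cauchy using (tail) public

  seriesRing : CommutativeRing 0ℓ 0ℓ
  seriesRing = record { isCommutativeRing = Cauchy.isCommutativeRing }

  open RingTools seriesRing public

  constant : A.Carrier → Series
  constant c zero = c
  constant c (suc n) = A.0#

  constant-* : ∀ c f n → (constant c * f) n A.≈ c A.* f n
  constant-* c f zero = A.refl
  constant-* c f (suc n) = A.trans (A.+-congˡ (Cauchy.mul-zeroˡ f n)) (A.+-identityʳ _)

  constant-cong : ∀ {c d} → c A.≈ d → constant c ≈ constant d
  constant-cong p = pointwise λ { zero → p ; (suc n) → A.refl }

  constant-1 : constant A.1# ≈ 1#
  constant-1 = pointwise λ { zero → A.refl ; (suc n) → A.refl }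

  constant-0 : constant A.0# ≈ 0#
  constant-0 = pointwise λ { zero → A.refl ; (suc n) → A.refl }

  constant-+ : ∀ c d → constant (c A.+ d) ≈ constant c + constant d
  constant-+ c d = pointwise λ { zero → A.refl ; (suc n) → A.sym (A.+-identityˡ _) }

  constant-mul : ∀ c d → constant (c A.* d) ≈ constant c * constant d
  constant-mul c d = pointwise λ { zero → A.refl ; (suc n) → A.sym (A.trans (constant-* c (constant d) (suc n)) (A.zeroʳ c)) }

  constant-neg : ∀ c → constant (A.- c) ≈ - constant c
  constant-neg c = pointwise λ { zero → A.refl ; (suc n) → A.sym A.-0#≈0# }

  nat-constant : ∀ m → constant (A.nat m) ≈ nat m
  nat-constant 0 = constant-0
  nat-constant 1 = constant-1
  nat-constant (suc (suc m)) = trans (constant-+ _ _) (+-cong constant-1 (nat-constant (suc m)))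

  nat-coeff : ∀ m f n → (nat m * f) n A.≈ A.nat m A.* f n
  nat-coeff m f n = A.trans (at (*-congʳ (sym (nat-constant m))) n) (constant-* _ f n)

  x : Series
  x zero = A.0#
  x (suc n) = 1# n

  x*-zero : ∀ f → (x * f) 0 A.≈ A.0#
  x*-zero f = A.zeroˡ _

  x*-suc : ∀ f n → (x * f) (suc n) A.≈ f n
  x*-suc f n = A.trans (A.+-cong (A.zeroˡ _) (Cauchy.mul-identityˡ f n)) (A.+-identityˡ _)

  x*-injective : ∀ {f g} → x * f ≈ x * g → f ≈ g
  x*-injective {f} {g} p = pointwise λ n → A.trans (A.sym (x*-suc f n)) (A.trans (at p (suc n)) (x*-suc g n))

  head-tail : ∀ f → f ≈ constant (f 0) + x * tail f
  head-tail f = pointwise λ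
    { zero → A.sym (A.trans (A.+-congˡ (x*-zero (tail f))) (A.+-identityʳ _))
    ; (suc n) → A.sym (A.trans (A.+-congˡ (x*-suc (tail f) n)) (A.+-identityˡ _)) }

  infix 4 _≈[_]_
  -- Congruence modulo x^N, which takes the place of convergence throughout.
  record _≈[_]_ (f : Series) (N : ℕ) (g : Series) : Set where
    constructor below
    field at< : ∀ n → n < N → f n A.≈ g n
  open _≈[_]_ public

  ≈⇒≈[] : ∀ {N f g} → f ≈ g → f ≈[ N ] g
  ≈⇒≈[] p = below λ n _ → at p n

  ≈[]⇒≈ : ∀ {f g} → (∀ N → f ≈[ N ] g) → f ≈ g
  ≈[]⇒≈ p = pointwise λ n → at< (p (suc n)) n ℕₚ.≤-refl

  ≈[]-refl : ∀ {N f} → f ≈[ N ] f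
  ≈[]-refl = below λ n _ → A.refl

  ≈[]-sym : ∀ {N f g} → f ≈[ N ] g → g ≈[ N ] f
  ≈[]-sym p = below λ n n<N → A.sym (at< p n n<N)

  ≈[]-trans : ∀ {N f g h} → f ≈[ N ] g → g ≈[ N ] h → f ≈[ N ] h
  ≈[]-trans p q = below λ n n<N → A.trans (at< p n n<N) (at< q n n<N)

  ≈[]-weaken : ∀ {M N f g} → M ≤ N → f ≈[ N ] g → f ≈[ M ] g
  ≈[]-weaken M≤N p = below λ n n<M → at< p n (ℕₚ.<-≤-trans n<M M≤N)

  +-≈[] : ∀ {N f f′ g g′} → f ≈[ N ] f′ → g ≈[ N ] g′ → f + g ≈[ N ] f′ + g′
  +-≈[] p q = below λ n n<N → A.+-cong (at< p n n<N) (at< q n n<N)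

  neg-≈[] : ∀ {N f g} → f ≈[ N ] g → - f ≈[ N ] - g
  neg-≈[] p = below λ n n<N → A.-‿cong (at< p n n<N)

  *-≈[] : ∀ {N f f′ g g′} → f ≈[ N ] f′ → g ≈[ N ] g′ → f * g ≈[ N ] f′ * g′
  *-≈[] p q = below λ n n<N → Cauchy.mul-cong n
    (λ k k≤n → at< p k (ℕₚ.≤-<-trans k≤n n<N)) (λ k k≤n → at< q k (ℕₚ.≤-<-trans k≤n n<N))

  ∑-≈[] : ∀ {N} n {f g : ℕ → Series} → (∀ k → k < n → f k ≈[ N ] g k) → ∑< n f ≈[ N ] ∑< n g
  ∑-≈[] zero p = ≈[]-refl
  ∑-≈[] (suc n) p = +-≈[] (∑-≈[] n (λ k k<n → p k (ℕₚ.m<n⇒m<1+n k<n))) (p n ℕₚ.≤-refl)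

  x*-≈[] : ∀ {N f g} → f ≈[ N ] g → x * f ≈[ suc N ] x * g
  x*-≈[] {N} {f} {g} p = below λ
    { zero _ → A.trans (x*-zero f) (A.sym (x*-zero g))
    ; (suc n) (s≤s n<N) → A.trans (x*-suc f n) (A.trans (at< p n n<N) (A.sym (x*-suc g n))) }

  x^-≈[] : ∀ d {N f g} → f ≈[ N ] g → x ^ d * f ≈[ d ℕ.+ N ] x ^ d * g
  x^-≈[] zero p = *-≈[] ≈[]-refl p
  x^-≈[] (suc d) {f = f} {g} p = ≈[]-trans (≈⇒≈[] (*-assoc x (x ^ d) f))
    (≈[]-trans (x*-≈[] (x^-≈[] d p)) (≈⇒≈[] (sym (*-assoc x (x ^ d) g))))

  x^*≈[]0 : ∀ {d N} f → N ≤ d → x ^ d * f ≈[ N ] 0#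
  x^*≈[]0 {d} {N} f N≤d = ≈[]-trans
    (≈[]-weaken (ℕₚ.≤-trans N≤d (ℕₚ.m≤m+n d 0)) (x^-≈[] d {g = 0#} (below λ _ ())))
    (≈⇒≈[] (zeroʳ _))

  x^≈[]0 : ∀ {d N} → N ≤ d → x ^ d ≈[ N ] 0#
  x^≈[]0 N≤d = ≈[]-trans (≈⇒≈[] (sym (*-identityʳ _))) (x^*≈[]0 1# N≤d)

  x^-+ : ∀ m n → x ^ (m ℕ.+ n) ≈ x ^ m * x ^ n
  x^-+ m n = ^-homo-* x m n

  x^-≡ : ∀ {m n} → m ≡ n → x ^ m ≈ x ^ n
  x^-≡ p = reflexive (cong (x ^_) p)

  -- Coefficient n is read off approximation n + 1. This is the intended limit when `F k` and
  -- `F (suc k)` agree below degree k.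
  lim : (ℕ → Series) → Series
  lim F n = F (suc n) n

  ∑∞ ∏∞ : (ℕ → Series) → Series
  ∑∞ t = lim (λ k → ∑< k t)
  ∏∞ t = lim (λ k → ∏< k t)

  lim-≈[] : ∀ F → (∀ k → F k ≈[ k ] F (suc k)) → ∀ {k N} → N ≤ k → lim F ≈[ N ] F k
  lim-≈[] F stable {k} N≤k = below λ n n<N → A.trans (reach n (k ℕ.∸ suc n))
      (A.reflexive (cong (λ m → F m n) (ℕₚ.m∸n+n≡m (ℕₚ.≤-trans n<N N≤k))))
    where
    reach : ∀ n d → F (suc n) n A.≈ F (d ℕ.+ suc n) n
    reach n zero = A.refl
    reach n (suc d) = A.trans (reach n d) (at< (stable (d ℕ.+ suc n)) n (ℕₚ.m≤n+m (suc n) d))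

  module InfiniteSum (t : ℕ → Series) (small : ∀ k → t k ≈[ k ] 0#) where
    ∑∞-≈[] : ∀ {k N} → N ≤ k → ∑∞ t ≈[ N ] ∑< k t
    ∑∞-≈[] = lim-≈[] (λ k → ∑< k t) (λ k → ≈[]-sym (≈[]-trans (+-≈[] ≈[]-refl (small k)) (≈⇒≈[] (+-identityʳ _))))

  module InfiniteProduct (t : ℕ → Series) (small : ∀ k → t k ≈[ k ] 1#) where
    ∏∞-≈[] : ∀ {k N} → N ≤ k → ∏∞ t ≈[ N ] ∏< k t
    ∏∞-≈[] = lim-≈[] (λ k → ∏< k t) (λ k → ≈[]-sym (≈[]-trans (*-≈[] ≈[]-refl (small k)) (≈⇒≈[] (*-identityʳ _))))

  -- The geometric series of 1 - f; an inverse when f 0 ≈ 1#, otherwise a junk value.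
  module Geometric (f : Series) where
    partial : ℕ → Series
    partial zero = 0#
    partial (suc k) = 1# + x * (- tail f * partial k)

    partial-stable : ∀ k → partial k ≈[ k ] partial (suc k)
    partial-stable zero = below λ _ ()
    partial-stable (suc k) = +-≈[] ≈[]-refl (x*-≈[] (*-≈[] ≈[]-refl (partial-stable k)))

  infix 9 _⁻¹
  _⁻¹ : Series → Series
  f ⁻¹ = lim (Geometric.partial f)

  record Unit (f : Series) : Set where
    constructor unit
    field at0 : f 0 A.≈ A.1#
  open Unit public

  unit-inverse : ∀ {f} → Unit f → f * f ⁻¹ ≈ 1#
  unit-inverse {f} u = ≈[]⇒≈ λ N → ≈[]-weaken (ℕₚ.n≤1+n N) (approx N)
    where
    open Geometric f
    f-split : f ≈ 1# + x * tail f
    f-split = trans (head-tail f) (+-congʳ (trans (constant-cong (at0 u)) constant-1))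
    approx : ∀ N → f * f ⁻¹ ≈[ suc N ] 1#
    approx N =
      ≈[]-trans (*-≈[] (≈⇒≈[] f-split) (lim-≈[] partial partial-stable ℕₚ.≤-refl))
      (≈[]-trans (≈⇒≈[] (solve 3 (λ a b c → (con (+ 1) :+ a :* b) :* c := c :+ a :* (b :* c)) refl x (tail f) (partial (suc N))))
      (≈[]-trans (+-≈[] ≈[]-refl (x*-≈[] (*-≈[] ≈[]-refl (≈[]-sym (partial-stable N)))))
      (≈⇒≈[] (solve 3 (λ a b c → con (+ 1) :+ a :* (:- b :* c) :+ a :* (b :* c) := con (+ 1)) refl x (tail f) (partial N)))))

  *-cancelˡ : ∀ {f g h} → Unit f → f * g ≈ f * h → g ≈ h
  *-cancelˡ {f} {g} {h} u p = begin
    g                ≈⟨ sym (*-identityˡ g) ⟩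
    1# * g           ≈⟨ *-congʳ (sym (unit-inverse u)) ⟩
    f * f ⁻¹ * g     ≈⟨ solve 3 (λ a b c → a :* b :* c := b :* (a :* c)) refl _ _ _ ⟩
    f ⁻¹ * (f * g)   ≈⟨ *-congˡ p ⟩
    f ⁻¹ * (f * h)   ≈⟨ solve 3 (λ a b c → b :* (a :* c) := a :* b :* c) refl _ _ _ ⟩
    f * f ⁻¹ * h     ≈⟨ *-congʳ (unit-inverse u) ⟩
    1# * h           ≈⟨ *-identityˡ h ⟩
    h ∎

  ⁻¹-unique : ∀ {f g} → Unit f → f * g ≈ 1# → g ≈ f ⁻¹
  ⁻¹-unique u p = *-cancelˡ u (trans p (sym (unit-inverse u)))

  ⁻¹-cong : ∀ {f g} → Unit f → f ≈ g → f ⁻¹ ≈ g ⁻¹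
  ⁻¹-cong u p = ⁻¹-unique (unit (A.trans (A.sym (at p 0)) (at0 u))) (trans (*-congʳ (sym p)) (unit-inverse u))

  *-cancelˡ-≈[] : ∀ {N f g h} → Unit f → f * g ≈[ N ] f * h → g ≈[ N ] h
  *-cancelˡ-≈[] {N} {f} {g} {h} u p = ≈[]-trans (≈⇒≈[] (step g)) (≈[]-trans (*-≈[] (≈[]-refl {f = f ⁻¹}) p) (≈⇒≈[] (sym (step h))))
    where
    step : ∀ g → g ≈ f ⁻¹ * (f * g)
    step g = trans (sym (*-identityˡ g)) (trans (*-congʳ (sym (unit-inverse u)))
      (solve 3 (λ a b c → a :* b :* c := b :* (a :* c)) refl _ _ _))

  unit-1 : Unit 1#
  unit-1 = unit A.refl

  unit-* : ∀ {f g} → Unit f → Unit g → Unit (f * g)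
  unit-* u v = unit (A.trans (A.*-cong (at0 u) (at0 v)) (A.*-identityˡ _))

  unit-∏ : ∀ {f} → (∀ k → Unit (f k)) → ∀ n → Unit (∏< n f)
  unit-∏ u zero = unit-1
  unit-∏ u (suc n) = unit-* (unit-∏ u n) (u n)

  unit-≈[] : ∀ {N f g} → Unit g → f ≈[ suc N ] g → Unit f
  unit-≈[] u p = unit (A.trans (at< p 0 (s≤s z≤n)) (at0 u))

  unit-≈ : ∀ {f g} → Unit g → f ≈ g → Unit f
  unit-≈ u p = unit (A.trans (at p 0) (at0 u))

  unit-+x* : ∀ f → Unit (1# + x * f)
  unit-+x* f = unit (A.trans (A.+-congˡ (x*-zero f)) (A.+-identityʳ _))

  unit-⁻¹ : ∀ {f} → Unit f → Unit (f ⁻¹)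
  unit-⁻¹ {f} u = unit (A.trans (A.sym (A.trans (A.*-congʳ (at0 u)) (A.*-identityˡ _))) (at (unit-inverse u) 0))

  -- Even and odd parts, and the substitutions of x² and -x for x.

  ev od : Series → Series
  ev f n = f (double n)
  od f n = f (suc (double n))

  ev-cong : ∀ {f g} → f ≈ g → ev f ≈ ev g
  ev-cong p = pointwise λ n → at p (double n)

  od-cong : ∀ {f g} → f ≈ g → od f ≈ od g
  od-cong p = pointwise λ n → at p (suc (double n))

  ev-od-ext : ∀ {f g} → ev f ≈ ev g → od f ≈ od g → f ≈ g
  ev-od-ext {f} {g} p q = pointwise (go f g (at p) (at q))
    where
    go : ∀ f g → (∀ n → ev f n A.≈ ev g n) → (∀ n → od f n A.≈ od g n) → ∀ n → f n A.≈ g n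
    go f g p q 0 = p 0
    go f g p q 1 = q 0
    go f g p q (suc (suc n)) = go (tail (tail f)) (tail (tail g)) (p ∘ suc) (q ∘ suc) n

  mul-head-tail : ∀ f g → f * g ≈ constant (f 0) * g + x * (tail f * g)
  mul-head-tail f g = trans (*-congʳ (head-tail f)) (solve 4 (λ c x t g → (c :+ x :* t) :* g := c :* g :+ x :* (t :* g)) refl _ _ _ _)

  private
    -- Mutual induction: removing the head of f turns its odd part into the even part, and the tail
    -- of its even part into the odd part.
    ev-at : ∀ f g n → (f * g) (double n) A.≈ (ev f * ev g + x * (od f * od g)) n
    od-at : ∀ f g n → (f * g) (suc (double n)) A.≈ (ev f * od g + od f * ev g) n

    ev-at f g zero = A.sym (A.trans (A.+-congˡ (x*-zero (od f * od g))) (A.+-identityʳ _))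
    ev-at f g (suc n) = A.trans (A.+-congˡ (od-at (tail f) g n)) (A.trans
      (A.solve 3 (λ a b c → a A.:+ (b A.:+ c) A.:= a A.:+ c A.:+ b) A.refl _ _ _)
      (A.+-congˡ (A.sym (x*-suc (od f * od g) n))))
    od-at f g n = A.begin
      f 0 A.* od g n A.+ (tail f * g) (double n)
        A.≈⟨ A.+-congˡ (ev-at (tail f) g n) ⟩
      f 0 A.* od g n A.+ ((od f * ev g) n A.+ (x * (tail (ev f) * od g)) n)
        A.≈⟨ A.solve 3 (λ a b c → a A.:+ (b A.:+ c) A.:= a A.:+ c A.:+ b) A.refl _ _ _ ⟩
      f 0 A.* od g n A.+ (x * (tail (ev f) * od g)) n A.+ (od f * ev g) n
        A.≈⟨ A.+-congʳ (A.sym (A.trans (at (mul-head-tail (ev f) (od g)) n) (A.+-congʳ (constant-* (f 0) (od g) n)))) ⟩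
      (ev f * od g) n A.+ (od f * ev g) n A.∎

  ev-* : ∀ f g → ev (f * g) ≈ ev f * ev g + x * (od f * od g)
  ev-* f g = pointwise (ev-at f g)

  od-* : ∀ f g → od (f * g) ≈ ev f * od g + od f * ev g
  od-* f g = pointwise (od-at f g)

  -- The substitution f(x²).
  dil : Series → Series
  dil f 0 = f 0
  dil f 1 = A.0#
  dil f (suc (suc n)) = dil (tail f) n

  ev-dil : ∀ f → ev (dil f) ≈ f
  ev-dil f = pointwise (go f)
    where
    go : ∀ f n → dil f (double n) A.≈ f n
    go f zero = A.refl
    go f (suc n) = go (tail f) n

  od-dil : ∀ f → od (dil f) ≈ 0#
  od-dil f = pointwise (go f)
    where
    go : ∀ f n → dil f (suc (double n)) A.≈ A.0#
    go f zero = A.refl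
    go f (suc n) = go (tail f) n

  dil-≈[] : ∀ {N f g} → f ≈[ N ] g → dil f ≈[ N ] dil g
  dil-≈[] {N} {f} {g} p = below (go N f g (at< p))
    where
    go : ∀ N f g → (∀ n → n < N → f n A.≈ g n) → ∀ n → n < N → dil f n A.≈ dil g n
    go N f g p 0 n<N = p 0 n<N
    go N f g p 1 n<N = A.refl
    go (suc (suc N)) f g p (suc (suc n)) (s≤s (s≤s n<N)) =
      go (suc N) (tail f) (tail g) (λ k k<N → p (suc k) (s≤s k<N)) n (ℕₚ.m<n⇒m<1+n n<N)

  dil-cong : ∀ {f g} → f ≈ g → dil f ≈ dil g
  dil-cong p = ≈[]⇒≈ λ N → dil-≈[] (≈⇒≈[] p)

  dil-injective : ∀ {f g} → dil f ≈ dil g → f ≈ g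
  dil-injective {f} {g} p = trans (sym (ev-dil f)) (trans (ev-cong p) (ev-dil g))

  -- Reduces each homomorphism property of `dil` to one check on even parts and one on odd parts.
  dil-unique : ∀ {f g} → ev f ≈ g → od f ≈ 0# → dil g ≈ f
  dil-unique {f} {g} p q = ev-od-ext (trans (ev-dil g) (sym p)) (trans (od-dil g) (sym q))

  ev-dil-* : ∀ f g → ev (dil f * g) ≈ f * ev g
  ev-dil-* f g = trans (ev-* (dil f) g) (trans
    (+-cong (*-congʳ (ev-dil f)) (*-congˡ (*-congʳ (od-dil f))))
    (solve 4 (λ a b c d → a :* b :+ c :* (con (+ 0) :* d) := a :* b) refl f (ev g) x (od g)))

  od-dil-* : ∀ f g → od (dil f * g) ≈ f * od g
  od-dil-* f g = trans (od-* (dil f) g) (trans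
    (+-cong (*-congʳ (ev-dil f)) (*-congʳ (od-dil f)))
    (solve 3 (λ a b c → a :* b :+ con (+ 0) :* c := a :* b) refl f (od g) (ev g)))

  dil-+ : ∀ f g → dil (f + g) ≈ dil f + dil g
  dil-+ f g = dil-unique (+-cong (ev-dil f) (ev-dil g)) (trans (+-cong (od-dil f) (od-dil g)) (+-identityˡ _))

  dil-neg : ∀ f → dil (- f) ≈ - dil f
  dil-neg f = dil-unique (-‿cong (ev-dil f)) (trans (-‿cong (od-dil f)) -0#≈0#)

  dil-* : ∀ f g → dil (f * g) ≈ dil f * dil g
  dil-* f g = dil-unique (trans (ev-dil-* f (dil g)) (*-congˡ (ev-dil g)))
    (trans (od-dil-* f (dil g)) (trans (*-congˡ (od-dil g)) (zeroʳ f)))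

  dil-0 : dil 0# ≈ 0#
  dil-0 = dil-unique (pointwise λ _ → A.refl) (pointwise λ _ → A.refl)

  dil-constant : ∀ c → dil (constant c) ≈ constant c
  dil-constant c = dil-unique (pointwise λ { zero → A.refl ; (suc n) → A.refl }) (pointwise λ _ → A.refl)

  dil-1 : dil 1# ≈ 1#
  dil-1 = dil-unique (pointwise λ { zero → A.refl ; (suc n) → A.refl }) (pointwise λ _ → A.refl)

  dil-- : ∀ f g → dil (f - g) ≈ dil f - dil g
  dil-- f g = trans (dil-+ f (- g)) (+-congˡ (dil-neg g))

  dil-x : dil x ≈ x * x
  dil-x = pointwise λ
    { 0 → A.sym (x*-zero x)
    ; 1 → A.sym (x*-suc x 0)
    ; (suc (suc n)) → A.trans (at dil-1 n) (A.sym (x*-suc x (suc n))) }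

  dil-x^ : ∀ n → dil (x ^ n) ≈ x ^ (2 ℕ.* n)
  dil-x^ n = trans (go n) (x^-≡ (double≡2* n))
    where
    go : ∀ n → dil (x ^ n) ≈ x ^ double n
    go zero = dil-1
    go (suc n) = trans (dil-* x (x ^ n)) (trans (*-cong dil-x (go n)) (*-assoc _ _ _))

  dil-^ : ∀ f n → dil (f ^ n) ≈ dil f ^ n
  dil-^ f zero = dil-1
  dil-^ f (suc n) = trans (dil-* f (f ^ n)) (*-congˡ (dil-^ f n))

  dil-∏ : ∀ n f → dil (∏< n f) ≈ ∏< n (dil ∘ f)
  dil-∏ zero f = dil-1
  dil-∏ (suc n) f = trans (dil-* _ _) (*-congʳ (dil-∏ n f))

  dil-∑ : ∀ n f → dil (∑< n f) ≈ ∑< n (dil ∘ f)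
  dil-∑ zero f = dil-0
  dil-∑ (suc n) f = trans (dil-+ _ _) (+-congʳ (dil-∑ n f))

  unit-dil : ∀ {f} → Unit f → Unit (dil f)
  unit-dil u = unit (at0 u)

  dil-⁻¹ : ∀ {f} → Unit f → dil (f ⁻¹) ≈ dil f ⁻¹
  dil-⁻¹ {f} u = ⁻¹-unique (unit-dil u) (trans (sym (dil-* f (f ⁻¹))) (trans (dil-cong (unit-inverse u)) dil-1))

  ev-x* : ∀ f → ev (x * f) ≈ x * od f
  ev-x* f = pointwise λ
    { zero → A.trans (x*-zero f) (A.sym (x*-zero (od f)))
    ; (suc n) → A.trans (x*-suc f _) (A.sym (x*-suc (od f) n)) }

  od-x* : ∀ f → od (x * f) ≈ ev f
  od-x* f = pointwise λ n → x*-suc f (double n)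

  -- The substitution f(-x).
  σ : Series → Series
  σ f zero = f 0
  σ f (suc n) = A.- σ (tail f) n

  ev-σ : ∀ f → ev (σ f) ≈ ev f
  ev-σ f = pointwise (go f)
    where
    go : ∀ f n → σ f (double n) A.≈ f (double n)
    go f zero = A.refl
    go f (suc n) = A.trans (A.-‿involutive _) (go (tail (tail f)) n)

  od-σ : ∀ f → od (σ f) ≈ - od f
  od-σ f = pointwise λ n → A.-‿cong (at (ev-σ (tail f)) n)

  σ-unique : ∀ {f g} → ev f ≈ ev g → - od f ≈ od g → σ f ≈ g
  σ-unique {f} {g} p q = ev-od-ext (trans (ev-σ f) p) (trans (od-σ f) q)

  σ-≈[] : ∀ {N f g} → f ≈[ N ] g → σ f ≈[ N ] σ g
  σ-≈[] {N} {f} {g} p = below (go N f g (at< p))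
    where
    go : ∀ N f g → (∀ n → n < N → f n A.≈ g n) → ∀ n → n < N → σ f n A.≈ σ g n
    go N f g p zero n<N = p 0 n<N
    go (suc N) f g p (suc n) (s≤s n<N) = A.-‿cong (go N (tail f) (tail g) (λ k k<N → p (suc k) (s≤s k<N)) n n<N)

  σ-cong : ∀ {f g} → f ≈ g → σ f ≈ σ g
  σ-cong p = ≈[]⇒≈ λ N → σ-≈[] (≈⇒≈[] p)

  σ-* : ∀ f g → σ (f * g) ≈ σ f * σ g
  σ-* f g = σ-unique
    (trans (ev-* f g) (sym (trans (ev-* (σ f) (σ g)) (+-cong (*-cong (ev-σ f) (ev-σ g)) (*-congˡ
      (trans (*-cong (od-σ f) (od-σ g)) (solve 2 (λ a b → :- a :* :- b := a :* b) refl (od f) (od g))))))))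
    (trans (-‿cong (od-* f g)) (sym (trans (od-* (σ f) (σ g)) (trans
      (+-cong (*-cong (ev-σ f) (od-σ g)) (*-cong (od-σ f) (ev-σ g)))
      (solve 4 (λ a b c d → a :* :- b :+ :- c :* d := :- (a :* b :+ c :* d)) refl (ev f) (od g) (od f) (ev g))))))

  σ-+ : ∀ f g → σ (f + g) ≈ σ f + σ g
  σ-+ f g = σ-unique (sym (+-cong (ev-σ f) (ev-σ g)))
    (sym (trans (+-cong (od-σ f) (od-σ g)) (-‿+-comm _ _)))

  σ-neg : ∀ f → σ (- f) ≈ - σ f
  σ-neg f = σ-unique (sym (-‿cong (ev-σ f))) (sym (-‿cong (od-σ f)))

  σ-dil : ∀ f → σ (dil f) ≈ dil f
  σ-dil f = σ-unique refl (trans (-‿cong (od-dil f)) (trans -0#≈0# (sym (od-dil f))))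

  σσ : ∀ f → σ (σ f) ≈ f
  σσ f = σ-unique (ev-σ f) (trans (-‿cong (od-σ f)) (-‿involutive _))

  σ-1 : σ 1# ≈ 1#
  σ-1 = σ-unique refl (pointwise λ _ → A.-0#≈0#)

  σ-x : σ x ≈ - x
  σ-x = σ-unique (pointwise λ { zero → A.sym A.-0#≈0# ; (suc n) → A.sym A.-0#≈0# }) refl

  σ-^ : ∀ f n → σ (f ^ n) ≈ σ f ^ n
  σ-^ f zero = σ-1
  σ-^ f (suc n) = trans (σ-* f (f ^ n)) (*-congˡ (σ-^ f n))

  σ-∏ : ∀ n f → σ (∏< n f) ≈ ∏< n (σ ∘ f)
  σ-∏ zero f = σ-1
  σ-∏ (suc n) f = trans (σ-* _ _) (*-congʳ (σ-∏ n f))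

  σ-∑ : ∀ n f → σ (∑< n f) ≈ ∑< n (σ ∘ f)
  σ-∑ zero f = σ-unique refl (pointwise λ _ → A.-0#≈0#)
  σ-∑ (suc n) f = trans (σ-+ _ _) (+-congʳ (σ-∑ n f))

  -- Infinite products and theta series

  x^-double : ∀ n → x ^ (2 ℕ.* n) ≈ x ^ n * x ^ n
  x^-double n = trans (x^-+ n (n ℕ.+ 0)) (*-congˡ (x^-≡ (ℕₚ.+-identityʳ n)))

  σ-x^-odd : ∀ k → σ (x ^ suc (2 ℕ.* k)) ≈ - x ^ suc (2 ℕ.* k)
  σ-x^-odd k = begin
    σ (x * x ^ (2 ℕ.* k))      ≈⟨ σ-* _ _ ⟩
    σ x * σ (x ^ (2 ℕ.* k))    ≈⟨ *-cong σ-x (trans (σ-cong (sym (dil-x^ k))) (trans (σ-dil _) (dil-x^ k))) ⟩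
    - x * x ^ (2 ℕ.* k)        ≈⟨ sym (-‿distribˡ-* _ _) ⟩
    - (x * x ^ (2 ℕ.* k)) ∎

  1-x^≈[]1 : ∀ {N d} → N ≤ d → 1# - x ^ d ≈[ N ] 1#
  1-x^≈[]1 N≤d = ≈[]-trans (+-≈[] ≈[]-refl (neg-≈[] (x^≈[]0 N≤d)))
    (≈⇒≈[] (trans (+-congˡ -0#≈0#) (+-identityʳ 1#)))

  1+x^≈[]1 : ∀ {N d} → N ≤ d → 1# + x ^ d ≈[ N ] 1#
  1+x^≈[]1 N≤d = ≈[]-trans (+-≈[] ≈[]-refl (x^≈[]0 N≤d)) (≈⇒≈[] (+-identityʳ 1#))

  unit-1-x^ : ∀ n → Unit (1# - x ^ suc n)
  unit-1-x^ n = unit-≈ (unit-+x* (- x ^ n)) (+-congˡ (-‿distribʳ-* _ _))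

  unit-1+x^ : ∀ n → Unit (1# + x ^ suc n)
  unit-1+x^ n = unit-+x* (x ^ n)

  k≤1+2k : ∀ k → k ≤ suc (2 ℕ.* k)
  k≤1+2k k = ℕₚ.m≤n⇒m≤1+n (ℕₚ.m≤m+n k _)

  eulerFactor oddFactor oddFactor⁺ eulerFactor⁺ : ℕ → Series
  eulerFactor k = 1# - x ^ suc k
  eulerFactor⁺ k = 1# + x ^ suc k
  oddFactor k = 1# - x ^ suc (2 ℕ.* k)
  oddFactor⁺ k = 1# + x ^ suc (2 ℕ.* k)

  module Euler = InfiniteProduct eulerFactor (λ k → 1-x^≈[]1 (ℕₚ.n≤1+n k))
  module Euler⁺ = InfiniteProduct eulerFactor⁺ (λ k → 1+x^≈[]1 (ℕₚ.n≤1+n k))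
  module Odd = InfiniteProduct oddFactor (λ k → 1-x^≈[]1 (k≤1+2k k))
  module Odd⁺ = InfiniteProduct oddFactor⁺ (λ k → 1+x^≈[]1 (k≤1+2k k))

  -- In q-Pochhammer notation: a = (x; x)∞, b = (x²; x²)∞, o = (x; x²)∞, ō = (−x; x²)∞.
  a b o ō : Series
  a = ∏∞ eulerFactor
  b = dil a
  o = ∏∞ oddFactor
  ō = ∏∞ oddFactor⁺

  poch : ℕ → Series
  poch n = ∏< n eulerFactor

  unit-poch : ∀ n → Unit (poch n)
  unit-poch = unit-∏ unit-1-x^

  unit-a : Unit a
  unit-a = unit-≈[] {0} (unit-poch 1) (Euler.∏∞-≈[] ℕₚ.≤-refl)

  unit-o : Unit o
  unit-o = unit-≈[] {0} (unit-∏ (λ k → unit-1-x^ (2 ℕ.* k)) 1) (Odd.∏∞-≈[] ℕₚ.≤-refl)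

  unit-ō : Unit ō
  unit-ō = unit-≈[] {0} (unit-∏ (λ k → unit-1+x^ (2 ℕ.* k)) 1) (Odd⁺.∏∞-≈[] ℕₚ.≤-refl)

  unit-b : Unit b
  unit-b = unit-dil unit-a

  σ-o : σ o ≈ ō
  σ-o = ≈[]⇒≈ λ N → ≈[]-trans (σ-≈[] (Odd.∏∞-≈[] ℕₚ.≤-refl))
    (≈[]-trans (≈⇒≈[] (trans (σ-∏ N _) (∏-cong N factor))) (≈[]-sym (Odd⁺.∏∞-≈[] ℕₚ.≤-refl)))
    where
    factor : ∀ k → σ (oddFactor k) ≈ oddFactor⁺ k
    factor k = trans (σ-+ _ _) (+-cong σ-1 (trans (σ-neg _) (trans (-‿cong (σ-x^-odd k)) (-‿involutive _))))

  dil-1-x^ : ∀ n → dil (1# - x ^ n) ≈ 1# - x ^ (2 ℕ.* n)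
  dil-1-x^ n = trans (dil-- _ _) (+-cong dil-1 (-‿cong (dil-x^ n)))

  dil-1+x^ : ∀ n → dil (1# + x ^ n) ≈ 1# + x ^ (2 ℕ.* n)
  dil-1+x^ n = trans (dil-+ _ _) (+-cong dil-1 (dil-x^ n))

  difference-of-squares : ∀ n → (1# - x ^ n) * (1# + x ^ n) ≈ dil (1# - x ^ n)
  difference-of-squares n = sym (trans (dil-1-x^ n) (trans (+-congˡ (-‿cong (x^-double n)))
    (solve 1 (λ v → con (+ 1) :- v :* v := (con (+ 1) :- v) :* (con (+ 1) :+ v)) refl (x ^ n))))

  o*ō : o * ō ≈ dil o
  o*ō = ≈[]⇒≈ λ N → ≈[]-trans (*-≈[] (Odd.∏∞-≈[] {N} ℕₚ.≤-refl) (Odd⁺.∏∞-≈[] ℕₚ.≤-refl))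
    (≈[]-trans (≈⇒≈[] (trans (sym (∏-* N _ _)) (trans (∏-cong N (λ k → difference-of-squares (suc (2 ℕ.* k)))) (sym (dil-∏ N _)))))
      (dil-≈[] (≈[]-sym (Odd.∏∞-≈[] ℕₚ.≤-refl))))

  a≈o*b : a ≈ o * b
  a≈o*b = ≈[]⇒≈ λ N → ≈[]-trans (Euler.∏∞-≈[] (ℕₚ.≤-trans (ℕₚ.m≤m+n N N) (ℕₚ.≤-reflexive (≡.sym (double≡+ N)))))
    (≈[]-trans (≈⇒≈[] (finite N)) (*-≈[] (≈[]-sym (Odd.∏∞-≈[] ℕₚ.≤-refl)) (dil-≈[] (≈[]-sym (Euler.∏∞-≈[] ℕₚ.≤-refl)))))
    where
    finite : ∀ n → poch (double n) ≈ ∏< n oddFactor * dil (poch n)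
    finite zero = sym (trans (*-identityˡ _) dil-1)
    finite (suc n) = begin
      poch (double n) * (1# - x ^ suc (double n)) * (1# - x ^ suc (suc (double n)))
        ≈⟨ *-cong (*-cong (finite n) (+-congˡ (-‿cong (x^-≡ (cong suc (double≡2* n))))))
             (+-congˡ (-‿cong (x^-≡ (double≡2* (suc n))))) ⟩
      ∏< n oddFactor * dil (poch n) * oddFactor n * (1# - x ^ (2 ℕ.* suc n))
        ≈⟨ solve 4 (λ a b c d → a :* b :* c :* d := a :* c :* (b :* d)) refl _ _ _ _ ⟩
      ∏< (suc n) oddFactor * (dil (poch n) * (1# - x ^ (2 ℕ.* suc n)))
        ≈⟨ *-congˡ (sym (trans (dil-* _ _) (*-congˡ (dil-1-x^ (suc n))))) ⟩
      ∏< (suc n) oddFactor * dil (poch (suc n)) ∎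

  a⁺ : Series
  a⁺ = ∏∞ eulerFactor⁺

  a*a⁺ : a * a⁺ ≈ b
  a*a⁺ = ≈[]⇒≈ λ N → ≈[]-trans (*-≈[] (Euler.∏∞-≈[] {N} ℕₚ.≤-refl) (Euler⁺.∏∞-≈[] ℕₚ.≤-refl))
    (≈[]-trans (≈⇒≈[] (trans (sym (∏-* N _ _)) (trans (∏-cong N (difference-of-squares ∘ suc)) (sym (dil-∏ N _)))))
      (dil-≈[] (≈[]-sym (Euler.∏∞-≈[] ℕₚ.≤-refl))))

  -- Euler's theorem that partitions into distinct parts and into odd parts are equally numerous, in
  -- product form.
  o*a⁺ : o * a⁺ ≈ 1#
  o*a⁺ = *-cancelˡ unit-b (begin
    b * (o * a⁺)  ≈⟨ solve 3 (λ b o c → b :* (o :* c) := o :* b :* c) refl _ _ _ ⟩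
    o * b * a⁺    ≈⟨ *-congʳ (sym a≈o*b) ⟩
    a * a⁺        ≈⟨ a*a⁺ ⟩
    b             ≈⟨ sym (*-identityʳ b) ⟩
    b * 1# ∎)

  sign : ℕ → Series
  sign n = (- 1#) ^ n

  -- Shanks' finite form of the theta expansions; c = 0 gives Euler's pentagonal
  -- number theorem and c = 1 gives Gauss' product for φ(−x).
  module Shanks (c : Series) where

    C : ℕ → Series
    C s = ∏< s (λ i → c + x ^ i)

    term : ℕ → ℕ → Series
    term n s = sign s * (poch n * poch s ⁻¹) * C s * ((x ^ n) ^ s * x ^ s)

    G : ℕ → Series
    G n = ∑< (suc n) (term n)

    poch⁻¹-suc : ∀ s → poch s ⁻¹ ≈ poch (suc s) ⁻¹ * (1# - x ^ suc s)
    poch⁻¹-suc s = sym (⁻¹-unique (unit-poch s) (trans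
      (solve 3 (λ a b c → a :* (b :* c) := a :* c :* b) refl _ _ _) (unit-inverse (unit-poch (suc s)))))

    private
      module _ (m : ℕ) where
        n = suc m
        y = x ^ n

        t : ℕ → Series
        t s = term n s - (1# + c * y) * term m s

        u : ℕ → Series
        u s = sign s * (poch m * poch s ⁻¹) * C (suc s) * y ^ suc s

        split : ∀ s → t s ≈ sign s * (poch m * poch s ⁻¹) * C s * y ^ s * ((1# - y) * x ^ s - 1# - c * y)
        split s = trans
          (+-congˡ (-‿cong (*-congˡ (*-congˡ (trans (*-comm _ _) (sym (^-distrib-* x (x ^ m) s)))))))
          (solve 8 (λ σ p i q C y c w →
              σ :* (p :* (con (+ 1) :- q) :* i) :* C :* (y :* w) :- (con (+ 1) :+ c :* q) :* (σ :* (p :* i) :* C :* y)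
              := σ :* (p :* i) :* C :* y :* ((con (+ 1) :- q) :* w :- con (+ 1) :- c :* q))
            refl (sign s) (poch m) (poch s ⁻¹) y (C s) (y ^ s) c (x ^ s))

        telescope : ∀ k → ∑< (suc k) t ≈ - u k
        telescope zero = trans (+-identityˡ _) (trans (split 0)
          (solve 4 (λ p i q c → con (+ 1) :* (p :* i) :* con (+ 1) :* con (+ 1) :* ((con (+ 1) :- q) :* con (+ 1) :- con (+ 1) :- c :* q)
              := :- (con (+ 1) :* (p :* i) :* (con (+ 1) :* (c :+ con (+ 1))) :* (q :* con (+ 1))))
            refl (poch m) (poch 0 ⁻¹) y c))
        telescope (suc k) = trans (+-cong (trans (telescope k) (-‿cong (*-congʳ (*-congʳ (*-congˡ (*-congˡ (poch⁻¹-suc k))))))) (split (suc k)))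
          (solve 8 (λ σ p i q C y c w →
              :- (σ :* (p :* (i :* (con (+ 1) :- w))) :* C :* y)
                :+ :- con (+ 1) :* σ :* (p :* i) :* C :* y :* ((con (+ 1) :- q) :* w :- con (+ 1) :- c :* q)
              := :- (:- con (+ 1) :* σ :* (p :* i) :* (C :* (c :+ w)) :* (q :* y)))
            refl (sign k) (poch m) (poch (suc k) ⁻¹) y (C (suc k)) (y ^ suc k) c (x ^ suc k))

    -- The termwise difference `t` telescopes with partial sums `- u k`, so only boundary terms
    -- survive.
    recurrence : ∀ m → G (suc m) ≈ (1# + c * x ^ suc m) * G m + sign (suc m) * C (suc m) * (x ^ suc m) ^ suc m * (1# + x ^ suc m)
    recurrence m = begin
      ∑< (suc m) (term (suc m)) + term (suc m) (suc m)
        ≈⟨ solve 3 (λ a b c → a :+ b := c :+ (a :- c) :+ b) refl _ _ (1+cy * G m) ⟩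
      1+cy * G m + (∑< (suc m) (term (suc m)) - 1+cy * G m) + term (suc m) (suc m)
        ≈⟨ +-congʳ (+-congˡ (trans (trans (+-congˡ (trans (-‿cong (sym (∑-*ˡ (suc m) 1+cy (term m)))) (neg-∑ (suc m) _))) (sym (∑-+ (suc m) _ _))) (telescope m m))) ⟩
      1+cy * G m + - u m m + term (suc m) (suc m)
        ≈⟨ +-cong (+-congˡ (-‿cong (*-congʳ (*-congʳ (trans (*-congˡ (unit-inverse (unit-poch m))) (*-identityʳ _))))))
             (*-congʳ (*-congʳ (trans (*-congˡ (unit-inverse (unit-poch (suc m)))) (*-identityʳ _)))) ⟩
      1+cy * G m + - (sign m * C (suc m) * (x ^ suc m) ^ suc m) + sign (suc m) * C (suc m) * ((x ^ suc m) ^ suc m * (x ^ suc m))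
        ≈⟨ solve 5 (λ g s C y w → g :+ :- (s :* C :* y) :+ :- con (+ 1) :* s :* C :* (y :* w)
             := g :+ :- con (+ 1) :* s :* C :* y :* (con (+ 1) :+ w)) refl _ (sign m) (C (suc m)) ((x ^ suc m) ^ suc m) (x ^ suc m) ⟩
      1+cy * G m + sign (suc m) * C (suc m) * (x ^ suc m) ^ suc m * (1# + x ^ suc m) ∎
      where
      1+cy = 1# + c * x ^ suc m
      neg-∑ : ∀ k f → - ∑< k f ≈ ∑< k (λ i → - f i)
      neg-∑ zero f = -0#≈0#
      neg-∑ (suc k) f = trans (sym (-‿+-comm _ _)) (+-congʳ (neg-∑ k f))

    G-0 : G 0 ≈ 1#
    G-0 = trans (solve 1 (λ i → con (+ 0) :+ con (+ 1) :* (con (+ 1) :* i) :* con (+ 1) :* (con (+ 1) :* con (+ 1)) := con (+ 1) :* i) refl (poch 0 ⁻¹))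
      (unit-inverse (unit-poch 0))

    -- Every term after the first carries the factor x^n, so the finite forms tend to the infinite
    -- product.
    G-≈[] : ∀ n → G n ≈[ n ] poch n
    G-≈[] n = ≈[]-trans (≈⇒≈[] (∑-first n (term n))) (≈[]-trans
      (+-≈[] (≈⇒≈[] first) (≈[]-trans (∑-≈[] n (λ k _ → rest k)) (≈⇒≈[] (∑-0 n)))) (≈⇒≈[] (+-identityʳ _)))
      where
      first : term n 0 ≈ poch n
      first = trans (solve 2 (λ p i → con (+ 1) :* (p :* i) :* con (+ 1) :* (con (+ 1) :* con (+ 1)) := p :* (con (+ 1) :* i)) refl (poch n) (poch 0 ⁻¹))
        (trans (*-congˡ (unit-inverse (unit-poch 0))) (*-identityʳ _))
      rest : ∀ k → term n (suc k) ≈[ n ] 0#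
      rest k = ≈[]-trans (≈⇒≈[] (solve 4 (λ p y z w → p :* (y :* z :* w) := y :* (p :* (z :* w))) refl _ (x ^ n) _ _)) (x^*≈[]0 _ ℕₚ.≤-refl)

  two : Series
  two = nat 2

  squareTerm : ℕ → Series
  squareTerm k = two * (sign (suc k) * x ^ (suc k ℕ.* suc k))

  squareTerm-small : ∀ k → squareTerm k ≈[ k ] 0#
  squareTerm-small k = ≈[]-trans (≈⇒≈[] (solve 3 (λ a b c → a :* (b :* c) := c :* (a :* b)) refl _ _ _))
    (x^*≈[]0 _ (ℕₚ.≤-trans (ℕₚ.n≤1+n k) (ℕₚ.m≤m+n (suc k) _)))

  module Squares = InfiniteSum squareTerm squareTerm-small

  -- φ̄ = ∑ (−1)ⁿ x^(n²) over all integers n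
  φ̄ : Series
  φ̄ = 1# + (∑∞ squareTerm)

  -- The case c = 1 of the finite form gives `a ≈ a⁺ * φ̄`, and `o` is the inverse of `a⁺`.
  gauss : φ̄ ≈ a * o
  gauss = begin
    φ̄              ≈⟨ sym (*-identityˡ φ̄) ⟩
    1# * φ̄         ≈⟨ *-congʳ (sym o*a⁺) ⟩
    o * a⁺ * φ̄     ≈⟨ *-assoc _ _ _ ⟩
    o * (a⁺ * φ̄)   ≈⟨ *-congˡ (sym a≈a⁺φ̄) ⟩
    o * a          ≈⟨ *-comm o a ⟩
    a * o ∎
    where
    open Shanks 1#
    C-suc : ∀ m → C (suc m) ≈ two * ∏< m eulerFactor⁺
    C-suc m = ∏-first m _
    finite : ∀ n → G n ≈ ∏< n eulerFactor⁺ * (1# + ∑< n squareTerm)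
    finite zero = trans G-0 (solve 0 (con (+ 1) := con (+ 1) :* (con (+ 1) :+ con (+ 0))) refl)
    finite (suc m) = begin
      G (suc m)
        ≈⟨ recurrence m ⟩
      (1# + 1# * x ^ suc m) * G m + sign (suc m) * C (suc m) * (x ^ suc m) ^ suc m * (1# + x ^ suc m)
        ≈⟨ +-cong (*-congˡ (finite m)) (*-congʳ (*-cong (*-congˡ (C-suc m)) (^-assocʳ x (suc m) (suc m)))) ⟩
      (1# + 1# * x ^ suc m) * (P * S) + sign (suc m) * (two * P) * x ^ (suc m ℕ.* suc m) * (1# + x ^ suc m)
        ≈⟨ solve 6 (λ y P T s w t → (con (+ 1) :+ con (+ 1) :* y) :* (P :* (con (+ 1) :+ T)) :+ s :* (t :* P) :* w :* (con (+ 1) :+ y)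
             := P :* (con (+ 1) :+ y) :* (con (+ 1) :+ (T :+ t :* (s :* w)))) refl (x ^ suc m) P (∑< m squareTerm) (sign (suc m)) _ two ⟩
      ∏< (suc m) eulerFactor⁺ * (1# + ∑< (suc m) squareTerm) ∎
      where
      P = ∏< m eulerFactor⁺
      S = 1# + ∑< m squareTerm
    a≈a⁺φ̄ : a ≈ a⁺ * φ̄
    a≈a⁺φ̄ = ≈[]⇒≈ λ N → ≈[]-trans (Euler.∏∞-≈[] ℕₚ.≤-refl) (≈[]-trans (≈[]-sym (G-≈[] N)) (≈[]-trans (≈⇒≈[] (finite N))
      (*-≈[] (≈[]-sym (Euler⁺.∏∞-≈[] ℕₚ.≤-refl)) (+-≈[] ≈[]-refl (≈[]-sym (Squares.∑∞-≈[] ℕₚ.≤-refl))))))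

  -- The generalised pentagonal numbers are pentagonal j and pentagonal j + (2j + 1).
  pentagonal : ℕ → ℕ
  pentagonal j = triangle j ℕ.+ j ℕ.* j

  k≤pentagonal : ∀ k → k ≤ pentagonal k
  k≤pentagonal k = ℕₚ.≤-trans (k≤triangle k) (ℕₚ.m≤m+n _ _)

  pentagonalTerm : ℕ → Series
  pentagonalTerm j = sign j * (x ^ pentagonal j * (1# - x ^ suc (2 ℕ.* j)))

  pentagonalTerm-small : ∀ k → pentagonalTerm k ≈[ k ] 0#
  pentagonalTerm-small k = ≈[]-trans (≈⇒≈[] (solve 3 (λ a b c → a :* (b :* c) := b :* (a :* c)) refl _ _ _))
    (x^*≈[]0 _ (k≤pentagonal k))

  module Pentagonal = InfiniteSum pentagonalTerm pentagonalTerm-small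

  pentagonalTheorem : a ≈ (∑∞ pentagonalTerm)
  pentagonalTheorem = ≈[]⇒≈ λ N → ≈[]-trans (Euler.∏∞-≈[] {N} ℕₚ.≤-refl) (≈[]-trans (≈[]-sym (G-≈[] N))
      (≈[]-trans (≈[]-trans (≈⇒≈[] (solve 2 (λ a b → a := a :- b :+ b) refl (G N) (sign N * x ^ pentagonal N)))
          (+-≈[] (≈⇒≈[] (sym (finite N))) (≈[]-trans (≈⇒≈[] (*-comm _ _)) (x^*≈[]0 _ (k≤pentagonal N)))))
        (≈[]-trans (≈⇒≈[] (+-identityʳ _)) (≈[]-sym (Pentagonal.∑∞-≈[] ℕₚ.≤-refl)))))
    where
    open Shanks 0#
    C≈x^ : ∀ m → C (suc m) ≈ x ^ triangle m
    C≈x^ zero = trans (*-identityˡ _) (+-identityˡ _)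
    C≈x^ (suc m) = trans (*-cong (C≈x^ m) (+-identityˡ _)) (sym (x^-+ (triangle m) (suc m)))
    finite : ∀ n → ∑< n pentagonalTerm ≈ G n - sign n * x ^ pentagonal n
    finite zero = sym (trans (+-congʳ G-0) (solve 0 (con (+ 1) :- con (+ 1) :* con (+ 1) := con (+ 0)) refl))
    finite (suc m) = begin
      ∑< m pentagonalTerm + pentagonalTerm m
        ≈⟨ +-congʳ (finite m) ⟩
      (G m - s * p) + s * (p * (1# - x ^ suc (2 ℕ.* m)))
        ≈⟨ solve 4 (λ g s p w → (g :- s :* p) :+ s :* (p :* (con (+ 1) :- w)) := g :- s :* (p :* w)) refl (G m) s p _ ⟩
      G m - s * (p * x ^ suc (2 ℕ.* m))
        ≈⟨ +-congˡ (-‿cong (*-congˡ (trans (sym (x^-+ (pentagonal m) (suc (2 ℕ.* m)))) (trans (x^-≡ exponent) (x^-+ (triangle m) (suc m ℕ.* suc m)))))) ⟩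
      G m - s * (x ^ triangle m * x ^ (suc m ℕ.* suc m))
        ≈⟨ solve 5 (λ g s T w y → g :- s :* (T :* w) := (con (+ 1) :+ con (+ 0) :* y) :* g :+ :- con (+ 1) :* s :* T :* w :* (con (+ 1) :+ y) :- :- con (+ 1) :* s :* ((T :* y) :* w))
             refl (G m) s _ _ (x ^ suc m) ⟩
      (1# + 0# * x ^ suc m) * G m + sign (suc m) * x ^ triangle m * x ^ (suc m ℕ.* suc m) * (1# + x ^ suc m) - sign (suc m) * (x ^ triangle m * x ^ suc m * x ^ (suc m ℕ.* suc m))
        ≈⟨ +-cong (+-congˡ (*-congʳ (*-cong (*-congˡ (sym (C≈x^ m))) (sym (^-assocʳ x (suc m) (suc m))))))
             (-‿cong (*-congˡ (trans (*-congʳ (sym (x^-+ (triangle m) (suc m)))) (sym (x^-+ (triangle (suc m)) (suc m ℕ.* suc m)))))) ⟩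
      (1# + 0# * x ^ suc m) * G m + sign (suc m) * C (suc m) * (x ^ suc m) ^ suc m * (1# + x ^ suc m) - sign (suc m) * x ^ pentagonal (suc m)
        ≈⟨ +-congʳ (sym (recurrence m)) ⟩
      G (suc m) - sign (suc m) * x ^ pentagonal (suc m) ∎
      where
      s = sign m
      p = x ^ pentagonal m
      exponent : pentagonal m ℕ.+ suc (2 ℕ.* m) ≡ triangle m ℕ.+ suc m ℕ.* suc m
      exponent = solveℕ 2 (λ t m → t ⊕ m ⊗ m ⊕ (conℕ 1 ⊕ conℕ 2 ⊗ m) ⊜ t ⊕ (conℕ 1 ⊕ m) ⊗ (conℕ 1 ⊕ m)) ≡.refl (triangle m) m

  -- Partial fraction coefficients for nodes of the form ± x^e.

  data Sign : Set where
    plus minus : Sign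

  ε : Sign → Series
  ε plus = 1#
  ε minus = - 1#

  ε² : ∀ s → ε s * ε s ≈ 1#
  ε² plus = *-identityˡ 1#
  ε² minus = solve 0 (:- con (+ 1) :* :- con (+ 1) := con (+ 1)) refl

  -- The node with exponent e has value ± x ^ e; e = 1 + pred-exp keeps it without constant term.
  record Node : Set where
    constructor node
    field
      sgn : Sign
      pred-exp : ℕ
  open Node public

  e : Node → ℕ
  e i = suc (pred-exp i)

  v : Node → Series
  v i = ε (sgn i) * x ^ e i

  s : Node → Node → Series
  s i k = ε (sgn i) * ε (sgn k)

  -- Exponents are compared, not values: `den` is a unit because the sum and the distance of two
  -- different exponents are positive.
  _#_ : Node → Node → Set
  i # k = ¬ e i ≡ e k

  -- Differences of nodes begin with a power of x; they are no units, yet they can be cancelled.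
  record Regular (f : Series) : Set where
    constructor regular
    field cancel : ∀ {g h} → f * g ≈ f * h → g ≈ h
  open Regular public

  regular-unit : ∀ {f} → Unit f → Regular f
  regular-unit u = regular (*-cancelˡ u)

  regular-* : ∀ {f g} → Regular f → Regular g → Regular (f * g)
  regular-* r r′ = regular λ p → cancel r′ (cancel r (trans (sym (*-assoc _ _ _)) (trans p (*-assoc _ _ _))))

  regular-≈ : ∀ {f g} → f ≈ g → Regular f → Regular g
  regular-≈ p r = regular λ q → cancel r (trans (*-congʳ p) (trans q (*-congʳ (sym p))))

  regular-x^ : ∀ n → Regular (x ^ n)
  regular-x^ zero = regular-unit unit-1
  regular-x^ (suc n) = regular-* (regular x*-injective) (regular-x^ n)

  regular-involution : ∀ {f} → f * f ≈ 1# → Regular f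
  regular-involution {f} p = regular λ {g} {h} q → begin
    g             ≈⟨ sym (*-identityˡ g) ⟩
    1# * g        ≈⟨ *-congʳ (sym p) ⟩
    f * f * g     ≈⟨ *-assoc _ _ _ ⟩
    f * (f * g)   ≈⟨ *-congˡ q ⟩
    f * (f * h)   ≈⟨ sym (*-assoc _ _ _) ⟩
    f * f * h     ≈⟨ *-congʳ p ⟩
    1# * h        ≈⟨ *-identityˡ h ⟩
    h ∎

  regular-v : ∀ i → Regular (v i)
  regular-v i = regular-* (regular-involution (ε² (sgn i))) (regular-x^ (e i))

  unit-1-s : ∀ (c : Series) {n} → 1 ≤ n → Unit (1# - c * x ^ n)
  unit-1-s c {suc n} _ = unit-≈ (unit-+x* (- (c * x ^ n)))
    (+-congˡ (solve 3 (λ c x y → :- (c :* (x :* y)) := x :* :- (c :* y)) refl c x (x ^ n)))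

  den : Node → Node → Series
  den i k = (1# - s i k * x ^ ∣ e i - e k ∣) * (1# - s i k * x ^ (e i ℕ.+ e k))

  1≤e+e : ∀ i k → 1 ≤ e i ℕ.+ e k
  1≤e+e i k = s≤s z≤n

  1≤∣-∣ : ∀ {m n} → ¬ m ≡ n → 1 ≤ ∣ m - n ∣
  1≤∣-∣ {m} {n} m≢n with ∣ m - n ∣ in eq
  ... | zero = ⊥-elim (m≢n (ℕₚ.∣m-n∣≡0⇒m≡n eq))
  ... | suc _ = s≤s z≤n

  unit-den : ∀ i k → i # k → Unit (den i k)
  unit-den i k i#k = unit-* (unit-1-s (s i k) (1≤∣-∣ i#k)) (unit-1-s (s i k) (1≤e+e i k))

  -- The coefficient v i / ((v i - v k)(1 - v i v k)), with the common power of x cancelled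
  -- beforehand; hence the case distinction. It equals 1 / quad w (v k) for w = v i + 1 / v i, which
  -- is not a power series. The value 1 on the diagonal lets products run over all nodes, including
  -- the node i itself.
  θ : Node → Node → Series
  θ i k with ℕₚ.<-cmp (e i) (e k)
  ... | tri< _ _ _ = den i k ⁻¹
  ... | tri≈ _ _ _ = 1#
  ... | tri> _ _ _ = - s i k * x ^ ∣ e i - e k ∣ * den i k ⁻¹

  θ-≈ : ∀ i k → e i ≡ e k → θ i k ≈ 1#
  θ-≈ i k p with ℕₚ.<-cmp (e i) (e k)
  ... | tri< _ ¬q _ = ⊥-elim (¬q p)
  ... | tri≈ _ _ _ = refl
  ... | tri> _ ¬q _ = ⊥-elim (¬q p)

  θ-diag : ∀ i → θ i i ≈ 1#
  θ-diag i = θ-≈ i i ≡.refl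

  θ-< : ∀ i k → e i < e k → θ i k * den i k ≈ 1#
  θ-< i k p with ℕₚ.<-cmp (e i) (e k)
  ... | tri< _ q _ = trans (*-comm _ _) (unit-inverse (unit-den i k q))
  ... | tri≈ ¬q _ _ = ⊥-elim (¬q p)
  ... | tri> ¬q _ _ = ⊥-elim (¬q p)

  θ-> : ∀ i k → e k < e i → θ i k * den i k ≈ - s i k * x ^ ∣ e i - e k ∣
  θ-> i k p with ℕₚ.<-cmp (e i) (e k)
  ... | tri< _ _ ¬q = ⊥-elim (¬q p)
  ... | tri≈ _ _ ¬q = ⊥-elim (¬q p)
  ... | tri> _ q _ = trans (*-assoc _ _ _) (trans (*-congˡ (trans (*-comm _ _) (unit-inverse (unit-den i k q)))) (*-identityʳ _))

  s-e+e : ∀ i k → s i k * x ^ (e i ℕ.+ e k) ≈ v i * v k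
  s-e+e i k = trans (*-congˡ (x^-+ (e i) (e k)))
    (solve 4 (λ a b c d → a :* b :* (c :* d) := a :* c :* (b :* d)) refl _ _ _ _)

  s-comm : ∀ i k → s i k ≈ s k i
  s-comm i k = *-comm _ _

  v-via-s : ∀ i k → e i ≤ e k → v k ≈ v i * (s i k * x ^ ∣ e i - e k ∣)
  v-via-s i k p = begin
    ε (sgn k) * x ^ e k
      ≈⟨ *-cong (sym (*-identityˡ _)) (trans (x^-≡ (≡.trans (≡.sym (ℕₚ.m+[n∸m]≡n p)) (cong (e i ℕ.+_) (≡.sym (ℕₚ.m≤n⇒∣m-n∣≡n∸m p))))) (x^-+ (e i) _)) ⟩
    1# * ε (sgn k) * (x ^ e i * x ^ ∣ e i - e k ∣)
      ≈⟨ *-congʳ (*-congʳ (sym (ε² (sgn i)))) ⟩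
    ε (sgn i) * ε (sgn i) * ε (sgn k) * (x ^ e i * x ^ ∣ e i - e k ∣)
      ≈⟨ solve 4 (λ a b c d → a :* a :* b :* (c :* d) := a :* c :* (a :* b :* d)) refl _ _ _ _ ⟩
    v i * (s i k * x ^ ∣ e i - e k ∣) ∎

  gap : Node → Node → Series
  gap i k = (v i - v k) * (1# - v i * v k)

  gap-< : ∀ i k → e i ≤ e k → gap i k ≈ v i * den i k
  gap-< i k p = begin
    (v i - v k) * (1# - v i * v k)
      ≈⟨ *-cong (+-congˡ (-‿cong (v-via-s i k p))) (+-congˡ (-‿cong (sym (s-e+e i k)))) ⟩
    (v i - v i * t) * (1# - s i k * x ^ (e i ℕ.+ e k))
      ≈⟨ solve 3 (λ v t d → (v :- v :* t) :* d := v :* ((con (+ 1) :- t) :* d)) refl _ _ _ ⟩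
    v i * den i k ∎
    where t = s i k * x ^ ∣ e i - e k ∣

  gap-sym : ∀ i k → gap i k ≈ - gap k i
  gap-sym i k = solve 2 (λ a b → (a :- b) :* (con (+ 1) :- a :* b) := :- ((b :- a) :* (con (+ 1) :- b :* a))) refl (v i) (v k)

  den-sym : ∀ i k → den i k ≈ den k i
  den-sym i k = *-cong
    (+-congˡ (-‿cong (*-cong (s-comm i k) (x^-≡ (ℕₚ.∣-∣-comm (e i) (e k))))))
    (+-congˡ (-‿cong (*-cong (s-comm i k) (x^-≡ (ℕₚ.+-comm (e i) (e k))))))

  θ-gap : ∀ i k → i # k → θ i k * gap i k ≈ v i
  θ-gap i k i#k with ℕₚ.<-cmp (e i) (e k)
  ... | tri< p _ _ = begin
    den i k ⁻¹ * gap i k          ≈⟨ *-congˡ (gap-< i k (ℕₚ.<⇒≤ p)) ⟩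
    den i k ⁻¹ * (v i * den i k)  ≈⟨ solve 3 (λ a b c → a :* (b :* c) := b :* (c :* a)) refl _ _ _ ⟩
    v i * (den i k * den i k ⁻¹)  ≈⟨ *-congˡ (unit-inverse (unit-den i k i#k)) ⟩
    v i * 1#                      ≈⟨ *-identityʳ _ ⟩
    v i ∎
  ... | tri≈ _ q _ = ⊥-elim (i#k q)
  ... | tri> _ _ p = begin
    - s i k * x ^ ∣ e i - e k ∣ * den i k ⁻¹ * gap i k
      ≈⟨ *-congˡ (trans (gap-sym i k) (-‿cong (trans (gap-< k i (ℕₚ.<⇒≤ p)) (*-congˡ (den-sym k i))))) ⟩
    - s i k * x ^ ∣ e i - e k ∣ * den i k ⁻¹ * - (v k * den i k)
      ≈⟨ solve 5 (λ s t d v D → :- s :* t :* d :* :- (v :* D) := v :* (s :* t) :* (D :* d)) refl _ _ _ _ _ ⟩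
    v k * (s i k * x ^ ∣ e i - e k ∣) * (den i k * den i k ⁻¹)
      ≈⟨ *-cong (*-congˡ (*-cong (s-comm i k) (x^-≡ (ℕₚ.∣-∣-comm (e i) (e k))))) (unit-inverse (unit-den i k i#k)) ⟩
    v k * (s k i * x ^ ∣ e k - e i ∣) * 1#
      ≈⟨ trans (*-identityʳ _) (sym (v-via-s k i (ℕₚ.<⇒≤ p))) ⟩
    v i ∎

  regular-gap : ∀ i k → i # k → Regular (gap i k)
  regular-gap i k i#k with ℕₚ.≤-total (e i) (e k)
  ... | inj₁ p = regular-≈ (sym (gap-< i k p)) (regular-* (regular-v i) (regular-unit (unit-den i k i#k)))
  ... | inj₂ p = regular-≈ (trans (*-congˡ (sym (gap-< k i p))) (trans (solve 1 (λ a → :- con (+ 1) :* a := :- a) refl _) (sym (gap-sym i k))))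
    (regular-* (regular-involution (ε² minus)) (regular-* (regular-v k) (regular-unit (unit-den k i (i#k ∘ ≡.sym)))))

  open PartialFractions _#_ θ θ-diag public

  -- Morally `γ-compatible` at w = v y + 1 / v y. As this w has a pole, the relation is multiplied
  -- by three regular gaps and checked as a polynomial identity.
  rows-compatible : ∀ {y i k} → y # i → y # k → i # k → Compatible (θ y) i k
  rows-compatible {y} {i} {k} y#i y#k i#k = cancel (regular-* (regular-* (regular-gap y i y#i) (regular-gap y k y#k)) (regular-gap i k i#k)) (begin
    gap y i * gap y k * gap i k * (θ y i * θ i k + θ y k * θ k i)
      ≈⟨ *-congʳ (*-congˡ (trans (solve 1 (λ g → g := :- (:- g)) refl _) (-‿cong (sym (gap-sym k i))))) ⟩
    gap y i * gap y k * - gap k i * (θ y i * θ i k + θ y k * θ k i)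
      ≈⟨ solve 7 (λ a b c p q r t → a :* b :* :- c :* (p :* q :+ r :* t) := (p :* a) :* (q :* :- c) :* b :- (r :* b) :* (t :* c) :* a) refl _ _ _ _ _ _ _ ⟩
    θ y i * gap y i * (θ i k * - gap k i) * gap y k - θ y k * gap y k * (θ k i * gap k i) * gap y i
      ≈⟨ +-cong (*-congʳ (*-cong (θ-gap y i y#i) (trans (*-congˡ (sym (gap-sym i k))) (θ-gap i k i#k))))
           (-‿cong (*-congʳ (*-cong (θ-gap y k y#k) (θ-gap k i (i#k ∘ ≡.sym))))) ⟩
    v y * v i * gap y k - v y * v k * gap y i
      ≈⟨ solve 3 (λ y i k → y :* i :* ((y :- k) :* (con (+ 1) :- y :* k)) :- y :* k :* ((y :- i) :* (con (+ 1) :- y :* i))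
           := y :* y :* ((i :- k) :* (con (+ 1) :- i :* k))) refl (v y) (v i) (v k) ⟩
    v y * v y * gap i k
      ≈⟨ *-congʳ (*-cong (sym (θ-gap y i y#i)) (sym (θ-gap y k y#k))) ⟩
    θ y i * gap y i * (θ y k * gap y k) * gap i k
      ≈⟨ solve 5 (λ a b c p q → p :* a :* (q :* b) :* c := a :* b :* c :* (p :* q)) refl _ _ _ _ _ ⟩
    gap y i * gap y k * gap i k * (θ y i * θ y k) ∎)

  quad : Series → Series → Series
  quad w z = 1# - w * z + z * z

  unit-quad : ∀ w z → z 0 A.≈ A.0# → Unit (quad w z)
  unit-quad w z z0 = unit (A.trans (A.+-cong (A.+-congˡ (A.-‿cong (A.*-congˡ z0))) (A.*-congˡ z0))
    (A.solve 2 (λ w z → A.con (+ 1) A.:- w A.:* A.con (+ 0) A.:+ z A.:* A.con (+ 0) A.:= A.con (+ 1)) A.refl (w 0) (z 0)))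

  v-0 : ∀ i → v i 0 A.≈ A.0#
  v-0 i = A.trans (A.*-congˡ (x*-zero (x ^ pred-exp i))) (A.zeroʳ _)

  γ : Series → Node → Series
  γ w i = quad w (v i) ⁻¹

  γ-quad : ∀ w i → quad w (v i) * γ w i ≈ 1#
  γ-quad w i = unit-inverse (unit-quad w (v i) (v-0 i))

  -- Clearing denominators leaves v i · q k - v k · q i = (v i - v k)(1 - v i · v k), from which w
  -- has disappeared.
  γ-compatible : ∀ w {i k} → i # k → Compatible (γ w) i k
  γ-compatible w {i} {k} i#k = cancel (regular-* (regular-* (regular-unit (uq i)) (regular-unit (uq k))) (regular-gap i k i#k)) (begin
    q i * q k * gap i k * (γ w i * θ i k + γ w k * θ k i)
      ≈⟨ *-congʳ (*-congˡ (trans (solve 1 (λ g → g := :- (:- g)) refl _) (-‿cong (sym (gap-sym k i))))) ⟩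
    q i * q k * - gap k i * (γ w i * θ i k + γ w k * θ k i)
      ≈⟨ solve 7 (λ a b c p q r t → a :* b :* :- c :* (p :* q :+ r :* t) := (a :* p) :* (q :* :- c) :* b :- (b :* r) :* (t :* c) :* a) refl _ _ _ _ _ _ _ ⟩
    q i * γ w i * (θ i k * - gap k i) * q k - q k * γ w k * (θ k i * gap k i) * q i
      ≈⟨ +-cong (*-congʳ (*-cong (γ-quad w i) (trans (*-congˡ (sym (gap-sym i k))) (θ-gap i k i#k))))
           (-‿cong (*-congʳ (*-cong (γ-quad w k) (θ-gap k i (i#k ∘ ≡.sym))))) ⟩
    1# * v i * q k - 1# * v k * q i
      ≈⟨ solve 3 (λ w i k → con (+ 1) :* i :* (con (+ 1) :- w :* k :+ k :* k) :- con (+ 1) :* k :* (con (+ 1) :- w :* i :+ i :* i)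
           := con (+ 1) :* con (+ 1) :* ((i :- k) :* (con (+ 1) :- i :* k))) refl w (v i) (v k) ⟩
    1# * 1# * gap i k
      ≈⟨ *-congʳ (*-cong (sym (γ-quad w i)) (sym (γ-quad w k))) ⟩
    q i * γ w i * (q k * γ w k) * gap i k
      ≈⟨ solve 5 (λ a b c p q → a :* p :* (b :* q) :* c := a :* b :* c :* (p :* q)) refl _ _ _ _ _ ⟩
    q i * q k * gap i k * (γ w i * γ w k) ∎)
    where
    q : Node → Series
    q i = quad w (v i)
    uq : ∀ i → Unit (q i)
    uq i = unit-quad w (v i) (v-0 i)

  ∑ₗ-applyDownFrom : {I : Set} (h : ℕ → I) (f : I → Series) (n : ℕ) → ∑ₗ (applyDownFrom h n) f ≈ ∑< n (f ∘ h)
  ∑ₗ-applyDownFrom h f zero = refl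
  ∑ₗ-applyDownFrom h f (suc n) = trans (+-congˡ (∑ₗ-applyDownFrom h f n)) (+-comm _ _)

  ∏ₗ-applyDownFrom : {I : Set} (h : ℕ → I) (f : I → Series) (n : ℕ) → ∏ₗ (applyDownFrom h n) f ≈ ∏< n (f ∘ h)
  ∏ₗ-applyDownFrom h f zero = refl
  ∏ₗ-applyDownFrom h f (suc n) = trans (*-congˡ (∏ₗ-applyDownFrom h f n)) (*-comm _ _)

  module TwoFamilies (J K : ℕ → Node)
    (J# : ∀ {i k} → k < i → J i # J k) (K# : ∀ {i k} → k < i → K i # K k) (J#K : ∀ i k → J i # K k) where

    weightJ : ℕ → ℕ → ℕ → Series
    weightJ m m′ j = ∏< m (θ (J j) ∘ J) * ∏< m′ (θ (J j) ∘ K)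

    weightK : ℕ → ℕ → ℕ → Series
    weightK m m′ k = ∏< m (θ (K k) ∘ J) * ∏< m′ (θ (K k) ∘ K)

    -- The bound 1 ≤ m keeps the list of nodes nonempty: an empty sum is 0 while an empty product is
    -- 1.
    expansion : ∀ w m m′ → 1 ≤ m →
      ∑< m (λ j → γ w (J j) * weightJ m m′ j) + ∑< m′ (λ k → γ w (K k) * weightK m m′ k)
        ≈ ∏< m (γ w ∘ J) * ∏< m′ (γ w ∘ K)
    expansion w (suc m) m′ _ = begin
      ∑< (suc m) (λ j → γ w (J j) * weightJ (suc m) m′ j) + ∑< m′ (λ k → γ w (K k) * weightK (suc m) m′ k)
        ≈⟨ +-cong (∑-cong (suc m) (λ j → *-congˡ (sym (prod (θ (J j)))))) (∑-cong m′ (λ k → *-congˡ (sym (prod (θ (K k)))))) ⟩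
      ∑< (suc m) (t ∘ J) + ∑< m′ (t ∘ K)
        ≈⟨ sym (+-cong (∑ₗ-applyDownFrom J t (suc m)) (∑ₗ-applyDownFrom K t m′)) ⟩
      ∑ₗ (applyDownFrom J (suc m)) t + ∑ₗ (applyDownFrom K m′) t
        ≈⟨ sym (∑ₗ-++ (applyDownFrom J (suc m)) (applyDownFrom K m′) t) ⟩
      ∑ₗ nodes t
        ≈⟨ partialFractions rows-compatible (γ w) (J m) _ distinct (AllPairs.map (γ-compatible w) distinct) ⟩
      ∏ₗ nodes (γ w)
        ≈⟨ prod (γ w) ⟩
      ∏< (suc m) (γ w ∘ J) * ∏< m′ (γ w ∘ K) ∎
      where
      nodes : List Node
      nodes = applyDownFrom J (suc m) ++ applyDownFrom K m′
      t : Node → Series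
      t i = γ w i * ∏ₗ nodes (θ i)
      prod : ∀ f → ∏ₗ nodes f ≈ ∏< (suc m) (f ∘ J) * ∏< m′ (f ∘ K)
      prod f = trans (∏ₗ-++ (applyDownFrom J (suc m)) (applyDownFrom K m′) f)
        (*-cong (∏ₗ-applyDownFrom J f (suc m)) (∏ₗ-applyDownFrom K f m′))
      distinct : AllPairs _#_ nodes
      distinct = AllPairsₚ.++⁺ (AllPairsₚ.applyDownFrom⁺₁ J (suc m) (λ k<i _ → J# k<i)) (AllPairsₚ.applyDownFrom⁺₁ K m′ (λ k<i _ → K# k<i))
        (Allₚ.applyDownFrom⁺₂ J (suc m) (λ i → Allₚ.applyDownFrom⁺₂ K m′ (J#K i)))

  -- Partial fractions and the Appell–Lerch form of the rank generating function

  stepPower : ℕ → Series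
  stepPower c = x ^ (2 ℕ.* c)

  -- For nodes of one sign with exponents c(2k + 1 + δ), sums and distances of exponents are
  -- multiples of 2c, so each row is a quotient of q-Pochhammer symbols in x^(2c).
  module Family (c δ : ℕ) (1≤c : 1 ≤ c) (L : ℕ → Node) (sg : Sign)
    (sgn-L : ∀ k → sgn (L k) ≡ sg) (e-L : ∀ k → e (L k) ≡ c ℕ.* (2 ℕ.* k ℕ.+ 1 ℕ.+ δ)) where

    y^ : ∀ n → stepPower c ^ n ≈ x ^ (2 ℕ.* c ℕ.* n)
    y^ n = ^-assocʳ x (2 ℕ.* c) n

    s-L : ∀ i k → s (L i) (L k) ≈ 1#
    s-L i k = trans (reflexive (cong₂ (λ p q → ε p * ε q) (sgn-L i) (sgn-L k))) (ε² sg)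

    e-step : ∀ k d → e (L (k ℕ.+ d)) ≡ e (L k) ℕ.+ 2 ℕ.* c ℕ.* d
    e-step k d = ≡.trans (e-L (k ℕ.+ d)) (≡.trans
      (solveℕ 4 (λ c δ k d → c ⊗ (conℕ 2 ⊗ (k ⊕ d) ⊕ conℕ 1 ⊕ δ) ⊜ c ⊗ (conℕ 2 ⊗ k ⊕ conℕ 1 ⊕ δ) ⊕ conℕ 2 ⊗ c ⊗ d) ≡.refl c δ k d)
      (cong (ℕ._+ 2 ℕ.* c ℕ.* d) (≡.sym (e-L k))))

    e-< : ∀ k d → e (L k) < e (L (k ℕ.+ suc d))
    e-< k d = subst (e (L k) <_) (≡.sym (e-step k (suc d)))
      (ℕₚ.m<m+n (e (L k)) (ℕₚ.≤-trans 1≤c (ℕₚ.≤-trans (ℕₚ.m≤n*m c 2) (ℕₚ.m≤m*n (2 ℕ.* c) (suc d)))))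

    e-<′ : ∀ {k i} → k < i → e (L k) < e (L i)
    e-<′ {k} {i} k<i = subst (λ m → e (L k) < e (L m)) (≡.trans (ℕₚ.+-suc k _) (ℕₚ.m+[n∸m]≡n k<i)) (e-< k (i ℕ.∸ suc k))

    L# : ∀ {i k} → k < i → L i # L k
    L# k<i p = ℕₚ.<⇒≢ (e-<′ k<i) (≡.sym p)

    e-sum : ∀ i k → e (L i) ℕ.+ e (L k) ≡ 2 ℕ.* c ℕ.* (i ℕ.+ k ℕ.+ 1 ℕ.+ δ)
    e-sum i k = ≡.trans (cong₂ ℕ._+_ (e-L i) (e-L k))
      (solveℕ 4 (λ c δ i k → c ⊗ (conℕ 2 ⊗ i ⊕ conℕ 1 ⊕ δ) ⊕ c ⊗ (conℕ 2 ⊗ k ⊕ conℕ 1 ⊕ δ) ⊜ conℕ 2 ⊗ c ⊗ (i ⊕ k ⊕ conℕ 1 ⊕ δ)) ≡.refl c δ i k)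

    factor : ∀ i k {m n} → m ≡ 2 ℕ.* c ℕ.* n → s (L i) (L k) * x ^ m ≈ stepPower c ^ n
    factor i k {n = n} p = trans (*-cong (s-L i k) (x^-≡ p)) (trans (*-identityˡ _) (sym (y^ n)))

    den-L : ∀ i k d → ∣ e (L i) - e (L k) ∣ ≡ 2 ℕ.* c ℕ.* d → den (L i) (L k) ≈ (1# - stepPower c ^ d) * (1# - stepPower c ^ (i ℕ.+ k ℕ.+ 1 ℕ.+ δ))
    den-L i k d p = *-cong (+-congˡ (-‿cong (factor i k p))) (+-congˡ (-‿cong (factor i k (e-sum i k))))

    distance-> : ∀ {i k} → k < i → ∣ e (L i) - e (L k) ∣ ≡ 2 ℕ.* c ℕ.* (i ℕ.∸ k)
    distance-> {i} {k} k<i = ≡.trans (ℕₚ.∣-∣-comm (e (L i)) (e (L k))) (≡.trans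
      (cong (λ m → ∣ e (L k) - m ∣) (≡.trans (cong (e ∘ L) (≡.sym (ℕₚ.m+[n∸m]≡n (ℕₚ.<⇒≤ k<i)))) (e-step k (i ℕ.∸ k))))
      (ℕₚ.∣m-m+n∣≡n (e (L k)) _))

    open module Row (j : ℕ) = ArithmeticRow (stepPower c) δ (λ i k → θ (L i) (L k)) j (θ-diag (L j))
      (λ m → trans (*-congˡ (sym (den-L j (j ℕ.+ suc m) (suc m) (≡.trans (cong (λ k → ∣ e (L j) - k ∣) (e-step j (suc m))) (ℕₚ.∣m-m+n∣≡n (e (L j)) _)))))
        (θ-< (L j) (L (j ℕ.+ suc m)) (e-< j m)))
      (λ k k<j → trans (*-congˡ (sym (den-L j k (j ℕ.∸ k) (distance-> k<j)))) (trans (θ-> (L j) (L k) (e-<′ k<j))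
        (trans (sym (-‿distribˡ-* _ _)) (-‿cong (factor j k (distance-> k<j))))))
      public using (row)

  J : ℕ → Node
  J k = node plus (2 ℕ.* k)

  K : ℕ → ℕ → Node
  K δ k = node minus (suc (2 ℕ.* (2 ℕ.* k ℕ.+ δ)))

  e-J : ∀ k → e (J k) ≡ 1 ℕ.* (2 ℕ.* k ℕ.+ 1 ℕ.+ 0)
  e-J = solveℕ 1 (λ k → conℕ 1 ⊕ conℕ 2 ⊗ k ⊜ conℕ 1 ⊗ (conℕ 2 ⊗ k ⊕ conℕ 1 ⊕ conℕ 0)) ≡.refl

  e-K : ∀ δ k → e (K δ k) ≡ 2 ℕ.* (2 ℕ.* k ℕ.+ 1 ℕ.+ δ)
  e-K δ k = solveℕ 2 (λ k δ → conℕ 2 ⊕ conℕ 2 ⊗ (conℕ 2 ⊗ k ⊕ δ) ⊜ conℕ 2 ⊗ (conℕ 2 ⊗ k ⊕ conℕ 1 ⊕ δ)) ≡.refl k δ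

  1≤2 : 1 ≤ 2
  1≤2 = s≤s z≤n

  sgn-J : ∀ k → sgn (J k) ≡ plus
  sgn-J _ = ≡.refl

  sgn-K : ∀ δ k → sgn (K δ k) ≡ minus
  sgn-K _ _ = ≡.refl

  module JJ = Family 1 0 ℕₚ.≤-refl J plus sgn-J e-J
  module KK (δ : ℕ) = Family 2 δ 1≤2 (K δ) minus (sgn-K δ) (e-K δ)

  J#K : ∀ δ i k → J i # K δ k
  J#K δ i k p = ℕₚ.even≢odd i (2 ℕ.* k ℕ.+ δ) (ℕₚ.suc-injective p)

  module JK (δ : ℕ) = TwoFamilies J (K δ) JJ.L# (KK.L# δ) (J#K δ)

  -- ∑ₙ x^(n² + n c) / ((x; x)ₙ (x; x)ₙ₊c) does not depend on c, because consecutive values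
  -- differ by a multiple of every power of x; the limit c → ∞ evaluates it.
  module Durfee where

    ι : ℕ → Series
    ι n = poch n ⁻¹

    ι-suc : ∀ n → ι n ≈ ι (suc n) * (1# - x ^ suc n)
    ι-suc = Shanks.poch⁻¹-suc 1#

    t : ℕ → ℕ → Series
    t c n = x ^ (n ℕ.* n ℕ.+ n ℕ.* c) * (ι n * ι (n ℕ.+ c))

    n≤n² : ∀ n → n ≤ n ℕ.* n
    n≤n² zero = z≤n
    n≤n² (suc n) = ℕₚ.m≤m+n (suc n) _

    t-small : ∀ c n → t c n ≈[ n ] 0#
    t-small c n = x^*≈[]0 _ (ℕₚ.≤-trans (n≤n² n) (ℕₚ.m≤m+n _ _))

    module X (c : ℕ) = InfiniteSum (t c) (t-small c)

    X∞ : ℕ → Series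
    X∞ c = ∑∞ (t c)

    private
      τ : ℕ → ℕ → Series
      τ c n = x ^ (n ℕ.* n ℕ.+ n ℕ.* c) * (ι n * ι (n ℕ.+ suc c)) * (1# - x ^ n)

      t-τ : ∀ c n → t c n + x ^ suc c * t (suc c) n ≈ t (suc c) n + τ c n
      t-τ c n = begin
        P * (ι n * ι (n ℕ.+ c)) + x ^ suc c * t (suc c) n
          ≈⟨ +-cong (*-congˡ (*-congˡ (trans (ι-suc (n ℕ.+ c)) (*-cong (reflexive (cong ι (≡.sym (ℕₚ.+-suc n c))))
               (+-congˡ (-‿cong (trans (x^-≡ (≡.sym (ℕₚ.+-suc n c))) (x^-+ n (suc c)))))))))
               (*-congˡ t-suc) ⟩
        P * (ι n * (I * (1# - x ^ n * x ^ suc c))) + x ^ suc c * (P * x ^ n * (ι n * I))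
          ≈⟨ solve 5 (λ P i I n c → P :* (i :* (I :* (con (+ 1) :- n :* c))) :+ c :* (P :* n :* (i :* I)) := P :* n :* (i :* I) :+ P :* (i :* I) :* (con (+ 1) :- n)) refl _ _ _ _ _ ⟩
        P * x ^ n * (ι n * I) + P * (ι n * I) * (1# - x ^ n)
          ≈⟨ +-congʳ (sym t-suc) ⟩
        t (suc c) n + τ c n ∎
        where
        P = x ^ (n ℕ.* n ℕ.+ n ℕ.* c)
        I = ι (n ℕ.+ suc c)
        t-suc : t (suc c) n ≈ P * x ^ n * (ι n * I)
        t-suc = *-congʳ (trans (x^-≡ (solveℕ 2 (λ n c → n ⊗ n ⊕ n ⊗ (conℕ 1 ⊕ c) ⊜ n ⊗ n ⊕ n ⊗ c ⊕ n) ≡.refl n c)) (x^-+ (n ℕ.* n ℕ.+ n ℕ.* c) n))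

      τ-zero : ∀ c → τ c 0 ≈ 0#
      τ-zero c = trans (*-congˡ (-‿inverseʳ 1#)) (zeroʳ _)

      τ-suc : ∀ c n → τ c (suc n) ≈ x ^ suc c * t (suc (suc c)) n
      τ-suc c n = begin
        x ^ (suc n ℕ.* suc n ℕ.+ suc n ℕ.* c) * (ι (suc n) * ι (suc n ℕ.+ suc c)) * (1# - x ^ suc n)
          ≈⟨ *-congʳ (*-cong (trans (x^-≡ (solveℕ 2 (λ n c → (conℕ 1 ⊕ n) ⊗ (conℕ 1 ⊕ n) ⊕ (conℕ 1 ⊕ n) ⊗ c ⊜ (conℕ 1 ⊕ c) ⊕ (n ⊗ n ⊕ n ⊗ (conℕ 2 ⊕ c))) ≡.refl n c))
               (x^-+ (suc c) (n ℕ.* n ℕ.+ n ℕ.* suc (suc c)))) (*-congˡ (reflexive (cong ι (≡.sym (ℕₚ.+-suc n (suc c))))))) ⟩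
        x ^ suc c * P * (ι (suc n) * I) * (1# - x ^ suc n)
          ≈⟨ solve 5 (λ c P i I z → c :* P :* (i :* I) :* z := c :* (P :* (i :* z :* I))) refl _ _ _ _ _ ⟩
        x ^ suc c * (P * (ι (suc n) * (1# - x ^ suc n) * I))
          ≈⟨ *-congˡ (*-congˡ (*-congʳ (sym (ι-suc n)))) ⟩
        x ^ suc c * t (suc (suc c)) n ∎
        where
        P = x ^ (n ℕ.* n ℕ.+ n ℕ.* suc (suc c))
        I = ι (n ℕ.+ suc (suc c))

      -- The sum of `t-τ` over n. As `τ` vanishes at n = 0, a shift of its index turns it into
      -- x^(c+1) times the terms for c + 2.
      X-recurrence : ∀ c → X∞ c + x ^ suc c * X∞ (suc c) ≈ X∞ (suc c) + x ^ suc c * X∞ (suc (suc c))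
      X-recurrence c = ≈[]⇒≈ λ N → ≈[]-trans
        (+-≈[] (X.∑∞-≈[] c (ℕₚ.n≤1+n N)) (*-≈[] (≈[]-refl {f = x ^ suc c}) (X.∑∞-≈[] (suc c) (ℕₚ.n≤1+n N))))
        (≈[]-trans (≈⇒≈[] (finite N))
          (≈[]-sym (+-≈[] (X.∑∞-≈[] (suc c) (ℕₚ.n≤1+n N)) (*-≈[] (≈[]-refl {f = x ^ suc c}) (X.∑∞-≈[] (suc (suc c)) ℕₚ.≤-refl)))))
        where
        finite : ∀ N → ∑< (suc N) (t c) + x ^ suc c * ∑< (suc N) (t (suc c)) ≈ ∑< (suc N) (t (suc c)) + x ^ suc c * ∑< N (t (suc (suc c)))
        finite N = begin
          ∑< (suc N) (t c) + x ^ suc c * ∑< (suc N) (t (suc c))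
            ≈⟨ trans (+-congˡ (sym (∑-*ˡ (suc N) _ _))) (sym (∑-+ (suc N) _ _)) ⟩
          ∑< (suc N) (λ n → t c n + x ^ suc c * t (suc c) n)
            ≈⟨ trans (∑-cong (suc N) (t-τ c)) (∑-+ (suc N) _ _) ⟩
          ∑< (suc N) (t (suc c)) + ∑< (suc N) (τ c)
            ≈⟨ +-congˡ (trans (∑-first N (τ c)) (trans (+-cong (τ-zero c) (trans (∑-cong N (τ-suc c)) (∑-*ˡ N _ _))) (+-identityˡ _))) ⟩
          ∑< (suc N) (t (suc c)) + x ^ suc c * ∑< N (t (suc (suc c))) ∎

      Δ : ℕ → Series
      Δ c = X∞ c - X∞ (suc c)

      Δ-recurrence : ∀ c → Δ c ≈ x * (- x ^ c * Δ (suc c))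
      Δ-recurrence c = begin
        X∞ c - X∞ (suc c)
          ≈⟨ solve 3 (λ p q r → p :- q := p :+ r :* q :- r :* q :- q) refl _ _ _ ⟩
        X∞ c + x ^ suc c * X∞ (suc c) - x ^ suc c * X∞ (suc c) - X∞ (suc c)
          ≈⟨ +-congʳ (+-congʳ (X-recurrence c)) ⟩
        X∞ (suc c) + x ^ suc c * X∞ (suc (suc c)) - x ^ suc c * X∞ (suc c) - X∞ (suc c)
          ≈⟨ solve 4 (λ q r x y → q :+ x :* y :* r :- x :* y :* q :- q := x :* (:- y :* (q :- r))) refl _ _ x (x ^ c) ⟩
        x * (- x ^ c * Δ (suc c)) ∎

      Δ≈[]0 : ∀ N c → Δ c ≈[ N ] 0#
      Δ≈[]0 zero c = below λ _ ()
      Δ≈[]0 (suc N) c = ≈[]-trans (≈⇒≈[] (Δ-recurrence c)) (≈[]-trans (x*-≈[] (*-≈[] (≈[]-refl {f = - x ^ c}) (Δ≈[]0 N (suc c))))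
        (≈⇒≈[] (trans (*-congˡ (zeroʳ _)) (zeroʳ _))))

      X-suc : ∀ c → X∞ c ≈ X∞ (suc c)
      X-suc c = trans (solve 2 (λ p q → p := p :- q :+ q) refl _ _) (trans (+-congʳ (≈[]⇒≈ λ N → Δ≈[]0 N c)) (+-identityˡ _))

      X-+ : ∀ d c → X∞ c ≈ X∞ (d ℕ.+ c)
      X-+ zero c = refl
      X-+ (suc d) c = trans (X-+ d c) (X-suc (d ℕ.+ c))

      -- Below degree c only the summand n = 0 is left.
      X-large : ∀ c → poch c * X∞ c ≈[ c ] 1#
      X-large c = ≈[]-trans (*-≈[] (≈[]-refl {f = poch c}) (≈[]-trans (X.∑∞-≈[] c (ℕₚ.n≤1+n c))
          (≈[]-trans (≈⇒≈[] (∑-first c (t c))) (≈[]-trans (+-≈[] ≈[]-refl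
            (≈[]-trans (∑-≈[] c (λ n _ → x^*≈[]0 _ (ℕₚ.≤-trans (ℕₚ.m≤m+n c (n ℕ.* c)) (ℕₚ.m≤n+m _ (suc n ℕ.* suc n))))) (≈⇒≈[] (∑-0 c))))
            (≈⇒≈[] (+-identityʳ _))))))
        (≈⇒≈[] (trans (solve 3 (λ p q i → p :* (con (+ 1) :* (q :* i)) := con (+ 1) :* q :* (p :* i)) refl _ _ _)
          (trans (*-cong (unit-inverse unit-1) (unit-inverse (unit-poch c))) (*-identityˡ _))))

    X≈ : ∀ c → X∞ c ≈ a ⁻¹
    X≈ c = ⁻¹-unique unit-a (≈[]⇒≈ λ N → ≈[]-weaken (ℕₚ.m≤m+n N c)
      (≈[]-trans (*-≈[] (Euler.∏∞-≈[] {N ℕ.+ c} ℕₚ.≤-refl) (≈⇒≈[] (X-+ N c))) (X-large (N ℕ.+ c))))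

  py≈ : ∀ n → qpoch (stepPower 1) n ≈ dil (poch n)
  py≈ n = sym (trans (dil-∏ n _) (∏-cong n (λ k → trans (dil-1-x^ (suc k)) (+-congˡ (-‿cong (sym (JJ.y^ (suc k))))))))

  module Rank (w : Series) where

    rankTerm : ℕ → Series
    rankTerm D = x ^ (2 ℕ.* (D ℕ.* D ℕ.+ D)) * ∏< (suc D) (γ w ∘ J)

    module R = InfiniteSum rankTerm
      (λ D → x^*≈[]0 _ (ℕₚ.≤-trans (ℕₚ.m≤n+m D (D ℕ.* D)) (ℕₚ.m≤n*m (D ℕ.* D ℕ.+ D) 2)))

    appellTerm : ℕ → Series
    appellTerm j = sign j * (x ^ (6 ℕ.* triangle j) * (1# - x ^ (2 ℕ.* suc (2 ℕ.* j)))) * γ w (J j)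

    module B = InfiniteSum appellTerm
      (λ j → ≈[]-trans (≈⇒≈[] (solve 4 (λ a b c d → a :* (b :* c) :* d := b :* (a :* c :* d)) refl _ _ _ _))
        (x^*≈[]0 _ (ℕₚ.≤-trans (k≤triangle j) (ℕₚ.m≤n*m (triangle j) 6))))

    open Durfee

    private
      head : ℕ → Series
      head j = sign j * x ^ (2 ℕ.* triangle j) * (1# - x ^ (2 ℕ.* suc (2 ℕ.* j)))

      -- The two growing symbols of `row` have lengths m and m + 2j + 1 in x², which are the
      -- denominators of the Durfee sum with c = 2j + 1.
      rowWeight : ∀ j m → JK.weightJ 0 (suc j ℕ.+ m) 0 j ≈ head j * dil (ι m * ι (m ℕ.+ (suc (2 ℕ.* j))))
      rowWeight j m = *-cancelˡ (unit-* (unit-* (unit-dil (unit-poch m)) (unit-dil (unit-poch (m ℕ.+ suc (2 ℕ.* j))))) (unit-dil (unit-poch j))) (begin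
        pm * pl * pj * (W * 1#)
          ≈⟨ trans (*-congˡ (*-identityʳ W)) (*-comm _ _) ⟩
        W * (pm * pl * pj)
          ≈⟨ *-congˡ (*-cong (*-cong (sym (py≈ m)) (trans (reflexive (cong (dil ∘ poch) index)) (sym (py≈ (suc (j ℕ.+ 0 ℕ.+ j) ℕ.+ m))))) (sym (py≈ j))) ⟩
        W * (qpoch (stepPower 1) m * qpoch (stepPower 1) (suc (j ℕ.+ 0 ℕ.+ j) ℕ.+ m) * qpoch (stepPower 1) j)
          ≈⟨ JJ.row j m ⟩
        sign j * stepPower 1 ^ triangle j * (1# - stepPower 1 ^ suc (j ℕ.+ 0 ℕ.+ j)) * qpoch (stepPower 1) (j ℕ.+ 0)
          ≈⟨ *-cong (*-cong (*-congˡ (JJ.y^ (triangle j))) (+-congˡ (-‿cong (trans (JJ.y^ (suc (j ℕ.+ 0 ℕ.+ j))) (x^-≡ (cong (λ k → 2 ℕ.* suc k)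
               (solveℕ 1 (λ j → j ⊕ conℕ 0 ⊕ j ⊜ conℕ 2 ⊗ j) ≡.refl j))))))) (trans (py≈ (j ℕ.+ 0)) (reflexive (cong (dil ∘ poch) (ℕₚ.+-identityʳ j)))) ⟩
        head j * pj
          ≈⟨ solve 2 (λ h p → h :* p := con (+ 1) :* con (+ 1) :* p :* h) refl (head j) pj ⟩
        1# * 1# * pj * head j
          ≈⟨ *-congʳ (*-congʳ (*-cong (sym (inv m)) (sym (inv (m ℕ.+ suc (2 ℕ.* j)))))) ⟩
        pm * dil (ι m) * (pl * dil (ι (m ℕ.+ suc (2 ℕ.* j)))) * pj * head j
          ≈⟨ solve 6 (λ a b c d e f → a :* b :* (c :* d) :* e :* f := a :* c :* e :* (f :* (b :* d))) refl _ _ _ _ _ _ ⟩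
        pm * pl * pj * (head j * (dil (ι m) * dil (ι (m ℕ.+ suc (2 ℕ.* j)))))
          ≈⟨ *-congˡ (*-congˡ (sym (dil-* _ _))) ⟩
        pm * pl * pj * (head j * dil (ι m * ι (m ℕ.+ suc (2 ℕ.* j)))) ∎)
        where
        W = ∏< (suc j ℕ.+ m) (θ (J j) ∘ J)
        pm = dil (poch m)
        pl = dil (poch (m ℕ.+ suc (2 ℕ.* j)))
        pj = dil (poch j)
        index : m ℕ.+ suc (2 ℕ.* j) ≡ suc (j ℕ.+ 0 ℕ.+ j) ℕ.+ m
        index = solveℕ 2 (λ m j → m ⊕ (conℕ 1 ⊕ conℕ 2 ⊗ j) ⊜ conℕ 1 ⊕ (j ⊕ conℕ 0 ⊕ j) ⊕ m) ≡.refl m j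
        inv : ∀ n → dil (poch n) * dil (ι n) ≈ 1#
        inv n = trans (sym (dil-* _ _)) (trans (dil-cong (unit-inverse (unit-poch n))) dil-1)

      product : ∀ D → ∏< (suc D) (γ w ∘ J) ≈ ∑< (suc D) (λ j → γ w (J j) * JK.weightJ 0 (suc D) 0 j)
      product D = trans (sym (*-identityʳ _)) (trans (sym (JK.expansion 0 w (suc D) 0 (s≤s z≤n))) (+-identityʳ _))

      inner : ℕ → ℕ → Series
      inner N j = γ w (J j) * head j * x ^ (2 ℕ.* (j ℕ.* j ℕ.+ j)) * dil (∑< (N ℕ.∸ j) (t (suc (2 ℕ.* j))))

      rearranged : ∀ N → ∑< N rankTerm ≈ ∑< N (inner N)
      rearranged N = begin
        ∑< N rankTerm
          ≈⟨ ∑-cong N (λ D → trans (*-congˡ (product D)) (sym (∑-*ˡ (suc D) _ _))) ⟩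
        ∑< N (λ D → ∑< (suc D) (f D))
          ≈⟨ ∑-triangle N f ⟩
        ∑< N (λ j → ∑< (N ℕ.∸ j) (λ m → f (j ℕ.+ m) j))
          ≈⟨ ∑-cong N (λ j → trans (∑-cong (N ℕ.∸ j) (summand j)) (trans (∑-*ˡ (N ℕ.∸ j) _ _) (*-congˡ (sym (dil-∑ (N ℕ.∸ j) _))))) ⟩
        ∑< N (inner N) ∎
        where
        f : ℕ → ℕ → Series
        f D j = x ^ (2 ℕ.* (D ℕ.* D ℕ.+ D)) * (γ w (J j) * JK.weightJ 0 (suc D) 0 j)
        summand : ∀ j m → f (j ℕ.+ m) j ≈ γ w (J j) * head j * x ^ (2 ℕ.* (j ℕ.* j ℕ.+ j)) * dil (t (suc (2 ℕ.* j)) m)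
        summand j m = begin
          x ^ (2 ℕ.* ((j ℕ.+ m) ℕ.* (j ℕ.+ m) ℕ.+ (j ℕ.+ m))) * (γ w (J j) * JK.weightJ 0 (suc j ℕ.+ m) 0 j)
            ≈⟨ *-cong (trans (x^-≡ (solveℕ 2 (λ j m → conℕ 2 ⊗ ((j ⊕ m) ⊗ (j ⊕ m) ⊕ (j ⊕ m)) ⊜ conℕ 2 ⊗ (j ⊗ j ⊕ j) ⊕ conℕ 2 ⊗ (m ⊗ m ⊕ m ⊗ (conℕ 1 ⊕ conℕ 2 ⊗ j))) ≡.refl j m))
                   (trans (x^-+ (2 ℕ.* (j ℕ.* j ℕ.+ j)) (2 ℕ.* (m ℕ.* m ℕ.+ m ℕ.* suc (2 ℕ.* j)))) (*-congˡ (sym (dil-x^ (m ℕ.* m ℕ.+ m ℕ.* suc (2 ℕ.* j))))))) (*-congˡ (rowWeight j m)) ⟩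
          x ^ (2 ℕ.* (j ℕ.* j ℕ.+ j)) * dil (x ^ (m ℕ.* m ℕ.+ m ℕ.* suc (2 ℕ.* j))) * (γ w (J j) * (head j * dil (ι m * ι (m ℕ.+ suc (2 ℕ.* j)))))
            ≈⟨ solve 5 (λ a b c d e → a :* b :* (c :* (d :* e)) := c :* d :* a :* (b :* e)) refl _ _ _ _ _ ⟩
          γ w (J j) * head j * x ^ (2 ℕ.* (j ℕ.* j ℕ.+ j)) * (dil (x ^ (m ℕ.* m ℕ.+ m ℕ.* suc (2 ℕ.* j))) * dil (ι m * ι (m ℕ.+ suc (2 ℕ.* j))))
            ≈⟨ *-congˡ (sym (dil-* _ _)) ⟩
          γ w (J j) * head j * x ^ (2 ℕ.* (j ℕ.* j ℕ.+ j)) * dil (t (suc (2 ℕ.* j)) m) ∎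

      -- The inner sum has only N - j terms and is correct only below that degree; the power x^(2(j²
      -- + j)) in front makes up for the loss.
      inner-limit : ∀ N j → b * inner N j ≈[ N ] appellTerm j
      inner-limit N j = ≈[]-trans (≈⇒≈[] (solve 5 (λ b g h z d → b :* (g :* h :* z :* d) := z :* (g :* h :* (b :* d))) refl _ _ _ _ _))
        (≈[]-trans (≈[]-weaken bound (x^-≈[] (2 ℕ.* (j ℕ.* j ℕ.+ j)) (*-≈[] (≈[]-refl {f = γ w (J j) * head j})
          (≈[]-trans (*-≈[] (≈[]-refl {f = b}) (dil-≈[] (≈[]-trans (≈[]-sym (X.∑∞-≈[] (suc (2 ℕ.* j)) ℕₚ.≤-refl)) (≈⇒≈[] (X≈ _)))))
            (≈⇒≈[] (trans (*-congˡ (dil-⁻¹ unit-a)) (unit-inverse unit-b)))))))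
        (≈⇒≈[] (trans (solve 5 (λ z g s t u → z :* (g :* (s :* t :* u) :* con (+ 1)) := s :* (t :* z :* u) :* g) refl _ _ _ _ _)
          (*-congʳ (*-congˡ (*-congʳ (trans (sym (x^-+ (2 ℕ.* triangle j) (2 ℕ.* (j ℕ.* j ℕ.+ j)))) (x^-≡ exponent))))))))
        where
        bound : N ≤ 2 ℕ.* (j ℕ.* j ℕ.+ j) ℕ.+ (N ℕ.∸ j)
        bound = ℕₚ.≤-trans (ℕₚ.m≤n+m∸n N j) (ℕₚ.+-monoˡ-≤ (N ℕ.∸ j) (ℕₚ.≤-trans (ℕₚ.m≤n+m j (j ℕ.* j)) (ℕₚ.m≤n*m (j ℕ.* j ℕ.+ j) 2)))
        exponent : 2 ℕ.* triangle j ℕ.+ 2 ℕ.* (j ℕ.* j ℕ.+ j) ≡ 6 ℕ.* triangle j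
        exponent = ≡.trans (cong (λ k → 2 ℕ.* triangle j ℕ.+ 2 ℕ.* k) (≡.trans (ℕₚ.+-comm (j ℕ.* j) j) (≡.trans (≡.sym (ℕₚ.*-suc j j)) (≡.sym (2*triangle j)))))
          (solveℕ 1 (λ t → conℕ 2 ⊗ t ⊕ conℕ 2 ⊗ (conℕ 2 ⊗ t) ⊜ conℕ 6 ⊗ t) ≡.refl (triangle j))

    -- After the exchange of sums, `Durfee.X≈` evaluates every inner sum to the same 1 / (x²; x²)∞,
    -- which multiplication by `b` clears.
    resummation : b * ∑∞ rankTerm ≈ ∑∞ appellTerm
    resummation = ≈[]⇒≈ λ N → ≈[]-trans (*-≈[] (≈[]-refl {f = b}) (≈[]-trans (R.∑∞-≈[] ℕₚ.≤-refl) (≈⇒≈[] (rearranged N))))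
      (≈[]-trans (≈⇒≈[] (sym (∑-*ˡ N b (inner N)))) (≈[]-trans (∑-≈[] N (λ j _ → inner-limit N j)) (≈[]-sym (B.∑∞-≈[] ℕₚ.≤-refl))))

  -- Weights of a node against an arithmetic progression of nodes of opposite sign.

  module Progression (r h : ℕ) where

    node-exp : ℕ → ℕ
    node-exp k = r ℕ.+ h ℕ.* k

    distances sums powers : ℕ → ℕ → Series
    distances f M = ∏< M (λ k → 1# + x ^ ∣ f - node-exp k ∣)
    sums f M = ∏< M (λ k → 1# + x ^ (f ℕ.+ node-exp k))
    powers f M = ∏< M (λ k → x ^ (f ℕ.∸ node-exp k))

    both : ℕ → ℕ → Series
    both f M = distances f M * sums f M

    private
      node-0 : node-exp 0 ≡ r
      node-0 = ≡.trans (cong (r ℕ.+_) (ℕₚ.*-zeroʳ h)) (ℕₚ.+-identityʳ r)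

      node-suc : ∀ k → node-exp (suc k) ≡ h ℕ.+ node-exp k
      node-suc k = solveℕ 3 (λ r h k → r ⊕ h ⊗ (conℕ 1 ⊕ k) ⊜ h ⊕ (r ⊕ h ⊗ k)) ≡.refl r h k

    distances-step : ∀ f M → distances (h ℕ.+ f) (suc M) ≈ (1# + x ^ ∣ h ℕ.+ f - r ∣) * distances f M
    distances-step f M = trans (∏-first M _) (*-cong (+-congˡ (x^-≡ (cong (λ k → ∣ h ℕ.+ f - k ∣) node-0)))
      (∏-cong M (λ k → +-congˡ (x^-≡ (≡.trans (cong (λ n → ∣ h ℕ.+ f - n ∣) (node-suc k)) (ℕₚ.∣m+n-m+o∣≡∣n-o∣ h f (node-exp k)))))))

    sums-step : ∀ f M → sums f (suc M) ≈ (1# + x ^ (f ℕ.+ r)) * sums (h ℕ.+ f) M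
    sums-step f M = trans (∏-first M _) (*-cong (+-congˡ (x^-≡ (cong (f ℕ.+_) node-0)))
      (∏-cong M (λ k → +-congˡ (x^-≡ (≡.trans (cong (f ℕ.+_) (node-suc k)) (solveℕ 3 (λ f h n → f ⊕ (h ⊕ n) ⊜ h ⊕ f ⊕ n) ≡.refl f h (node-exp k)))))))

    powers-step : ∀ f M → powers (h ℕ.+ f) (suc M) ≈ x ^ (h ℕ.+ f ℕ.∸ r) * powers f M
    powers-step f M = trans (∏-first M _) (*-cong (x^-≡ (cong (h ℕ.+ f ℕ.∸_) node-0))
      (∏-cong M (λ k → x^-≡ (≡.trans (cong (h ℕ.+ f ℕ.∸_) (node-suc k)) (ℕₚ.[m+n]∸[m+o]≡n∸o h f (node-exp k))))))

    sums-stable : 1 ≤ h → ∀ f {N M} → N ≤ M → sums f (suc M) ≈[ N ] sums f M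
    sums-stable 1≤h f {N} {M} N≤M = ≈[]-trans (*-≈[] (≈[]-refl {f = sums f M}) (1+x^≈[]1 (ℕₚ.≤-trans N≤M (ℕₚ.≤-trans
        (ℕₚ.≤-trans (ℕₚ.≤-reflexive (≡.sym (ℕₚ.*-identityˡ M))) (ℕₚ.*-monoˡ-≤ M 1≤h)) (ℕₚ.≤-trans (ℕₚ.m≤n+m (h ℕ.* M) r) (ℕₚ.m≤n+m _ f))))))
      (≈⇒≈[] (*-identityʳ _))

    -- Raising f by h moves distances and sums along the progression by one node, so that, up to
    -- degree N, `both` gains one factor and loses another.
    both-step : 1 ≤ h → ∀ f {N M} → N ≤ M →
      (1# + x ^ (f ℕ.+ r)) * both (h ℕ.+ f) (suc M) ≈[ N ] (1# + x ^ ∣ h ℕ.+ f - r ∣) * both f M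
    both-step 1≤h f {N} {M} N≤M =
      ≈[]-trans (*-≈[] (≈[]-refl {f = 1# + x ^ (f ℕ.+ r)}) (*-≈[] (≈⇒≈[] (distances-step f M)) (sums-stable 1≤h (h ℕ.+ f) N≤M)))
      (≈[]-trans (≈⇒≈[] (trans (solve 4 (λ a b c d → a :* (b :* c :* d) := b :* (c :* (a :* d))) refl _ _ _ _) (*-congˡ (*-congˡ (sym (sums-step f M))))))
      (*-≈[] (≈[]-refl {f = 1# + x ^ ∣ h ℕ.+ f - r ∣}) (*-≈[] (≈[]-refl {f = distances f M}) (sums-stable 1≤h f N≤M))))

    module _ (i : Node) (L : ℕ → Node) (e-L : ∀ k → e (L k) ≡ node-exp k) (s-L : ∀ k → s i (L k) ≈ - 1#) (i#L : ∀ k → i # L k) where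

      private
        den≈ : ∀ k → den i (L k) ≈ (1# + x ^ ∣ e i - node-exp k ∣) * (1# + x ^ (e i ℕ.+ node-exp k))
        den≈ k = *-cong (factor (cong (λ n → ∣ e i - n ∣) (e-L k))) (factor (cong (e i ℕ.+_) (e-L k)))
          where
          factor : ∀ {m n} → m ≡ n → 1# - s i (L k) * x ^ m ≈ 1# + x ^ n
          factor {m} p = trans (+-congˡ (-‿cong (*-congʳ (s-L k))))
            (trans (solve 1 (λ z → con (+ 1) :- :- con (+ 1) :* z := con (+ 1) :+ z) refl (x ^ m)) (+-congˡ (x^-≡ p)))

        -- Truncated subtraction unites the two cases of `θ`: below the progression node the
        -- numerator is 1 = x^0.
        θ-opposite : ∀ k → θ i (L k) * den i (L k) ≈ x ^ (e i ℕ.∸ node-exp k)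
        θ-opposite k with ℕₚ.<-cmp (e i) (e (L k))
        ... | tri< p _ _ = trans (trans (*-comm _ _) (unit-inverse (unit-den i (L k) (i#L k))))
          (x^-≡ (≡.sym (ℕₚ.m≤n⇒m∸n≡0 (ℕₚ.≤-trans (ℕₚ.<⇒≤ p) (ℕₚ.≤-reflexive (e-L k))))))
        ... | tri≈ _ p _ = ⊥-elim (i#L k p)
        ... | tri> _ _ p = begin
          - s i (L k) * x ^ ∣ e i - e (L k) ∣ * den i (L k) ⁻¹ * den i (L k)
            ≈⟨ trans (*-assoc _ _ _) (*-cong (*-congʳ (-‿cong (s-L k))) (trans (*-comm _ _) (unit-inverse (unit-den i (L k) (i#L k))))) ⟩
          - - 1# * x ^ ∣ e i - e (L k) ∣ * 1#
            ≈⟨ solve 1 (λ z → :- :- con (+ 1) :* z :* con (+ 1) := z) refl _ ⟩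
          x ^ ∣ e i - e (L k) ∣
            ≈⟨ x^-≡ (≡.trans (ℕₚ.m≤n⇒∣n-m∣≡n∸m (ℕₚ.<⇒≤ p)) (cong (e i ℕ.∸_) (e-L k))) ⟩
          x ^ (e i ℕ.∸ node-exp k) ∎

      crossWeight : ∀ M → ∏< M (θ i ∘ L) * both (e i) M ≈ powers (e i) M
      crossWeight M = begin
        ∏< M (θ i ∘ L) * (distances (e i) M * sums (e i) M)
          ≈⟨ *-congˡ (trans (sym (∏-* M _ _)) (∏-cong M (λ k → sym (den≈ k)))) ⟩
        ∏< M (θ i ∘ L) * ∏< M (λ k → den i (L k))
          ≈⟨ trans (sym (∏-* M _ _)) (∏-cong M θ-opposite) ⟩
        powers (e i) M ∎

  mod4 : ℕ → ℕ → Series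
  mod4 c M = ∏< M (λ k → 1# + x ^ (c ℕ.+ 4 ℕ.* k))

  mod2 : ∀ c M → ∏< (double M) (λ k → 1# + x ^ (c ℕ.+ 2 ℕ.* k)) ≈ mod4 c M * mod4 (2 ℕ.+ c) M
  mod2 c zero = sym (*-identityˡ _)
  mod2 c (suc M) = trans (*-cong (*-cong (mod2 c M) (+-congˡ (x^-≡ p))) (+-congˡ (x^-≡ q)))
    (solve 4 (λ a b c d → a :* b :* c :* d := a :* c :* (b :* d)) refl _ _ _ _)
    where
    p : c ℕ.+ 2 ℕ.* double M ≡ c ℕ.+ 4 ℕ.* M
    p = ≡.trans (cong (λ n → c ℕ.+ 2 ℕ.* n) (double≡2* M)) (solveℕ 2 (λ c M → c ⊕ conℕ 2 ⊗ (conℕ 2 ⊗ M) ⊜ c ⊕ conℕ 4 ⊗ M) ≡.refl c M)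
    q : c ℕ.+ 2 ℕ.* suc (double M) ≡ 2 ℕ.+ c ℕ.+ 4 ℕ.* M
    q = ≡.trans (cong (λ n → c ℕ.+ 2 ℕ.* suc n) (double≡2* M)) (solveℕ 2 (λ c M → c ⊕ conℕ 2 ⊗ (conℕ 1 ⊕ conℕ 2 ⊗ M) ⊜ conℕ 2 ⊕ c ⊕ conℕ 4 ⊗ M) ≡.refl c M)

  ō-even : ∀ {N M} → N ≤ M → mod4 1 M * mod4 3 M ≈[ N ] ō
  ō-even {N} {M} N≤M = ≈[]-trans (≈⇒≈[] (sym (mod2 1 M))) (≈[]-sym (Odd⁺.∏∞-≈[] (ℕₚ.≤-trans N≤M (n≤double M))))

  ō-odd : ∀ {N M} → N ≤ M → (1# + x ^ 1) * (mod4 3 M * mod4 5 M) ≈[ N ] ō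
  ō-odd {N} {M} N≤M = ≈[]-trans (≈⇒≈[] (sym (trans (∏-first (double M) _) (*-congˡ (trans
      (∏-cong (double M) (λ k → +-congˡ (x^-≡ (cong suc (ℕₚ.*-suc 2 k))))) (mod2 3 M))))))
    (≈[]-sym (Odd⁺.∏∞-≈[] (ℕₚ.≤-trans N≤M (ℕₚ.m≤n⇒m≤1+n (n≤double M)))))

  odd-step : ∀ j → suc (2 ℕ.* suc (suc j)) ≡ 4 ℕ.+ suc (2 ℕ.* j)
  odd-step = solveℕ 1 (λ j → conℕ 1 ⊕ conℕ 2 ⊗ (conℕ 2 ⊕ j) ⊜ conℕ 4 ⊕ (conℕ 1 ⊕ conℕ 2 ⊗ j)) ≡.refl

  module Cross₀ where
    open Progression 2 4

    -- Exponents of `J` advance by 2 and the progression by 4, hence two base cases. The factors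
    -- gained and lost in the step are both 1 + x^(f + 2), so the value remains `ō`. Each step uses
    -- up one node, whence the bound N + j.
    both-limit : ∀ j {N M} → N ℕ.+ j ≤ M → both (suc (2 ℕ.* j)) M ≈[ N ] ō
    both-limit 0 {N} {M} p = ō-even (ℕₚ.m+n≤o⇒m≤o N p)
    both-limit 1 {N} {zero} p = ⊥-elim (ℕₚ.<⇒≱ (ℕₚ.m≤n+m 1 N) p)
    both-limit 1 {N} {suc M} p = ≈[]-trans (*-≈[] (≈⇒≈[] (∏-first M _)) (sums-stable (s≤s z≤n) 3 N≤M))
      (≈[]-trans (≈⇒≈[] (trans (*-assoc _ _ _) (*-congˡ (*-congʳ (∏-cong M (λ k → +-congˡ (x^-≡ (cong (λ n → ∣ 3 - 2 ℕ.+ n ∣) (ℕₚ.*-suc 4 k)))))))))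
        (ō-odd N≤M))
      where
      N≤M : N ≤ M
      N≤M = ℕ.s≤s⁻¹ (ℕₚ.≤-trans (ℕₚ.≤-reflexive (ℕₚ.+-comm 1 N)) p)
    both-limit (suc (suc j)) {N} {zero} p = ⊥-elim (ℕₚ.<⇒≱ (ℕₚ.≤-trans (s≤s z≤n) (ℕₚ.m≤n+m (suc (suc j)) N)) p)
    both-limit (suc (suc j)) {N} {suc M} p = subst (λ f → both f (suc M) ≈[ N ] ō) (≡.sym (odd-step j)) $ ≈[]-trans
      (*-cancelˡ-≈[] (unit-1+x^ (2 ℕ.* j ℕ.+ 2)) (≈[]-trans (both-step (s≤s z≤n) (suc (2 ℕ.* j)) (ℕₚ.m+n≤o⇒m≤o N q))
        (≈⇒≈[] (*-congʳ (+-congˡ (x^-≡ (cong suc (ℕₚ.+-comm 2 (2 ℕ.* j)))))))))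
      (both-limit j q)
      where
      q : N ℕ.+ j ≤ M
      q = ℕₚ.≤-trans (ℕₚ.+-monoʳ-≤ N (ℕₚ.n≤1+n j)) (ℕ.s≤s⁻¹ (ℕₚ.≤-trans (ℕₚ.≤-reflexive (≡.sym (ℕₚ.+-suc N (suc j)))) p))

    powers-value : ∀ j {M} → j ≤ M → powers (suc (2 ℕ.* j)) M ≈ x ^ triangle j
    powers-value 0 {M} _ = trans (∏-cong M (λ k → x^-≡ (ℕₚ.0∸n≡0 (suc (4 ℕ.* k))))) (∏-1 M)
    powers-value 1 {suc M} _ = trans (∏-first M _) (trans (*-congˡ (trans (∏-cong M (λ k → x^-≡ (≡.trans (cong (λ n → 3 ℕ.∸ (2 ℕ.+ n)) (ℕₚ.*-suc 4 k)) (ℕₚ.0∸n≡0 (3 ℕ.+ 4 ℕ.* k))))) (∏-1 M)))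
      (*-identityʳ _))
    powers-value (suc (suc j)) {suc M} (s≤s p) = begin
      powers (suc (2 ℕ.* suc (suc j))) (suc M)          ≡⟨ cong (λ f → powers f (suc M)) (odd-step j) ⟩
      powers (4 ℕ.+ suc (2 ℕ.* j)) (suc M)             ≈⟨ powers-step (suc (2 ℕ.* j)) M ⟩
      x ^ (2 ℕ.+ suc (2 ℕ.* j)) * powers (suc (2 ℕ.* j)) M ≈⟨ *-congˡ (powers-value j (ℕₚ.≤-trans (ℕₚ.n≤1+n j) p)) ⟩
      x ^ (2 ℕ.+ suc (2 ℕ.* j)) * x ^ triangle j        ≈⟨ sym (x^-+ (2 ℕ.+ suc (2 ℕ.* j)) (triangle j)) ⟩
      x ^ (2 ℕ.+ suc (2 ℕ.* j) ℕ.+ triangle j)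
        ≈⟨ x^-≡ (solveℕ 2 (λ j t → conℕ 3 ⊕ conℕ 2 ⊗ j ⊕ t ⊜ t ⊕ (conℕ 1 ⊕ j) ⊕ (conℕ 2 ⊕ j)) ≡.refl j (triangle j)) ⟩
      x ^ triangle (suc (suc j)) ∎

    weight-limit : ∀ j {N M} → N ℕ.+ j ≤ M → ∏< M (θ (J j) ∘ K 0) * ō ≈[ N ] x ^ triangle j
    weight-limit j {N} {M} p = ≈[]-trans (*-≈[] (≈[]-refl {f = ∏< M (θ (J j) ∘ K 0)}) (≈[]-sym (both-limit j p)))
      (≈⇒≈[] (trans (crossWeight (J j) (K 0) (solveℕ 1 (λ k → conℕ 2 ⊕ conℕ 2 ⊗ (conℕ 2 ⊗ k ⊕ conℕ 0) ⊜ conℕ 2 ⊕ conℕ 4 ⊗ k) ≡.refl)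
        (λ _ → *-identityˡ _) (J#K 0 j) M) (powers-value j (ℕₚ.m+n≤o⇒n≤o N p))))

  pred-triangle : ℕ → ℕ
  pred-triangle zero = 0
  pred-triangle (suc j) = triangle j

  pred-triangle-+ : ∀ j → pred-triangle j ℕ.+ j ≡ triangle j
  pred-triangle-+ zero = ≡.refl
  pred-triangle-+ (suc j) = ≡.refl

  module Cross₁ where
    open Progression 4 4

    -- The sums begin at f + 4; the extra factor 1 + x^f completes them to all odd exponents.
    both-limit : ∀ j {N M} → N ℕ.+ j ≤ M → (1# + x ^ suc (2 ℕ.* j)) * both (suc (2 ℕ.* j)) M ≈[ N ] ō
    both-limit 0 {N} {M} p = ō-odd (ℕₚ.m+n≤o⇒m≤o N p)
    both-limit 1 {N} {M} p = ≈[]-trans (≈⇒≈[] (trans (solve 3 (λ a b c → a :* (b :* c) := b :* (a :* c)) refl _ _ _)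
        (*-congˡ (sym (trans (∏-first M _) (*-congˡ (∏-cong M (λ k → +-congˡ (x^-≡ (cong (3 ℕ.+_) (ℕₚ.*-suc 4 k)))))))))))
      (≈[]-trans (*-≈[] (≈[]-refl {f = mod4 1 M}) (≈[]-trans (*-≈[] (≈[]-refl {f = mod4 3 M})
          (1+x^≈[]1 (ℕₚ.≤-trans N≤M (ℕₚ.≤-trans (ℕₚ.m≤n*m M 4) (ℕₚ.m≤n+m _ 3))))) (≈⇒≈[] (*-identityʳ _))))
        (ō-even N≤M))
      where
      N≤M : N ≤ M
      N≤M = ℕₚ.m+n≤o⇒m≤o N p
    both-limit (suc (suc j)) {N} {zero} p = ⊥-elim (ℕₚ.<⇒≱ (ℕₚ.≤-trans (s≤s z≤n) (ℕₚ.m≤n+m (suc (suc j)) N)) p)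
    both-limit (suc (suc j)) {N} {suc M} p = subst (λ f → (1# + x ^ f) * both f (suc M) ≈[ N ] ō) (≡.sym (odd-step j)) $ ≈[]-trans
      (≈[]-trans (≈⇒≈[] (*-congʳ (+-congˡ (x^-≡ (ℕₚ.+-comm 4 (suc (2 ℕ.* j)))))))
        (both-step (s≤s z≤n) (suc (2 ℕ.* j)) (ℕₚ.m+n≤o⇒m≤o N q)))
      (both-limit j q)
      where
      q : N ℕ.+ j ≤ M
      q = ℕₚ.≤-trans (ℕₚ.+-monoʳ-≤ N (ℕₚ.n≤1+n j)) (ℕ.s≤s⁻¹ (ℕₚ.≤-trans (ℕₚ.≤-reflexive (≡.sym (ℕₚ.+-suc N (suc j)))) p))

    powers-value : ∀ j {M} → j ≤ M → powers (suc (2 ℕ.* j)) M ≈ x ^ pred-triangle j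
    powers-value 0 {M} _ = trans (∏-cong M (λ k → x^-≡ (ℕₚ.0∸n≡0 (3 ℕ.+ 4 ℕ.* k)))) (∏-1 M)
    powers-value 1 {M} _ = trans (∏-cong M (λ k → x^-≡ (ℕₚ.0∸n≡0 (1 ℕ.+ 4 ℕ.* k)))) (∏-1 M)
    powers-value (suc (suc j)) {suc M} (s≤s p) = begin
      powers (suc (2 ℕ.* suc (suc j))) (suc M)          ≡⟨ cong (λ f → powers f (suc M)) (odd-step j) ⟩
      powers (4 ℕ.+ suc (2 ℕ.* j)) (suc M)              ≈⟨ powers-step (suc (2 ℕ.* j)) M ⟩
      x ^ suc (2 ℕ.* j) * powers (suc (2 ℕ.* j)) M      ≈⟨ *-congˡ (powers-value j (ℕₚ.≤-trans (ℕₚ.n≤1+n j) p)) ⟩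
      x ^ suc (2 ℕ.* j) * x ^ pred-triangle j           ≈⟨ sym (x^-+ (suc (2 ℕ.* j)) (pred-triangle j)) ⟩
      x ^ (suc (2 ℕ.* j) ℕ.+ pred-triangle j)
        ≈⟨ x^-≡ (≡.trans (solveℕ 2 (λ j t → conℕ 1 ⊕ conℕ 2 ⊗ j ⊕ t ⊜ t ⊕ j ⊕ (conℕ 1 ⊕ j)) ≡.refl j (pred-triangle j)) (cong (ℕ._+ suc j) (pred-triangle-+ j))) ⟩
      x ^ triangle (suc j) ∎

    weight-limit : ∀ j {N M} → N ℕ.+ j ≤ M → ∏< M (θ (J j) ∘ K 1) * ō ≈[ N ] x ^ pred-triangle j * (1# + x ^ suc (2 ℕ.* j))
    weight-limit j {N} {M} p = ≈[]-trans (*-≈[] (≈[]-refl {f = ∏< M (θ (J j) ∘ K 1)}) (≈[]-sym (both-limit j p)))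
      (≈⇒≈[] (trans (solve 3 (λ a b c → a :* (b :* c) := a :* c :* b) refl _ _ _)
        (*-congʳ (trans (crossWeight (J j) (K 1) (solveℕ 1 (λ k → conℕ 2 ⊕ conℕ 2 ⊗ (conℕ 2 ⊗ k ⊕ conℕ 1) ⊜ conℕ 4 ⊕ conℕ 4 ⊗ k) ≡.refl)
        (λ _ → *-identityˡ _) (J#K 1 j) M) (powers-value j (ℕₚ.m+n≤o⇒n≤o N p))))))

  module CrossK where
    open Progression 1 2

    -- The factors gained and lost in the step are both 1 + x^(2c + 1), so every even f inherits the
    -- value at f = 0.
    both-limit : ∀ c {N M} → N ℕ.+ c ≤ M → both (2 ℕ.* c) M ≈[ N ] ō * ō
    both-limit zero {N} {M} p = ≈[]-sym (*-≈[] (Odd⁺.∏∞-≈[] N≤M) (Odd⁺.∏∞-≈[] N≤M))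
      where
      N≤M : N ≤ M
      N≤M = ℕₚ.m+n≤o⇒m≤o N p
    both-limit (suc c) {N} {zero} p = ⊥-elim (ℕₚ.<⇒≱ (ℕₚ.≤-trans (s≤s z≤n) (ℕₚ.m≤n+m (suc c) N)) p)
    both-limit (suc c) {N} {suc M} p = subst (λ f → both f (suc M) ≈[ N ] ō * ō) (≡.sym (ℕₚ.*-suc 2 c)) $ ≈[]-trans
      (*-cancelˡ-≈[] (unit-1+x^ (2 ℕ.* c)) (≈[]-trans (≈⇒≈[] (*-congʳ (+-congˡ (x^-≡ (ℕₚ.+-comm 1 (2 ℕ.* c))))))
        (both-step (s≤s z≤n) (2 ℕ.* c) (ℕₚ.m+n≤o⇒m≤o N q))))
      (both-limit c q)
      where
      q : N ℕ.+ c ≤ M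
      q = ℕ.s≤s⁻¹ (ℕₚ.≤-trans (ℕₚ.≤-reflexive (≡.sym (ℕₚ.+-suc N c))) p)

    powers-value : ∀ c {M} → c ≤ M → powers (2 ℕ.* c) M ≈ x ^ (c ℕ.* c)
    powers-value zero {M} _ = ∏-1 M
    powers-value (suc c) {suc M} (s≤s p) = begin
      powers (2 ℕ.* suc c) (suc M)                    ≡⟨ cong (λ f → powers f (suc M)) (ℕₚ.*-suc 2 c) ⟩
      powers (2 ℕ.+ 2 ℕ.* c) (suc M)                  ≈⟨ powers-step (2 ℕ.* c) M ⟩
      x ^ suc (2 ℕ.* c) * powers (2 ℕ.* c) M          ≈⟨ *-congˡ (powers-value c p) ⟩
      x ^ suc (2 ℕ.* c) * x ^ (c ℕ.* c)               ≈⟨ sym (x^-+ (suc (2 ℕ.* c)) (c ℕ.* c)) ⟩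
      x ^ (suc (2 ℕ.* c) ℕ.+ c ℕ.* c)
        ≈⟨ x^-≡ (solveℕ 1 (λ c → conℕ 1 ⊕ conℕ 2 ⊗ c ⊕ c ⊗ c ⊜ (conℕ 1 ⊕ c) ⊗ (conℕ 1 ⊕ c)) ≡.refl c) ⟩
      x ^ (suc c ℕ.* suc c) ∎

    weight-limit : ∀ δ k {N M} → N ℕ.+ suc (2 ℕ.* k ℕ.+ δ) ≤ M →
      ∏< M (θ (K δ k) ∘ J) * (ō * ō) ≈[ N ] x ^ (suc (2 ℕ.* k ℕ.+ δ) ℕ.* suc (2 ℕ.* k ℕ.+ δ))
    weight-limit δ k {N} {M} p = ≈[]-trans (*-≈[] (≈[]-refl {f = ∏< M (θ (K δ k) ∘ J)}) (≈[]-sym (both-limit c p)))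
      (≈⇒≈[] (trans (*-congˡ (reflexive (cong (λ f → both f M) 2c≡e))) (trans (crossWeight (K δ k) J (λ _ → ≡.refl)
        (λ _ → *-identityʳ _) (λ j → J#K δ j k ∘ ≡.sym) M) (trans (reflexive (cong (λ f → powers f M) (≡.sym 2c≡e))) (powers-value c (ℕₚ.m+n≤o⇒n≤o N p))))))
      where
      c = suc (2 ℕ.* k ℕ.+ δ)
      2c≡e : 2 ℕ.* c ≡ e (K δ k)
      2c≡e = ℕₚ.*-suc 2 (2 ℕ.* k ℕ.+ δ)

  -- Partial fractions of infinite products with nodes of both signs

  b₄ : Series
  b₄ = dil b

  b≈ : b ≈ o * ō * b₄
  b≈ = trans (dil-cong a≈o*b) (trans (dil-* o b) (*-congʳ (sym o*ō)))

  a≈ : a ≈ o * o * ō * b₄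
  a≈ = trans a≈o*b (trans (*-congˡ b≈) (solve 3 (λ p q r → p :* (p :* q :* r) := p :* p :* q :* r) refl o ō b₄))

  pyK≈ : ∀ δ n → qpoch (stepPower 2) n ≈ dil (dil (poch n))
  pyK≈ δ n = sym (trans (dil-cong (dil-∏ n _)) (trans (dil-∏ n _) (∏-cong n (λ k →
    trans (dil-cong (dil-1-x^ (suc k))) (trans (dil-1-x^ (2 ℕ.* suc k)) (+-congˡ (-‿cong (trans (x^-≡ (≡.sym (ℕₚ.*-assoc 2 2 (suc k)))) (sym (KK.y^ δ (suc k)))))))))))

  -- Lets the number of nodes in `row` grow: both growing q-Pochhammer symbols tend to B, while the
  -- one of length j stays.
  module RowLimit (py : ℕ → Series) (unit-py : ∀ n → Unit (py n)) (B : Series) (py-limit : ∀ {N n} → N ≤ n → py n ≈[ N ] B)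
    (W : ℕ → Series) (j l : ℕ) (rhs : Series) (row : ∀ m → W (suc j ℕ.+ m) * (py m * py (suc l ℕ.+ m) * py j) ≈ rhs) where

    limit : ∀ {N M} → N ℕ.+ suc j ≤ M → W M * (B * B * py j) ≈[ N ] rhs
    limit {N} {M} p = ≈[]-trans (≈[]-sym (*-≈[] (≈⇒≈[] (reflexive (cong W split)))
        (*-≈[] (*-≈[] (py-limit N≤m) (py-limit (ℕₚ.≤-trans N≤m (ℕₚ.m≤n+m m (suc l))))) ≈[]-refl))) (≈⇒≈[] (row m))
      where
      m = M ℕ.∸ suc j
      split : suc j ℕ.+ m ≡ M
      split = ℕₚ.m+[n∸m]≡n (ℕₚ.m+n≤o⇒n≤o N p)
      N≤m : N ≤ m
      N≤m = ℕₚ.≤-trans (ℕₚ.≤-reflexive (≡.sym (ℕₚ.m+n∸n≡m N (suc j)))) (ℕₚ.∸-monoˡ-≤ (suc j) p)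

    -- For j close to M too few nodes follow for `limit`. There the weight is negligible anyway,
    -- because the right side of its row begins with a high power of x.
    small : ∀ {N M} → rhs ≈[ N ] 0# → j < M → W M ≈[ N ] 0#
    small {N} {M} z p = *-cancelˡ-≈[] (unit-* (unit-* (unit-py m) (unit-py (suc l ℕ.+ m))) (unit-py j))
      (≈[]-trans (≈⇒≈[] (trans (*-comm _ _) (trans (*-congʳ (reflexive (cong W (≡.sym split)))) (row m)))) (≈[]-trans z (≈⇒≈[] (sym (zeroʳ _)))))
      where
      m = M ℕ.∸ suc j
      split : suc j ℕ.+ m ≡ M
      split = ℕₚ.m+[n∸m]≡n p

  rowJ : ℕ → Series
  rowJ j = sign j * x ^ (2 ℕ.* triangle j) * (1# - x ^ (2 ℕ.* suc (2 ℕ.* j)))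

  module RowJ (j : ℕ) where
    private module Limit′ = RowLimit (qpoch (stepPower 1)) (λ n → unit-≈ (unit-dil (unit-poch n)) (py≈ n)) b
                      (λ {N} {n} N≤n → ≈[]-trans (≈⇒≈[] (py≈ n)) (≈[]-sym (dil-≈[] (Euler.∏∞-≈[] N≤n))))
                      (λ M → ∏< M (θ (J j) ∘ J)) j (j ℕ.+ 0 ℕ.+ j) _ (JJ.row j)
    private
      rhs≈ : sign j * stepPower 1 ^ triangle j * (1# - stepPower 1 ^ suc (j ℕ.+ 0 ℕ.+ j)) ≈ rowJ j
      rhs≈ = *-cong (*-congˡ (JJ.y^ (triangle j))) (+-congˡ (-‿cong (trans (JJ.y^ (suc (j ℕ.+ 0 ℕ.+ j))) (x^-≡ (cong (λ k → 2 ℕ.* suc k)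
               (solveℕ 1 (λ j → j ⊕ conℕ 0 ⊕ j ⊜ conℕ 2 ⊗ j) ≡.refl j))))))

    rowJ-small : ∀ {N} → N ≤ j → rowJ j ≈[ N ] 0#
    rowJ-small p = ≈[]-trans (≈⇒≈[] (solve 3 (λ a b c → a :* b :* c := b :* (a :* c)) refl _ _ _))
      (x^*≈[]0 _ (ℕₚ.≤-trans p (ℕₚ.≤-trans (k≤triangle j) (ℕₚ.m≤n*m (triangle j) 2))))

    limit : ∀ {N M} → N ℕ.+ suc j ≤ M → ∏< M (θ (J j) ∘ J) * (b * b) ≈[ N ] rowJ j
    limit {N} {M} p = *-cancelˡ-≈[] (unit-≈ (unit-dil (unit-poch j)) (py≈ j))
      (≈[]-trans (≈⇒≈[] (solve 3 (λ p w z → p :* (w :* z) := w :* (z :* p)) refl _ _ _))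
        (≈[]-trans (Limit′.limit p) (≈⇒≈[] (trans (*-cong rhs≈ (reflexive (cong (qpoch (stepPower 1)) (ℕₚ.+-identityʳ j)))) (*-comm _ _)))))

    small : ∀ {N M} → N ≤ j → j < M → ∏< M (θ (J j) ∘ J) ≈[ N ] 0#
    small p = Limit′.small (≈[]-trans (*-≈[] (≈[]-trans (≈⇒≈[] rhs≈) (rowJ-small p)) ≈[]-refl) (≈⇒≈[] (zeroˡ _)))

  center : ℕ → ℕ → ℕ
  center δ k = suc (2 ℕ.* k ℕ.+ δ)

  rowK : ℕ → (ℕ → Series) → ℕ → Series
  rowK δ extra k = sign k * x ^ (4 ℕ.* triangle k) * (1# - x ^ (4 ℕ.* suc (k ℕ.+ δ ℕ.+ k))) * extra k

  mainJ : (ℕ → Series) → ℕ → Series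
  mainJ crossJ j = rowJ j * crossJ j

  mainK : ℕ → (ℕ → Series) → ℕ → Series
  mainK δ extra k = x ^ (center δ k ℕ.* center δ k) * rowK δ extra k

  sumJ : (ℕ → Series) → Series → Series
  sumJ crossJ w = ∑∞ (λ j → γ w (J j) * mainJ crossJ j)

  sumK : ℕ → (ℕ → Series) → Series → Series
  sumK δ extra w = ∑∞ (λ k → γ w (K δ k) * mainK δ extra k)

  crossJ₀ crossJ₁ extra₀ extra₁ : ℕ → Series
  crossJ₀ j = x ^ triangle j
  crossJ₁ j = x ^ pred-triangle j * (1# + x ^ suc (2 ℕ.* j))
  extra₀ _ = 1#
  extra₁ k = dil (dil (eulerFactor k))

  extra₀-poch : ∀ k → dil (dil (poch (k ℕ.+ 0))) ≈ dil (dil (poch k)) * extra₀ k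
  extra₀-poch k = trans (reflexive (cong (dil ∘ dil ∘ poch) (ℕₚ.+-identityʳ k))) (sym (*-identityʳ _))

  extra₁-poch : ∀ k → dil (dil (poch (k ℕ.+ 1))) ≈ dil (dil (poch k)) * extra₁ k
  extra₁-poch k = trans (reflexive (cong (dil ∘ dil ∘ poch) (ℕₚ.+-comm k 1))) (trans (dil-cong (dil-* _ _)) (dil-* _ _))

  module Mixed (δ : ℕ) (crossJ : ℕ → Series)
    (crossJ-limit : ∀ j {N M} → N ℕ.+ j ≤ M → ∏< M (θ (J j) ∘ K δ) * ō ≈[ N ] crossJ j)
    (extra : ℕ → Series) (extra-poch : ∀ k → dil (dil (poch (k ℕ.+ δ))) ≈ dil (dil (poch k)) * extra k) where

    module RowK (k : ℕ) where
      private
        unit-py : ∀ n → Unit (qpoch (stepPower 2) n)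
        unit-py n = unit-≈ (unit-dil (unit-dil (unit-poch n))) (pyK≈ δ n)
        module Limit′ = RowLimit (qpoch (stepPower 2)) unit-py b₄
                      (λ {N} {n} N≤n → ≈[]-trans (≈⇒≈[] (pyK≈ δ n)) (≈[]-sym (dil-≈[] (dil-≈[] (Euler.∏∞-≈[] N≤n)))))
                      (λ M → ∏< M (θ (K δ k) ∘ K δ)) k (k ℕ.+ δ ℕ.+ k) _ (KK.row δ k)
        rhs≈ : sign k * stepPower 2 ^ triangle k * (1# - stepPower 2 ^ suc (k ℕ.+ δ ℕ.+ k)) * qpoch (stepPower 2) (k ℕ.+ δ)
               ≈ qpoch (stepPower 2) k * rowK δ extra k
        rhs≈ = trans (*-cong (*-cong (*-congˡ (KK.y^ δ (triangle k))) (+-congˡ (-‿cong (KK.y^ δ (suc (k ℕ.+ δ ℕ.+ k))))))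
            (trans (pyK≈ δ (k ℕ.+ δ)) (trans (extra-poch k) (*-congʳ (sym (pyK≈ δ k))))))
          (solve 3 (λ a b c → a :* (b :* c) := b :* (a :* c)) refl _ _ _)

      rowK-small : ∀ {N} → N ≤ k → rowK δ extra k ≈[ N ] 0#
      rowK-small p = ≈[]-trans (≈⇒≈[] (solve 4 (λ a b c d → a :* b :* c :* d := b :* (a :* c :* d)) refl _ _ _ _))
        (x^*≈[]0 _ (ℕₚ.≤-trans p (ℕₚ.≤-trans (k≤triangle k) (ℕₚ.m≤n*m (triangle k) 4))))

      limit : ∀ {N M} → N ℕ.+ suc k ≤ M → ∏< M (θ (K δ k) ∘ K δ) * (b₄ * b₄) ≈[ N ] rowK δ extra k
      limit {N} {M} p = *-cancelˡ-≈[] (unit-py k)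
        (≈[]-trans (≈⇒≈[] (solve 3 (λ p w z → p :* (w :* z) := w :* (z :* p)) refl _ _ _))
          (≈[]-trans (Limit′.limit p) (≈⇒≈[] rhs≈)))

      small : ∀ {N M} → N ≤ k → k < M → ∏< M (θ (K δ k) ∘ K δ) ≈[ N ] 0#
      small p = Limit′.small (≈[]-trans (≈⇒≈[] rhs≈) (≈[]-trans (*-≈[] ≈[]-refl (rowK-small p)) (≈⇒≈[] (zeroʳ _))))

    mainJ-small : ∀ {N} j → N ≤ j → mainJ crossJ j ≈[ N ] 0#
    mainJ-small j p = ≈[]-trans (*-≈[] (RowJ.rowJ-small j p) ≈[]-refl) (≈⇒≈[] (zeroˡ _))

    mainK-small : ∀ {N} k → N ≤ k → mainK δ extra k ≈[ N ] 0#
    mainK-small k p = ≈[]-trans (*-≈[] ≈[]-refl (RowK.rowK-small k p)) (≈⇒≈[] (zeroʳ _))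

    open JK δ

    -- Large enough that for every k < N at least N nodes remain beyond the first `center δ k`, the
    -- number of `J` nodes with exponent below that of `K δ k`.
    cutoff : ℕ → ℕ
    cutoff N = suc (3 ℕ.* N ℕ.+ δ)

    private
      bound : ∀ {N k} → k < N → N ℕ.+ center δ k ≤ cutoff N
      bound {N} {k} p = ℕₚ.≤-trans (ℕₚ.+-monoʳ-≤ N (s≤s (ℕₚ.+-monoˡ-≤ δ (ℕₚ.*-monoʳ-≤ 2 (ℕₚ.<⇒≤ p)))))
        (ℕₚ.≤-reflexive (solveℕ 2 (λ N d → N ⊕ (conℕ 1 ⊕ (conℕ 2 ⊗ N ⊕ d)) ⊜ conℕ 1 ⊕ (conℕ 3 ⊗ N ⊕ d)) ≡.refl N δ))

      bound′ : ∀ {N k} → k < N → N ℕ.+ suc k ≤ cutoff N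
      bound′ {N} {k} p = ℕₚ.≤-trans (ℕₚ.+-monoʳ-≤ N (s≤s (ℕₚ.≤-trans (ℕₚ.m≤n*m k 2) (ℕₚ.m≤m+n (2 ℕ.* k) δ)))) (bound p)

    weightJ-limit : ∀ N j → j < cutoff N → weightJ (cutoff N) (cutoff N) j * (b * b * ō) ≈[ N ] mainJ crossJ j
    weightJ-limit N j j<M with ℕₚ.<-≤-connex j N
    ... | inj₁ p = ≈[]-trans (≈⇒≈[] (solve 4 (λ a b c d → a :* b :* (c :* d) := a :* c :* (b :* d)) refl _ _ _ _))
        (*-≈[] (RowJ.limit j (bound′ p)) (crossJ-limit j (ℕₚ.≤-trans (ℕₚ.+-monoʳ-≤ N (ℕₚ.n≤1+n j)) (bound′ p))))
    ... | inj₂ p = ≈[]-trans (*-≈[] (*-≈[] (RowJ.small j p j<M) ≈[]-refl) ≈[]-refl)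
        (≈[]-trans (≈⇒≈[] (trans (*-congʳ (zeroˡ _)) (zeroˡ _))) (≈[]-sym (mainJ-small j p)))

    weightK-limit : ∀ N k → k < cutoff N → weightK (cutoff N) (cutoff N) k * (b₄ * b₄ * (ō * ō)) ≈[ N ] mainK δ extra k
    weightK-limit N k k<M with ℕₚ.<-≤-connex k N
    ... | inj₁ p = ≈[]-trans (≈⇒≈[] (solve 4 (λ a b c d → a :* b :* (c :* d) := a :* d :* (b :* c)) refl _ _ _ _))
        (*-≈[] (CrossK.weight-limit δ k (bound p)) (RowK.limit k (bound′ p)))
    ... | inj₂ p = ≈[]-trans (*-≈[] (*-≈[] ≈[]-refl (RowK.small k p k<M)) ≈[]-refl)
        (≈[]-trans (≈⇒≈[] (trans (*-congʳ (zeroʳ _)) (zeroˡ _))) (≈[]-sym (mainK-small k p)))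

    module _ (w : Series) where
      module SJ = InfiniteSum (λ j → γ w (J j) * mainJ crossJ j) (λ j → ≈[]-trans (*-≈[] ≈[]-refl (mainJ-small j ℕₚ.≤-refl)) (≈⇒≈[] (zeroʳ _)))
      module SK = InfiniteSum (λ k → γ w (K δ k) * mainK δ extra k) (λ k → ≈[]-trans (*-≈[] ≈[]-refl (mainK-small k ℕₚ.≤-refl)) (≈⇒≈[] (zeroʳ _)))

      -- The natural denominators of the weights are b² ō for `J` and b₄² ō² for `K`. As b = o ō b₄,
      -- their quotient is o² ō, the factor before the second sum.
      mainIdentity : ∀ qJ qK →
        (∀ {N M} → N ≤ M → ∏< M (λ j → quad w (v (J j))) ≈[ N ] qJ) →
        (∀ {N M} → N ≤ M → ∏< M (λ k → quad w (v (K δ k))) ≈[ N ] qK) →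
        qJ * qK * (sumJ crossJ w + o * o * ō * sumK δ extra w) ≈ b * b * ō
      mainIdentity qJ qK limJ limK = ≈[]⇒≈ approx
        where
        approx : ∀ N → qJ * qK * (sumJ crossJ w + o * o * ō * sumK δ extra w) ≈[ N ] b * b * ō
        approx N = ≈[]-trans (*-≈[] (*-≈[] (≈[]-sym (limJ N≤M)) (≈[]-sym (limK N≤M))) (+-≈[] partJ (*-≈[] (≈[]-refl {f = o * o * ō}) partK)))
            (≈⇒≈[] (begin
              QJ * QK * (ΣJ * (b * b * ō) + o * o * ō * (ΣK * (b₄ * b₄ * (ō * ō))))
                ≈⟨ *-congˡ (+-congʳ (*-congˡ (*-congʳ (*-cong b≈ b≈)))) ⟩
              QJ * QK * (ΣJ * (o * ō * b₄ * (o * ō * b₄) * ō) + o * o * ō * (ΣK * (b₄ * b₄ * (ō * ō))))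
                ≈⟨ solve 7 (λ qj qk p q o ō b → qj :* qk :* (p :* (o :* ō :* b :* (o :* ō :* b) :* ō) :+ o :* o :* ō :* (q :* (b :* b :* (ō :* ō))))
                     := qj :* qk :* (p :+ q) :* (o :* ō :* b :* (o :* ō :* b) :* ō)) refl QJ QK ΣJ ΣK o ō b₄ ⟩
              QJ * QK * (ΣJ + ΣK) * (o * ō * b₄ * (o * ō * b₄) * ō)
                ≈⟨ *-cong (*-congˡ (expansion w M M (s≤s z≤n))) (*-congʳ (sym (*-cong b≈ b≈))) ⟩
              QJ * QK * (∏< M (γ w ∘ J) * ∏< M (γ w ∘ K δ)) * (b * b * ō)
                ≈⟨ *-congʳ (trans (solve 4 (λ a b c d → a :* b :* (c :* d) := a :* c :* (b :* d)) refl _ _ _ _) (*-cong (inverse J) (inverse (K δ)))) ⟩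
              1# * 1# * (b * b * ō)
                ≈⟨ trans (*-congʳ (*-identityˡ _)) (*-identityˡ _) ⟩
              b * b * ō ∎))
          where
          M = cutoff N
          N≤M : N ≤ M
          N≤M = ℕₚ.m≤n⇒m≤1+n (ℕₚ.≤-trans (ℕₚ.m≤n*m N 3) (ℕₚ.m≤m+n (3 ℕ.* N) δ))
          QJ = ∏< M (λ j → quad w (v (J j)))
          QK = ∏< M (λ k → quad w (v (K δ k)))
          ΣJ = ∑< M (λ j → γ w (J j) * weightJ M M j)
          ΣK = ∑< M (λ k → γ w (K δ k) * weightK M M k)
          inverse : ∀ (L : ℕ → Node) → ∏< M (λ j → quad w (v (L j))) * ∏< M (γ w ∘ L) ≈ 1#
          inverse L = trans (sym (∏-* M _ _)) (trans (∏-cong M (λ k → γ-quad w (L k))) (∏-1 M))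
          pull : ∀ (f g : ℕ → Series) z → ∑< M (λ j → f j * (g j * z)) ≈ ∑< M (λ j → f j * g j) * z
          pull f g z = trans (∑-cong M (λ j → solve 3 (λ a b c → a :* (b :* c) := c :* (a :* b)) refl _ _ _)) (trans (∑-*ˡ M z _) (*-comm _ _))
          partJ : sumJ crossJ w ≈[ N ] ΣJ * (b * b * ō)
          partJ = ≈[]-trans (SJ.∑∞-≈[] N≤M) (≈[]-trans (∑-≈[] M (λ j j<M → *-≈[] ≈[]-refl (≈[]-sym (weightJ-limit N j j<M)))) (≈⇒≈[] (pull _ _ _)))
          partK : sumK δ extra w ≈[ N ] ΣK * (b₄ * b₄ * (ō * ō))
          partK = ≈[]-trans (SK.∑∞-≈[] N≤M) (≈[]-trans (∑-≈[] M (λ k k<M → *-≈[] ≈[]-refl (≈[]-sym (weightK-limit N k k<M)))) (≈⇒≈[] (pull _ _ _)))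

  module Mixed₀ = Mixed 0 crossJ₀ Cross₀.weight-limit extra₀ extra₀-poch
  module Mixed₁ = Mixed 1 crossJ₁ Cross₁.weight-limit extra₁ extra₁-poch

  -- The coefficient of x ^ n in R w belongs to the symbols of n + 1; w = 2, 0 and √2 weigh a
  -- symbol of rank r by 1, cos (π r / 2) and cos (π r / 4) respectively.
  R B : Series → Series
  R w = ∑∞ (Rank.rankTerm w)
  B w = ∑∞ (Rank.appellTerm w)

  γ-cong : ∀ {w w′} → w ≈ w′ → ∀ i → γ w i ≈ γ w′ i
  γ-cong {w} p i = ⁻¹-cong (unit-quad w (v i) (v-0 i)) (+-congʳ (+-congˡ (-‿cong (*-congʳ p))))

  R-cong : ∀ {w w′} → w ≈ w′ → R w ≈ R w′
  R-cong {w} {w′} p = ≈[]⇒≈ λ N → ≈[]-trans (Rank.R.∑∞-≈[] w ℕₚ.≤-refl)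
    (≈[]-trans (≈⇒≈[] (∑-cong N (λ D → *-congˡ (∏-cong (suc D) (λ j → γ-cong p (J j)))))) (≈[]-sym (Rank.R.∑∞-≈[] w′ ℕₚ.≤-refl)))

  dil-two : dil two ≈ two
  dil-two = trans (dil-cong (sym (nat-constant 2))) (trans (dil-constant _) (nat-constant 2))

  dil-nat : ∀ n → dil (nat n) ≈ nat n
  dil-nat n = trans (dil-cong (sym (nat-constant n))) (trans (dil-constant _) (nat-constant n))

  sign-dil : ∀ j → dil (sign j) ≈ sign j
  sign-dil j = trans (dil-^ _ j) (^-congˡ j (trans (dil-neg 1#) (-‿cong dil-1)))

  σ-two : σ two ≈ two
  σ-two = trans (σ-cong (sym dil-two)) (trans (σ-dil two) dil-two)

  dil-quad : ∀ {w} z → dil w ≈ w → dil (quad w z) ≈ quad w (dil z)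
  dil-quad {w} z p = trans (dil-+ _ _) (+-cong (trans (dil-- _ _) (+-cong dil-1 (-‿cong (trans (dil-* _ _) (*-congʳ p))))) (dil-* _ _))

  -- All exponents of `J` are odd, so replacing x by -x negates the node, which has the same effect
  -- as negating w.
  σ-γ : ∀ {w} → dil w ≈ w → ∀ j → σ (γ w (J j)) ≈ γ (- w) (J j)
  σ-γ {w} p j = ⁻¹-unique (unit-quad (- w) (v (J j)) (v-0 (J j))) (trans (*-congʳ (sym σ-quad)) (trans (sym (σ-* _ _)) (trans (σ-cong (γ-quad w (J j))) σ-1)))
    where
    z = v (J j)
    σ-z : σ z ≈ - z
    σ-z = trans (σ-* _ _) (trans (*-cong σ-1 (σ-x^-odd j)) (sym (-‿distribʳ-* _ _)))
    σ-quad : σ (quad w z) ≈ quad (- w) z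
    σ-quad = begin
      σ (1# - w * z + z * z)              ≈⟨ trans (σ-+ _ _) (+-cong (trans (σ-+ _ _) (+-cong σ-1 (trans (σ-neg _) (-‿cong (σ-* _ _))))) (σ-* _ _)) ⟩
      1# - σ w * σ z + σ z * σ z          ≈⟨ +-cong (+-congˡ (-‿cong (*-cong (trans (σ-cong (sym p)) (trans (σ-dil w) p)) σ-z))) (*-cong σ-z σ-z) ⟩
      1# - w * - z + - z * - z            ≈⟨ solve 2 (λ w z → con (+ 1) :- w :* :- z :+ :- z :* :- z := con (+ 1) :- :- w :* z :+ z :* z) refl w z ⟩
      quad (- w) z ∎

  σ-R : ∀ {w} → dil w ≈ w → σ (R w) ≈ R (- w)
  σ-R {w} p = ≈[]⇒≈ λ N → ≈[]-trans (σ-≈[] (Rank.R.∑∞-≈[] w ℕₚ.≤-refl))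
    (≈[]-trans (≈⇒≈[] (trans (σ-∑ N _) (∑-cong N (λ D → trans (σ-* _ _) (*-cong
        (trans (σ-cong (sym (dil-x^ (D ℕ.* D ℕ.+ D)))) (trans (σ-dil _) (dil-x^ (D ℕ.* D ℕ.+ D))))
        (trans (σ-∏ (suc D) _) (∏-cong (suc D) (σ-γ p))))))))
      (≈[]-sym (Rank.R.∑∞-≈[] (- w) ℕₚ.≤-refl)))

  ev-≈[] : ∀ {N f g} → f ≈[ double N ] g → ev f ≈[ N ] ev g
  ev-≈[] p = below λ n n<N → at< p (double n) (ℕₚ.<-trans (ℕₚ.n<1+n _) (double-< n<N))

  od-≈[] : ∀ {N f g} → f ≈[ double N ] g → od f ≈[ N ] od g
  od-≈[] p = below λ n n<N → at< p (suc (double n)) (double-< n<N)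

  ev-∑ : ∀ n f → ev (∑< n f) ≈ ∑< n (ev ∘ f)
  ev-∑ zero f = refl
  ev-∑ (suc n) f = +-congʳ (ev-∑ n f)

  od-∑ : ∀ n f → od (∑< n f) ≈ ∑< n (od ∘ f)
  od-∑ zero f = refl
  od-∑ (suc n) f = +-congʳ (od-∑ n f)

  -- Even and odd parts of the rank series.

  two² : two * two ≈ two + two
  two² = solve 0 (con (+ 2) :* con (+ 2) := con (+ 2) :+ con (+ 2)) refl

  zero² : 0# * 0# ≈ - two + two
  zero² = solve 0 (con (+ 0) :* con (+ 0) := :- con (+ 2) :+ con (+ 2)) refl

  dil-neg-two : dil (- two) ≈ - two
  dil-neg-two = trans (dil-neg two) (-‿cong dil-two)

  -- If w₀ = z + z⁻¹ then w = z² + z⁻².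
  module EvenOdd (w₀ w : Series) (dil-w₀ : dil w₀ ≈ w₀) (dil-w : dil w ≈ w) (w₀² : w₀ * w₀ ≈ w + two) where

    u : ℕ → Series
    u j = x ^ suc (2 ℕ.* j)

    core : ℕ → Series
    core j = sign j * (x ^ (3 ℕ.* triangle j) * (1# - u j)) * γ w (J j)

    private
      z≈ : ∀ j → v (J j) ≈ u j
      z≈ j = *-identityˡ _

      -- Expansion of the fraction by 1 + w₀ z + z² makes the denominator a series in x² and
      -- confines the odd powers of x to the numerator.
      γ-split : ∀ j → γ w₀ (J j) ≈ (1# + w₀ * v (J j) + v (J j) * v (J j)) * dil (γ w (J j))
      γ-split j = sym (⁻¹-unique (unit-quad w₀ z (v-0 (J j))) (begin
        quad w₀ z * ((1# + w₀ * z + z * z) * dil (γ w (J j)))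
          ≈⟨ solve 3 (λ w z g → (con (+ 1) :- w :* z :+ z :* z) :* ((con (+ 1) :+ w :* z :+ z :* z) :* g)
               := ((con (+ 1) :+ z :* z) :* (con (+ 1) :+ z :* z) :- w :* w :* (z :* z)) :* g) refl w₀ z _ ⟩
        ((1# + z * z) * (1# + z * z) - w₀ * w₀ * (z * z)) * dil (γ w (J j))
          ≈⟨ *-congʳ (+-congˡ (-‿cong (*-congʳ w₀²))) ⟩
        ((1# + z * z) * (1# + z * z) - (w + two) * (z * z)) * dil (γ w (J j))
          ≈⟨ *-congʳ (solve 2 (λ w z → (con (+ 1) :+ z :* z) :* (con (+ 1) :+ z :* z) :- (w :+ con (+ 2)) :* (z :* z) := con (+ 1) :- w :* (z :* z) :+ z :* z :* (z :* z)) refl w z) ⟩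
        quad w (z * z) * dil (γ w (J j))
          ≈⟨ *-congʳ (sym (trans (dil-quad z dil-w) (+-cong (+-congˡ (-‿cong (*-congˡ dil-z))) (*-cong dil-z dil-z)))) ⟩
        dil (quad w z) * dil (γ w (J j))
          ≈⟨ trans (sym (dil-* _ _)) (trans (dil-cong (γ-quad w (J j))) dil-1) ⟩
        1# ∎))
        where
        z = v (J j)
        dil-z : dil z ≈ z * z
        dil-z = trans (dil-cong (z≈ j)) (trans (dil-x^ (suc (2 ℕ.* j))) (trans (x^-double (suc (2 ℕ.* j))) (*-cong (sym (z≈ j)) (sym (z≈ j)))))

      h≈ : ∀ j → 1# + w₀ * v (J j) + v (J j) * v (J j) ≈ dil (1# + u j) + x * dil (w₀ * x ^ j)
      h≈ j = begin
        1# + w₀ * v (J j) + v (J j) * v (J j)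
          ≈⟨ +-cong (+-congˡ (*-congˡ (z≈ j))) (*-cong (z≈ j) (z≈ j)) ⟩
        1# + w₀ * (x * x ^ (2 ℕ.* j)) + u j * u j
          ≈⟨ solve 4 (λ w x y u → con (+ 1) :+ w :* (x :* y) :+ u :* u := (con (+ 1) :+ u :* u) :+ x :* (w :* y)) refl w₀ x (x ^ (2 ℕ.* j)) (u j) ⟩
        (1# + u j * u j) + x * (w₀ * x ^ (2 ℕ.* j))
          ≈⟨ +-cong (sym (trans (dil-1+x^ (suc (2 ℕ.* j))) (+-congˡ (x^-double (suc (2 ℕ.* j)))))) (*-congˡ (sym (trans (dil-* _ _) (*-cong dil-w₀ (dil-x^ j))))) ⟩
        dil (1# + u j) + x * dil (w₀ * x ^ j) ∎

      appell≈ : ∀ j → Rank.appellTerm w₀ j ≈ dil (core j) * (dil (1# + u j) + x * dil (w₀ * x ^ j))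
      appell≈ j = begin
        sign j * (x ^ (6 ℕ.* triangle j) * (1# - x ^ (2 ℕ.* suc (2 ℕ.* j)))) * γ w₀ (J j)
          ≈⟨ *-cong (*-cong (sym (sign-dil j)) (*-cong (trans (x^-≡ (ℕₚ.*-assoc 2 3 (triangle j))) (sym (dil-x^ (3 ℕ.* triangle j)))) (sym (dil-1-x^ (suc (2 ℕ.* j)))))) (trans (γ-split j) (*-congʳ (h≈ j))) ⟩
        dil (sign j) * (dil (x ^ (3 ℕ.* triangle j)) * dil (1# - u j)) * (h * dil (γ w (J j)))
          ≈⟨ solve 5 (λ a b c d e → a :* (b :* c) :* (d :* e) := a :* (b :* c) :* e :* d) refl _ _ _ _ _ ⟩
        dil (sign j) * (dil (x ^ (3 ℕ.* triangle j)) * dil (1# - u j)) * dil (γ w (J j)) * h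
          ≈⟨ *-congʳ (sym (trans (dil-* _ _) (*-congʳ (trans (dil-* _ _) (*-congˡ (dil-* _ _)))))) ⟩
        dil (core j) * h ∎
        where h = dil (1# + u j) + x * dil (w₀ * x ^ j)

    ev-appell : ∀ j → ev (Rank.appellTerm w₀ j) ≈ core j * (1# + u j)
    ev-appell j = trans (ev-cong (appell≈ j)) (trans (ev-dil-* _ _) (*-congˡ
      (trans (+-cong (ev-dil _) (trans (ev-x* _) (trans (*-congˡ (od-dil _)) (zeroʳ x)))) (+-identityʳ _))))

    od-appell : ∀ j → od (Rank.appellTerm w₀ j) ≈ core j * (w₀ * x ^ j)
    od-appell j = trans (od-cong (appell≈ j)) (trans (od-dil-* _ _) (*-congˡ
      (trans (+-cong (od-dil _) (trans (od-x* _) (ev-dil _))) (+-identityˡ _))))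

    -- The exponent 3T of the even part is 2T from the row of `J` plus T from `crossJ₀`, so the two
    -- sums agree term by term.
    ev-R : a * ev (R w₀) ≈ sumJ crossJ₀ w
    ev-R = trans (sym (trans (ev-cong (sym (Rank.resummation w₀))) (ev-dil-* a (R w₀)))) (≈[]⇒≈ λ N → ≈[]-trans
      (ev-≈[] (Rank.B.∑∞-≈[] w₀ (ℕₚ.≤-refl))) (≈[]-trans (≈⇒≈[] (trans (ev-∑ (double N) _) (∑-cong (double N) term)))
        (≈[]-sym (Mixed₀.SJ.∑∞-≈[] w (n≤double N)))))
      where
      term : ∀ j → ev (Rank.appellTerm w₀ j) ≈ γ w (J j) * mainJ crossJ₀ j
      term j = trans (ev-appell j) (begin
        sign j * (x ^ (3 ℕ.* triangle j) * (1# - u j)) * γ w (J j) * (1# + u j)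
          ≈⟨ *-congʳ (*-congʳ (*-congˡ (*-congʳ (trans (x^-≡ (ℕₚ.+-comm (triangle j) (2 ℕ.* triangle j))) (x^-+ (2 ℕ.* triangle j) (triangle j)))))) ⟩
        sign j * (x ^ (2 ℕ.* triangle j) * x ^ triangle j * (1# - u j)) * γ w (J j) * (1# + u j)
          ≈⟨ solve 5 (λ s p t u g → s :* (p :* t :* (con (+ 1) :- u)) :* g :* (con (+ 1) :+ u) := g :* (s :* p :* (con (+ 1) :- u :* u) :* t)) refl _ _ _ _ _ ⟩
        γ w (J j) * (sign j * x ^ (2 ℕ.* triangle j) * (1# - u j * u j) * x ^ triangle j)
          ≈⟨ *-congˡ (*-congʳ (*-congˡ (+-congˡ (-‿cong (sym (x^-double (suc (2 ℕ.* j)))))))) ⟩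
        γ w (J j) * mainJ crossJ₀ j ∎)

    -- The node -x^(4k+2) is minus the dilation of `v (J k)`, and the minus sign can be moved to w.
    -- The exponents add up to 1 + 8T + 4T, because (2k + 1)² = 1 + 8T.
    SK≈ : sumK 0 extra₀ w ≈ x * dil (b * R (- w))
    SK≈ = trans (≈[]⇒≈ λ N → ≈[]-trans (Mixed₀.SK.∑∞-≈[] w ℕₚ.≤-refl) (≈[]-trans
        (≈⇒≈[] (trans (∑-cong N term) (trans (∑-*ˡ N x _) (*-congˡ (sym (dil-∑ N _))))))
        (*-≈[] (≈[]-refl {f = x}) (dil-≈[] (≈[]-sym (Rank.B.∑∞-≈[] (- w) ℕₚ.≤-refl)))))) (*-congˡ (dil-cong (sym (Rank.resummation (- w)))))
      where
      γK : ∀ k → γ w (K 0 k) ≈ dil (γ (- w) (J k))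
      γK k = trans (⁻¹-cong (unit-quad w (v (K 0 k)) (v-0 (K 0 k))) (begin
          quad w (v (K 0 k))
            ≈⟨ +-cong (+-congˡ (-‿cong (*-congˡ vK))) (*-cong vK vK) ⟩
          quad w (- dil (v (J k)))
            ≈⟨ solve 2 (λ w z → con (+ 1) :- w :* :- z :+ :- z :* :- z := con (+ 1) :- :- w :* z :+ z :* z) refl w (dil (v (J k))) ⟩
          quad (- w) (dil (v (J k)))
            ≈⟨ sym (dil-quad (v (J k)) (trans (dil-neg w) (-‿cong dil-w))) ⟩
          dil (quad (- w) (v (J k))) ∎))
        (sym (dil-⁻¹ (unit-quad (- w) (v (J k)) (v-0 (J k)))))
        where
        vK : v (K 0 k) ≈ - dil (v (J k))
        vK = trans (sym (-‿distribˡ-* _ _)) (-‿cong (trans (*-identityˡ _) (sym (trans (dil-cong (z≈ k)) (trans (dil-x^ (suc (2 ℕ.* k)))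
          (x^-≡ (solveℕ 1 (λ k → conℕ 2 ⊗ (conℕ 1 ⊕ conℕ 2 ⊗ k) ⊜ conℕ 2 ⊕ conℕ 2 ⊗ (conℕ 2 ⊗ k ⊕ conℕ 0)) ≡.refl k)))))))
      term : ∀ k → γ w (K 0 k) * mainK 0 extra₀ k ≈ x * dil (Rank.appellTerm (- w) k)
      term k = begin
        γ w (K 0 k) * (x ^ (c ℕ.* c) * (sign k * x ^ (4 ℕ.* triangle k) * (1# - x ^ (4 ℕ.* suc (k ℕ.+ 0 ℕ.+ k))) * 1#))
          ≈⟨ *-cong (γK k) (*-congʳ (trans (x^-≡ exponent) (*-congˡ (x^-+ (8 ℕ.* triangle k) 0)))) ⟩
        dil (γ (- w) (J k)) * (x * (x ^ (8 ℕ.* triangle k) * 1#) * (sign k * x ^ (4 ℕ.* triangle k) * (1# - x ^ (4 ℕ.* suc (k ℕ.+ 0 ℕ.+ k))) * 1#))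
          ≈⟨ solve 6 (λ g x p s q r → g :* (x :* (p :* con (+ 1)) :* (s :* q :* r :* con (+ 1))) := x :* (s :* (p :* q :* r) :* g)) refl _ _ _ _ _ _ ⟩
        x * (sign k * (x ^ (8 ℕ.* triangle k) * x ^ (4 ℕ.* triangle k) * (1# - x ^ (4 ℕ.* suc (k ℕ.+ 0 ℕ.+ k)))) * dil (γ (- w) (J k)))
          ≈⟨ *-congˡ (*-congʳ (*-cong (sym (sign-dil k)) (*-cong
               (trans (sym (x^-+ (8 ℕ.* triangle k) (4 ℕ.* triangle k))) (trans (x^-≡ (solveℕ 1 (λ t → conℕ 8 ⊗ t ⊕ conℕ 4 ⊗ t ⊜ conℕ 2 ⊗ (conℕ 6 ⊗ t)) ≡.refl (triangle k))) (sym (dil-x^ (6 ℕ.* triangle k)))))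
               (trans (+-congˡ (-‿cong (x^-≡ (solveℕ 1 (λ k → conℕ 4 ⊗ (conℕ 1 ⊕ (k ⊕ conℕ 0 ⊕ k)) ⊜ conℕ 2 ⊗ (conℕ 2 ⊗ (conℕ 1 ⊕ conℕ 2 ⊗ k))) ≡.refl k)))) (sym (dil-1-x^ (2 ℕ.* suc (2 ℕ.* k)))))))) ⟩
        x * (dil (sign k) * (dil (x ^ (6 ℕ.* triangle k)) * dil (1# - x ^ (2 ℕ.* suc (2 ℕ.* k)))) * dil (γ (- w) (J k)))
          ≈⟨ *-congˡ (sym (trans (dil-* _ _) (*-congʳ (trans (dil-* _ _) (*-congˡ (dil-* _ _)))))) ⟩
        x * dil (Rank.appellTerm (- w) k) ∎
        where
        c = suc (2 ℕ.* k ℕ.+ 0)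
        exponent : c ℕ.* c ≡ suc (8 ℕ.* triangle k ℕ.+ 0)
        exponent = ≡.trans (solveℕ 1 (λ k → (conℕ 1 ⊕ (conℕ 2 ⊗ k ⊕ conℕ 0)) ⊗ (conℕ 1 ⊕ (conℕ 2 ⊗ k ⊕ conℕ 0)) ⊜ conℕ 1 ⊕ conℕ 4 ⊗ (k ⊗ (conℕ 1 ⊕ k))) ≡.refl k)
          (≡.trans (cong (λ n → suc (4 ℕ.* n)) (≡.sym (2*triangle k))) (solveℕ 1 (λ t → conℕ 1 ⊕ conℕ 4 ⊗ (conℕ 2 ⊗ t) ⊜ conℕ 1 ⊕ (conℕ 8 ⊗ t ⊕ conℕ 0)) ≡.refl (triangle k)))

    evenIdentity : ∀ qJ qK →
      (∀ {N M} → N ≤ M → ∏< M (λ j → quad w (v (J j))) ≈[ N ] qJ) →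
      (∀ {N M} → N ≤ M → ∏< M (λ k → quad w (v (K 0 k))) ≈[ N ] qK) →
      qJ * qK * (a * (ev (R w₀) + x * dil (R (- w)))) ≈ b * b * ō
    evenIdentity qJ qK limJ limK = trans (*-congˡ (sym (begin
        sumJ crossJ₀ w + o * o * ō * sumK 0 extra₀ w
          ≈⟨ +-cong (sym ev-R) (*-congˡ (trans SK≈ (*-congˡ (dil-* b _)))) ⟩
        a * ev (R w₀) + o * o * ō * (x * (b₄ * dil (R (- w))))
          ≈⟨ +-congˡ (trans (solve 4 (λ o x b r → o :* (x :* (b :* r)) := o :* b :* (x :* r)) refl _ _ _ _) (*-congʳ (sym a≈))) ⟩
        a * ev (R w₀) + a * (x * dil (R (- w)))
          ≈⟨ sym (distribˡ _ _ _) ⟩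
        a * (ev (R w₀) + x * dil (R (- w))) ∎)))
      (Mixed₀.mainIdentity w qJ qK limJ limK)

  -- The odd part of each Appell-Lerch term carries the factor w₀, which is 0 here; combinatorially,
  -- cos (π r / 2) vanishes for odd r.
  od-R-zero : od (R 0#) ≈ 0#
  od-R-zero = *-cancelˡ unit-a (trans (sym (od-dil-* a (R 0#))) (trans (od-cong (Rank.resummation 0#)) (trans
      (≈[]⇒≈ λ N → ≈[]-trans (od-≈[] (Rank.B.∑∞-≈[] 0# (ℕₚ.≤-refl {double N})))
        (≈⇒≈[] (trans (od-∑ (double N) _) (trans (∑-cong (double N) (λ j → trans (od-appell j) (trans (*-congˡ (zeroˡ _)) (zeroʳ _)))) (∑-0 (double N))))))
      (sym (zeroʳ a)))))
    where open EvenOdd 0# (- two) dil-0 dil-neg-two zero²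

  -- The odd part for w = 2.

  module OddPart where

    open EvenOdd two two dil-two dil-two two²

    private
      g : ℕ → Series
      g j = (1# - u j) ⁻¹

      g-inverse : ∀ j → (1# - u j) * g j ≈ 1#
      g-inverse j = unit-inverse (unit-1-x^ (2 ℕ.* j))

      γ≈ : ∀ j → γ two (J j) ≈ g j * g j
      γ≈ j = sym (⁻¹-unique (unit-quad two (v (J j)) (v-0 (J j))) (begin
        quad two (v (J j)) * (g j * g j)
          ≈⟨ solve 2 (λ z g → (con (+ 1) :- con (+ 2) :* (con (+ 1) :* z) :+ con (+ 1) :* z :* (con (+ 1) :* z)) :* (g :* g) := (con (+ 1) :- z) :* g :* ((con (+ 1) :- z) :* g)) refl (u j) (g j) ⟩
        (1# - u j) * g j * ((1# - u j) * g j)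
          ≈⟨ *-cong (g-inverse j) (g-inverse j) ⟩
        1# * 1#
          ≈⟨ *-identityˡ _ ⟩
        1# ∎))

      exponent₁ : ∀ j → 2 ℕ.* triangle j ℕ.+ pred-triangle j ≡ pentagonal j
      exponent₁ j = ℕₚ.+-cancelʳ-≡ j _ _ (≡.trans (ℕₚ.+-assoc (2 ℕ.* triangle j) (pred-triangle j) j) (≡.trans (cong₂ ℕ._+_ (2*triangle j) (pred-triangle-+ j))
        (solveℕ 2 (λ j t → j ⊗ (conℕ 1 ⊕ j) ⊕ t ⊜ t ⊕ j ⊗ j ⊕ j) ≡.refl j (triangle j))))

      exponent₂ : ∀ j → pentagonal j ℕ.+ suc (2 ℕ.* j) ≡ suc (3 ℕ.* triangle j ℕ.+ j)
      exponent₂ j = ≡.trans (solveℕ 2 (λ j t → t ⊕ j ⊗ j ⊕ (conℕ 1 ⊕ conℕ 2 ⊗ j) ⊜ conℕ 1 ⊕ (t ⊕ j ⊗ (conℕ 1 ⊕ j) ⊕ j)) ≡.refl j (triangle j))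
        (cong (λ n → suc (triangle j ℕ.+ n ℕ.+ j)) (≡.sym (2*triangle j)))

      -- With u = x^(2j+1) the numerator contains (1 + u)² = (1 - u)² + 4u. The first summand
      -- cancels the double pole of γ and leaves a pentagonal term, so that Euler's theorem sums
      -- these to `a`; the second is the odd part of the Appell-Lerch term.
      termJ : ∀ j → γ two (J j) * mainJ crossJ₁ j ≈ pentagonalTerm j + two * x * od (Rank.appellTerm two j)
      termJ j = begin
        γ two (J j) * (sign j * x ^ (2 ℕ.* triangle j) * (1# - x ^ (2 ℕ.* suc (2 ℕ.* j))) * (x ^ pred-triangle j * (1# + u j)))
          ≈⟨ *-cong (γ≈ j) (*-congʳ (*-congˡ (+-congˡ (-‿cong (x^-double (suc (2 ℕ.* j))))))) ⟩
        g j * g j * (sign j * x ^ (2 ℕ.* triangle j) * (1# - u j * u j) * (x ^ pred-triangle j * (1# + u j)))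
          ≈⟨ solve 5 (λ g s p u q → g :* g :* (s :* p :* (con (+ 1) :- u :* u) :* (q :* (con (+ 1) :+ u)))
               := s :* (p :* q) :* (((con (+ 1) :- u) :* g) :* ((con (+ 1) :- u) :* g)) :* (con (+ 1) :- u)
                  :+ con (+ 4) :* s :* (p :* q :* u) :* ((con (+ 1) :- u) :* g) :* g) refl _ _ _ _ _ ⟩
        sign j * P * ((1# - u j) * g j * ((1# - u j) * g j)) * (1# - u j) + nat 4 * sign j * (P * u j) * ((1# - u j) * g j) * g j
          ≈⟨ +-cong (*-congʳ (*-cong (*-congˡ P≈) (*-cong (g-inverse j) (g-inverse j)))) (*-congʳ (*-cong (*-congˡ Pu≈) (g-inverse j))) ⟩
        sign j * x ^ pentagonal j * (1# * 1#) * (1# - u j) + nat 4 * sign j * (x * (x ^ (3 ℕ.* triangle j) * x ^ j)) * 1# * g j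
          ≈⟨ +-cong (solve 3 (λ s p u → s :* p :* (con (+ 1) :* con (+ 1)) :* u := s :* (p :* u)) refl _ _ _)
               (solve 5 (λ s x t y g → con (+ 4) :* s :* (x :* (t :* y)) :* con (+ 1) :* g := con (+ 2) :* x :* (s :* (t :* con (+ 1)) :* g :* (con (+ 2) :* y))) refl _ _ _ _ _) ⟩
        pentagonalTerm j + two * x * (sign j * (x ^ (3 ℕ.* triangle j) * 1#) * g j * (two * x ^ j))
          ≈⟨ +-congˡ (*-congˡ (*-congʳ (*-congʳ (*-congˡ (*-congˡ (sym (g-inverse j))))))) ⟩
        pentagonalTerm j + two * x * (sign j * (x ^ (3 ℕ.* triangle j) * ((1# - u j) * g j)) * g j * (two * x ^ j))
          ≈⟨ +-congˡ (*-congˡ (trans (solve 6 (λ s t u g w y → s :* (t :* (u :* g)) :* g :* (w :* y) := s :* (t :* u) :* (g :* g) :* (w :* y)) refl _ _ _ _ _ _)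
               (trans (*-congʳ (*-congˡ (sym (γ≈ j)))) (sym (od-appell j))))) ⟩
        pentagonalTerm j + two * x * od (Rank.appellTerm two j) ∎
        where
        P = x ^ (2 ℕ.* triangle j) * x ^ pred-triangle j
        P≈ : P ≈ x ^ pentagonal j
        P≈ = trans (sym (x^-+ (2 ℕ.* triangle j) (pred-triangle j))) (x^-≡ (exponent₁ j))
        Pu≈ : P * u j ≈ x * (x ^ (3 ℕ.* triangle j) * x ^ j)
        Pu≈ = trans (*-congʳ P≈) (trans (sym (x^-+ (pentagonal j) (suc (2 ℕ.* j)))) (trans (x^-≡ (exponent₂ j)) (*-congˡ (x^-+ (3 ℕ.* triangle j) j))))

      SJ≈ : sumJ crossJ₁ two ≈ a * (1# + two * x * od (R two))
      SJ≈ = begin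
        sumJ crossJ₁ two
          ≈⟨ (≈[]⇒≈ λ N → ≈[]-trans (Mixed₁.SJ.∑∞-≈[] two (n≤double N)) (≈[]-trans
               (≈⇒≈[] (trans (∑-cong (double N) termJ) (trans (∑-+ (double N) _ _) (+-congˡ (trans (∑-*ˡ (double N) (two * x) _) (*-congˡ (sym (od-∑ (double N) _))))))))
               (+-≈[] (≈[]-sym (Pentagonal.∑∞-≈[] (n≤double N))) (*-≈[] (≈[]-refl {f = two * x}) (≈[]-sym (od-≈[] (Rank.B.∑∞-≈[] two (ℕₚ.≤-refl {double N})))))))) ⟩
        (∑∞ pentagonalTerm) + two * x * od (B two)
          ≈⟨ +-cong (sym pentagonalTheorem) (*-congˡ (trans (od-cong (sym (Rank.resummation two))) (od-dil-* a (R two)))) ⟩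
        a + two * x * (a * od (R two))
          ≈⟨ solve 3 (λ a x r → a :+ con (+ 2) :* x :* (a :* r) := a :* (con (+ 1) :+ con (+ 2) :* x :* r)) refl a x _ ⟩
        a * (1# + two * x * od (R two)) ∎

      q⁺ : ℕ → Series
      q⁺ k = quad (- two) (x ^ suc k)

      unit-q⁺ : ∀ k → Unit (q⁺ k)
      unit-q⁺ k = unit-quad (- two) (x ^ suc k) (x*-zero (x ^ k))

      uTerm : ℕ → Series
      uTerm k = q⁺ k ⁻¹ * (x ^ (suc k ℕ.* suc k) * (sign k * x ^ triangle k * (1# - x ^ suc (k ℕ.+ 1 ℕ.+ k)) * eulerFactor k))

      module U = InfiniteSum uTerm (λ k → ≈[]-trans (≈⇒≈[] (solve 3 (λ a b c → a :* (b :* c) := b :* (a :* c)) refl _ _ _))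
        (x^*≈[]0 _ (ℕₚ.≤-trans (ℕₚ.n≤1+n k) (ℕₚ.m≤m+n (suc k) _))))

      dil² : ∀ n → dil (dil (x ^ n)) ≈ x ^ (4 ℕ.* n)
      dil² n = trans (dil-cong (dil-x^ n)) (trans (dil-x^ (2 ℕ.* n)) (x^-≡ (≡.sym (ℕₚ.*-assoc 2 2 n))))

      dil²-* : ∀ f g → dil (dil (f * g)) ≈ dil (dil f) * dil (dil g)
      dil²-* f g = trans (dil-cong (dil-* f g)) (dil-* _ _)

      dil²-1-x^ : ∀ n → dil (dil (1# - x ^ n)) ≈ 1# - x ^ (4 ℕ.* n)
      dil²-1-x^ n = trans (dil-cong (dil-1-x^ n)) (trans (dil-1-x^ (2 ℕ.* n)) (+-congˡ (-‿cong (x^-≡ (≡.sym (ℕₚ.*-assoc 2 2 n))))))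

      vK : ∀ k → v (K 1 k) ≈ - dil (dil (x ^ suc k))
      vK k = trans (sym (-‿distribˡ-* _ _)) (-‿cong (trans (*-identityˡ _) (sym (trans (dil² (suc k))
        (x^-≡ (solveℕ 1 (λ k → conℕ 4 ⊗ (conℕ 1 ⊕ k) ⊜ conℕ 2 ⊕ conℕ 2 ⊗ (conℕ 2 ⊗ k ⊕ conℕ 1)) ≡.refl k))))))

      quadK : ∀ k → quad two (v (K 1 k)) ≈ dil (dil (q⁺ k))
      quadK k = begin
        quad two (v (K 1 k))
          ≈⟨ +-cong (+-congˡ (-‿cong (*-congˡ (vK k)))) (*-cong (vK k) (vK k)) ⟩
        quad two (- dil (dil (x ^ suc k)))
          ≈⟨ solve 1 (λ z → con (+ 1) :- con (+ 2) :* :- z :+ :- z :* :- z := con (+ 1) :- :- con (+ 2) :* z :+ z :* z) refl _ ⟩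
        quad (- two) (dil (dil (x ^ suc k)))
          ≈⟨ sym (trans (dil-cong (dil-quad (x ^ suc k) dil-neg-two)) (dil-quad (dil (x ^ suc k)) dil-neg-two)) ⟩
        dil (dil (q⁺ k)) ∎

      termK : ∀ k → γ two (K 1 k) * mainK 1 extra₁ k ≈ dil (dil (uTerm k))
      termK k = begin
        γ two (K 1 k) * (x ^ (c ℕ.* c) * (sign k * x ^ (4 ℕ.* triangle k) * (1# - x ^ (4 ℕ.* suc (k ℕ.+ 1 ℕ.+ k))) * dil (dil (eulerFactor k))))
          ≈⟨ *-cong (trans (⁻¹-cong (unit-quad two (v (K 1 k)) (v-0 (K 1 k))) (quadK k)) (sym (trans (dil-cong (dil-⁻¹ (unit-q⁺ k))) (dil-⁻¹ (unit-dil (unit-q⁺ k))))))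
               (*-cong (trans (x^-≡ exponent) (sym (dil² (suc k ℕ.* suc k))))
                 (*-congʳ (*-cong (*-cong (sym (trans (dil-cong (sign-dil k)) (sign-dil k))) (sym (dil² (triangle k)))) (sym (dil²-1-x^ (suc (k ℕ.+ 1 ℕ.+ k))))))) ⟩
        d (q⁺ k ⁻¹) * (d (x ^ (suc k ℕ.* suc k)) * (d (sign k) * d (x ^ triangle k) * d (1# - x ^ suc (k ℕ.+ 1 ℕ.+ k)) * d (eulerFactor k)))
          ≈⟨ sym (trans (dil²-* _ _) (*-congˡ (trans (dil²-* _ _) (*-congˡ (trans (dil²-* _ _) (*-congʳ (trans (dil²-* _ _) (*-congʳ (dil²-* _ _))))))))) ⟩
        dil (dil (uTerm k)) ∎
        where
        d : Series → Series
        d f = dil (dil f)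
        c = suc (2 ℕ.* k ℕ.+ 1)
        exponent : c ℕ.* c ≡ 4 ℕ.* (suc k ℕ.* suc k)
        exponent = solveℕ 1 (λ k → (conℕ 1 ⊕ (conℕ 2 ⊗ k ⊕ conℕ 1)) ⊗ (conℕ 1 ⊕ (conℕ 2 ⊗ k ⊕ conℕ 1)) ⊜ conℕ 4 ⊗ ((conℕ 1 ⊕ k) ⊗ (conℕ 1 ⊕ k))) ≡.refl k

      SK≈₁ : sumK 1 extra₁ two ≈ dil (dil (∑∞ uTerm))
      SK≈₁ = ≈[]⇒≈ λ N → ≈[]-trans (Mixed₁.SK.∑∞-≈[] two ℕₚ.≤-refl) (≈[]-trans
        (≈⇒≈[] (trans (∑-cong N termK) (sym (trans (dil-cong (dil-∑ N _)) (dil-∑ N _)))))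
        (dil-≈[] (dil-≈[] (≈[]-sym (U.∑∞-≈[] ℕₚ.≤-refl)))))

      limJ : ∀ {N M} → N ≤ M → ∏< M (λ j → quad two (v (J j))) ≈[ N ] o * o
      limJ {N} {M} p = ≈[]-trans (≈⇒≈[] (trans (∏-cong M (λ j → solve 1 (λ z → con (+ 1) :- con (+ 2) :* (con (+ 1) :* z) :+ con (+ 1) :* z :* (con (+ 1) :* z)
          := (con (+ 1) :- z) :* (con (+ 1) :- z)) refl (u j))) (∏-* M _ _)))
        (≈[]-sym (*-≈[] (Odd.∏∞-≈[] p) (Odd.∏∞-≈[] p)))

      limK : ∀ {N M} → N ≤ M → ∏< M (λ k → quad two (v (K 1 k))) ≈[ N ] dil (dil (a⁺ * a⁺))
      limK {N} {M} p = ≈[]-trans (≈⇒≈[] (trans (∏-cong M (λ k → trans (quadK k) (dil-cong (dil-cong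
          (solve 1 (λ z → con (+ 1) :- :- con (+ 2) :* z :+ z :* z := (con (+ 1) :+ z) :* (con (+ 1) :+ z)) refl (x ^ suc k))))))
          (trans (sym (trans (dil-cong (dil-∏ M _)) (dil-∏ M _))) (dil-cong (dil-cong (∏-* M _ _))))))
        (dil-≈[] (dil-≈[] (≈[]-sym (*-≈[] (Euler⁺.∏∞-≈[] p) (Euler⁺.∏∞-≈[] p)))))

    -- The contribution of the nodes -x^(4k+4), after division by (x⁴; x⁴)∞ and with x for x⁴.
    -- Entering the identity as a series in x⁴, it disappears from odd parts.
    remainder : Series
    remainder = a ⁻¹ * (∑∞ uTerm)

    oddIdentity : o * o * dil (dil (a⁺ * a⁺)) * (a * (1# + two * x * od (R two) + dil (dil remainder))) ≈ b * b * ō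
    oddIdentity = trans (*-congˡ (sym (begin
        sumJ crossJ₁ two + o * o * ō * sumK 1 extra₁ two
          ≈⟨ +-cong SJ≈ (*-congˡ (trans SK≈₁ U≈)) ⟩
        a * (1# + two * x * od (R two)) + o * o * ō * (b₄ * dil (dil remainder))
          ≈⟨ +-congˡ (trans (sym (*-assoc _ _ _)) (*-congʳ (sym a≈))) ⟩
        a * (1# + two * x * od (R two)) + a * dil (dil remainder)
          ≈⟨ sym (distribˡ _ _ _) ⟩
        a * (1# + two * x * od (R two) + dil (dil remainder)) ∎)))
      (Mixed₁.mainIdentity two (o * o) (dil (dil (a⁺ * a⁺))) limJ limK)
      where
      U≈ : dil (dil (∑∞ uTerm)) ≈ b₄ * dil (dil remainder)
      U≈ = trans (dil-cong (dil-cong (trans (sym (*-identityˡ _)) (trans (*-congʳ (sym (unit-inverse unit-a))) (*-assoc _ _ _))))) (dil²-* _ _)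

  open OddPart public using (oddIdentity; remainder)

  -- Product evaluations for w² - 2 equal to 2, -2 and 0.

  private
    module _ (w : Series) (f : Series → Series) (f-quad : ∀ z → quad w z ≈ f z)
      (f-cong : ∀ {z z′} → z ≈ z′ → f z ≈ f z′) where

      prodJ : ∀ M → ∏< M (λ j → quad w (v (J j))) ≈ ∏< M (λ j → f (x ^ suc (2 ℕ.* j)))
      prodJ M = ∏-cong M (λ j → trans (f-quad _) (f-cong (*-identityˡ _)))

      prodK : ∀ M → ∏< M (λ k → quad w (v (K 0 k))) ≈ ∏< M (λ k → f (- dil (x ^ suc (2 ℕ.* k))))
      prodK M = ∏-cong M (λ k → trans (f-quad _) (f-cong (trans (sym (-‿distribˡ-* _ _)) (-‿cong (trans (*-identityˡ _)
        (sym (trans (dil-x^ (suc (2 ℕ.* k))) (x^-≡ (solveℕ 1 (λ k → conℕ 2 ⊗ (conℕ 1 ⊕ conℕ 2 ⊗ k) ⊜ conℕ 2 ⊕ conℕ 2 ⊗ (conℕ 2 ⊗ k ⊕ conℕ 0)) ≡.refl k)))))))))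

    square-∏ : ∀ M (f : ℕ → Series) → ∏< M (λ k → f k * f k) ≈ ∏< M f * ∏< M f
    square-∏ M f = ∏-* M f f

    1-z-square 1+z-square : Series → Series
    1-z-square z = (1# - z) * (1# - z)
    1+z-square z = (1# + z) * (1# + z)

    1-z-cong : ∀ {z z′} → z ≈ z′ → 1-z-square z ≈ 1-z-square z′
    1-z-cong p = *-cong (+-congˡ (-‿cong p)) (+-congˡ (-‿cong p))

    1+z-cong : ∀ {z z′} → z ≈ z′ → 1+z-square z ≈ 1+z-square z′
    1+z-cong p = *-cong (+-congˡ p) (+-congˡ p)

    squareK⁺ : ∀ k → 1-z-square (- dil (x ^ suc (2 ℕ.* k))) ≈ dil (oddFactor⁺ k * oddFactor⁺ k)
    squareK⁺ k = trans (solve 1 (λ z → (con (+ 1) :- :- z) :* (con (+ 1) :- :- z) := (con (+ 1) :+ z) :* (con (+ 1) :+ z)) refl _)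
      (sym (trans (dil-* _ _) (*-cong p p)))
      where
      p : dil (oddFactor⁺ k) ≈ 1# + dil (x ^ suc (2 ℕ.* k))
      p = trans (dil-+ _ _) (+-congʳ dil-1)

    squareK : ∀ k → 1+z-square (- dil (x ^ suc (2 ℕ.* k))) ≈ dil (oddFactor k * oddFactor k)
    squareK k = sym (trans (dil-* _ _) (*-cong p p))
      where
      p : dil (oddFactor k) ≈ 1# - dil (x ^ suc (2 ℕ.* k))
      p = trans (dil-- _ _) (+-congʳ dil-1)

  evaluation₂ : o * o * dil (ō * ō) * (a * (ev (R two) + x * dil (σ (R two)))) ≈ b * b * ō
  evaluation₂ = trans (*-congˡ (*-congˡ (+-congˡ (*-congˡ (dil-cong (σ-R dil-two))))))
    (evenIdentity (o * o) (dil (ō * ō))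
      (λ {N} {M} p → ≈[]-trans (≈⇒≈[] (trans (prodJ two 1-z-square quad≈ 1-z-cong M) (square-∏ M oddFactor)))
        (≈[]-sym (*-≈[] (Odd.∏∞-≈[] p) (Odd.∏∞-≈[] p))))
      (λ {N} {M} p → ≈[]-trans (≈⇒≈[] (trans (prodK two 1-z-square quad≈ 1-z-cong M) (trans (∏-cong M squareK⁺) (trans (sym (dil-∏ M _)) (dil-cong (square-∏ M oddFactor⁺))))))
        (dil-≈[] (≈[]-sym (*-≈[] (Odd⁺.∏∞-≈[] p) (Odd⁺.∏∞-≈[] p))))))
    where
    open EvenOdd two two dil-two dil-two two²
    quad≈ : ∀ z → quad two z ≈ 1-z-square z
    quad≈ = solve 1 (λ z → con (+ 1) :- con (+ 2) :* z :+ z :* z := (con (+ 1) :- z) :* (con (+ 1) :- z)) refl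

  -- From w₀ = 0 one gets w = -2, and the sign change of w in the dilated term turns it into
  -- `R two`: the weights cos (π r / 2) are tied to plain counting.
  evaluation₋₂ : ō * ō * dil (o * o) * (a * (ev (R 0#) + x * dil (R two))) ≈ b * b * ō
  evaluation₋₂ = trans (*-congˡ (*-congˡ (+-congˡ (*-congˡ (dil-cong (R-cong (sym (-‿involutive two))))))))
    (evenIdentity (ō * ō) (dil (o * o))
      (λ {N} {M} p → ≈[]-trans (≈⇒≈[] (trans (prodJ (- two) 1+z-square quad≈ 1+z-cong M) (square-∏ M oddFactor⁺)))
        (≈[]-sym (*-≈[] (Odd⁺.∏∞-≈[] p) (Odd⁺.∏∞-≈[] p))))
      (λ {N} {M} p → ≈[]-trans (≈⇒≈[] (trans (prodK (- two) 1+z-square quad≈ 1+z-cong M) (trans (∏-cong M squareK) (trans (sym (dil-∏ M _)) (dil-cong (square-∏ M oddFactor))))))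
        (dil-≈[] (≈[]-sym (*-≈[] (Odd.∏∞-≈[] p) (Odd.∏∞-≈[] p))))))
    where
    open EvenOdd 0# (- two) dil-0 dil-neg-two zero²
    quad≈ : ∀ z → quad (- two) z ≈ 1+z-square z
    quad≈ = solve 1 (λ z → con (+ 1) :- :- con (+ 2) :* z :+ z :* z := (con (+ 1) :+ z) :* (con (+ 1) :+ z)) refl

  -- For a square root of 2 the value w² - 2 is 0, so the quadratic factors become 1 + z² and the
  -- dilated companion is `R 0#`.
  evaluation₀ : ∀ w → dil w ≈ w → w * w ≈ two → dil ō * dil (dil ō) * (a * (ev (R w) + x * dil (R 0#))) ≈ b * b * ō
  evaluation₀ w dil-w w² = trans (*-congˡ (*-congˡ (+-congˡ (*-congˡ (dil-cong (R-cong (sym -0#≈0#)))))))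
    (evenIdentity (dil ō) (dil (dil ō))
      (λ {N} {M} p → ≈[]-trans (≈⇒≈[] (trans (prodJ 0# sq quad≈ sq-cong M) (trans (∏-cong M (λ j → trans (+-congˡ (sym (x^-double (suc (2 ℕ.* j))))) (sym (dil-1+x^ (suc (2 ℕ.* j)))))) (sym (dil-∏ M _)))))
        (dil-≈[] (≈[]-sym (Odd⁺.∏∞-≈[] p))))
      (λ {N} {M} p → ≈[]-trans (≈⇒≈[] (trans (prodK 0# sq quad≈ sq-cong M) (trans (∏-cong M factorK) (sym (trans (dil-cong (dil-∏ M _)) (dil-∏ M _))))))
        (dil-≈[] (dil-≈[] (≈[]-sym (Odd⁺.∏∞-≈[] p))))))
    where
    open EvenOdd w 0# dil-w dil-0 (trans w² (sym (+-identityˡ two)))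
    sq : Series → Series
    sq z = 1# + z * z
    sq-cong : ∀ {z z′} → z ≈ z′ → sq z ≈ sq z′
    sq-cong p = +-congˡ (*-cong p p)
    quad≈ : ∀ z → quad 0# z ≈ sq z
    quad≈ = solve 1 (λ z → con (+ 1) :- con (+ 0) :* z :+ z :* z := con (+ 1) :+ z :* z) refl
    factorK : ∀ k → sq (- dil (x ^ suc (2 ℕ.* k))) ≈ dil (dil (oddFactor⁺ k))
    factorK k = begin
      1# + - dil y * - dil y    ≈⟨ solve 1 (λ z → con (+ 1) :+ :- z :* :- z := con (+ 1) :+ z :* z) refl (dil y) ⟩
      1# + dil y * dil y        ≈⟨ +-cong (sym dil-1) (sym (dil-* y y)) ⟩
      dil 1# + dil (y * y)      ≈⟨ sym (dil-+ 1# (y * y)) ⟩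
      dil (1# + y * y)          ≈⟨ dil-cong (trans (+-congˡ (sym (x^-double (suc (2 ℕ.* k))))) (sym (dil-1+x^ (suc (2 ℕ.* k))))) ⟩
      dil (dil (oddFactor⁺ k)) ∎
      where y = x ^ suc (2 ℕ.* k)

  -- φ = ∑ x^(n²) over all integers n, and ψ = ∑ x^(n(n+1)/2) over n ≥ 0
  φ ψ : Series
  squareTerm⁺ triangleTerm : ℕ → Series
  squareTerm⁺ k = two * x ^ (suc k ℕ.* suc k)
  triangleTerm k = x ^ triangle k

  module Squares⁺ = InfiniteSum squareTerm⁺ (λ k → ≈[]-trans (≈⇒≈[] (*-comm _ _)) (x^*≈[]0 _ (ℕₚ.≤-trans (ℕₚ.n≤1+n k) (ℕₚ.m≤m+n (suc k) _))))
  module Triangles = InfiniteSum triangleTerm (λ k → x^≈[]0 (k≤triangle k))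

  φ = 1# + (∑∞ squareTerm⁺)
  ψ = (∑∞ triangleTerm)

  sign² : ∀ n → sign n * sign n ≈ 1#
  sign² zero = *-identityˡ 1#
  sign² (suc n) = trans (solve 1 (λ s → :- con (+ 1) :* s :* (:- con (+ 1) :* s) := s :* s) refl (sign n)) (sign² n)

  sign-2* : ∀ n → sign (2 ℕ.* n) ≈ 1#
  sign-2* n = trans (^-homo-* (- 1#) n (n ℕ.+ 0)) (trans (*-congˡ (reflexive (cong sign (ℕₚ.+-identityʳ n)))) (sign² n))

  σ-x^ : ∀ n → σ (x ^ n) ≈ sign n * x ^ n
  σ-x^ n = trans (σ-^ x n) (trans (^-congˡ n (trans σ-x (solve 1 (λ x → :- x := :- con (+ 1) :* x) refl x))) (^-distrib-* (- 1#) x n))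

  σφ̄ : σ φ̄ ≈ φ
  σφ̄ = trans (σ-+ _ _) (+-cong σ-1 (≈[]⇒≈ λ N → ≈[]-trans (σ-≈[] (Squares.∑∞-≈[] ℕₚ.≤-refl))
      (≈[]-trans (≈⇒≈[] (trans (σ-∑ N _) (∑-cong N term))) (≈[]-sym (Squares⁺.∑∞-≈[] ℕₚ.≤-refl)))))
    where
    term : ∀ k → σ (squareTerm k) ≈ squareTerm⁺ k
    term k = begin
      σ (two * (sign n * x ^ (n ℕ.* n)))
        ≈⟨ trans (σ-* _ _) (*-cong σ-two (trans (σ-* _ _) (*-cong (trans (σ-cong (sym (sign-dil n))) (trans (σ-dil _) (sign-dil n))) (σ-x^ (n ℕ.* n))))) ⟩
      two * (sign n * (sign (n ℕ.* n) * x ^ (n ℕ.* n)))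
        ≈⟨ *-congˡ (trans (sym (*-assoc _ _ _)) (*-congʳ (trans (*-congˡ signs) (sign² n)))) ⟩
      two * (1# * x ^ (n ℕ.* n))
        ≈⟨ *-congˡ (*-identityˡ _) ⟩
      squareTerm⁺ k ∎
      where
      n = suc k
      signs : sign (n ℕ.* n) ≈ sign n
      signs = trans (reflexive (cong sign (cong (n ℕ.+_) (≡.sym (2*triangle k))))) (trans (^-homo-* (- 1#) n (2 ℕ.* triangle k)) (trans (*-congˡ (sign-2* (triangle k))) (*-identityʳ _)))

  private
    ∑-pairs : ∀ n f → ∑< (double n) f ≈ ∑< n (λ k → f (double k)) + ∑< n (λ k → f (suc (double k)))
    ∑-pairs zero f = sym (+-identityˡ _)
    ∑-pairs (suc n) f = trans (+-congʳ (+-congʳ (∑-pairs n f)))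
      (solve 4 (λ a b c d → a :+ b :+ c :+ d := a :+ c :+ (b :+ d)) refl _ _ _ _)

    double² : ∀ k → suc (suc (double k)) ℕ.* suc (suc (double k)) ≡ 2 ℕ.* (2 ℕ.* (suc k ℕ.* suc k))
    double² k = ≡.trans (cong (λ n → suc (suc n) ℕ.* suc (suc n)) (double≡2* k))
      (solveℕ 1 (λ k → (conℕ 2 ⊕ conℕ 2 ⊗ k) ⊗ (conℕ 2 ⊕ conℕ 2 ⊗ k) ⊜ conℕ 2 ⊗ (conℕ 2 ⊗ ((conℕ 1 ⊕ k) ⊗ (conℕ 1 ⊕ k)))) ≡.refl k)

    double²′ : ∀ k → suc (double k) ℕ.* suc (double k) ≡ suc (2 ℕ.* (2 ℕ.* (2 ℕ.* triangle k)))
    double²′ k = ≡.trans (cong (λ n → suc n ℕ.* suc n) (double≡2* k)) (≡.trans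
      (solveℕ 1 (λ k → (conℕ 1 ⊕ conℕ 2 ⊗ k) ⊗ (conℕ 1 ⊕ conℕ 2 ⊗ k) ⊜ conℕ 1 ⊕ conℕ 2 ⊗ (conℕ 2 ⊗ (k ⊗ (conℕ 1 ⊕ k)))) ≡.refl k)
      (cong (λ n → suc (2 ℕ.* (2 ℕ.* n))) (≡.sym (2*triangle k))))

  -- Even squares are 4m² and odd squares 1 + 8T, so φ(x) = φ(x⁴) + 2x ψ(x⁸).
  φ-decompose : φ ≈ dil (dil φ) + x * dil (two * dil (dil ψ))
  φ-decompose = begin
    1# + (∑∞ squareTerm⁺)
      ≈⟨ +-congˡ (≈[]⇒≈ λ N → ≈[]-trans (Squares⁺.∑∞-≈[] (n≤double N)) (≈[]-trans
           (≈⇒≈[] (trans (∑-pairs N squareTerm⁺) (+-cong (trans (∑-cong N oddTerm) (trans (∑-*ˡ N x _) (*-congˡ (trans (sym (dil-∑ N _)) (dil-cong (trans (∑-*ˡ N two _) (*-congˡ (sym (trans (dil-cong (dil-∑ N _)) (dil-∑ N _))))))))))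
             (trans (∑-cong N evenTerm) (sym (trans (dil-cong (dil-∑ N _)) (dil-∑ N _)))))))
           (+-≈[] (*-≈[] (≈[]-refl {f = x}) (dil-≈[] (*-≈[] (≈[]-refl {f = two}) (dil-≈[] (dil-≈[] (≈[]-sym (Triangles.∑∞-≈[] ℕₚ.≤-refl)))))))
             (dil-≈[] (dil-≈[] (≈[]-sym (Squares⁺.∑∞-≈[] ℕₚ.≤-refl))))))) ⟩
    1# + (x * dil (two * dil (dil ψ)) + dil (dil (∑∞ squareTerm⁺)))
      ≈⟨ solve 2 (λ p q → con (+ 1) :+ (p :+ q) := con (+ 1) :+ q :+ p) refl _ _ ⟩
    1# + dil (dil (∑∞ squareTerm⁺)) + x * dil (two * dil (dil ψ))
      ≈⟨ +-congʳ (sym (trans (dil-cong (trans (dil-+ _ _) (+-congʳ dil-1))) (trans (dil-+ _ _) (+-congʳ dil-1)))) ⟩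
    dil (dil φ) + x * dil (two * dil (dil ψ)) ∎
    where
    evenTerm : ∀ k → squareTerm⁺ (suc (double k)) ≈ dil (dil (squareTerm⁺ k))
    evenTerm k = sym (trans (dil-cong (trans (dil-* _ _) (*-cong dil-two (dil-x^ (suc k ℕ.* suc k))))) (trans (dil-* _ _) (*-cong dil-two (trans (dil-x^ (2 ℕ.* (suc k ℕ.* suc k))) (x^-≡ (≡.sym (double² k)))))))
    oddTerm : ∀ k → squareTerm⁺ (double k) ≈ x * dil (two * dil (dil (triangleTerm k)))
    oddTerm k = begin
      two * x ^ (suc (double k) ℕ.* suc (double k))
        ≈⟨ *-congˡ (x^-≡ (double²′ k)) ⟩
      two * (x * x ^ (2 ℕ.* (2 ℕ.* (2 ℕ.* triangle k))))
        ≈⟨ solve 3 (λ t x y → t :* (x :* y) := x :* (t :* y)) refl _ _ _ ⟩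
      x * (two * x ^ (2 ℕ.* (2 ℕ.* (2 ℕ.* triangle k))))
        ≈⟨ *-congˡ (sym (trans (dil-* _ _) (*-cong dil-two (trans (dil-cong (trans (dil-cong (dil-x^ (triangle k))) (dil-x^ (2 ℕ.* triangle k)))) (dil-x^ (2 ℕ.* (2 ℕ.* triangle k))))))) ⟩
      x * dil (two * dil (dil (triangleTerm k))) ∎

  ev-combine : ∀ f g → ev (dil f + x * dil g) ≈ f
  ev-combine f g = trans (+-cong (ev-dil f) (trans (ev-x* _) (trans (*-congˡ (od-dil g)) (zeroʳ x)))) (+-identityʳ f)

  od-combine : ∀ f g → od (dil f + x * dil g) ≈ g
  od-combine f g = trans (+-cong (od-dil f) (trans (od-x* _) (ev-dil g))) (+-identityˡ g)

  ev-φ : ev φ ≈ dil φ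
  ev-φ = trans (ev-cong φ-decompose) (ev-combine _ _)

  od-φ : od φ ≈ two * dil (dil ψ)
  od-φ = trans (od-cong φ-decompose) (od-combine _ _)

  φ̄≈σφ : φ̄ ≈ σ φ
  φ̄≈σφ = trans (sym (σσ φ̄)) (σ-cong σφ̄)

  φ̄≈ : φ̄ ≈ o * o * b
  φ̄≈ = trans gauss (trans (*-congʳ a≈o*b) (solve 2 (λ o b → o :* b :* o := o :* o :* b) refl o b))

  φ≈ : φ ≈ ō * ō * b
  φ≈ = trans (sym σφ̄) (trans (σ-cong φ̄≈) (trans (σ-* _ _) (*-cong (trans (σ-* _ _) (*-cong σ-o σ-o)) (σ-dil a))))

  o⁻¹ : Series
  o⁻¹ = o ⁻¹

  o*o⁻¹ : o * o⁻¹ ≈ 1#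
  o*o⁻¹ = unit-inverse unit-o

  a⁻¹ b⁻¹ m : Series
  a⁻¹ = a ⁻¹
  b⁻¹ = dil a⁻¹
  m = (a * (o * o)) ⁻¹

  b*b⁻¹ : b * b⁻¹ ≈ 1#
  b*b⁻¹ = trans (sym (dil-* _ _)) (trans (dil-cong (unit-inverse unit-a)) dil-1)

  dil³-o : dil (dil (dil o)) ≈ o * ō * dil ō * dil (dil ō)
  dil³-o = trans (dil-cong (trans (dil-cong (sym o*ō)) (trans (dil-* _ _) (*-congʳ (sym o*ō)))))
    (trans (dil-* _ _) (*-congʳ (trans (dil-* _ _) (*-congʳ (sym o*ō)))))

  module Vanishing (w : Series) (dil-w : dil w ≈ w) (w² : w * w ≈ two) where

    private
      Z : Series
      Z = dil (dil (dil o⁻¹))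

      dil³o*Z : o * ō * dil ō * dil (dil ō) * Z ≈ 1#
      dil³o*Z = trans (*-congʳ (sym dil³-o)) (trans (sym (trans (dil-cong (trans (dil-cong (dil-* _ _)) (dil-* _ _))) (dil-* _ _)))
        (trans (dil-cong (dil-cong (dil-cong o*o⁻¹))) (trans (dil-cong (trans (dil-cong dil-1) dil-1)) dil-1)))

      -- Everything except φ combines to 1 / o(x⁸). Which coefficients vanish is then decided by the
      -- gaps of φ.
      X≈ : ev (R w) + x * dil (R 0#) ≈ φ * Z
      X≈ = *-cancelˡ (unit-* (unit-* (unit-dil unit-ō) (unit-dil (unit-dil unit-ō))) unit-a) (begin
        dil ō * dil (dil ō) * a * (ev (R w) + x * dil (R 0#))
          ≈⟨ trans (*-assoc _ _ _) (evaluation₀ w dil-w w²) ⟩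
        b * b * ō
          ≈⟨ sym (trans (*-congˡ dil³o*Z) (*-identityʳ _)) ⟩
        b * b * ō * (o * ō * dil ō * dil (dil ō) * Z)
          ≈⟨ solve 6 (λ b ō o p q z → b :* b :* ō :* (o :* ō :* p :* q :* z) := p :* q :* (o :* b) :* (ō :* ō :* b :* z)) refl _ _ _ _ _ _ ⟩
        dil ō * dil (dil ō) * (o * b) * (ō * ō * b * Z)
          ≈⟨ *-cong (*-congˡ (sym a≈o*b)) (*-congʳ (sym φ≈)) ⟩
        dil ō * dil (dil ō) * a * (φ * Z) ∎)

      ev-X : ev (ev (R w)) ≈ dil φ * dil (dil o⁻¹)
      ev-X = trans (sym (trans (+-congˡ (trans (ev-x* _) (trans (*-congˡ (od-dil (R 0#))) (zeroʳ x)))) (+-identityʳ _)))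
        (trans (ev-cong X≈) (trans (ev-cong (*-comm φ Z)) (trans (ev-dil-* _ φ) (trans (*-congˡ ev-φ) (*-comm _ _)))))

      od-X : od (ev (R w)) + R 0# ≈ dil (dil o⁻¹) * (two * dil (dil ψ))
      od-X = trans (sym (+-congˡ (trans (od-x* _) (ev-dil _)))) (trans (od-cong X≈) (trans (od-cong (*-comm φ Z)) (trans (od-dil-* _ φ) (*-congˡ od-φ))))

    vanish-8n+5 : od (ev (ev (R w))) ≈ 0#
    vanish-8n+5 = trans (od-cong ev-X) (trans (od-cong (sym (dil-* φ (dil o⁻¹)))) (od-dil _))

    -- The companion `R 0#` has no odd part, and the right side of `od-X` is a series in x².
    vanish-8n+7 : od (od (ev (R w))) ≈ 0#
    vanish-8n+7 = begin
      od (od (ev (R w)))                            ≈⟨ sym (trans (+-congˡ od-R-zero) (+-identityʳ _)) ⟩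
      od (od (ev (R w))) + od (R 0#)                ≈⟨ od-cong od-X ⟩
      od (dil (dil o⁻¹) * (two * dil (dil ψ)))      ≈⟨ od-cong {dil (dil o⁻¹) * (two * dil (dil ψ))} (*-congˡ (trans (*-congʳ (sym dil-two)) (sym (dil-* two (dil ψ))))) ⟩
      od (dil (dil o⁻¹) * dil (two * dil ψ))        ≈⟨ od-cong (sym (dil-* _ _)) ⟩
      od (dil (dil o⁻¹ * (two * dil ψ)))            ≈⟨ od-dil _ ⟩
      0# ∎

  -- Theta quotients for w = 2 and w = 0.

  P V : Series
  P = R two
  V = R 0#

  -- As o = a / b, the series m is b² / a³; thus ν = b⁴ / a⁶, κ₃ = b² / a⁵ and τ = b⁶ / a¹¹. They
  -- are the cofactors that remain, at x or x², when powers of φ are split off.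
  ν η K₃ κ₃ τ : Series
  ν = m * m
  η = φ̄ * (φ * φ) * dil ν
  K₃ = φ * (a⁻¹ * a⁻¹)
  κ₃ = m * (a⁻¹ * a⁻¹)
  τ = m * m * m * (a⁻¹ * a⁻¹)

  private
    unit-m-den : Unit (a * (o * o))
    unit-m-den = unit-* unit-a (unit-* unit-o unit-o)

    m-inverse : o * b * (o * o) * m ≈ 1#
    m-inverse = trans (*-congʳ (*-congʳ (sym a≈o*b))) (unit-inverse unit-m-den)

    dil-m-inverse : b * (o * ō * (o * ō)) * dil m ≈ 1#
    dil-m-inverse = trans (*-congʳ (*-congˡ (*-cong o*ō o*ō))) (trans (*-congʳ (*-congˡ (sym (dil-* o o))))
      (trans (*-congʳ (sym (dil-* a (o * o)))) (trans (sym (dil-* _ _)) (trans (dil-cong (unit-inverse unit-m-den)) dil-1))))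

    dil-ν : dil ν ≈ dil m * dil m
    dil-ν = dil-* m m

    dil-a⁻²  : dil (a⁻¹ * a⁻¹) ≈ b⁻¹ * b⁻¹
    dil-a⁻² = dil-* _ _

    κ : Series
    κ = φ * dil ν

    κ-inverse : a * (o * o * o) * (ō * ō) * κ ≈ 1#
    κ-inverse = begin
      a * (o * o * o) * (ō * ō) * (φ * dil ν)
        ≈⟨ *-cong (*-congʳ (*-congʳ a≈o*b)) (*-cong φ≈ dil-ν) ⟩
      o * b * (o * o * o) * (ō * ō) * (ō * ō * b * (dil m * dil m))
        ≈⟨ solve 4 (λ o ō b m → o :* b :* (o :* o :* o) :* (ō :* ō) :* (ō :* ō :* b :* (m :* m)) := b :* (o :* ō :* (o :* ō)) :* m :* (b :* (o :* ō :* (o :* ō)) :* m)) refl o ō b (dil m) ⟩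
      b * (o * ō * (o * ō)) * dil m * (b * (o * ō * (o * ō)) * dil m)
        ≈⟨ trans (*-cong dil-m-inverse dil-m-inverse) (*-identityˡ _) ⟩
      1# ∎

    dil-κ-inverse : b * (o * ō * (o * ō) * (o * ō)) * (dil ō * dil ō) * dil κ ≈ 1#
    dil-κ-inverse = trans (*-congʳ (sym (trans (dil-* _ _) (*-cong (trans (dil-* _ _) (*-congˡ (trans (dil-* _ _) (*-cong (trans (dil-* _ _) (*-cong (sym o*ō) (sym o*ō))) (sym o*ō))))) (dil-* ō ō)))))
      (trans (sym (dil-* _ _)) (trans (dil-cong κ-inverse) dil-1))

    -- By φ = ō² b the product becomes φ² times a series in x², so the dissection of φ² yields its
    -- even and odd parts.
    X₂≈ : ev P + x * dil (σ P) ≈ φ * φ * dil κ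
    X₂≈ = *-cancelˡ (unit-* (unit-* (unit-* unit-o unit-o) (unit-dil (unit-* unit-ō unit-ō))) unit-a) (begin
      o * o * dil (ō * ō) * a * (ev P + x * dil (σ P))
        ≈⟨ trans (*-assoc _ _ _) evaluation₂ ⟩
      b * b * ō
        ≈⟨ sym (trans (*-congˡ dil-κ-inverse) (*-identityʳ _)) ⟩
      b * b * ō * (b * (o * ō * (o * ō) * (o * ō)) * (dil ō * dil ō) * dil κ)
        ≈⟨ solve 5 (λ o ō b d k → b :* b :* ō :* (b :* (o :* ō :* (o :* ō) :* (o :* ō)) :* (d :* d) :* k)
             := o :* o :* (d :* d) :* (o :* b) :* (ō :* ō :* b :* (ō :* ō :* b) :* k)) refl o ō b (dil ō) (dil κ) ⟩
      o * o * (dil ō * dil ō) * (o * b) * (ō * ō * b * (ō * ō * b) * dil κ)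
        ≈⟨ *-cong (*-cong (*-congˡ (sym (dil-* ō ō))) (sym a≈o*b)) (*-congʳ (*-cong (sym φ≈) (sym φ≈))) ⟩
      o * o * dil (ō * ō) * a * (φ * φ * dil κ) ∎)

    η-o : o * o * o * η ≈ a
    η-o = begin
      o * o * o * (φ̄ * (φ * φ) * dil ν)
        ≈⟨ *-congˡ (*-cong (*-cong φ̄≈ (*-cong φ≈ φ≈)) dil-ν) ⟩
      o * o * o * (o * o * b * (ō * ō * b * (ō * ō * b)) * (dil m * dil m))
        ≈⟨ solve 4 (λ o ō b m → o :* o :* o :* (o :* o :* b :* (ō :* ō :* b :* (ō :* ō :* b)) :* (m :* m))
             := o :* b :* (b :* (o :* ō :* (o :* ō)) :* m :* (b :* (o :* ō :* (o :* ō)) :* m))) refl o ō b (dil m) ⟩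
      o * b * (b * (o * ō * (o * ō)) * dil m * (b * (o * ō * (o * ō)) * dil m))
        ≈⟨ trans (*-congˡ (trans (*-cong dil-m-inverse dil-m-inverse) (*-identityˡ _))) (*-identityʳ _) ⟩
      o * b
        ≈⟨ sym a≈o*b ⟩
      a ∎

    -- The right side is a series in x²; the vanishing of its odd part expresses `od (ev V)` by `P`.
    X₋₂≈ : ev V + x * dil P ≈ dil η
    X₋₂≈ = *-cancelˡ (unit-* (unit-* (unit-* unit-ō unit-ō) (unit-dil (unit-* unit-o unit-o))) unit-a) (begin
      ō * ō * dil (o * o) * a * (ev V + x * dil P)
        ≈⟨ trans (*-assoc _ _ _) evaluation₋₂ ⟩
      b * b * ō
        ≈⟨ *-congʳ (*-congˡ (sym (trans (sym (trans (dil-* _ _) (*-congʳ (trans (dil-* _ _) (*-cong (trans (dil-* _ _) (*-cong (sym o*ō) (sym o*ō))) (sym o*ō)))))) (dil-cong η-o)))) ⟩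
      b * (o * ō * (o * ō) * (o * ō) * dil η) * ō
        ≈⟨ solve 4 (λ o ō b h → b :* (o :* ō :* (o :* ō) :* (o :* ō) :* h) :* ō := ō :* ō :* (o :* ō :* (o :* ō)) :* (o :* b) :* h) refl o ō b (dil η) ⟩
      ō * ō * (o * ō * (o * ō)) * (o * b) * dil η
        ≈⟨ *-congʳ (*-cong (*-congˡ (trans (*-cong o*ō o*ō) (sym (dil-* o o)))) (sym a≈o*b)) ⟩
      ō * ō * dil (o * o) * a * dil η ∎)

    Y≈ : 1# + two * x * od P + dil (dil remainder) ≈ φ * φ * dil K₃
    Y≈ = *-cancelˡ (unit-* (unit-* (unit-* unit-o unit-o) (unit-dil (unit-dil (unit-* unit-a⁺ unit-a⁺)))) unit-a) (begin
      o * o * dil (dil (a⁺ * a⁺)) * a * (1# + two * x * od P + dil (dil remainder))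
        ≈⟨ trans (*-assoc _ _ _) oddIdentity ⟩
      b * b * ō
        ≈⟨ *-congʳ (*-congˡ b≈) ⟩
      b * (o * ō * b₄) * ō
        ≈⟨ solve 4 (λ o ō b c → b :* (o :* ō :* c) :* ō := b :* (o :* ō :* c) :* ō :* (con (+ 1) :* con (+ 1)) :* (con (+ 1) :* con (+ 1))) refl o ō b b₄ ⟩
      b * (o * ō * b₄) * ō * (1# * 1#) * (1# * 1#)
        ≈⟨ *-cong (*-congˡ (sym (*-cong α-inverse α-inverse))) (sym (*-cong b*b⁻¹ b*b⁻¹)) ⟩
      b * (o * ō * b₄) * ō * (o * ō * dil ō * α * (o * ō * dil ō * α)) * (b * b⁻¹ * (b * b⁻¹))
        ≈⟨ solve 7 (λ o ō b c d α r → b :* (o :* ō :* c) :* ō :* (o :* ō :* d :* α :* (o :* ō :* d :* α)) :* (b :* r :* (b :* r))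
             := o :* o :* (α :* α) :* (o :* b) :* (ō :* ō :* b :* (ō :* ō :* b) :* (d :* d :* c :* (r :* r)))) refl o ō b b₄ (dil ō) α b⁻¹ ⟩
      o * o * (α * α) * (o * b) * (ō * ō * b * (ō * ō * b) * (dil ō * dil ō * b₄ * (b⁻¹ * b⁻¹)))
        ≈⟨ *-cong (*-cong (*-congˡ (sym (trans (dil-cong (dil-* a⁺ a⁺)) (dil-* _ _)))) (sym a≈o*b))
             (*-cong (*-cong (sym φ≈) (sym φ≈)) (sym (trans (dil-* _ _) (*-cong (trans (dil-cong φ≈) (trans (dil-* _ _) (*-congʳ (dil-* _ _)))) dil-a⁻²)))) ⟩
      o * o * dil (dil (a⁺ * a⁺)) * a * (φ * φ * dil K₃) ∎)
      where
      α = dil (dil a⁺)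
      α-inverse : o * ō * dil ō * α ≈ 1#
      α-inverse = trans (*-congʳ (sym (trans (dil-cong (sym o*ō)) (trans (dil-* _ _) (*-congʳ (sym o*ō)))))) (trans (sym (trans (dil-cong (dil-* _ _)) (dil-* _ _)))
        (trans (dil-cong (trans (dil-cong o*a⁺) dil-1)) dil-1))
      unit-a⁺ : Unit a⁺
      unit-a⁺ = unit-≈[] {0} (unit-∏ unit-1+x^ 1) (Euler⁺.∏∞-≈[] ℕₚ.≤-refl)

  -- Since 1 / a² is φ times a series in x², a second factor φ splits off and K₃ can be dissected
  -- like φ².
  K₃≈ : K₃ ≈ φ * φ * dil κ₃
  K₃≈ = trans (*-congˡ (*-cancelˡ (unit-* unit-a unit-a) (begin
      a * a * (a⁻¹ * a⁻¹)
        ≈⟨ trans (solve 2 (λ a i → a :* a :* (i :* i) := a :* i :* (a :* i)) refl _ _) (*-cong (unit-inverse unit-a) (unit-inverse unit-a)) ⟩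
      1# * 1#
        ≈⟨ *-cong (sym dil-m-inverse) (sym (trans (*-cong b*b⁻¹ b*b⁻¹) (*-identityˡ _))) ⟩
      b * (o * ō * (o * ō)) * dil m * (b * b⁻¹ * (b * b⁻¹))
        ≈⟨ solve 5 (λ o ō b m r → b :* (o :* ō :* (o :* ō)) :* m :* (b :* r :* (b :* r)) := o :* b :* (o :* b) :* (ō :* ō :* b :* (m :* (r :* r)))) refl o ō b (dil m) b⁻¹ ⟩
      o * b * (o * b) * (ō * ō * b * (dil m * (b⁻¹ * b⁻¹)))
        ≈⟨ *-cong (*-cong (sym a≈o*b) (sym a≈o*b)) (*-cong (sym φ≈) (sym (trans (dil-* _ _) (*-congˡ dil-a⁻²)))) ⟩
      a * a * (φ * dil κ₃) ∎))) (sym (*-assoc _ _ _))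

  -- Produces three factors φ; the fourth will come from ψ² = φ(x) ψ(x²).
  ν≈ : ν ≈ φ * φ * φ * dil τ
  ν≈ = *-cancelˡ (unit-* unit-D unit-D) (begin
      D * D * (m * m)
        ≈⟨ trans (solve 2 (λ a i → a :* a :* (i :* i) := a :* i :* (a :* i)) refl _ _) (*-cong m-inverse m-inverse) ⟩
      1# * 1#
        ≈⟨ *-cong (sym (trans (*-cong (trans (*-cong dil-m-inverse dil-m-inverse) (*-identityˡ _)) dil-m-inverse) (*-identityˡ _))) (sym (trans (*-cong b*b⁻¹ b*b⁻¹) (*-identityˡ _))) ⟩
      M * M * M * (b * b⁻¹ * (b * b⁻¹))
        ≈⟨ solve 5 (λ o ō b m r → b :* (o :* ō :* (o :* ō)) :* m :* (b :* (o :* ō :* (o :* ō)) :* m) :* (b :* (o :* ō :* (o :* ō)) :* m) :* (b :* r :* (b :* r))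
             := o :* b :* (o :* o) :* (o :* b :* (o :* o)) :* (ō :* ō :* b :* (ō :* ō :* b) :* (ō :* ō :* b) :* (m :* m :* m :* (r :* r)))) refl o ō b (dil m) b⁻¹ ⟩
      D * D * (ō * ō * b * (ō * ō * b) * (ō * ō * b) * (dil m * dil m * dil m * (b⁻¹ * b⁻¹)))
        ≈⟨ *-congˡ (*-cong (*-cong (*-cong (sym φ≈) (sym φ≈)) (sym φ≈)) (sym (trans (dil-* _ _) (*-cong (trans (dil-* _ _) (*-congʳ (dil-* _ _))) dil-a⁻²)))) ⟩
      D * D * (φ * φ * φ * dil τ) ∎)
    where
    D = o * b * (o * o)
    M = b * (o * ō * (o * ō)) * dil m
    unit-D : Unit D
    unit-D = unit-* (unit-* unit-o unit-b) (unit-* unit-o unit-o)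

  four : Series
  four = nat 4

  -- φ(x) φ(−x) = φ(−x²)², compared with the dissection of φ
  φ² : φ * φ ≈ dil (φ * φ) + x * dil (four * dil (ψ * ψ))
  φ² = begin
    φ * φ
      ≈⟨ sym (*-cong σφ̄ σφ̄) ⟩
    σ φ̄ * σ φ̄
      ≈⟨ trans (sym (σ-* φ̄ φ̄)) (σ-cong φ̄²) ⟩
    σ (dil φ * dil φ - x * (od φ * od φ))
      ≈⟨ trans (σ-+ _ _) (+-cong (trans (σ-cong (sym (dil-* φ φ))) (σ-dil _)) (trans (σ-neg _) (-‿cong (trans (σ-* _ _) (*-cong σ-x (trans (σ-cong odφ²) (σ-dil _))))))) ⟩
    dil (φ * φ) - (- x * dil (four * dil (ψ * ψ)))
      ≈⟨ solve 3 (λ p x q → p :- (:- x :* q) := p :+ x :* q) refl _ _ _ ⟩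
    dil (φ * φ) + x * dil (four * dil (ψ * ψ)) ∎
    where
    odφ² : od φ * od φ ≈ dil (four * dil (ψ * ψ))
    odφ² = trans (*-cong od-φ od-φ) (trans (solve 1 (λ p → con (+ 2) :* p :* (con (+ 2) :* p) := con (+ 4) :* (p :* p)) refl _)
      (sym (trans (dil-* _ _) (*-cong (dil-nat 4) (trans (dil-cong (dil-* ψ ψ)) (dil-* _ _))))))
    φφ̄ : φ * φ̄ ≈ dil (φ̄ * φ̄)
    φφ̄ = begin
      φ * φ̄
        ≈⟨ *-cong φ≈ φ̄≈ ⟩
      ō * ō * b * (o * o * b)
        ≈⟨ *-cong (*-congˡ b≈) (*-congˡ b≈) ⟩
      ō * ō * (o * ō * b₄) * (o * o * (o * ō * b₄))
        ≈⟨ solve 3 (λ o ō b → ō :* ō :* (o :* ō :* b) :* (o :* o :* (o :* ō :* b)) := o :* ō :* (o :* ō) :* b :* (o :* ō :* (o :* ō) :* b)) refl o ō b₄ ⟩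
      o * ō * (o * ō) * b₄ * (o * ō * (o * ō) * b₄)
        ≈⟨ *-cong dφ̄ dφ̄ ⟩
      dil φ̄ * dil φ̄
        ≈⟨ sym (dil-* φ̄ φ̄) ⟩
      dil (φ̄ * φ̄) ∎
      where
      dφ̄ : o * ō * (o * ō) * b₄ ≈ dil φ̄
      dφ̄ = sym (trans (dil-cong φ̄≈) (trans (dil-* _ _) (*-congʳ (trans (dil-* _ _) (*-cong (sym o*ō) (sym o*ō))))))
    φ̄² : φ̄ * φ̄ ≈ dil φ * dil φ - x * (od φ * od φ)
    φ̄² = begin
      φ̄ * φ̄
        ≈⟨ sym (trans (ev-cong φφ̄) (ev-dil _)) ⟩
      ev (φ * φ̄)
        ≈⟨ trans (ev-cong (*-congˡ φ̄≈σφ)) (ev-* φ (σ φ)) ⟩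
      ev φ * ev (σ φ) + x * (od φ * od (σ φ))
        ≈⟨ +-cong (*-cong ev-φ (trans (ev-σ φ) ev-φ)) (*-congˡ (*-congˡ (od-σ φ))) ⟩
      dil φ * dil φ + x * (od φ * - od φ)
        ≈⟨ +-congˡ (solve 2 (λ x p → x :* (p :* :- p) := :- (x :* (p :* p))) refl x (od φ)) ⟩
      dil φ * dil φ - x * (od φ * od φ) ∎

  ev-φ² : ev (φ * φ) ≈ φ * φ
  ev-φ² = trans (ev-cong φ²) (ev-combine _ _)

  od-φ² : od (φ * φ) ≈ four * dil (ψ * ψ)
  od-φ² = trans (od-cong φ²) (od-combine _ _)

  ev-ev-P : ev (ev P) ≈ φ * φ * κ
  ev-ev-P = trans (sym (trans (+-congˡ (trans (ev-x* _) (trans (*-congˡ (od-dil (σ P))) (zeroʳ x)))) (+-identityʳ _)))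
    (trans (ev-cong X₂≈) (trans (ev-cong (*-comm _ _)) (trans (ev-dil-* κ (φ * φ)) (trans (*-congˡ ev-φ²) (*-comm _ _)))))

  od-ev-P : od (ev P) + σ P ≈ four * dil (ψ * ψ) * φ * dil ν
  od-ev-P = trans (sym (+-congˡ (trans (od-x* _) (ev-dil _)))) (trans (od-cong X₂≈) (trans (od-cong (*-comm _ _)) (trans (od-dil-* κ (φ * φ)) (trans (*-congˡ od-φ²)
    (solve 3 (λ p d q → p :* d :* q := q :* p :* d) refl _ _ _)))))

  ev-ev-V : ev (ev V) ≈ η
  ev-ev-V = trans (sym (trans (+-congˡ (trans (ev-x* _) (trans (*-congˡ (od-dil P)) (zeroʳ x)))) (+-identityʳ _))) (trans (ev-cong X₋₂≈) (ev-dil η))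

  od-ev-V : od (ev V) + P ≈ 0#
  od-ev-V = trans (sym (+-congˡ (trans (od-x* _) (ev-dil _)))) (trans (od-cong X₋₂≈) (od-dil η))

  -- Taking the odd part of `Y≈` removes both the constant and the term `dil (dil remainder)`.
  two-ev-od-P : two * ev (od P) ≈ four * dil (ψ * ψ) * K₃
  two-ev-od-P = begin
    two * ev (od P)
      ≈⟨ sym (trans (od-cong Y-split) (trans (+-cong (trans (+-cong {od 1#} {0#} (pointwise λ _ → A.refl) (trans (od-x* (dil two * od P)) (ev-dil-* two (od P)))) (+-identityˡ _)) (od-dil _)) (+-identityʳ _))) ⟩
    od (1# + two * x * od P + dil (dil remainder))
      ≈⟨ trans (od-cong Y≈) (trans (od-cong (*-comm _ _)) (trans (od-dil-* K₃ (φ * φ)) (trans (*-congˡ od-φ²) (*-comm _ _)))) ⟩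
    four * dil (ψ * ψ) * K₃ ∎
    where
    Y-split : 1# + two * x * od P + dil (dil remainder) ≈ 1# + x * (dil two * od P) + dil (dil remainder)
    Y-split = +-congʳ (+-congˡ (trans (solve 3 (λ t x p → t :* x :* p := x :* (t :* p)) refl _ _ _) (*-congˡ (*-congʳ (sym dil-two)))))

  two-od-od-P : 1# + x * (two * od (od P)) + dil remainder ≈ φ * φ * K₃
  two-od-od-P = begin
    1# + x * (two * od (od P)) + dil remainder
      ≈⟨ sym (trans (ev-cong Y-split) (+-cong (+-cong ev-1 (trans (ev-x* _) (*-congˡ (od-dil-* two (od P))))) (ev-dil _))) ⟩
    ev (1# + two * x * od P + dil (dil remainder))
      ≈⟨ trans (ev-cong Y≈) (trans (ev-cong (*-comm _ _)) (trans (ev-dil-* K₃ (φ * φ)) (trans (*-congˡ ev-φ²) (*-comm _ _)))) ⟩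
    φ * φ * K₃ ∎
    where
    ev-1 : ev 1# ≈ 1#
    ev-1 = pointwise λ { zero → A.refl ; (suc n) → A.refl }
    Y-split : 1# + two * x * od P + dil (dil remainder) ≈ 1# + x * (dil two * od P) + dil (dil remainder)
    Y-split = +-congʳ (+-congˡ (trans (solve 3 (λ t x p → t :* x :* p := x :* (t :* p)) refl _ _ _) (*-congˡ (*-congʳ (sym dil-two)))))

  open Enumeration

  -- Generating functions of odd Durfee symbols

  swap : {X Y : Set} → X × Y → Y × X
  swap (y , z) = z , y

  ∑-cart : {X Y : Set} (l : List X) (l′ : List Y) (f : X × Y → A.Carrier) →
    A.∑ₗ (cartesianProduct l l′) f A.≈ A.∑ₗ l (λ y → A.∑ₗ l′ (λ z → f (y , z)))
  ∑-cart [] l′ f = A.refl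
  ∑-cart (y ∷ l) l′ f = A.trans (A.∑ₗ-++ (map (y ,_) l′) _ f) (A.+-cong (A.∑ₗ-map (y ,_) l′ f) (∑-cart l l′ f))

  ∑ₗ-0 : {X : Set} (l : List X) → A.∑ₗ l (λ _ → A.0#) A.≈ A.0#
  ∑ₗ-0 [] = A.refl
  ∑ₗ-0 (y ∷ l) = A.trans (A.+-identityˡ _) (∑ₗ-0 l)

  ∑ₗ-exchange : {X Y : Set} (l : List X) (l′ : List Y) (f : X → Y → A.Carrier) →
    A.∑ₗ l (λ y → A.∑ₗ l′ (f y)) A.≈ A.∑ₗ l′ (λ z → A.∑ₗ l (λ y → f y z))
  ∑ₗ-exchange [] l′ f = A.sym (∑ₗ-0 l′)
  ∑ₗ-exchange (y ∷ l) l′ f = A.trans (A.+-congˡ (∑ₗ-exchange l l′ f)) (A.sym (A.∑ₗ-+ l′ _ _))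

  ∑-cart-swap : {X Y : Set} (l : List X) (l′ : List Y) (f : X × Y → A.Carrier) →
    A.∑ₗ (cartesianProduct l l′) f A.≈ A.∑ₗ (cartesianProduct l′ l) (f ∘ swap)
  ∑-cart-swap l l′ f = A.trans (∑-cart l l′ f) (A.trans (∑ₗ-exchange l l′ _) (A.sym (∑-cart l′ l (f ∘ swap))))

  ∑-conv : {X Y : Set} → (ℕ → List X) → (ℕ → List Y) → (X × Y → A.Carrier) → Series
  ∑-conv f g h n = A.∑ₗ (conv f g n) h

  ∑-conv-suc : {X Y : Set} (f : ℕ → List X) (g : ℕ → List Y) (h : X × Y → A.Carrier) → ∀ n →
    ∑-conv f g h (suc n) A.≈ A.∑ₗ (cartesianProduct (f 0) (g (suc n))) h A.+ ∑-conv (f ∘ suc) g h n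
  ∑-conv-suc f g h n = A.∑ₗ-++ (cartesianProduct (f 0) (g (suc n))) _ h

  ∑-conv-sucʳ : {X Y : Set} (f : ℕ → List X) (g : ℕ → List Y) (h : X × Y → A.Carrier) → ∀ n →
    ∑-conv f g h (suc n) A.≈ A.∑ₗ (cartesianProduct (f (suc n)) (g 0)) h A.+ ∑-conv f (g ∘ suc) h n
  ∑-conv-sucʳ f g h zero = A.trans (∑-conv-suc f g h 0) (A.+-comm _ _)
  ∑-conv-sucʳ f g h (suc n) = A.trans (∑-conv-suc f g h (suc n)) (A.trans (A.+-congˡ (∑-conv-sucʳ (f ∘ suc) g h n))
    (A.trans (A.solve 3 (λ a b c → a A.:+ (b A.:+ c) A.:= b A.:+ (a A.:+ c)) A.refl _ _ _) (A.+-congˡ (A.sym (∑-conv-suc f (g ∘ suc) h n)))))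

  ∑-conv-swap : {X Y : Set} (f : ℕ → List X) (g : ℕ → List Y) (h : X × Y → A.Carrier) → ∑-conv f g h ≈ ∑-conv g f (h ∘ swap)
  ∑-conv-swap f g h = pointwise (go f)
    where
    go : ∀ f n → ∑-conv f g h n A.≈ ∑-conv g f (h ∘ swap) n
    go f zero = ∑-cart-swap (f 0) (g 0) h
    go f (suc n) = A.trans (∑-conv-suc f g h n) (A.trans (A.+-cong (∑-cart-swap (f 0) (g (suc n)) h) (go (f ∘ suc) n))
      (A.sym (∑-conv-sucʳ g f (h ∘ swap) n)))

  conv-cong : {X Y : Set} {f f′ : ℕ → List X} (g : ℕ → List Y) → (∀ k → f k ≡ f′ k) → ∀ n → conv f g n ≡ conv f′ g n
  conv-cong g p zero = cong (λ l → cartesianProduct l (g 0)) (p 0)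
  conv-cong g p (suc n) = cong₂ _++_ (cong (λ l → cartesianProduct l (g (suc n))) (p 0)) (conv-cong g (p ∘ suc) n)

  ∑-conv-++ : {X Y : Set} (f f′ : ℕ → List X) (g : ℕ → List Y) (h : X × Y → A.Carrier) →
    ∑-conv (λ k → f k ++ f′ k) g h ≈ ∑-conv f g h + ∑-conv f′ g h
  ∑-conv-++ f f′ g h = pointwise (go f f′)
    where
    cart : ∀ l l′ k → A.∑ₗ (cartesianProduct (l ++ l′) (g k)) h A.≈ A.∑ₗ (cartesianProduct l (g k)) h A.+ A.∑ₗ (cartesianProduct l′ (g k)) h
    cart l l′ k = A.trans (∑-cart (l ++ l′) (g k) h) (A.trans (A.∑ₗ-++ l l′ _) (A.sym (A.+-cong (∑-cart l (g k) h) (∑-cart l′ (g k) h))))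
    go : ∀ f f′ n → ∑-conv (λ k → f k ++ f′ k) g h n A.≈ ∑-conv f g h n A.+ ∑-conv f′ g h n
    go f f′ zero = cart (f 0) (f′ 0) 0
    go f f′ (suc n) = A.trans (∑-conv-suc (λ k → f k ++ f′ k) g h n) (A.trans (A.+-cong (cart (f 0) (f′ 0) (suc n)) (go (f ∘ suc) (f′ ∘ suc) n))
      (A.trans (A.solve 4 (λ a b c d → a A.:+ b A.:+ (c A.:+ d) A.:= a A.:+ c A.:+ (b A.:+ d)) A.refl _ _ _ _)
        (A.sym (A.+-cong (∑-conv-suc f g h n) (∑-conv-suc f′ g h n)))))

  ∑-conv-map : {X X′ Y : Set} (k : X → X′) (f : ℕ → List X) (g : ℕ → List Y) (h : X′ × Y → A.Carrier) →
    ∑-conv (map k ∘ f) g h ≈ ∑-conv f g (λ (y , z) → h (k y , z))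
  ∑-conv-map k f g h = pointwise (go f)
    where
    cart : ∀ l j → A.∑ₗ (cartesianProduct (map k l) (g j)) h A.≈ A.∑ₗ (cartesianProduct l (g j)) (λ (y , z) → h (k y , z))
    cart l j = A.trans (∑-cart (map k l) (g j) h) (A.trans (A.∑ₗ-map k l _) (A.sym (∑-cart l (g j) _)))
    go : ∀ f n → ∑-conv (map k ∘ f) g h n A.≈ ∑-conv f g (λ (y , z) → h (k y , z)) n
    go f zero = cart (f 0) 0
    go f (suc n) = A.trans (∑-conv-suc (map k ∘ f) g h n) (A.trans (A.+-cong (cart (f 0) (suc n)) (go (f ∘ suc) n)) (A.sym (∑-conv-suc f g _ n)))

  conv-delay : {X Y : Set} → ∀ d (f : ℕ → List X) (g : ℕ → List Y) n → conv (delay d f) g n ≡ delay d (conv f g) n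
  conv-delay zero f g n = conv-cong g (λ _ → ≡.refl) n
  conv-delay (suc d) f g zero = ≡.refl
  conv-delay (suc d) f g (suc n) = conv-delay d f g n

  ∑-delay : {X : Set} → ∀ d (f : ℕ → List X) (h : X → A.Carrier) n → A.∑ₗ (delay d f n) h A.≈ (x ^ d * (λ k → A.∑ₗ (f k) h)) n
  ∑-delay zero f h n = A.sym (at (*-identityˡ _) n)
  ∑-delay (suc d) f h zero = A.sym (A.trans (at (*-assoc x (x ^ d) (λ k → A.∑ₗ (f k) h)) 0) (x*-zero (x ^ d * (λ k → A.∑ₗ (f k) h))))
  ∑-delay (suc d) f h (suc n) = A.trans (∑-delay d f h n) (A.sym (A.trans (at (*-assoc x (x ^ d) (λ k → A.∑ₗ (f k) h)) (suc n)) (x*-suc (x ^ d * (λ k → A.∑ₗ (f k) h)) n)))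

  Weight : Set
  Weight = ℕ → ℕ → A.Carrier

  lengths : Weight → List ℕ × List ℕ → A.Carrier
  lengths χ (t , u) = χ (length t) (length u)

  S : ℕ → ℕ → Weight → Series
  S m m′ χ = ∑-conv (rows m) (rows m′) (lengths χ)

  S-swap : ∀ m m′ χ → S m m′ χ ≈ S m′ m (λ i j → χ j i)
  S-swap m m′ χ = ∑-conv-swap (rows m) (rows m′) (lengths χ)

  S-cong : ∀ m m′ {χ χ′ : Weight} → (∀ i j → χ i j A.≈ χ′ i j) → S m m′ χ ≈ S m m′ χ′
  S-cong m m′ p = pointwise λ n → A.∑ₗ-cong (conv (rows m) (rows m′) n) (λ (t , u) → p (length t) (length u))

  S-left : ∀ m m′ χ → S (suc m) m′ χ ≈ S m m′ χ + x ^ odd m * S (suc m) m′ (χ ∘ suc)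
  S-left m m′ χ = begin
    S (suc m) m′ χ
      ≈⟨ (pointwise λ n → A.reflexive (cong (λ l → A.∑ₗ l (lengths χ)) (conv-cong (rows m′) (rows-unfold m) n))) ⟩
    ∑-conv (λ n → rows m n ++ delay (odd m) (map (odd m ∷_) ∘ rows (suc m)) n) (rows m′) (lengths χ)
      ≈⟨ ∑-conv-++ (rows m) (delay (odd m) (map (odd m ∷_) ∘ rows (suc m))) (rows m′) (lengths χ) ⟩
    S m m′ χ + ∑-conv (delay (odd m) (map (odd m ∷_) ∘ rows (suc m))) (rows m′) (lengths χ)
      ≈⟨ +-congˡ (pointwise λ n → A.trans (A.reflexive (cong (λ l → A.∑ₗ l (lengths χ)) (conv-delay (odd m) (map (odd m ∷_) ∘ rows (suc m)) (rows m′) n)))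
           (∑-delay (odd m) (conv (map (odd m ∷_) ∘ rows (suc m)) (rows m′)) (lengths χ) n)) ⟩
    S m m′ χ + x ^ odd m * ∑-conv (map (odd m ∷_) ∘ rows (suc m)) (rows m′) (lengths χ)
      ≈⟨ +-congˡ (*-congˡ (∑-conv-map (odd m ∷_) (rows (suc m)) (rows m′) (lengths χ))) ⟩
    S m m′ χ + x ^ odd m * S (suc m) m′ (χ ∘ suc) ∎

  S-right : ∀ m m′ χ → S m (suc m′) χ ≈ S m m′ χ + x ^ odd m′ * S m (suc m′) (λ i j → χ i (suc j))
  S-right m m′ χ = trans (S-swap m (suc m′) χ) (trans (S-left m′ m (λ i j → χ j i))
    (+-cong (S-swap m′ m (λ i j → χ j i)) (*-congˡ (S-swap (suc m′) m (λ i j → χ j (suc i))))))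

  S-+ : ∀ m m′ χ χ′ → S m m′ (λ i j → χ i j A.+ χ′ i j) ≈ S m m′ χ + S m m′ χ′
  S-+ m m′ χ χ′ = pointwise λ n → A.∑ₗ-+ (conv (rows m) (rows m′) n) (lengths χ) (lengths χ′)

  S-* : ∀ m m′ c χ → S m m′ (λ i j → c A.* χ i j) ≈ constant c * S m m′ χ
  S-* m m′ c χ = pointwise λ n → A.trans (A.∑ₗ-*ˡ (conv (rows m) (rows m′) n) c (lengths χ)) (A.sym (constant-* c (S m m′ χ) n))

  -- χ i j behaves like z ^ (i - j) + z ^ (j - i) with w = z + z⁻¹.
  module _ (w : A.Carrier) (χ : Weight) (χ-diagonal : ∀ i j → χ (suc i) (suc j) A.≈ χ i j)
    (χ-step : ∀ i j → χ (suc i) j A.+ χ i (suc j) A.≈ w A.* χ i j) where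

    -- Let T and T′ raise the first and the second argument of χ by one. Applying 1 - zT and 1 - zT′
    -- removes the part 2m + 1 from the top and the bottom row. As TT′ fixes χ and T + T′ multiplies
    -- it by w, the product of the two operators is the quadratic factor.
    S-quad : ∀ m → quad (constant w) (v (J m)) * S (suc m) (suc m) χ ≈ S m m χ
    S-quad m = begin
      quad (constant w) (v (J m)) * G χ
        ≈⟨ *-congʳ (+-cong (+-congˡ (-‿cong (*-congˡ (*-identityˡ z)))) (*-cong (*-identityˡ z) (*-identityˡ z))) ⟩
      quad (constant w) z * G χ
        ≈⟨ solve 3 (λ w z g → (con (+ 1) :- w :* z :+ z :* z) :* g := g :- z :* (w :* g) :+ z :* (z :* g)) refl (constant w) z (G χ) ⟩
      G χ - z * (constant w * G χ) + z * (z * G χ)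
        ≈⟨ +-cong (+-congˡ (-‿cong (*-congˡ (sym shifts)))) (*-congˡ (*-congˡ (sym (S-cong (suc m) (suc m) χ-diagonal)))) ⟩
      G χ - z * (G (χ ∘ suc) + G χʳ) + z * (z * G (χʳ ∘ suc))
        ≈⟨ solve 5 (λ z g p q r → g :- z :* (p :+ q) :+ z :* (z :* r) := (g :- z :* p) :- z :* (q :- z :* r)) refl z (G χ) (G (χ ∘ suc)) (G χʳ) (G (χʳ ∘ suc)) ⟩
      (G χ - z * G (χ ∘ suc)) - z * (G χʳ - z * G (χʳ ∘ suc))
        ≈⟨ +-cong (left χ) (-‿cong (*-congˡ (left χʳ))) ⟩
      S m (suc m) χ - z * S m (suc m) χʳ
        ≈⟨ trans (+-congʳ (S-right m m χ)) (solve 2 (λ p q → p :+ q :- q := p) refl _ _) ⟩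
      S m m χ ∎
      where
      z = x ^ odd m
      G = S (suc m) (suc m)
      χʳ : Weight
      χʳ i j = χ i (suc j)
      left : ∀ χ → G χ - z * G (χ ∘ suc) ≈ S m (suc m) χ
      left χ = trans (+-congʳ (S-left m (suc m) χ)) (solve 2 (λ p q → p :+ q :- q := p) refl _ _)
      shifts : G (χ ∘ suc) + G χʳ ≈ constant w * G χ
      shifts = trans (sym (S-+ (suc m) (suc m) (χ ∘ suc) χʳ)) (trans (S-cong (suc m) (suc m) χ-step) (S-* (suc m) (suc m) w χ))

    S-product : ∀ m → S m m χ ≈ constant (χ 0 0) * ∏< m (γ (constant w) ∘ J)
    S-product zero = trans (pointwise λ { zero → A.+-identityʳ _ ; (suc n) → empty n }) (sym (*-identityʳ _))
      where
      empty : ∀ n → S 0 0 χ (suc n) A.≈ A.0#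
      empty n = A.trans (∑-conv-suc (rows 0) (rows 0) (lengths χ) n) (A.trans (A.+-identityˡ _) (rest n))
        where
        rest : ∀ n → ∑-conv (rows 0 ∘ suc) (rows 0) (lengths χ) n A.≈ A.0#
        rest n = A.trans (A.reflexive (cong (λ l → A.∑ₗ l (lengths χ)) (conv-cong {f′ = λ _ → []} (rows 0) (λ _ → ≡.refl) n))) (none n)
          where
          none : ∀ n → ∑-conv (λ _ → []) (rows 0) (lengths χ) n A.≈ A.0#
          none zero = A.refl
          none (suc n) = none n
    S-product (suc m) = *-cancelˡ (unit-quad (constant w) (v (J m)) (v-0 (J m))) (begin
      quad (constant w) (v (J m)) * S (suc m) (suc m) χ
        ≈⟨ trans (S-quad m) (S-product m) ⟩
      constant (χ 0 0) * ∏< m (γ (constant w) ∘ J)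
        ≈⟨ sym (trans (*-congˡ (γ-quad (constant w) (J m))) (*-identityʳ _)) ⟩
      constant (χ 0 0) * ∏< m (γ (constant w) ∘ J) * (quad (constant w) (v (J m)) * γ (constant w) (J m))
        ≈⟨ solve 4 (λ c p q g → c :* p :* (q :* g) := q :* (c :* (p :* g))) refl _ _ _ _ ⟩
      quad (constant w) (v (J m)) * (constant (χ 0 0) * ∏< (suc m) (γ (constant w) ∘ J)) ∎)

    ∑-symbols< : ∀ E n → A.∑ₗ (symbols< E n) (lengths χ ∘ proj₂) A.≈ (constant (χ 0 0) * (x * ∑< E (Rank.rankTerm (constant w)))) n
    ∑-symbols< zero n = A.sym (at (trans (*-congˡ (zeroʳ x)) (zeroʳ _)) n)
    ∑-symbols< (suc E) n = A.trans (A.∑ₗ-++ (symbols< E n) _ _) (A.trans (A.+-cong (∑-symbols< E n) (A.trans (A.∑ₗ-map (E ,_) (block E n) _)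
        (A.trans (∑-delay (durfee E) (conv (rows (suc E)) (rows (suc E))) (lengths χ) n) (at (trans (*-congˡ (S-product (suc E)))
          (solve 4 (λ x y c p → x :* y :* (c :* p) := c :* (x :* (y :* p))) refl x _ _ _)) n))))
      (at (solve 4 (λ c x s r → c :* (x :* s) :+ c :* (x :* r) := c :* (x :* (s :+ r))) refl (constant (χ 0 0)) x _ _) n))

    -- The shift of the degree by one is the summand 1 in 2D² + 2D + 1. The factor `χ 0 0` leaves
    -- room for weights that are twice a cosine.
    generatingFunction : ∀ n → A.∑ₗ (symbols (suc n)) (lengths χ ∘ proj₂) A.≈ χ 0 0 A.* R (constant w) n
    generatingFunction n = A.trans (∑-symbols< (suc n) (suc n)) (A.trans (constant-* (χ 0 0) (x * ∑< (suc n) (Rank.rankTerm (constant w))) (suc n)) (A.*-congˡ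
      (A.trans (x*-suc _ n) (A.sym (at< (Rank.R.∑∞-≈[] (constant w) (ℕₚ.≤-refl {suc n})) n ℕₚ.≤-refl)))))

  -- Exchange of the two rows, which negates the rank.
  ∑-symbols-swap : ∀ (χ : Weight) n → A.∑ₗ (symbols n) (lengths χ ∘ proj₂) A.≈ A.∑ₗ (symbols n) (lengths (λ i j → χ j i) ∘ proj₂)
  ∑-symbols-swap χ n = go n
    where
    go : ∀ E → A.∑ₗ (symbols< E n) (lengths χ ∘ proj₂) A.≈ A.∑ₗ (symbols< E n) (lengths (λ i j → χ j i) ∘ proj₂)
    go zero = A.refl
    go (suc E) = A.trans (A.∑ₗ-++ (symbols< E n) _ _) (A.trans (A.+-cong (go E) (A.trans (A.∑ₗ-map (E ,_) (block E n) _) (A.trans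
        (A.trans (∑-delay (durfee E) (conv (rows (suc E)) (rows (suc E))) (lengths χ) n)
          (A.trans (at (*-congˡ (S-swap (suc E) (suc E) χ)) n) (A.sym (∑-delay (durfee E) (conv (rows (suc E)) (rows (suc E))) (lengths (λ i j → χ j i)) n))))
        (A.sym (A.∑ₗ-map (E ,_) (block E n) _)))))
      (A.sym (A.∑ₗ-++ (symbols< E n) _ _)))

  even : (ℕ → A.Carrier) → Weight
  even c i j = c ∣ i - j ∣

  -- For c n proportional to cos (n t) and w = 2 cos t the premises are the addition theorem; the
  -- conclusion is the step condition of the generating function.
  even-step : ∀ w c → c 1 A.+ c 1 A.≈ w A.* c 0 → (∀ n → c (suc (suc n)) A.+ c n A.≈ w A.* c (suc n)) →
    ∀ i j → even c (suc i) j A.+ even c i (suc j) A.≈ w A.* even c i j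
  even-step w c p q zero zero = p
  even-step w c p q zero (suc j) = A.trans (A.+-comm _ _) (q j)
  even-step w c p q (suc i) zero = A.trans (A.+-congˡ (A.reflexive (cong c (ℕₚ.∣-∣-identityʳ i)))) (q i)
  even-step w c p q (suc i) (suc j) = even-step w c p q i j


-- Powers of 2 from theta dissections.

module Congruences (A : CommutativeRing 0ℓ 0ℓ)
  (halve : ∀ {c d} → CommutativeRing._≈_ A (CommutativeRing._+_ A c c) (CommutativeRing._+_ A d d) → CommutativeRing._≈_ A c d) where

  open SeriesIdentities A public

  record Multiple (k : ℕ) (f : Series) : Set where
    constructor multiple
    field
      factor : Series
      factorises : f ≈ nat k * factor

  halve-two : ∀ {f g} → two * f ≈ two * g → f ≈ g
  halve-two {f} {g} p = pointwise λ n → halve (A.trans (A.sym (at (twice f) n)) (A.trans (at p n) (at (twice g) n)))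
    where
    twice : ∀ f → two * f ≈ f + f
    twice f = solve 1 (λ f → con (+ 2) :* f := f :+ f) refl f

  halve-four : ∀ {f g} → four * f ≈ four * g → f ≈ g
  halve-four {f} {g} p = halve-two (halve-two (trans (step f) (trans p (sym (step g)))))
    where
    step : ∀ f → two * (two * f) ≈ four * f
    step f = solve 1 (λ f → con (+ 2) :* (con (+ 2) :* f) := con (+ 4) :* f) refl f

  od-nat : ∀ k f → od (nat k * f) ≈ nat k * od f
  od-nat k f = trans (od-cong (*-congʳ (sym (dil-nat k)))) (od-dil-* (nat k) f)

  ev-nat : ∀ k f → ev (nat k * f) ≈ nat k * ev f
  ev-nat k f = trans (ev-cong (*-congʳ (sym (dil-nat k)))) (ev-dil-* (nat k) f)

  od-square : ∀ f → od (f * f) ≈ two * (ev f * od f)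
  od-square f = trans (od-* f f) (solve 2 (λ e o → e :* o :+ o :* e := con (+ 2) :* (e :* o)) refl _ _)

  -- Compares two computations of the odd part of φ²: from the dissection of φ² and from that of φ.
  ψ² : ψ * ψ ≈ φ * dil ψ
  ψ² = dil-injective (halve-four (begin
    four * dil (ψ * ψ)                ≈⟨ sym od-φ² ⟩
    od (φ * φ)                        ≈⟨ trans (od-square φ) (*-congˡ (*-cong ev-φ od-φ)) ⟩
    two * (dil φ * (two * dil (dil ψ))) ≈⟨ solve 2 (λ p q → con (+ 2) :* (p :* (con (+ 2) :* q)) := con (+ 4) :* (p :* q)) refl _ _ ⟩
    four * (dil φ * dil (dil ψ))      ≈⟨ *-congˡ (sym (dil-* φ (dil ψ))) ⟩
    four * dil (φ * dil ψ) ∎))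

  φ⁴ : Series
  φ⁴ = φ * φ * (φ * φ)

  od-φ⁴ : od φ⁴ ≈ nat 8 * (φ * φ * dil (ψ * ψ))
  od-φ⁴ = trans (od-square (φ * φ)) (trans (*-congˡ (*-cong ev-φ² od-φ²))
    (solve 2 (λ p q → con (+ 2) :* (p :* (con (+ 4) :* q)) := con (+ 8) :* (p :* q)) refl _ _))

  -- Gathers four factors φ, three from `ν≈` and one from `ψ²`; everything else is a series in x²,
  -- so the odd part inherits the factor 8 of φ⁴.
  ψ²ν : ψ * ψ * ν ≈ dil (ψ * τ) * φ⁴
  ψ²ν = trans (*-cong ψ² ν≈) (trans (solve 3 (λ f p t → f :* p :* (f :* f :* f :* t) := p :* t :* (f :* f :* (f :* f))) refl φ (dil ψ) (dil τ))
    (*-congʳ (sym (dil-* ψ τ))))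

  φ+φ̄ : φ + φ̄ ≈ dil (two * dil φ)
  φ+φ̄ = trans (+-congˡ φ̄≈σφ) (sym (dil-unique
    (trans (+-cong ev-φ (trans (ev-σ φ) ev-φ)) (solve 1 (λ p → p :+ p := con (+ 2) :* p) refl _))
    (trans (+-congˡ (od-σ φ)) (-‿inverseʳ _))))

  φ-φ̄ : φ - φ̄ ≈ x * dil (four * dil (dil ψ))
  φ-φ̄ = ev-od-ext
    (trans (+-cong ev-φ (-‿cong (trans (ev-cong φ̄≈σφ) (trans (ev-σ φ) ev-φ)))) (trans (-‿inverseʳ _) (sym (trans (ev-x* _) (trans (*-congˡ (od-dil _)) (zeroʳ x))))))
    (trans (+-cong od-φ (-‿cong (trans (od-cong φ̄≈σφ) (trans (od-σ φ) (-‿cong od-φ)))))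
      (trans (solve 1 (λ p → con (+ 2) :* p :- :- (con (+ 2) :* p) := con (+ 4) :* p) refl _) (sym (trans (od-x* _) (ev-dil _)))))

  private
    shift : ∀ {s} f g → f + g ≈ s → f ≈ s - g
    shift f g p = trans (solve 2 (λ f g → f := f :+ g :- g) refl f g) (+-congʳ p)

    -- The two series differ only in φ(x) against φ(-x), whose sum 2 φ(x⁴) and difference 4x ψ(x⁸)
    -- bring further factors 2 and 4.
    sum≈ : ev (ev P) + ev (ev V) ≈ dil (two * dil φ * ν) * (φ * φ)
    sum≈ = begin
      ev (ev P) + ev (ev V)
        ≈⟨ +-cong ev-ev-P ev-ev-V ⟩
      φ * φ * (φ * dil ν) + φ̄ * (φ * φ) * dil ν
        ≈⟨ solve 3 (λ p q n → p :* p :* (p :* n) :+ q :* (p :* p) :* n := (p :+ q) :* n :* (p :* p)) refl φ φ̄ (dil ν) ⟩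
      (φ + φ̄) * dil ν * (φ * φ)
        ≈⟨ *-congʳ (trans (*-congʳ φ+φ̄) (sym (dil-* _ ν))) ⟩
      dil (two * dil φ * ν) * (φ * φ) ∎

    difference≈ : ev (ev P) - ev (ev V) ≈ x * (dil (four * dil (dil ψ) * ν) * (φ * φ))
    difference≈ = begin
      ev (ev P) - ev (ev V)
        ≈⟨ +-cong ev-ev-P (-‿cong ev-ev-V) ⟩
      φ * φ * (φ * dil ν) - φ̄ * (φ * φ) * dil ν
        ≈⟨ solve 3 (λ p q n → p :* p :* (p :* n) :- q :* (p :* p) :* n := (p :- q) :* (n :* (p :* p))) refl φ φ̄ (dil ν) ⟩
      (φ - φ̄) * (dil ν * (φ * φ))
        ≈⟨ *-congʳ φ-φ̄ ⟩
      x * dil (four * dil (dil ψ)) * (dil ν * (φ * φ))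
        ≈⟨ solve 4 (λ x d n f → x :* d :* (n :* f) := x :* (d :* n :* f)) refl _ _ _ _ ⟩
      x * (dil (four * dil (dil ψ)) * dil ν * (φ * φ))
        ≈⟨ *-congˡ (*-congʳ (sym (dil-* _ ν))) ⟩
      x * (dil (four * dil (dil ψ) * ν) * (φ * φ)) ∎

    od-sum : od (ev (ev P) + ev (ev V)) ≈ nat 8 * (dil (φ * (ψ * ψ)) * ν)
    od-sum = trans (od-cong sum≈) (trans (od-dil-* _ (φ * φ)) (trans (*-congˡ od-φ²)
      (trans (solve 3 (λ p n q → con (+ 2) :* p :* n :* (con (+ 4) :* q) := con (+ 8) :* (p :* q :* n)) refl _ _ _) (*-congˡ (*-congʳ (sym (dil-* φ (ψ * ψ))))))))

    od-difference : od (ev (ev P) - ev (ev V)) ≈ four * (dil (dil ψ) * (ν * (φ * φ)))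
    od-difference = trans (od-cong difference≈) (trans (od-x* _) (trans (ev-dil-* _ (φ * φ)) (trans (*-congˡ ev-φ²)
      (solve 4 (λ f d n q → f :* d :* n :* q := f :* (d :* (n :* q))) refl _ _ _ _))))

    -- `od-ev-P` brings -σ P and `od-ev-V` brings -P. They cancel in the odd degrees of the sum and,
    -- for `even-difference`, in the even degrees of the difference.
    odd-sum : od (od (ev P) + od (ev V)) ≈ nat 8 * (ψ * ψ * ν * dil (dil ψ))
    odd-sum = begin
      od (od (ev P) + od (ev V))
        ≈⟨ +-cong (trans (shift _ _ (trans (od-cong od-ev-P) S≈)) (+-congˡ (trans (-‿cong (od-σ P)) (-‿involutive _)))) (trans (shift _ _ (od-cong od-ev-V)) (+-identityˡ _)) ⟩
      (nat 8 * (ψ * ψ * ν * dil (dil ψ)) + od P) - od P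
        ≈⟨ solve 2 (λ s p → s :+ p :- p := s) refl _ _ ⟩
      nat 8 * (ψ * ψ * ν * dil (dil ψ)) ∎
      where
      S≈ : od (four * dil (ψ * ψ) * φ * dil ν) ≈ nat 8 * (ψ * ψ * ν * dil (dil ψ))
      S≈ = begin
        od (four * dil (ψ * ψ) * φ * dil ν)
          ≈⟨ od-cong (trans (solve 4 (λ f p q n → f :* p :* q :* n := f :* (p :* n :* q)) refl four (dil (ψ * ψ)) φ (dil ν)) (*-congˡ (*-congʳ (sym (dil-* (ψ * ψ) ν))))) ⟩
        od (four * (dil (ψ * ψ * ν) * φ))
          ≈⟨ trans (od-nat 4 (dil (ψ * ψ * ν) * φ)) (*-congˡ (trans (od-dil-* _ φ) (*-congˡ od-φ))) ⟩
        four * (ψ * ψ * ν * (two * dil (dil ψ)))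
          ≈⟨ solve 2 (λ p q → con (+ 4) :* (p :* (con (+ 2) :* q)) := con (+ 8) :* (p :* q)) refl _ _ ⟩
        nat 8 * (ψ * ψ * ν * dil (dil ψ)) ∎

    even-difference : ev (od (ev P) - od (ev V)) ≈ four * (ψ * ψ * ν * dil φ)
    even-difference = begin
      ev (od (ev P) - od (ev V))
        ≈⟨ +-cong (trans (shift (ev (od (ev P))) (ev (σ P)) (trans (ev-cong od-ev-P) S≈)) (+-congˡ (-‿cong (ev-σ P)))) (-‿cong (trans (shift (ev (od (ev V))) (ev P) (ev-cong od-ev-V)) (+-identityˡ _))) ⟩
      (four * (ψ * ψ * ν * dil φ) - ev P) - (- ev P)
        ≈⟨ solve 2 (λ s p → s :- p :- :- p := s) refl _ _ ⟩
      four * (ψ * ψ * ν * dil φ) ∎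
      where
      S≈ : ev (four * dil (ψ * ψ) * φ * dil ν) ≈ four * (ψ * ψ * ν * dil φ)
      S≈ = begin
        ev (four * dil (ψ * ψ) * φ * dil ν)
          ≈⟨ ev-cong (trans (solve 4 (λ f p q n → f :* p :* q :* n := f :* (p :* n :* q)) refl four (dil (ψ * ψ)) φ (dil ν)) (*-congˡ (*-congʳ (sym (dil-* (ψ * ψ) ν))))) ⟩
        ev (four * (dil (ψ * ψ * ν) * φ))
          ≈⟨ trans (ev-nat 4 (dil (ψ * ψ * ν) * φ)) (*-congˡ (trans (ev-dil-* _ φ) (*-congˡ ev-φ))) ⟩
        four * (ψ * ψ * ν * dil φ) ∎

  sum-8n+5 : Multiple 8 (od (ev (ev P) + ev (ev V)))
  sum-8n+5 = multiple _ od-sum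

  -- One more factor 2 than at 8n + 5: ν = m² is a square, and the odd part of a square is twice a
  -- series.
  sum-16n+13 : Multiple 16 (od (od (ev (ev P) + ev (ev V))))
  sum-16n+13 = multiple _ (begin
    od (od (ev (ev P) + ev (ev V)))                  ≈⟨ od-cong od-sum ⟩
    od (nat 8 * (dil (φ * (ψ * ψ)) * ν))             ≈⟨ trans (od-nat 8 (dil (φ * (ψ * ψ)) * ν)) (*-congˡ (trans (od-dil-* (φ * (ψ * ψ)) ν) (*-congˡ (od-square m)))) ⟩
    nat 8 * (φ * (ψ * ψ) * (two * (ev m * od m)))    ≈⟨ solve 2 (λ p q → con (+ 8) :* (p :* (con (+ 2) :* q)) := con (+ 16) :* (p :* q)) refl _ _ ⟩
    nat 16 * (φ * (ψ * ψ) * (ev m * od m)) ∎)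

  sum-8n+7 : Multiple 8 (od (od (ev P) + od (ev V)))
  sum-8n+7 = multiple _ odd-sum

  -- The factor 8 of `odd-sum` is joined by the factor 8 in the odd part of φ⁴.
  sum-16n+15 : Multiple 64 (od (od (od (ev P) + od (ev V))))
  sum-16n+15 = multiple _ (begin
    od (od (od (ev P) + od (ev V)))
      ≈⟨ od-cong odd-sum ⟩
    od (nat 8 * (ψ * ψ * ν * dil (dil ψ)))
      ≈⟨ trans (od-nat 8 (ψ * ψ * ν * dil (dil ψ))) (*-congˡ (od-cong (trans (*-congʳ ψ²ν) (trans (solve 3 (λ p q r → p :* q :* r := p :* r :* q) refl _ _ _) (*-congʳ (sym (dil-* (ψ * τ) (dil ψ)))))))) ⟩
    nat 8 * od (dil (ψ * τ * dil ψ) * φ⁴)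
      ≈⟨ *-congˡ (trans (od-dil-* (ψ * τ * dil ψ) φ⁴) (*-congˡ od-φ⁴)) ⟩
    nat 8 * (ψ * τ * dil ψ * (nat 8 * (φ * φ * dil (ψ * ψ))))
      ≈⟨ solve 2 (λ p q → con (+ 8) :* (p :* (con (+ 8) :* q)) := con (+ 64) :* (p :* q)) refl _ _ ⟩
    nat 64 * (ψ * τ * dil ψ * (φ * φ * dil (ψ * ψ))) ∎)

  difference-8n+1 : Multiple 16 (ev (ev (ev P) - ev (ev V)))
  difference-8n+1 = multiple _ (begin
    ev (ev (ev P) - ev (ev V))
      ≈⟨ trans (ev-cong difference≈) (trans (ev-x* _) (*-congˡ (trans (od-dil-* _ (φ * φ)) (*-congˡ od-φ²)))) ⟩
    x * (four * dil (dil ψ) * ν * (four * dil (ψ * ψ)))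
      ≈⟨ solve 4 (λ x d n q → x :* (con (+ 4) :* d :* n :* (con (+ 4) :* q)) := con (+ 16) :* (x :* (d :* n :* q))) refl _ _ _ _ ⟩
    nat 16 * (x * (dil (dil ψ) * ν * dil (ψ * ψ))) ∎)

  difference-16n+13 : Multiple 8 (od (od (ev (ev P) - ev (ev V))))
  difference-16n+13 = multiple _ (begin
    od (od (ev (ev P) - ev (ev V)))
      ≈⟨ od-cong od-difference ⟩
    od (four * (dil (dil ψ) * (ν * (φ * φ))))
      ≈⟨ trans (od-nat 4 (dil (dil ψ) * (ν * (φ * φ)))) (*-congˡ (trans (od-dil-* (dil ψ) (ν * (φ * φ))) (*-congˡ (od-* ν (φ * φ))))) ⟩
    four * (dil ψ * (ev ν * od (φ * φ) + od ν * ev (φ * φ)))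
      ≈⟨ *-congˡ (*-congˡ (+-cong (*-congˡ od-φ²) (*-congʳ (od-square m)))) ⟩
    four * (dil ψ * (ev ν * (four * dil (ψ * ψ)) + two * (ev m * od m) * ev (φ * φ)))
      ≈⟨ solve 5 (λ p n q r s → con (+ 4) :* (p :* (n :* (con (+ 4) :* q) :+ con (+ 2) :* r :* s)) := con (+ 8) :* (p :* (con (+ 2) :* n :* q :+ r :* s))) refl _ _ _ _ _ ⟩
    nat 8 * (dil ψ * (two * ev ν * dil (ψ * ψ) + ev m * od m * ev (φ * φ))) ∎)

  difference-16n+11 : Multiple 32 (od (ev (od (ev P) - od (ev V))))
  difference-16n+11 = multiple _ (begin
    od (ev (od (ev P) - od (ev V)))
      ≈⟨ od-cong even-difference ⟩
    od (four * (ψ * ψ * ν * dil φ))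
      ≈⟨ trans (od-nat 4 (ψ * ψ * ν * dil φ)) (*-congˡ (od-cong (trans (*-congʳ ψ²ν) (trans (solve 3 (λ p q r → p :* q :* r := p :* r :* q) refl _ _ _) (*-congʳ (sym (dil-* (ψ * τ) φ))))))) ⟩
    four * od (dil (ψ * τ * φ) * φ⁴)
      ≈⟨ *-congˡ (trans (od-dil-* (ψ * τ * φ) φ⁴) (*-congˡ od-φ⁴)) ⟩
    four * (ψ * τ * φ * (nat 8 * (φ * φ * dil (ψ * ψ))))
      ≈⟨ solve 2 (λ p q → con (+ 4) :* (p :* (con (+ 8) :* q)) := con (+ 32) :* (p :* q)) refl _ _ ⟩
    nat 32 * (ψ * τ * φ * (φ * φ * dil (ψ * ψ))) ∎)

  ev-od-P : ev (od P) ≈ two * (dil (ψ * ψ) * K₃)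
  ev-od-P = halve-two (trans two-ev-od-P (solve 2 (λ p q → con (+ 4) :* p :* q := con (+ 2) :* (con (+ 2) :* (p :* q))) refl _ _))

  P-8n+6 : Multiple 8 (od (ev (od P)))
  P-8n+6 = multiple _ (begin
    od (ev (od P))
      ≈⟨ trans (od-cong ev-od-P) (trans (od-nat 2 (dil (ψ * ψ) * K₃)) (*-congˡ (od-dil-* (ψ * ψ) K₃))) ⟩
    two * (ψ * ψ * od K₃)
      ≈⟨ *-congˡ (*-congˡ (trans (od-cong (trans K₃≈ (*-comm _ _))) (trans (od-dil-* κ₃ (φ * φ)) (*-congˡ od-φ²)))) ⟩
    two * (ψ * ψ * (κ₃ * (four * dil (ψ * ψ))))
      ≈⟨ solve 3 (λ p q r → con (+ 2) :* (p :* (q :* (con (+ 4) :* r))) := con (+ 8) :* (p :* (q :* r))) refl _ _ _ ⟩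
    nat 8 * (ψ * ψ * (κ₃ * dil (ψ * ψ))) ∎)

  -- In `two-od-od-P` the terms 1 and `dil remainder` have no odd part, and the right side is φ⁴
  -- times a series in x², whose odd part brings 8; half of it remains.
  ev-od-od-P : ev (od (od P)) ≈ four * (φ * φ * dil (ψ * ψ) * κ₃)
  ev-od-od-P = halve-two (begin
    two * ev (od (od P))
      ≈⟨ sym (ev-nat 2 (od (od P))) ⟩
    ev (two * od (od P))
      ≈⟨ sym (trans (+-cong (trans (+-cong {od 1#} {0#} (pointwise λ _ → A.refl) (od-x* (two * od (od P)))) (+-identityˡ _)) (od-dil remainder)) (+-identityʳ _)) ⟩
    od (1# + x * (two * od (od P)) + dil remainder)
      ≈⟨ od-cong (trans two-od-od-P (trans (*-congˡ K₃≈) (solve 2 (λ f k → f :* f :* (f :* f :* k) := k :* (f :* f :* (f :* f))) refl φ (dil κ₃)))) ⟩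
    od (dil κ₃ * φ⁴)
      ≈⟨ trans (od-dil-* κ₃ φ⁴) (*-congˡ od-φ⁴) ⟩
    κ₃ * (nat 8 * (φ * φ * dil (ψ * ψ)))
      ≈⟨ solve 2 (λ k p → k :* (con (+ 8) :* p) := con (+ 2) :* (con (+ 4) :* (p :* k))) refl _ _ ⟩
    two * (four * (φ * φ * dil (ψ * ψ) * κ₃)) ∎)

  P-8n+4 : Multiple 4 (ev (od (od P)))
  P-8n+4 = multiple _ ev-od-od-P

  -- Comparing lowest terms: a nontrivial term c xⁿ of f - 1 would give 2 c = 0.
  square≈dil⇒1 : ∀ {f} → Unit f → f * f ≈ dil f → f ≈ 1#
  square≈dil⇒1 {f} u p = trans (solve 1 (λ f → f := f :- con (+ 1) :+ con (+ 1)) refl f) (trans (+-congʳ (≈[]⇒≈ g-small)) (+-identityˡ _))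
    where
    g = f - 1#
    g0 : g 0 A.≈ A.0#
    g0 = A.trans (A.+-congʳ (at0 u)) (A.-‿inverseʳ _)
    g≈x* : g ≈ x * tail g
    g≈x* = trans (head-tail g) (trans (+-congʳ (trans (constant-cong g0) constant-0)) (+-identityˡ _))
    g-equation : g + g ≈ dil g - g * g
    g-equation = begin
      g + g                     ≈⟨ solve 1 (λ f → f :- con (+ 1) :+ (f :- con (+ 1)) := f :* f :- con (+ 1) :- (f :- con (+ 1)) :* (f :- con (+ 1))) refl f ⟩
      f * f - 1# - g * g        ≈⟨ +-congʳ (+-cong p (-‿cong (sym dil-1))) ⟩
      dil f - dil 1# - g * g    ≈⟨ +-congʳ (sym (dil-- f 1#)) ⟩
      dil g - g * g ∎
    step : ∀ N → g ≈[ suc N ] 0# → g ≈[ suc (suc N) ] 0#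
    step N ih = below λ n n<N → halve (A.trans (at< double-small n n<N) (A.sym (A.+-identityˡ _)))
      where
      tail-small : tail g ≈[ N ] 0#
      tail-small = below λ n n<N → at< ih (suc n) (s≤s n<N)
      dil-small : dil g ≈[ suc (suc N) ] 0#
      dil-small = ≈[]-trans (≈⇒≈[] (trans (dil-cong g≈x*) (trans (dil-* x (tail g)) (trans (*-congʳ dil-x) (*-assoc _ _ _)))))
        (≈[]-trans (x*-≈[] (x*-≈[] (≈[]-trans (dil-≈[] tail-small) (≈⇒≈[] dil-0)))) (≈⇒≈[] (trans (*-congˡ (zeroʳ x)) (zeroʳ x))))
      square-small : g * g ≈[ suc (suc N) ] 0#
      square-small = ≈[]-trans (≈⇒≈[] (trans (*-congʳ g≈x*) (*-assoc _ _ _))) (≈[]-trans (x*-≈[] (≈[]-trans (*-≈[] (≈[]-refl {f = tail g}) ih) (≈⇒≈[] (zeroʳ _)))) (≈⇒≈[] (zeroʳ x)))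
      double-small : g + g ≈[ suc (suc N) ] 0#
      double-small = ≈[]-trans (≈⇒≈[] g-equation) (≈[]-trans (+-≈[] dil-small (neg-≈[] square-small)) (≈⇒≈[] (-‿inverseʳ 0#)))
    g-small : ∀ N → g ≈[ N ] 0#
    g-small zero = below λ _ ()
    g-small (suc zero) = below λ { zero _ → g0 ; (suc n) (s≤s ()) }
    g-small (suc (suc N)) = step N (g-small (suc N))

  -- Gauss's product for ψ. The quotient Λ of the two sides satisfies Λ(x)² = Λ(x²), by `ψ²` and
  -- `φ≈`, and is therefore 1.
  ψ*a : ψ * a ≈ b * b
  ψ*a = begin
    ψ * a                         ≈⟨ sym (trans (*-congˡ (trans (*-cong b*b⁻¹ b*b⁻¹) (*-identityˡ _))) (*-identityʳ _)) ⟩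
    ψ * a * (b * b⁻¹ * (b * b⁻¹)) ≈⟨ solve 4 (λ p a b r → p :* a :* (b :* r :* (b :* r)) := p :* a :* (r :* r) :* (b :* b)) refl _ _ _ _ ⟩
    Λ * (b * b)                   ≈⟨ *-congʳ (square≈dil⇒1 unit-Λ Λ²) ⟩
    1# * (b * b)                  ≈⟨ *-identityˡ _ ⟩
    b * b ∎
    where
    Λ = ψ * a * (b⁻¹ * b⁻¹)
    r₄ = dil b⁻¹
    b₄*r₄ : b₄ * r₄ ≈ 1#
    b₄*r₄ = trans (sym (dil-* _ _)) (trans (dil-cong b*b⁻¹) dil-1)
    unit-b⁻¹ : Unit b⁻¹
    unit-b⁻¹ = unit-dil (unit-⁻¹ unit-a)
    unit-ψ : Unit ψ
    unit-ψ = unit-≈[] {0} (unit (A.+-identityˡ _)) (Triangles.∑∞-≈[] ℕₚ.≤-refl)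
    unit-Λ : Unit Λ
    unit-Λ = unit-* (unit-* unit-ψ unit-a) (unit-* unit-b⁻¹ unit-b⁻¹)
    Λ² : Λ * Λ ≈ dil Λ
    Λ² = begin
      ψ * a * (b⁻¹ * b⁻¹) * (ψ * a * (b⁻¹ * b⁻¹))
        ≈⟨ solve 3 (λ p a r → p :* a :* (r :* r) :* (p :* a :* (r :* r)) := p :* p :* (a :* a) :* (r :* r :* (r :* r))) refl _ _ _ ⟩
      ψ * ψ * (a * a) * (b⁻¹ * b⁻¹ * (b⁻¹ * b⁻¹))
        ≈⟨ *-congʳ (*-cong (trans ψ² (*-congʳ φ≈)) (*-cong a≈o*b a≈o*b)) ⟩
      ō * ō * b * dil ψ * (o * b * (o * b)) * (b⁻¹ * b⁻¹ * (b⁻¹ * b⁻¹))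
        ≈⟨ solve 5 (λ o ō b p r → ō :* ō :* b :* p :* (o :* b :* (o :* b)) :* (r :* r :* (r :* r)) := p :* (o :* ō) :* (o :* ō) :* r :* (b :* r :* (b :* r) :* (b :* r))) refl o ō b (dil ψ) b⁻¹ ⟩
      dil ψ * (o * ō) * (o * ō) * b⁻¹ * (b * b⁻¹ * (b * b⁻¹) * (b * b⁻¹))
        ≈⟨ *-congˡ (trans (*-cong (*-cong b*b⁻¹ b*b⁻¹) b*b⁻¹) (trans (*-congʳ (*-identityˡ _)) (sym (*-cong b₄*r₄ b₄*r₄)))) ⟩
      dil ψ * (o * ō) * (o * ō) * b⁻¹ * (b₄ * r₄ * (b₄ * r₄))
        ≈⟨ solve 5 (λ p q c r s → p :* q :* q :* r :* (c :* s :* (c :* s)) := p :* (q :* c) :* ((q :* c) :* r) :* (s :* s)) refl (dil ψ) (o * ō) b₄ b⁻¹ r₄ ⟩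
      dil ψ * (o * ō * b₄) * (o * ō * b₄ * b⁻¹) * (r₄ * r₄)
        ≈⟨ *-congʳ (*-cong (*-congˡ (sym b≈)) (trans (*-congʳ (sym b≈)) b*b⁻¹)) ⟩
      dil ψ * b * 1# * (r₄ * r₄)
        ≈⟨ *-congʳ (*-identityʳ _) ⟩
      dil ψ * b * (r₄ * r₄)
        ≈⟨ sym (trans (dil-* _ _) (*-cong (dil-* ψ a) (dil-* b⁻¹ b⁻¹))) ⟩
      dil Λ ∎

  F : Series
  F = b * b * (a⁻¹ * a⁻¹)

  -- a F⁵ = b¹⁰ a⁻⁹
  P-8n+4-product : ev (od (od P)) ≈ four * (a * F ^ 5)
  P-8n+4-product = trans ev-od-od-P (*-congˡ (*-cancelˡ (unit-* unit-a⁴ (unit-* unit-a⁴ unit-a)) (begin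
    a * a * (a * a) * (a * a * (a * a) * a) * (φ * φ * dil (ψ * ψ) * κ₃)
      ≈⟨ *-congˡ (*-congʳ (trans (*-congˡ (dil-* ψ ψ)) (trans (solve 2 (λ p q → p :* p :* (q :* q) := p :* q :* (p :* q)) refl _ _) (sym (*-cong ψ² ψ²))))) ⟩
    a * a * (a * a) * (a * a * (a * a) * a) * (ψ * ψ * (ψ * ψ) * (m * (a⁻¹ * a⁻¹)))
      ≈⟨ solve 4 (λ a p m i → a :* a :* (a :* a) :* (a :* a :* (a :* a) :* a) :* (p :* p :* (p :* p) :* (m :* (i :* i)))
           := p :* a :* (p :* a) :* (p :* a :* (p :* a)) :* (a :* a :* a :* m) :* (a :* i :* (a :* i))) refl a ψ m a⁻¹ ⟩
    ψ * a * (ψ * a) * (ψ * a * (ψ * a)) * (a * a * a * m) * (a * a⁻¹ * (a * a⁻¹))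
      ≈⟨ *-cong (*-cong (*-cong (*-cong ψ*a ψ*a) (*-cong ψ*a ψ*a)) a³m) (trans (*-cong (unit-inverse unit-a) (unit-inverse unit-a)) (*-identityˡ _)) ⟩
    b * b * (b * b) * (b * b * (b * b)) * (b * b) * 1#
      ≈⟨ *-congˡ (sym (trans (^-congˡ 10 (unit-inverse unit-a)) (1^ 10))) ⟩
    b * b * (b * b) * (b * b * (b * b)) * (b * b) * (a * a⁻¹) ^ 10
      ≈⟨ solve 3 (λ a b i → b :* b :* (b :* b) :* (b :* b :* (b :* b)) :* (b :* b) :* (a :* i) :^ 10
           := a :* a :* (a :* a) :* (a :* a :* (a :* a) :* a) :* (a :* (b :* b :* (i :* i)) :^ 5)) refl a b a⁻¹ ⟩
    a * a * (a * a) * (a * a * (a * a) * a) * (a * F ^ 5) ∎)))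
    where
    unit-a⁴ : Unit (a * a * (a * a))
    unit-a⁴ = unit-* (unit-* unit-a unit-a) (unit-* unit-a unit-a)
    1^ : ∀ n → 1# ^ n ≈ 1#
    1^ zero = refl
    1^ (suc n) = trans (*-identityˡ _) (1^ n)
    a³m : a * a * a * m ≈ b * b
    a³m = begin
      a * a * a * m                              ≈⟨ *-congʳ (*-cong (*-cong a≈o*b a≈o*b) a≈o*b) ⟩
      o * b * (o * b) * (o * b) * m              ≈⟨ solve 3 (λ o b m → o :* b :* (o :* b) :* (o :* b) :* m := b :* b :* (o :* b :* (o :* o) :* m)) refl o b m ⟩
      b * b * (o * b * (o * o) * m)              ≈⟨ *-congˡ m-inverse′ ⟩
      b * b * 1#                                 ≈⟨ *-identityʳ _ ⟩
      b * b ∎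
      where
      m-inverse′ : o * b * (o * o) * m ≈ 1#
      m-inverse′ = trans (*-congʳ (*-congʳ (sym a≈o*b))) (unit-inverse (unit-* unit-a (unit-* unit-o unit-o)))

  -- The congruence modulo 5.

  infix 4 _∣_
  record _∣_ (k : ℕ) (c : A.Carrier) : Set where
    constructor divides
    field
      quotient : A.Carrier
      equality : c A.≈ A.nat k A.* quotient

  ∣-≈ : ∀ {k c d} → c A.≈ d → k ∣ d → k ∣ c
  ∣-≈ p (divides q r) = divides q (A.trans p r)

  ∣-+ : ∀ {k c d} → k ∣ c → k ∣ d → k ∣ c A.+ d
  ∣-+ (divides q p) (divides r s) = divides (q A.+ r) (A.trans (A.+-cong p s) (A.sym (A.distribˡ _ _ _)))

  ∣-0 : ∀ {k} → k ∣ A.0#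
  ∣-0 = divides A.0# (A.sym (A.zeroʳ _))

  ∣-*ˡ : ∀ {k d} c → k ∣ d → k ∣ c A.* d
  ∣-*ˡ c (divides q p) = divides (c A.* q) (A.trans (A.*-congˡ p) (A.solve 3 (λ a b c → a A.:* (b A.:* c) A.:= b A.:* (a A.:* c)) A.refl _ _ _))

  multiple-∣ : ∀ {k f} → Multiple k f → ∀ n → k ∣ f n
  multiple-∣ {k} (multiple g p) n = divides (g n) (A.trans (at p n) (nat-coeff k g n))

  mul-∣ : ∀ {k} f g n → (∀ i j → i ℕ.+ j ≡ n → k ∣ f i A.* g j) → k ∣ (f * g) n
  mul-∣ f g zero h = h 0 0 ≡.refl
  mul-∣ f g (suc n) h = ∣-+ (h 0 (suc n) ≡.refl) (mul-∣ (tail f) g n (λ i j p → h (suc i) j (cong suc p)))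

  res : ℕ → ℕ
  res 0 = 0
  res 1 = 1
  res 2 = 2
  res 3 = 3
  res 4 = 4
  res (suc (suc (suc (suc (suc n))))) = res n

  res-+ : ∀ i j → res j ≡ 0 → res (i ℕ.+ j) ≡ res i
  res-+ i 0 _ = cong res (ℕₚ.+-identityʳ i)
  res-+ i (suc (suc (suc (suc (suc j))))) p = ≡.trans (cong res (ℕₚ.+-comm i (5 ℕ.+ j))) (≡.trans (cong res (ℕₚ.+-comm j i)) (res-+ i j p))

  res-5* : ∀ k → res (5 ℕ.* k) ≡ 0
  res-5* zero = ≡.refl
  res-5* (suc k) = ≡.trans (cong res (ℕₚ.*-suc 5 k)) (res-5* k)

  -- The residues modulo 5, computed by `res`, that no generalised pentagonal number attains.
  Missing : ℕ → Set
  Missing n = res n ≡ 3 ⊎ res n ≡ 4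

  missing-≡ : ∀ m n → res m ≡ res n → Missing m → Missing n
  missing-≡ m n p (inj₁ q) = inj₁ (≡.trans (≡.sym p) q)
  missing-≡ m n p (inj₂ q) = inj₂ (≡.trans (≡.sym p) q)

  pentagonal-step : ∀ j → pentagonal (5 ℕ.+ j) ≡ pentagonal j ℕ.+ 5 ℕ.* (3 ℕ.* j ℕ.+ 8)
  pentagonal-step j = solveℕ 2 (λ t j → t ⊕ (conℕ 1 ⊕ j) ⊕ (conℕ 2 ⊕ j) ⊕ (conℕ 3 ⊕ j) ⊕ (conℕ 4 ⊕ j) ⊕ (conℕ 5 ⊕ j) ⊕ (conℕ 5 ⊕ j) ⊗ (conℕ 5 ⊕ j)
    ⊜ t ⊕ j ⊗ j ⊕ conℕ 5 ⊗ (conℕ 3 ⊗ j ⊕ conℕ 8)) ≡.refl (triangle j) j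

  -- Modulo 5 the value has period 5 in j, so five cases decide.
  pentagonal-res : ∀ j → ¬ Missing (pentagonal j)
  pentagonal-res 0 = λ { (inj₁ ()) ; (inj₂ ()) }
  pentagonal-res 1 = λ { (inj₁ ()) ; (inj₂ ()) }
  pentagonal-res 2 = λ { (inj₁ ()) ; (inj₂ ()) }
  pentagonal-res 3 = λ { (inj₁ ()) ; (inj₂ ()) }
  pentagonal-res 4 = λ { (inj₁ ()) ; (inj₂ ()) }
  pentagonal-res (suc (suc (suc (suc (suc j))))) p = pentagonal-res j
    (missing-≡ (pentagonal (5 ℕ.+ j)) (pentagonal j) (≡.trans (cong res (pentagonal-step j)) (res-+ (pentagonal j) _ (res-5* (3 ℕ.* j ℕ.+ 8)))) p)

  pentagonal-res′ : ∀ j → ¬ Missing (pentagonal j ℕ.+ suc (2 ℕ.* j))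
  pentagonal-res′ 0 = λ { (inj₁ ()) ; (inj₂ ()) }
  pentagonal-res′ 1 = λ { (inj₁ ()) ; (inj₂ ()) }
  pentagonal-res′ 2 = λ { (inj₁ ()) ; (inj₂ ()) }
  pentagonal-res′ 3 = λ { (inj₁ ()) ; (inj₂ ()) }
  pentagonal-res′ 4 = λ { (inj₁ ()) ; (inj₂ ()) }
  pentagonal-res′ (suc (suc (suc (suc (suc j))))) p = pentagonal-res′ j
    (missing-≡ (pentagonal (5 ℕ.+ j) ℕ.+ suc (2 ℕ.* (5 ℕ.+ j))) (pentagonal j ℕ.+ suc (2 ℕ.* j)) (≡.trans (cong res step) (res-+ (pentagonal j ℕ.+ suc (2 ℕ.* j)) _ (res-5* (3 ℕ.* j ℕ.+ 10)))) p)
    where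
    step : pentagonal (5 ℕ.+ j) ℕ.+ suc (2 ℕ.* (5 ℕ.+ j)) ≡ pentagonal j ℕ.+ suc (2 ℕ.* j) ℕ.+ 5 ℕ.* (3 ℕ.* j ℕ.+ 10)
    step = ≡.trans (cong (ℕ._+ suc (2 ℕ.* (5 ℕ.+ j))) (pentagonal-step j))
      (solveℕ 2 (λ p j → p ⊕ conℕ 5 ⊗ (conℕ 3 ⊗ j ⊕ conℕ 8) ⊕ (conℕ 1 ⊕ conℕ 2 ⊗ (conℕ 5 ⊕ j)) ⊜ p ⊕ (conℕ 1 ⊕ conℕ 2 ⊗ j) ⊕ conℕ 5 ⊗ (conℕ 3 ⊗ j ⊕ conℕ 10)) ≡.refl (pentagonal j) j)

  x^-coeff : ∀ p i → ¬ i ≡ p → (x ^ p) i A.≈ A.0#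
  x^-coeff zero zero i≢p = ⊥-elim (i≢p ≡.refl)
  x^-coeff zero (suc i) _ = A.refl
  x^-coeff (suc p) zero _ = x*-zero (x ^ p)
  x^-coeff (suc p) (suc i) i≢p = A.trans (x*-suc (x ^ p) i) (x^-coeff p i (i≢p ∘ cong suc))

  sign-coeff : ∀ j f i → f i A.≈ A.0# → (sign j * f) i A.≈ A.0#
  sign-coeff zero f i p = A.trans (at (*-identityˡ f) i) p
  sign-coeff (suc j) f i p = A.trans (at (solve 2 (λ s f → :- con (+ 1) :* s :* f := :- (s :* f)) refl (sign j) f) i)
    (A.trans (A.-‿cong (sign-coeff j f i p)) A.-0#≈0#)

  a-missing : ∀ i → Missing i → a i A.≈ A.0#
  a-missing i h = A.trans (at pentagonalTheorem i) (A.trans (at< (Pentagonal.∑∞-≈[] (ℕₚ.≤-refl {suc i})) i ℕₚ.≤-refl) (partial (suc i)))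
    where
    term : ∀ j → pentagonalTerm j i A.≈ A.0#
    term j = sign-coeff j _ i (A.trans (at expand i) (A.trans (A.+-cong (x^-coeff (pentagonal j) i (λ p → pentagonal-res j (subst Missing p h)))
        (A.trans (A.-‿cong (x^-coeff (pentagonal j ℕ.+ suc (2 ℕ.* j)) i (λ p → pentagonal-res′ j (subst Missing p h)))) A.-0#≈0#)) (A.+-identityˡ _)))
      where
      expand : x ^ pentagonal j * (1# - x ^ suc (2 ℕ.* j)) ≈ x ^ pentagonal j - x ^ (pentagonal j ℕ.+ suc (2 ℕ.* j))
      expand = trans (solve 2 (λ p q → p :* (con (+ 1) :- q) := p :- p :* q) refl _ _) (+-congˡ (-‿cong (sym (x^-+ (pentagonal j) (suc (2 ℕ.* j))))))
    partial : ∀ N → ∑< N pentagonalTerm i A.≈ A.0#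
    partial zero = A.refl
    partial (suc N) = A.trans (A.+-cong (partial N) (term N)) (A.+-identityˡ _)

  -- Modulo 5, f ^ 5 is f 0 ^ 5 + x ^ 5 * tail f ^ 5.
  fifth-power : ∀ f n → ¬ res n ≡ 0 → 5 ∣ (f ^ 5) n
  fifth-power f n h = ∣-≈ (at expand n) (∣-+ (∣-+ (constant-part n h) (shifted-part n h)) (divides (E n) (nat-coeff 5 E n)))
    where
    c = constant (f 0)
    t = tail f
    E = c * c * c * c * (x * t) + two * (c * c * c * (x * t * (x * t))) + two * (c * c * (x * t * (x * t) * (x * t))) + c * (x * t * (x * t) * (x * t) * (x * t))
    expand : f ^ 5 ≈ c ^ 5 + x ^ 5 * t ^ 5 + nat 5 * E
    expand = trans (^-congˡ 5 (head-tail f)) (solve 3 (λ c x t → (c :+ x :* t) :^ 5 := c :^ 5 :+ x :^ 5 :* t :^ 5 :+ con (+ 5) :*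
      (c :* c :* c :* c :* (x :* t) :+ con (+ 2) :* (c :* c :* c :* (x :* t :* (x :* t))) :+ con (+ 2) :* (c :* c :* (x :* t :* (x :* t) :* (x :* t))) :+ c :* (x :* t :* (x :* t) :* (x :* t) :* (x :* t)))) refl c x t)
    constant-power : ∀ k → constant (f 0) ^ k ≈ constant (f 0 A.^ k)
    constant-power zero = sym constant-1
    constant-power (suc k) = trans (*-congˡ (constant-power k)) (sym (constant-mul _ _))
    constant-part : ∀ n → ¬ res n ≡ 0 → 5 ∣ (c ^ 5) n
    constant-part zero h = ⊥-elim (h ≡.refl)
    constant-part (suc n) h = ∣-≈ (at (constant-power 5) (suc n)) ∣-0
    low : ∀ n → n < 5 → 5 ∣ (x ^ 5 * t ^ 5) n
    low n n<5 = ∣-≈ (at< (x^*≈[]0 {5} (t ^ 5) ℕₚ.≤-refl) n n<5) ∣-0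
    unfold : ∀ n → (x ^ 5 * t ^ 5) (5 ℕ.+ n) A.≈ (t ^ 5) n
    unfold n = A.trans (at (solve 2 (λ x t → x :^ 5 :* t := x :* (x :* (x :* (x :* (x :* t))))) refl x (t ^ 5)) (5 ℕ.+ n))
      (A.trans (x*-suc _ (4 ℕ.+ n)) (A.trans (x*-suc _ (3 ℕ.+ n)) (A.trans (x*-suc _ (2 ℕ.+ n)) (A.trans (x*-suc _ (1 ℕ.+ n)) (x*-suc (t ^ 5) n)))))
    shifted-part : ∀ n → ¬ res n ≡ 0 → 5 ∣ (x ^ 5 * t ^ 5) n
    shifted-part 0 _ = low 0 (s≤s z≤n)
    shifted-part 1 _ = low 1 (s≤s (s≤s z≤n))
    shifted-part 2 _ = low 2 (s≤s (s≤s (s≤s z≤n)))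
    shifted-part 3 _ = low 3 (s≤s (s≤s (s≤s (s≤s z≤n))))
    shifted-part 4 _ = low 4 (s≤s (s≤s (s≤s (s≤s (s≤s z≤n)))))
    shifted-part (suc (suc (suc (suc (suc n))))) h = ∣-≈ (unfold n) (fifth-power t n h)

  -- In each product of coefficients either the degree in F⁵ is prime to 5, so that 5 divides the
  -- second factor, or the degree in `a` is congruent to n and the first factor is 0.
  P-mod-5 : ∀ n → Missing n → 5 ∣ ev (od (od P)) n
  P-mod-5 n h = ∣-≈ (A.trans (at P-8n+4-product n) (nat-coeff 4 (a * F ^ 5) n)) (∣-*ˡ (A.nat 4) (mul-∣ a (F ^ 5) n cases))
    where
    cases : ∀ i j → i ℕ.+ j ≡ n → 5 ∣ a i A.* (F ^ 5) j
    cases i j p with res j ℕₚ.≟ 0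
    ... | no q = ∣-*ˡ (a i) (fifth-power F j q)
    ... | yes q = ∣-≈ (A.trans (A.*-congʳ (a-missing i (missing-≡ n i (≡.trans (cong res (≡.sym p)) (res-+ i j q)) h))) (A.zeroˡ _)) ∣-0

-- Coefficients of the rank series as cosine sums over symbols.

module Counting where

  open Enumeration

  ℤ-ring : CommutativeRing 0ℓ 0ℓ
  ℤ-ring = ℤₚ.+-*-commutativeRing

  module ℤR = RingTools ℤ-ring

  halve-ℤ : ∀ {c d} → c ℤ.+ c ≡ d ℤ.+ d → c ≡ d
  halve-ℤ {c} {d} p = ℤₚ.*-cancelˡ-≡ (+ 2) c d (≡.trans (twice c) (≡.trans p (≡.sym (twice d))))
    where
    twice : ∀ c → + 2 ℤ.* c ≡ c ℤ.+ c
    twice = ℤR.solve 1 (λ c → ℤR.con (+ 2) ℤR.:* c ℤR.:= c ℤR.:+ c) ≡.refl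

  -- ℤ[√2], with (p , q) standing for p + q √2
  module Sqrt2 where
    open ℤR using (solve; con; _:=_; _:+_; _:*_; :-_)

    add mul : ℤ × ℤ → ℤ × ℤ → ℤ × ℤ
    add (p , q) (r , s) = p ℤ.+ r , q ℤ.+ s
    mul (p , q) (r , s) = p ℤ.* r ℤ.+ + 2 ℤ.* (q ℤ.* s) , p ℤ.* s ℤ.+ q ℤ.* r

    neg : ℤ × ℤ → ℤ × ℤ
    neg (p , q) = ℤ.- p , ℤ.- q

    mul-comm : ∀ y z → mul y z ≡ mul z y
    mul-comm (p , q) (r , s) = cong₂ _,_
      (solve 4 (λ p q r s → p :* r :+ con (+ 2) :* (q :* s) := r :* p :+ con (+ 2) :* (s :* q)) ≡.refl p q r s)
      (solve 4 (λ p q r s → p :* s :+ q :* r := r :* q :+ s :* p) ≡.refl p q r s)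

    mul-identityˡ : ∀ y → mul (+ 1 , + 0) y ≡ y
    mul-identityˡ (r , s) = cong₂ _,_
      (solve 2 (λ r s → con (+ 1) :* r :+ con (+ 2) :* (con (+ 0) :* s) := r) ≡.refl r s)
      (solve 2 (λ r s → con (+ 1) :* s :+ con (+ 0) :* r := s) ≡.refl r s)

    distribʳ : ∀ y z w → mul (add z w) y ≡ add (mul z y) (mul w y)
    distribʳ (r , s) (p , q) (p′ , q′) = cong₂ _,_
      (solve 6 (λ p q p′ q′ r s → (p :+ p′) :* r :+ con (+ 2) :* ((q :+ q′) :* s) := p :* r :+ con (+ 2) :* (q :* s) :+ (p′ :* r :+ con (+ 2) :* (q′ :* s))) ≡.refl p q p′ q′ r s)
      (solve 6 (λ p q p′ q′ r s → (p :+ p′) :* s :+ (q :+ q′) :* r := p :* s :+ q :* r :+ (p′ :* s :+ q′ :* r)) ≡.refl p q p′ q′ r s)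

    isCommutativeRing : IsCommutativeRing _≡_ add mul neg (+ 0 , + 0) (+ 1 , + 0)
    isCommutativeRing = record
      { isRing = record
        { +-isAbelianGroup = record
          { isGroup = record
            { isMonoid = record
              { isSemigroup = record
                { isMagma = record { isEquivalence = ≡.isEquivalence ; ∙-cong = cong₂ add }
                ; assoc = λ (p , q) (r , s) (t , u) → cong₂ _,_ (ℤₚ.+-assoc p r t) (ℤₚ.+-assoc q s u) }
              ; identity = (λ (p , q) → cong₂ _,_ (ℤₚ.+-identityˡ p) (ℤₚ.+-identityˡ q)) , (λ (p , q) → cong₂ _,_ (ℤₚ.+-identityʳ p) (ℤₚ.+-identityʳ q)) }
            ; inverse = (λ (p , q) → cong₂ _,_ (ℤₚ.+-inverseˡ p) (ℤₚ.+-inverseˡ q)) , (λ (p , q) → cong₂ _,_ (ℤₚ.+-inverseʳ p) (ℤₚ.+-inverseʳ q))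
            ; ⁻¹-cong = cong neg }
          ; comm = λ (p , q) (r , s) → cong₂ _,_ (ℤₚ.+-comm p r) (ℤₚ.+-comm q s) }
        ; *-cong = cong₂ mul
        ; *-assoc = λ (p , q) (r , s) (t , u) → cong₂ _,_
            (solve 6 (λ p q r s t u → (p :* r :+ con (+ 2) :* (q :* s)) :* t :+ con (+ 2) :* ((p :* s :+ q :* r) :* u)
               := p :* (r :* t :+ con (+ 2) :* (s :* u)) :+ con (+ 2) :* (q :* (r :* u :+ s :* t))) ≡.refl p q r s t u)
            (solve 6 (λ p q r s t u → (p :* r :+ con (+ 2) :* (q :* s)) :* u :+ (p :* s :+ q :* r) :* t
               := p :* (r :* u :+ s :* t) :+ q :* (r :* t :+ con (+ 2) :* (s :* u))) ≡.refl p q r s t u)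
        ; *-identity = mul-identityˡ , (λ y → ≡.trans (mul-comm y (+ 1 , + 0)) (mul-identityˡ y))
        ; distrib = (λ y z w → ≡.trans (mul-comm y (add z w)) (≡.trans (distribʳ y z w) (cong₂ add (mul-comm z y) (mul-comm w y)))) , distribʳ }
      ; *-comm = mul-comm }

    ring : CommutativeRing 0ℓ 0ℓ
    ring = record { isCommutativeRing = isCommutativeRing }

    root : ℤ × ℤ
    root = + 0 , + 1

  module ℤS = Congruences ℤ-ring halve-ℤ
  open ℤS using (even; even-step)

  ∑ : List Raw → (ℕ → ℕ → ℤ) → ℤ
  ∑ l χ = ℤR.∑ₗ l (ℤS.lengths χ ∘ proj₂)


  ε : ℕ → ℤ
  ε zero = + 1
  ε (suc n) = ℤ.- ε n

  -- The cosine of n π / 2.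
  c₄ : ℕ → ℤ
  c₄ 0 = + 1
  c₄ 1 = + 0
  c₄ (suc (suc n)) = ℤ.- c₄ n

  -- twice the cosine of n π / 4
  c₈ : ℕ → ℤ × ℤ
  c₈ 0 = + 2 , + 0
  c₈ 1 = + 0 , + 1
  c₈ 2 = + 0 , + 0
  c₈ 3 = + 0 , ℤ.- (+ 1)
  c₈ 4 = ℤ.- (+ 2) , + 0
  c₈ 5 = + 0 , ℤ.- (+ 1)
  c₈ 6 = + 0 , + 0
  c₈ 7 = + 0 , + 1
  c₈ (suc (suc (suc (suc (suc (suc (suc (suc n)))))))) = c₈ n

  c₈-step : ∀ n → Sqrt2.add (c₈ (suc (suc n))) (c₈ n) ≡ Sqrt2.mul Sqrt2.root (c₈ (suc n))
  c₈-step 0 = ≡.refl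
  c₈-step 1 = ≡.refl
  c₈-step 2 = ≡.refl
  c₈-step 3 = ≡.refl
  c₈-step 4 = ≡.refl
  c₈-step 5 = ≡.refl
  c₈-step 6 = ≡.refl
  c₈-step 7 = ≡.refl
  c₈-step (suc (suc (suc (suc (suc (suc (suc (suc n)))))))) = c₈-step n

  ∑-1 : ∀ n → ∑ (symbols (suc n)) (even (λ _ → + 1)) ≡ ℤS.P n
  ∑-1 n = ≡.trans (ℤS.generatingFunction (+ 2) (even (λ _ → + 1)) (λ _ _ → ≡.refl) (even-step (+ 2) (λ _ → + 1) ≡.refl (λ _ → ≡.refl)) n)
    (≡.trans (ℤₚ.*-identityˡ _) (ℤS.at (ℤS.R-cong (ℤS.nat-constant 2)) n))

  ∑-ε : ∀ n → ∑ (symbols (suc n)) (even ε) ≡ ℤS.σ ℤS.P n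
  ∑-ε n = ≡.trans (ℤS.generatingFunction (ℤ.- (+ 2)) (even ε) (λ _ _ → ≡.refl) (even-step (ℤ.- (+ 2)) ε ≡.refl step) n)
    (≡.trans (ℤₚ.*-identityˡ _) (ℤS.at (ℤS.trans (ℤS.R-cong (ℤS.trans (ℤS.constant-neg (+ 2)) (ℤS.-‿cong (ℤS.nat-constant 2)))) (ℤS.sym (ℤS.σ-R ℤS.dil-two))) n))
    where
    step : ∀ n → ε (suc (suc n)) ℤ.+ ε n ≡ ℤ.- (+ 2) ℤ.* ε (suc n)
    step n = ℤR.solve 1 (λ e → ℤR.:- ℤR.:- e ℤR.:+ e ℤR.:= ℤR.:- ℤR.con (+ 2) ℤR.:* ℤR.:- e) ≡.refl (ε n)

  ∑-c₄ : ∀ n → ∑ (symbols (suc n)) (even c₄) ≡ ℤS.V n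
  ∑-c₄ n = ≡.trans (ℤS.generatingFunction (+ 0) (even c₄) (λ _ _ → ≡.refl) (even-step (+ 0) c₄ ≡.refl (λ n → ≡.trans (ℤₚ.+-inverseˡ (c₄ n)) (≡.sym (ℤₚ.*-zeroˡ (c₄ (suc n)))))) n)
    (≡.trans (ℤₚ.*-identityˡ _) (ℤS.at (ℤS.R-cong ℤS.constant-0) n))

  module D₂ = SeriesIdentities Sqrt2.ring

  private
    w₂ : D₂.Series
    w₂ = D₂.constant Sqrt2.root

    w₂² : w₂ D₂.* w₂ D₂.≈ D₂.two
    w₂² = D₂.trans (D₂.sym (D₂.constant-mul Sqrt2.root Sqrt2.root)) (D₂.nat-constant 2)

    ∑-c₈′ : ∀ n → D₂.A.∑ₗ (symbols (suc n)) (D₂.lengths (D₂.even c₈) ∘ proj₂) ≡ Sqrt2.mul (+ 2 , + 0) (D₂.R w₂ n)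
    ∑-c₈′ = D₂.generatingFunction Sqrt2.root (D₂.even c₈) (λ _ _ → ≡.refl) (D₂.even-step Sqrt2.root c₈ ≡.refl c₈-step)

    ∑-proj₁ : ∀ (l : List Raw) (f : Raw → ℤ × ℤ) → proj₁ (D₂.A.∑ₗ l f) ≡ ℤR.∑ₗ l (proj₁ ∘ f)
    ∑-proj₁ [] f = ≡.refl
    ∑-proj₁ (y ∷ l) f = cong (λ s → proj₁ (f y) ℤ.+ s) (∑-proj₁ l f)

    module Van = D₂.Vanishing w₂ (D₂.dil-constant Sqrt2.root) w₂²

  -- In the Fourier expansion of class 0 modulo 8 the characters of order 8 occur together with
  -- their √2-conjugates, which leaves twice the rational part. It vanishes with the whole sum in
  -- ℤ[√2].
  ∑-c₈ : ∀ n → D₂.R w₂ n ≡ (+ 0 , + 0) → ∑ (symbols (suc n)) (even (proj₁ ∘ c₈)) ≡ + 0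
  ∑-c₈ n p = ≡.trans (≡.sym (∑-proj₁ (symbols (suc n)) (D₂.lengths (D₂.even c₈) ∘ proj₂))) (cong proj₁ (≡.trans (∑-c₈′ n) (cong (Sqrt2.mul (+ 2 , + 0)) p)))

  W-8n+5 : ∀ n → ∑ (symbols (suc (double (double (suc (double n)))))) (even (proj₁ ∘ c₈)) ≡ + 0
  W-8n+5 n = ∑-c₈ (double (double (suc (double n)))) (D₂.at Van.vanish-8n+5 n)

  W-8n+7 : ∀ n → ∑ (symbols (suc (double (suc (double (suc (double n))))))) (even (proj₁ ∘ c₈)) ≡ + 0
  W-8n+7 n = ∑-c₈ (double (suc (double (suc (double n))))) (D₂.at Van.vanish-8n+7 n)


-- Finite Fourier analysis of the residue classes of the rank.

module ResidueClasses where

  open import Defs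
  import Data.Integer.Divisibility.Signed as ℤ∣

  open Enumeration
  open Counting
  open ℤS using (even)

  indicator : ℤ → ℕ → ℤ → ℤ
  indicator a M r = if does (class? a M r) then + 1 else + 0

  count≡∑ : ∀ a {M} n c → 1 ≤ M → N⁰≡ a M n c → + c ≡ ∑ (symbols n) (λ i j → indicator a M (+ i ℤ.- + j))
  count≡∑ a {M} n c 1≤M iso = ≡.trans (cong +_ (count≡length a n c 1≤M iso)) (go (symbols n))
    where
    go : ∀ l → + length (filter (class? a M ∘ rank) l) ≡ ∑ l (λ i j → indicator a M (+ i ℤ.- + j))
    go [] = ≡.refl
    go (y ∷ l) with class? a M (rank y)
    ... | yes _ = cong (λ s → + 1 ℤ.+ s) (go l)
    ... | no _ = ≡.trans (go l) (≡.sym (ℤₚ.+-identityˡ _))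

  symmetrised : ℤ → ℕ → ℕ → ℤ
  symmetrised a M k = indicator a M (+ k) ℤ.+ indicator a M (ℤ.- (+ k))

  ∑-cong : ∀ l {χ χ′ : ℕ → ℕ → ℤ} → (∀ i j → χ i j ≡ χ′ i j) → ∑ l χ ≡ ∑ l χ′
  ∑-cong l p = ℤR.∑ₗ-cong l (λ (_ , t , u) → p (length t) (length u))

  ∑-+ : ∀ l (χ χ′ : ℕ → ℕ → ℤ) → ∑ l (λ i j → χ i j ℤ.+ χ′ i j) ≡ ∑ l χ ℤ.+ ∑ l χ′
  ∑-+ l χ χ′ = ℤR.∑ₗ-+ l (ℤS.lengths χ ∘ proj₂) (ℤS.lengths χ′ ∘ proj₂)

  ∑-* : ∀ l k (χ : ℕ → ℕ → ℤ) → ∑ l (λ i j → k ℤ.* χ i j) ≡ k ℤ.* ∑ l χ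
  ∑-* l k χ = ℤR.∑ₗ-*ˡ l k (ℤS.lengths χ ∘ proj₂)

  ordered-difference : ∀ {i j} → j ≤ i → + i ℤ.- + j ≡ + ∣ i - j ∣ × + j ℤ.- + i ≡ ℤ.- (+ ∣ i - j ∣)
  ordered-difference {i} {j} p = eq , ≡.trans (ℤR.solve 2 (λ i j → j ℤR.:- i ℤR.:= ℤR.:- (i ℤR.:- j)) ≡.refl (+ i) (+ j)) (cong ℤ.-_ eq)
    where
    eq : + i ℤ.- + j ≡ + ∣ i - j ∣
    eq = ≡.trans (ℤₚ.m-n≡m⊖n i j) (≡.trans (ℤₚ.⊖-≥ p) (cong +_ (≡.sym (ℕₚ.m≤n⇒∣n-m∣≡n∸m p))))

  symmetrised-∣-∣ : ∀ a M i j → indicator a M (+ i ℤ.- + j) ℤ.+ indicator a M (+ j ℤ.- + i) ≡ symmetrised a M ∣ i - j ∣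
  symmetrised-∣-∣ a M i j with ℕₚ.≤-total j i
  ... | inj₁ p with eq , eq′ ← ordered-difference p = cong₂ (λ r s → indicator a M r ℤ.+ indicator a M s) eq eq′
  ... | inj₂ p with eq , eq′ ← ordered-difference p = ≡.trans (ℤₚ.+-comm (indicator a M (+ i ℤ.- + j)) _)
    (≡.trans (cong₂ (λ r s → indicator a M r ℤ.+ indicator a M s) eq eq′) (cong (symmetrised a M) (ℕₚ.∣-∣-comm j i)))

  -- Symmetry under exchange of the rows allows r and -r to be counted together, at the cost of a
  -- factor 2; the weight then depends on the distance of the two lengths alone, as the generating
  -- function requires.
  double-count : ∀ a {M} n c → 1 ≤ M → N⁰≡ a M n c → + 2 ℤ.* + c ≡ ∑ (symbols n) (even (symmetrised a M))
  double-count a {M} n c 1≤M iso = begin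
    + 2 ℤ.* + c
      ≡⟨ ℤR.solve 1 (λ c → ℤR.con (+ 2) ℤR.:* c ℤR.:= c ℤR.:+ c) ≡.refl (+ c) ⟩
    + c ℤ.+ + c
      ≡⟨ cong₂ ℤ._+_ eq (≡.trans eq (ℤS.∑-symbols-swap (λ i j → indicator a M (+ i ℤ.- + j)) n)) ⟩
    ∑ (symbols n) (λ i j → indicator a M (+ i ℤ.- + j)) ℤ.+ ∑ (symbols n) (λ i j → indicator a M (+ j ℤ.- + i))
      ≡⟨ ∑-+ (symbols n) (λ i j → indicator a M (+ i ℤ.- + j)) (λ i j → indicator a M (+ j ℤ.- + i)) ⟨
    ∑ (symbols n) (λ i j → indicator a M (+ i ℤ.- + j) ℤ.+ indicator a M (+ j ℤ.- + i))
      ≡⟨ ∑-cong (symbols n) (symmetrised-∣-∣ a M) ⟩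
    ∑ (symbols n) (even (symmetrised a M)) ∎
    where
    open ≡-Reasoning
    eq = count≡∑ a n c 1≤M iso

  indicator-cong : ∀ a M {r s} → (r ≡ a [mod M ] → s ≡ a [mod M ]) → (s ≡ a [mod M ] → r ≡ a [mod M ]) → indicator a M r ≡ indicator a M s
  indicator-cong a M {r} {s} f g with class? a M r | class? a M s
  ... | yes _ | yes _ = ≡.refl
  ... | yes p | no q = ⊥-elim (q (f p))
  ... | no p | yes q = ⊥-elim (p (g q))
  ... | no _ | no _ = ≡.refl

  class-shift : ∀ a M k r → r ≡ a [mod M ] → (r ℤ.+ k ℤ.* + M) ≡ a [mod M ]
  class-shift a M k r p = ℤ∣.∣⇒∣ᵤ (subst (ℤ∣._∣_ (+ M)) (ℤR.solve 3 (λ r a s → r ℤR.:- a ℤR.:+ s ℤR.:= r ℤR.:+ s ℤR.:- a) ≡.refl r a (k ℤ.* + M))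
    (ℤ∣.∣m∣n⇒∣m+n (ℤ∣.∣ᵤ⇒∣ {+ M} {r ℤ.- a} p) (ℤ∣.divides k ≡.refl)))

  indicator-shift : ∀ a M k r → indicator a M (r ℤ.+ k ℤ.* + M) ≡ indicator a M r
  indicator-shift a M k r = indicator-cong a M {r ℤ.+ k ℤ.* + M} {r}
    (λ p → subst (λ s → s ≡ a [mod M ]) (ℤR.solve 3 (λ r k m → r ℤR.:+ k ℤR.:* m ℤR.:+ ℤR.:- k ℤR.:* m ℤR.:= r) ≡.refl r k (+ M)) (class-shift a M (ℤ.- k) (r ℤ.+ k ℤ.* + M) p))
    (class-shift a M k r)

  symmetrised-periodic : ∀ a M k q → k ℕ.* M ≡ 8 → symmetrised a M (8 ℕ.+ q) ≡ symmetrised a M q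
  symmetrised-periodic a M k q p = cong₂ ℤ._+_
    (≡.trans (cong (indicator a M) eq) (indicator-shift a M (+ k) (+ q)))
    (≡.trans (cong (indicator a M) (≡.trans (cong ℤ.-_ eq) (ℤR.solve 3 (λ q k m → ℤR.:- (q ℤR.:+ k ℤR.:* m) ℤR.:= ℤR.:- q ℤR.:+ ℤR.:- k ℤR.:* m) ≡.refl (+ q) (+ k) (+ M))))
      (indicator-shift a M (ℤ.- (+ k)) (ℤ.- (+ q))))
    where
    eq : + (8 ℕ.+ q) ≡ + q ℤ.+ + k ℤ.* + M
    eq = ≡.trans (cong +_ (≡.trans (ℕₚ.+-comm 8 q) (cong (q ℕ.+_) (≡.sym p)))) (cong (λ s → + q ℤ.+ s) (ℤₚ.pos-* k M))

  -- Moduli 4 and 8 and all characters involved share the period 8, so eight evaluations settle each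
  -- expansion.
  periodic-≡ : ∀ (f g : ℕ → ℤ) → (∀ q → f (8 ℕ.+ q) ≡ f q) → (∀ q → g (8 ℕ.+ q) ≡ g q) →
    f 0 ≡ g 0 → f 1 ≡ g 1 → f 2 ≡ g 2 → f 3 ≡ g 3 → f 4 ≡ g 4 → f 5 ≡ g 5 → f 6 ≡ g 6 → f 7 ≡ g 7 → ∀ q → f q ≡ g q
  periodic-≡ f g pf pg e0 e1 e2 e3 e4 e5 e6 e7 = go
    where
    go : ∀ q → f q ≡ g q
    go 0 = e0
    go 1 = e1
    go 2 = e2
    go 3 = e3
    go 4 = e4
    go 5 = e5
    go 6 = e6
    go 7 = e7
    go (suc (suc (suc (suc (suc (suc (suc (suc q)))))))) = ≡.trans (pf q) (≡.trans (go q) (≡.sym (pg q)))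

  ε-periodic : ∀ q → ε (8 ℕ.+ q) ≡ ε q
  ε-periodic q = ℤR.solve 1 (λ e → ℤR.:- ℤR.:- ℤR.:- ℤR.:- ℤR.:- ℤR.:- ℤR.:- ℤR.:- e ℤR.:= e) ≡.refl (ε q)

  c₄-periodic : ∀ q → c₄ (8 ℕ.+ q) ≡ c₄ q
  c₄-periodic q = ℤR.solve 1 (λ e → ℤR.:- ℤR.:- ℤR.:- ℤR.:- e ℤR.:= e) ≡.refl (c₄ q)

  -- Finite Fourier expansions of the symmetrised indicators
  fourier-0-4 : ∀ q → + 2 ℤ.* symmetrised (+ 0) 4 q ≡ + 1 ℤ.+ ε q ℤ.+ + 2 ℤ.* c₄ q
  fourier-0-4 = periodic-≡ _ _ (λ q → cong (λ s → + 2 ℤ.* s) (symmetrised-periodic (+ 0) 4 2 q ≡.refl))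
    (λ q → cong₂ (λ e c → + 1 ℤ.+ e ℤ.+ + 2 ℤ.* c) (ε-periodic q) (c₄-periodic q)) ≡.refl ≡.refl ≡.refl ≡.refl ≡.refl ≡.refl ≡.refl ≡.refl

  fourier-2-4 : ∀ q → + 2 ℤ.* symmetrised (+ 2) 4 q ≡ + 1 ℤ.+ ε q ℤ.+ ℤ.- (+ 2) ℤ.* c₄ q
  fourier-2-4 = periodic-≡ _ _ (λ q → cong (λ s → + 2 ℤ.* s) (symmetrised-periodic (+ 2) 4 2 q ≡.refl))
    (λ q → cong₂ (λ e c → + 1 ℤ.+ e ℤ.+ ℤ.- (+ 2) ℤ.* c) (ε-periodic q) (c₄-periodic q)) ≡.refl ≡.refl ≡.refl ≡.refl ≡.refl ≡.refl ≡.refl ≡.refl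

  fourier-1-4 : ∀ q → + 2 ℤ.* symmetrised (+ 1) 4 q ≡ + 1 ℤ.+ ℤ.- (+ 1) ℤ.* ε q
  fourier-1-4 = periodic-≡ _ _ (λ q → cong (λ s → + 2 ℤ.* s) (symmetrised-periodic (+ 1) 4 2 q ≡.refl))
    (λ q → cong (λ e → + 1 ℤ.+ ℤ.- (+ 1) ℤ.* e) (ε-periodic q)) ≡.refl ≡.refl ≡.refl ≡.refl ≡.refl ≡.refl ≡.refl ≡.refl

  fourier-0-8 : ∀ q → + 4 ℤ.* symmetrised (+ 0) 8 q ≡ + 1 ℤ.+ ε q ℤ.+ + 2 ℤ.* c₄ q ℤ.+ + 2 ℤ.* proj₁ (c₈ q)
  fourier-0-8 = periodic-≡ _ _ (λ q → cong (λ s → + 4 ℤ.* s) (symmetrised-periodic (+ 0) 8 1 q ≡.refl))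
    (λ q → cong₂ (λ e c → + 1 ℤ.+ e ℤ.+ + 2 ℤ.* c ℤ.+ + 2 ℤ.* proj₁ (c₈ q)) (ε-periodic q) (c₄-periodic q)) ≡.refl ≡.refl ≡.refl ≡.refl ≡.refl ≡.refl ≡.refl ≡.refl

  -- The characters of order 8 enter class a with weights cos (π a / 4) and cos (3π a / 4), both of
  -- which are 0 at a = 2.
  fourier-2-8 : ∀ q → + 4 ℤ.* symmetrised (+ 2) 8 q ≡ + 1 ℤ.+ ε q ℤ.+ ℤ.- (+ 2) ℤ.* c₄ q
  fourier-2-8 = periodic-≡ _ _ (λ q → cong (λ s → + 4 ℤ.* s) (symmetrised-periodic (+ 2) 8 1 q ≡.refl))
    (λ q → cong₂ (λ e c → + 1 ℤ.+ e ℤ.+ ℤ.- (+ 2) ℤ.* c) (ε-periodic q) (c₄-periodic q)) ≡.refl ≡.refl ≡.refl ≡.refl ≡.refl ≡.refl ≡.refl ≡.refl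

-- From series identities to divisibility of counts.

module Divisibility where

  open import Defs
  import Data.Nat.Divisibility as ℕ∣
  import Data.Integer.Divisibility.Signed as ℤ∣
  open Enumeration
  open Counting
  open ResidueClasses
  open ℤS using (P; V; σ; even; at)

  divisible : ∀ d m {c} q → + suc d ℤ.* + c ≡ + suc d ℤ.* (+ m ℤ.* q) → m ℕ∣.∣ c
  divisible d m {c} q p = ℕ∣.divides ℤ.∣ q ∣ (≡.trans (cong ℤ.∣_∣ (ℤₚ.*-cancelˡ-≡ (+ suc d) (+ c) (+ m ℤ.* q) p))
    (≡.trans (ℤₚ.abs-* (+ m) q) (ℕₚ.*-comm m ℤ.∣ q ∣)))

  private
    module _ (n : ℕ) where
      l = symbols (suc n)

      ∑-1+ε : ∑ l (even (λ q → + 1 ℤ.+ ε q)) ≡ P n ℤ.+ σ P n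
      ∑-1+ε = ≡.trans (∑-+ l (even (λ _ → + 1)) (even ε)) (cong₂ ℤ._+_ (∑-1 n) (∑-ε n))

      ∑-1+kε : ∀ k → ∑ l (even (λ q → + 1 ℤ.+ k ℤ.* ε q)) ≡ P n ℤ.+ k ℤ.* σ P n
      ∑-1+kε k = ≡.trans (∑-+ l (even (λ _ → + 1)) (even (λ q → k ℤ.* ε q))) (cong₂ ℤ._+_ (∑-1 n) (≡.trans (∑-* l k (even ε)) (cong (λ s → k ℤ.* s) (∑-ε n))))

      ∑-1+ε+kc₄ : ∀ k → ∑ l (even (λ q → + 1 ℤ.+ ε q ℤ.+ k ℤ.* c₄ q)) ≡ P n ℤ.+ σ P n ℤ.+ k ℤ.* V n
      ∑-1+ε+kc₄ k = ≡.trans (∑-+ l (even (λ q → + 1 ℤ.+ ε q)) (even (λ q → k ℤ.* c₄ q)))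
        (cong₂ ℤ._+_ ∑-1+ε (≡.trans (∑-* l k (even c₄)) (cong (λ s → k ℤ.* s) (∑-c₄ n))))

      expand : ∀ a M d (f : ℕ → ℤ) → 1 ≤ M → (∀ q → d ℤ.* symmetrised a M q ≡ f q) → ∀ c → N⁰≡ a M (suc n) c → d ℤ.* (+ 2 ℤ.* + c) ≡ ∑ l (even f)
      expand a M d f 1≤M p c iso = ≡.trans (cong (λ s → d ℤ.* s) (double-count a (suc n) c 1≤M iso))
        (≡.trans (≡.sym (∑-* l d (even (symmetrised a M)))) (∑-cong l (λ i j → p ∣ i - j ∣)))

    open ℤR using (solve; con; _:=_; _:+_; _:*_; _:-_; :-_)

    -- For odd size `σ P` and `P` agree at the degree in question, so both sides of the expansion
    -- carry the factor 2 of `double-count`, which cancels.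
    regroup : ∀ d s k r t q m c {u} → t ≡ s → s ℤ.+ k ℤ.* r ≡ + m ℤ.* q →
      d ℤ.* (+ 2 ℤ.* c) ≡ u → u ≡ s ℤ.+ t ℤ.+ (+ 2 ℤ.* k) ℤ.* r → d ℤ.* c ≡ + m ℤ.* q
    regroup d s k r t q m c {u} ≡.refl p e e′ = ℤₚ.*-cancelˡ-≡ (+ 2) _ _ (begin
      + 2 ℤ.* (d ℤ.* c)                          ≡⟨ solve 2 (λ d c → con (+ 2) :* (d :* c) := d :* (con (+ 2) :* c)) ≡.refl d c ⟩
      d ℤ.* (+ 2 ℤ.* c)                          ≡⟨ ≡.trans e e′ ⟩
      s ℤ.+ s ℤ.+ (+ 2 ℤ.* k) ℤ.* r              ≡⟨ solve 3 (λ s k r → s :+ s :+ con (+ 2) :* k :* r := con (+ 2) :* (s :+ k :* r)) ≡.refl s k r ⟩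
      + 2 ℤ.* (s ℤ.+ k ℤ.* r)                    ≡⟨ cong (λ y → + 2 ℤ.* y) p ⟩
      + 2 ℤ.* (+ m ℤ.* q) ∎)
      where open ≡-Reasoning

  -- Symbols of the odd number suc n: all ranks are even, which σP expresses.
  module _ (i : ℕ) where
    private
      n = double i
      σP : σ P n ≡ P n
      σP = at (ℤS.ev-σ P) i

    odd-0-4 : ∀ m q → P n ℤ.+ V n ≡ + (2 ℕ.* m) ℤ.* q → N⁰-divisible m (+ 0) 4 (suc n)
    odd-0-4 m q p c iso = divisible 1 m q (≡.trans (regroup (+ 2) (P n) (+ 1) (V n) (σ P n) q (2 ℕ.* m) (+ c) σP (≡.trans (cong (λ s → P n ℤ.+ s) (ℤₚ.*-identityˡ (V n))) p)
      (expand n (+ 0) 4 (+ 2) _ (s≤s z≤n) fourier-0-4 c iso) (∑-1+ε+kc₄ n (+ 2)))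
      (≡.trans (cong (λ s → s ℤ.* q) (ℤₚ.pos-* 2 m)) (ℤₚ.*-assoc (+ 2) (+ m) q)))

    odd-2-4 : ∀ m q → P n ℤ.- V n ≡ + (2 ℕ.* m) ℤ.* q → N⁰-divisible m (+ 2) 4 (suc n)
    odd-2-4 m q p c iso = divisible 1 m q (≡.trans (regroup (+ 2) (P n) (ℤ.- (+ 1)) (V n) (σ P n) q (2 ℕ.* m) (+ c) σP (≡.trans (cong (λ s → P n ℤ.+ s) (ℤₚ.-1*i≡-i (V n))) p)
      (expand n (+ 2) 4 (+ 2) _ (s≤s z≤n) fourier-2-4 c iso) (∑-1+ε+kc₄ n (ℤ.- (+ 2))))
      (≡.trans (cong (λ s → s ℤ.* q) (ℤₚ.pos-* 2 m)) (ℤₚ.*-assoc (+ 2) (+ m) q)))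

    odd-2-8 : ∀ m q → P n ℤ.- V n ≡ + (4 ℕ.* m) ℤ.* q → N⁰-divisible m (+ 2) 8 (suc n)
    odd-2-8 m q p c iso = divisible 3 m q (≡.trans (regroup (+ 4) (P n) (ℤ.- (+ 1)) (V n) (σ P n) q (4 ℕ.* m) (+ c) σP (≡.trans (cong (λ s → P n ℤ.+ s) (ℤₚ.-1*i≡-i (V n))) p)
      (expand n (+ 2) 8 (+ 4) _ (s≤s z≤n) fourier-2-8 c iso) (∑-1+ε+kc₄ n (ℤ.- (+ 2))))
      (≡.trans (cong (λ s → s ℤ.* q) (ℤₚ.pos-* 4 m)) (ℤₚ.*-assoc (+ 4) (+ m) q)))

    odd-0-8 : ∀ m q → ∑ (symbols (suc n)) (even (proj₁ ∘ c₈)) ≡ + 0 → P n ℤ.+ V n ≡ + (4 ℕ.* m) ℤ.* q → N⁰-divisible m (+ 0) 8 (suc n)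
    odd-0-8 m q W p c iso = divisible 3 m q (≡.trans (regroup (+ 4) (P n) (+ 1) (V n) (σ P n) q (4 ℕ.* m) (+ c) σP (≡.trans (cong (λ s → P n ℤ.+ s) (ℤₚ.*-identityˡ (V n))) p)
      (expand n (+ 0) 8 (+ 4) _ (s≤s z≤n) fourier-0-8 c iso) sum)
      (≡.trans (cong (λ s → s ℤ.* q) (ℤₚ.pos-* 4 m)) (ℤₚ.*-assoc (+ 4) (+ m) q)))
      where
      sum : ∑ (symbols (suc n)) (even (λ q → + 1 ℤ.+ ε q ℤ.+ + 2 ℤ.* c₄ q ℤ.+ + 2 ℤ.* proj₁ (c₈ q))) ≡ P n ℤ.+ σ P n ℤ.+ + 2 ℤ.* V n
      sum = ≡.trans (∑-+ (symbols (suc n)) (even (λ q → + 1 ℤ.+ ε q ℤ.+ + 2 ℤ.* c₄ q)) (even (λ q → + 2 ℤ.* proj₁ (c₈ q))))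
        (≡.trans (cong₂ ℤ._+_ (∑-1+ε+kc₄ n (+ 2)) (≡.trans (∑-* (symbols (suc n)) (+ 2) (even (proj₁ ∘ c₈))) (cong (λ s → + 2 ℤ.* s) W))) (ℤₚ.+-identityʳ _))

  -- Symbols of the even number suc n: all ranks are odd.
  module _ (i : ℕ) where
    private
      n = suc (double i)
      σP : σ P n ≡ ℤ.- P n
      σP = at (ℤS.od-σ P) i

    even-1-4 : ∀ c → N⁰≡ (+ 1) 4 (suc n) c → + 2 ℤ.* + c ≡ P n
    even-1-4 c iso = ℤₚ.*-cancelˡ-≡ (+ 2) _ _ (≡.trans (expand n (+ 1) 4 (+ 2) _ (s≤s z≤n) fourier-1-4 c iso) (≡.trans (∑-1+kε n (ℤ.- (+ 1)))
      (≡.trans (cong (λ s → P n ℤ.+ ℤ.- (+ 1) ℤ.* s) σP) (solve 1 (λ p → p :+ :- con (+ 1) :* :- p := con (+ 2) :* p) ≡.refl (P n)))))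

    even-1-4-divisible : ∀ m q → P n ≡ + (2 ℕ.* m) ℤ.* q → N⁰-divisible m (+ 1) 4 (suc n)
    even-1-4-divisible m q p c iso = divisible 1 m q (≡.trans (even-1-4 c iso) (≡.trans p
      (≡.trans (cong (λ s → s ℤ.* q) (ℤₚ.pos-* 2 m)) (ℤₚ.*-assoc (+ 2) (+ m) q))))

    -- Here 2c = 5q. The relation 1 = 5 - 2 · 2 gives c = 5c - 2 · 5q, so q need not be halved.
    even-1-4-divisible-5 : ∀ q → P n ≡ + 5 ℤ.* q → N⁰-divisible 5 (+ 1) 4 (suc n)
    even-1-4-divisible-5 q p c iso = divisible 0 5 (+ c ℤ.- + 2 ℤ.* q) (begin
      + 1 ℤ.* + c                                      ≡⟨ solve 1 (λ c → con (+ 1) :* c := con (+ 5) :* c :- con (+ 2) :* (con (+ 2) :* c)) ≡.refl (+ c) ⟩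
      + 5 ℤ.* + c ℤ.- + 2 ℤ.* (+ 2 ℤ.* + c)            ≡⟨ cong (λ s → + 5 ℤ.* + c ℤ.- + 2 ℤ.* s) (≡.trans (even-1-4 c iso) p) ⟩
      + 5 ℤ.* + c ℤ.- + 2 ℤ.* (+ 5 ℤ.* q)              ≡⟨ solve 2 (λ c q → con (+ 5) :* c :- con (+ 2) :* (con (+ 5) :* q) := con (+ 1) :* (con (+ 5) :* (c :- con (+ 2) :* q))) ≡.refl (+ c) q ⟩
      + 1 ℤ.* (+ 5 ℤ.* (+ c ℤ.- + 2 ℤ.* q)) ∎)
      where open ≡-Reasoning

  module OppositeClass (k : ℕ) (1≤k : 1 ≤ k) where
    private
      M = 2 ℕ.* k
      ι : ℤ → ℤ
      ι = indicator (+ k) M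

      reflect : ∀ r → r ≡ + k [mod M ] → (ℤ.- r) ≡ + k [mod M ]
      reflect r p = ℤ∣.∣⇒∣ᵤ (subst (ℤ∣._∣_ (+ M)) (≡.trans (cong (λ m → ℤ.- (r ℤ.- + k) ℤ.- m) (ℤₚ.pos-* 2 k))
          (solve 2 (λ r k → :- (r :- k) :- con (+ 2) :* k := :- r :- k) ≡.refl r (+ k)))
        (ℤ∣.∣m∣n⇒∣m-n (ℤ∣.∣m⇒∣-m (ℤ∣.∣ᵤ⇒∣ {+ M} {r ℤ.- + k} p)) ℤ∣.∣-refl))

      ι-neg : ∀ r → ι (ℤ.- r) ≡ ι r
      ι-neg r = indicator-cong (+ k) M {ℤ.- r} {r} (λ p → subst (λ s → s ≡ + k [mod M ]) (ℤₚ.neg-involutive r) (reflect (ℤ.- r) p)) (reflect r)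

      ι-0 : ι (+ 0) ≡ + 0
      ι-0 with class? (+ k) M (+ 0)
      ... | no _ = ≡.refl
      ... | yes p = ⊥-elim (ℕₚ.<⇒≱ (ℕₚ.m<m+n k (ℕₚ.≤-trans 1≤k (ℕₚ.m≤m+n k 0))) (ℕ∣.∣⇒≤ {{ℕ.>-nonZero 1≤k}} (subst (M ℕ∣.∣_) ∣0-k∣ p)))
        where
        ∣0-k∣ : ℤ.∣ + 0 ℤ.- + k ∣ ≡ k
        ∣0-k∣ = ≡.trans (cong ℤ.∣_∣ (ℤₚ.+-identityˡ (ℤ.- (+ k)))) (ℤₚ.∣-i∣≡∣i∣ (+ k))

      positive : ℕ → ℤ
      positive zero = + 0
      positive (suc d) = ι (+ suc d)

      ι-positive : ∀ d → ι (+ d) ≡ positive d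
      ι-positive zero = ι-0
      ι-positive (suc d) = ≡.refl

      -- One of the truncated differences is 0 and `positive` is 0 there; the other is the absolute
      -- rank. The two summands are exchanged with the rows, so they have equal sums.
      split : ∀ i j → ι (+ i ℤ.- + j) ≡ positive (i ℕ.∸ j) ℤ.+ positive (j ℕ.∸ i)
      split i j with ℕₚ.≤-total j i
      ... | inj₁ p = ≡.trans (cong ι (proj₁ (ordered-difference p))) (≡.trans (ι-positive ∣ i - j ∣) (≡.trans (cong positive (ℕₚ.m≤n⇒∣n-m∣≡n∸m p))
        (≡.trans (≡.sym (ℤₚ.+-identityʳ _)) (cong (λ d → positive (i ℕ.∸ j) ℤ.+ positive d) (≡.sym (ℕₚ.m≤n⇒m∸n≡0 p))))))
      ... | inj₂ p = ≡.trans (cong ι (proj₂ (ordered-difference p))) (≡.trans (ι-neg (+ ∣ j - i ∣)) (≡.trans (ι-positive ∣ j - i ∣) (≡.trans (cong positive (ℕₚ.m≤n⇒∣n-m∣≡n∸m p))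
        (≡.trans (≡.sym (ℤₚ.+-identityˡ _)) (cong (λ d → positive d ℤ.+ positive (j ℕ.∸ i)) (≡.sym (ℕₚ.m≤n⇒m∸n≡0 p)))))))

    half-class : ∀ n → N⁰-divisible 2 (+ k) (2 ℕ.* k) n
    half-class n c iso = divisible 0 2 S (begin
      + 1 ℤ.* + c                                ≡⟨ ℤₚ.*-identityˡ (+ c) ⟩
      + c                                        ≡⟨ count≡∑ (+ k) n c (ℕₚ.≤-trans 1≤k (ℕₚ.m≤m+n k (k ℕ.+ 0))) iso ⟩
      ∑ (symbols n) (λ i j → ι (+ i ℤ.- + j))    ≡⟨ ≡.trans (∑-cong (symbols n) split) (∑-+ (symbols n) (λ i j → positive (i ℕ.∸ j)) (λ i j → positive (j ℕ.∸ i))) ⟩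
      S ℤ.+ ∑ (symbols n) (λ i j → positive (j ℕ.∸ i)) ≡⟨ cong (λ s → S ℤ.+ s) (≡.sym (ℤS.∑-symbols-swap (λ i j → positive (i ℕ.∸ j)) n)) ⟩
      S ℤ.+ S                                    ≡⟨ solve 1 (λ s → s :+ s := con (+ 1) :* (con (+ 2) :* s)) ≡.refl S ⟩
      + 1 ℤ.* (+ 2 ℤ.* S) ∎)
      where
      open ≡-Reasoning
      S = ∑ (symbols n) (λ i j → positive (i ℕ.∸ j))

-- Assembly: arithmetic progressions as iterated even and odd parts.

open import Defs
open import Data.Nat using (_+_; _*_; _≥_)

private
  module D = Divisibility
  module Z = Counting.ℤS

  at-index : ∀ m a M {N N′} → N ≡ N′ → N⁰-divisible m a M N′ → N⁰-divisible m a M N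
  at-index m a M ≡.refl h = h

  double-≡ : ∀ {m n} → m ≡ n → double m ≡ 2 * n
  double-≡ {m} p = ≡.trans (double≡2* m) (cong (2 *_) p)

  suc-double-≡ : ∀ {m n} → m ≡ n → suc (double m) ≡ 1 + 2 * n
  suc-double-≡ p = cong suc (double-≡ p)

  -- Symbols of size N belong to degree N - 1. The low binary digits of N - 1, starting with the
  -- lowest, tell whether `ev` or `od` is taken; the remaining equations of this kind read likewise.
  index₁ : ∀ n → 8 * n + 1 ≡ suc (double (double (double n)))
  index₁ n = ≡.trans (solveℕ 1 (λ n → conℕ 8 ⊗ n ⊕ conℕ 1 ⊜ conℕ 1 ⊕ conℕ 2 ⊗ (conℕ 2 ⊗ (conℕ 2 ⊗ n))) ≡.refl n)
    (≡.sym (suc-double-≡ (double-≡ (double-≡ ≡.refl))))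

  index₅ : ∀ n → 8 * n + 5 ≡ suc (double (double (suc (double n))))
  index₅ n = ≡.trans (solveℕ 1 (λ n → conℕ 8 ⊗ n ⊕ conℕ 5 ⊜ conℕ 1 ⊕ conℕ 2 ⊗ (conℕ 2 ⊗ (conℕ 1 ⊕ conℕ 2 ⊗ n))) ≡.refl n)
    (≡.sym (suc-double-≡ (double-≡ (suc-double-≡ ≡.refl))))

  index₇ : ∀ n → 8 * n + 7 ≡ suc (double (suc (double (suc (double n)))))
  index₇ n = ≡.trans (solveℕ 1 (λ n → conℕ 8 ⊗ n ⊕ conℕ 7 ⊜ conℕ 1 ⊕ conℕ 2 ⊗ (conℕ 1 ⊕ conℕ 2 ⊗ (conℕ 1 ⊕ conℕ 2 ⊗ n))) ≡.refl n)
    (≡.sym (suc-double-≡ (suc-double-≡ (suc-double-≡ ≡.refl))))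

  index₁₁ : ∀ n → 16 * n + 11 ≡ suc (double (suc (double (double (suc (double n))))))
  index₁₁ n = ≡.trans (solveℕ 1 (λ n → conℕ 16 ⊗ n ⊕ conℕ 11 ⊜ conℕ 1 ⊕ conℕ 2 ⊗ (conℕ 1 ⊕ conℕ 2 ⊗ (conℕ 2 ⊗ (conℕ 1 ⊕ conℕ 2 ⊗ n)))) ≡.refl n)
    (≡.sym (suc-double-≡ (suc-double-≡ (double-≡ (suc-double-≡ ≡.refl)))))

  index₁₃ : ∀ n → 16 * n + 13 ≡ suc (double (double (suc (double (suc (double n))))))
  index₁₃ n = ≡.trans (solveℕ 1 (λ n → conℕ 16 ⊗ n ⊕ conℕ 13 ⊜ conℕ 1 ⊕ conℕ 2 ⊗ (conℕ 2 ⊗ (conℕ 1 ⊕ conℕ 2 ⊗ (conℕ 1 ⊕ conℕ 2 ⊗ n)))) ≡.refl n)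
    (≡.sym (suc-double-≡ (double-≡ (suc-double-≡ (suc-double-≡ ≡.refl)))))

  index₁₅ : ∀ n → 16 * n + 15 ≡ suc (double (suc (double (suc (double (suc (double n)))))))
  index₁₅ n = ≡.trans (solveℕ 1 (λ n → conℕ 16 ⊗ n ⊕ conℕ 15 ⊜ conℕ 1 ⊕ conℕ 2 ⊗ (conℕ 1 ⊕ conℕ 2 ⊗ (conℕ 1 ⊕ conℕ 2 ⊗ (conℕ 1 ⊕ conℕ 2 ⊗ n)))) ≡.refl n)
    (≡.sym (suc-double-≡ (suc-double-≡ (suc-double-≡ (suc-double-≡ ≡.refl)))))

  index₄ : ∀ n → 8 * n + 4 ≡ suc (suc (double (suc (double (double n)))))
  index₄ n = ≡.trans (solveℕ 1 (λ n → conℕ 8 ⊗ n ⊕ conℕ 4 ⊜ conℕ 2 ⊕ conℕ 2 ⊗ (conℕ 1 ⊕ conℕ 2 ⊗ (conℕ 2 ⊗ n))) ≡.refl n)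
    (≡.sym (cong suc (suc-double-≡ (suc-double-≡ (double-≡ ≡.refl)))))

  index₆ : ∀ n → 8 * n + 6 ≡ suc (suc (double (double (suc (double n)))))
  index₆ n = ≡.trans (solveℕ 1 (λ n → conℕ 8 ⊗ n ⊕ conℕ 6 ⊜ conℕ 2 ⊕ conℕ 2 ⊗ (conℕ 2 ⊗ (conℕ 1 ⊕ conℕ 2 ⊗ n))) ≡.refl n)
    (≡.sym (cong suc (suc-double-≡ (double-≡ (suc-double-≡ ≡.refl)))))

  module _ {k : ℕ} {f : Z.Series} (h : Z.Multiple k f) (n : ℕ) where
    quotient = Z._∣_.quotient (Z.multiple-∣ h n)
    equality = Z._∣_.equality (Z.multiple-∣ h n)

  divisible-5 : ∀ n → Z.Missing n → N⁰-divisible 5 (+ 1) 4 (8 * n + 4)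
  divisible-5 n h = at-index 5 (+ 1) 4 (index₄ n)
    (D.even-1-4-divisible-5 (suc (double (double n))) (Z._∣_.quotient (Z.P-mod-5 n h)) (Z._∣_.equality (Z.P-mod-5 n h)))

theorem1p12 : (k : ℕ) → k ≥ 1 → (n : ℕ) →
    N⁰-divisible 2 (+ k) (2 * k) n
    × N⁰-divisible 4 (+ 0) 4 (8 * n + 5)
    × N⁰-divisible 4 (+ 0) 4 (8 * n + 7)
    × N⁰-divisible 8 (+ 0) 4 (16 * n + 13)
    × N⁰-divisible 2 (+ 1) 4 (8 * n + 4)
    × N⁰-divisible 4 (+ 1) 4 (8 * n + 6)
    × N⁰-divisible 5 (+ 1) 4 (40 * n + 28)
    × N⁰-divisible 5 (+ 1) 4 (40 * n + 36)
    × N⁰-divisible 4 (+ 2) 4 (16 * n + 13)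
    × N⁰-divisible 2 (+ 0) 8 (8 * n + 5)
    × N⁰-divisible 2 (+ 0) 8 (8 * n + 7)
    × N⁰-divisible 4 (+ 0) 8 (16 * n + 13)
    × N⁰-divisible 16 (+ 0) 8 (16 * n + 15)
    × N⁰-divisible 4 (+ 2) 8 (8 * n + 1)
    × N⁰-divisible 8 (+ 2) 8 (16 * n + 11)
    × N⁰-divisible 2 (+ 2) 8 (16 * n + 13)
theorem1p12 k k≥1 n =
    D.OppositeClass.half-class k k≥1 n
  , at-index 4 (+ 0) 4 (index₅ n) (D.odd-0-4 (double (suc (double n))) 4 (quotient Z.sum-8n+5 n) (equality Z.sum-8n+5 n))
  , at-index 4 (+ 0) 4 (index₇ n) (D.odd-0-4 (suc (double (suc (double n)))) 4 (quotient Z.sum-8n+7 n) (equality Z.sum-8n+7 n))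
  , at-index 8 (+ 0) 4 (index₁₃ n) (D.odd-0-4 (double (suc (double (suc (double n))))) 8 (quotient Z.sum-16n+13 n) (equality Z.sum-16n+13 n))
  , at-index 2 (+ 1) 4 (index₄ n) (D.even-1-4-divisible (suc (double (double n))) 2 (quotient Z.P-8n+4 n) (equality Z.P-8n+4 n))
  , at-index 4 (+ 1) 4 (index₆ n) (D.even-1-4-divisible (double (suc (double n))) 4 (quotient Z.P-8n+6 n) (equality Z.P-8n+6 n))
  , at-index 5 (+ 1) 4 (solveℕ 1 (λ n → conℕ 40 ⊗ n ⊕ conℕ 28 ⊜ conℕ 8 ⊗ (conℕ 3 ⊕ conℕ 5 ⊗ n) ⊕ conℕ 4) ≡.refl n)
      (divisible-5 (3 + 5 * n) (inj₁ (Z.res-+ 3 (5 * n) (Z.res-5* n))))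
  , at-index 5 (+ 1) 4 (solveℕ 1 (λ n → conℕ 40 ⊗ n ⊕ conℕ 36 ⊜ conℕ 8 ⊗ (conℕ 4 ⊕ conℕ 5 ⊗ n) ⊕ conℕ 4) ≡.refl n)
      (divisible-5 (4 + 5 * n) (inj₂ (Z.res-+ 4 (5 * n) (Z.res-5* n))))
  , at-index 4 (+ 2) 4 (index₁₃ n) (D.odd-2-4 (double (suc (double (suc (double n))))) 4 (quotient Z.difference-16n+13 n) (equality Z.difference-16n+13 n))
  , at-index 2 (+ 0) 8 (index₅ n) (D.odd-0-8 (double (suc (double n))) 2 (quotient Z.sum-8n+5 n) (Counting.W-8n+5 n) (equality Z.sum-8n+5 n))
  , at-index 2 (+ 0) 8 (index₇ n) (D.odd-0-8 (suc (double (suc (double n)))) 2 (quotient Z.sum-8n+7 n) (Counting.W-8n+7 n) (equality Z.sum-8n+7 n))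
  -- The vanishing is used at 2n + 1: here 16n + 13 = 8(2n + 1) + 5, and in the next component 16n +
  -- 15 = 8(2n + 1) + 7.
  , at-index 4 (+ 0) 8 (index₁₃ n) (D.odd-0-8 (double (suc (double (suc (double n))))) 4 (quotient Z.sum-16n+13 n) (Counting.W-8n+5 (suc (double n))) (equality Z.sum-16n+13 n))
  , at-index 16 (+ 0) 8 (index₁₅ n) (D.odd-0-8 (suc (double (suc (double (suc (double n)))))) 16 (quotient Z.sum-16n+15 n) (Counting.W-8n+7 (suc (double n))) (equality Z.sum-16n+15 n))
  , at-index 4 (+ 2) 8 (index₁ n) (D.odd-2-8 (double (double n)) 4 (quotient Z.difference-8n+1 n) (equality Z.difference-8n+1 n))
  , at-index 8 (+ 2) 8 (index₁₁ n) (D.odd-2-8 (suc (double (double (suc (double n))))) 8 (quotient Z.difference-16n+11 n) (equality Z.difference-16n+11 n))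
  , at-index 2 (+ 2) 8 (index₁₃ n) (D.odd-2-8 (double (suc (double (suc (double n))))) 2 (quotient Z.difference-16n+13 n) (equality Z.difference-16n+13 n))
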